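{- Let $K$ be a field with $\mathrm{char}(K)\neq 2,3$, let $\overline{K}$ be an algebraic closure of $K$, and let $n$ be a positive integer with $\gcd(\mathrm{char}(K),n)=1$. Let $E$ be the elliptic curve over $K$ given by $y^2=x^3+ax+b$ with $a,b\in K$, and let $Q=(x_Q,y_Q)\in E$ be a point with $Q\neq\mathcal{O}$ (the point at infinity). Set $$\Lambda=\{P=(x_P,y_P)\in E(\overline{K})\mid nP=Q\}.$$ Then $$\frac{1}{n^2}\sum_{P\in\Lambda}x_P=x_Q\qquad\text{and}\qquad \frac{1}{n^2}\sum_{P\in\Lambda}y_P=n\,y_Q.$$
   Context: $nP$ denotes $P+P+\cdots+P$ ($n$ summands) in the group law of $E$ with identity $\mathcal{O}$. When $\mathrm{char}(K)=0$ the condition $\gcd(\mathrm{char}(K),n)=1$ is vacuous. -}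

module Defs where

open import Level using (Level; _⊔_) renaming (suc to lsuc)
open import Data.Nat as ℕ using (ℕ; zero; suc)
open import Data.Nat.GCD using (gcd)
open import Data.Product using (Σ; ∃; _×_; _,_)
open import Data.Sum using (_⊎_)
open import Data.List using (List; []; _∷_; _++_; [_]; map)
open import Data.List.Relation.Unary.All using (All)
open import Data.List.Relation.Unary.Any using (Any)
open import Data.List.Relation.Unary.AllPairs using (AllPairs)
open import Relation.Nullary using (¬_)
open import Relation.Binary.PropositionalEquality using (_≡_; _≢_)
open import Algebra.Bundles using (CommutativeRing)
open import Algebra.Morphism.Structures using (module RingMorphisms)

record Field (c ℓ : Level) : Set (lsuc (c ⊔ ℓ)) where
  field
    commutativeRing : CommutativeRing c ℓ
  open CommutativeRing commutativeRing public
  field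
    1≉0     : ¬ (1# ≈ 0#)
    inverse : ∀ x → ¬ (x ≈ 0#) → ∃ λ y → x * y ≈ 1#

module FieldOps {c ℓ : Level} (F : Field c ℓ) where
  open Field F

  fromℕ : ℕ → Carrier
  fromℕ zero    = 0#
  fromℕ (suc m) = 1# + fromℕ m

  eval : List Carrier → Carrier → Carrier
  eval []       x = 0#
  eval (k ∷ ks) x = k + x * eval ks x

  sum : List Carrier → Carrier
  sum []       = 0#
  sum (k ∷ ks) = k + sum ks

HasChar : {c ℓ : Level} → Field c ℓ → ℕ → Set ℓ
HasChar F p =
    (p ≡ 0 × (∀ m → ¬ (fromℕ (suc m) ≈ 0#)))
  ⊎ (p ≢ 0 × fromℕ p ≈ 0# × (∀ m → 0 ℕ.< m → m ℕ.< p → ¬ (fromℕ m ≈ 0#)))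
  where open Field F; open FieldOps F

record IsAlgebraicClosure {k kℓ c ℓ : Level} (K : Field k kℓ) (Kbar : Field c ℓ)
                          (ι : Field.Carrier K → Field.Carrier Kbar)
                          : Set (k ⊔ kℓ ⊔ c ⊔ ℓ) where
  open Field Kbar
  open FieldOps Kbar
  field
    isRingHomomorphism :
      RingMorphisms.IsRingHomomorphism (Field.rawRing K) (Field.rawRing Kbar) ι
    algClosed : ∀ (k₀ : Carrier) (ks : List Carrier) →
                ∃ λ x → eval ((k₀ ∷ ks) ++ [ 1# ]) x ≈ 0#
    algebraic : ∀ (x : Carrier) →
                ∃ λ (ks : List (Field.Carrier K)) → eval (map ι ks ++ [ 1# ]) x ≈ 0#

-- The Weierstrass curve y² = x³ + A x + B over a field F, its points
-- (the point at infinity O and the affine solutions), and the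
-- chord-and-tangent group law, given as a relation  Add P Q R  meaning
-- "R = P + Q" (formulated relationally so that no decidable equality on
-- F is needed).

module Weierstrass {c ℓ : Level} (F : Field c ℓ) (A B : Field.Carrier F) where
  open Field F
  open FieldOps F

  OnCurve : Carrier → Carrier → Set ℓ
  OnCurve x y = y * y ≈ x * x * x + A * x + B

  data Point : Set (c ⊔ ℓ) where
    O   : Point
    aff : (x y : Carrier) → OnCurve x y → Point

  _≈ₚ_ : Point → Point → Set ℓ
  O           ≈ₚ O           = Lift ℓ ⊤
    where open import Data.Unit using (⊤)
          open import Level using (Lift)
  O           ≈ₚ aff _ _ _   = Lift ℓ ⊥
    where open import Data.Empty using (⊥)
          open import Level using (Lift)
  aff _ _ _   ≈ₚ O           = Lift ℓ ⊥
    where open import Data.Empty using (⊥)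
          open import Level using (Lift)
  aff x y _   ≈ₚ aff x' y' _ = x ≈ x' × y ≈ y'

  data Add : Point → Point → Point → Set (c ⊔ ℓ) where
    O-left  : ∀ {P R} → R ≈ₚ P → Add O P R
    O-right : ∀ {x y h R} → R ≈ₚ aff x y h → Add (aff x y h) O R
    -- P = -Q (including doubling a point with y = 0)
    opposite : ∀ {x₁ y₁ h₁ x₂ y₂ h₂} →
               x₁ ≈ x₂ → y₁ ≈ - y₂ → Add (aff x₁ y₁ h₁) (aff x₂ y₂ h₂) O
    chord : ∀ {x₁ y₁ h₁ x₂ y₂ h₂ x₃ y₃ h₃} (λ′ : Carrier) →
            ¬ (x₁ ≈ x₂) →
            λ′ * (x₂ - x₁) ≈ y₂ - y₁ →
            x₃ ≈ λ′ * λ′ - x₁ - x₂ →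
            y₃ ≈ λ′ * (x₁ - x₃) - y₁ →
            Add (aff x₁ y₁ h₁) (aff x₂ y₂ h₂) (aff x₃ y₃ h₃)
    tangent : ∀ {x₁ y₁ h₁ x₂ y₂ h₂ x₃ y₃ h₃} (λ′ : Carrier) →
              x₁ ≈ x₂ → y₁ ≈ y₂ → ¬ (y₁ ≈ 0#) →
              λ′ * (fromℕ 2 * y₁) ≈ fromℕ 3 * x₁ * x₁ + A →
              x₃ ≈ λ′ * λ′ - x₁ - x₂ →
              y₃ ≈ λ′ * (x₁ - x₃) - y₁ →
              Add (aff x₁ y₁ h₁) (aff x₂ y₂ h₂) (aff x₃ y₃ h₃)

  Mul : ℕ → Point → Point → Set (c ⊔ ℓ)
  Mul zero    P R = Lift c (R ≈ₚ O)
    where open import Level using (Lift)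
  Mul (suc m) P R = ∃ λ S → Mul m P S × Add S P R

  Enumerates : ℕ → Point → List (Carrier × Carrier) → Set (c ⊔ ℓ)
  Enumerates m Q L =
      All (λ { (x , y) → Σ (OnCurve x y) λ h → Mul m (aff x y h) Q }) L
    × (∀ x y (h : OnCurve x y) → Mul m (aff x y h) Q →
         Any (λ { (x' , y') → x ≈ x' × y ≈ y' }) L)
    × AllPairs (λ { (x , y) (x' , y') → ¬ (x ≈ x' × y ≈ y') }) L

{-# OPTIONS --safe #-}
-- The x-coordinates of the points P with nP = Q are roots of φₙ - x_Q ψₙ², a monic polynomial of degree
-- n² whose second coefficient is -n² x_Q.  If the points account for all its roots, with multiplicity,
-- Vieta's formula gives Σ x_P = n² x_Q.  Since P and -P share their x-coordinate, the factorisation is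
-- obtained in the coordinate ring of the curve: φₙ - x_Q ψₙ² and ωₙ ∓ y_Q ψₙ³ lie in products of the
-- maximal ideals of the points ±P, and as Q is a smooth point their products generate what is needed.
-- The y-coordinates come from the same formula over the dual numbers: displacing P by ε along the
-- invariant vector field displaces nP by n ε, and the ε-part of the x-coordinate of P is then 2 y_P.
--
-- Equality in the field need not be decidable, so all of this consists of identities in commutative
-- rings; only the number of points, n², is found by contradiction.  The identities between division
-- polynomials are proved in the domain ℤ[A,x,y], where ψₙ ≠ 0 may be cancelled, and then specialised.
module Submission where

open import Defs
open import Level using (Level; _⊔_; 0ℓ; Lift; lift; lower)
open import Data.Bool using (Bool; true; false; not)
open import Data.Empty using (⊥; ⊥-elim)
open import Data.Fin using (Fin; zero; suc)
open import Data.Integer as ℤ using (ℤ; +_; -[1+_])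
import Data.Integer.Properties as ℤₚ
open import Data.List as List using (List; []; _∷_; map; length; _++_; [_])
import Data.List.Properties as Listₚ
open import Data.List.Relation.Unary.All as All using (All; []; _∷_)
import Data.List.Relation.Unary.All.Properties as Allₚ
open import Data.List.Relation.Unary.AllPairs using (AllPairs; []; _∷_)
open import Data.List.Relation.Unary.Any using (Any; here; there)
open import Data.Nat as ℕ using (ℕ; zero; suc; s≤s; z≤n)
open import Data.Nat.GCD using (gcd)
open import Data.Nat.Induction using (<-rec)
import Data.Nat.Properties as ℕₚ
open import Data.Nat.Tactic.RingSolver using (solve-∀)
open import Data.Product using (Σ; ∃; _×_; _,_; proj₁; proj₂)
open import Data.Sum using (_⊎_; inj₁; inj₂)
open import Data.Unit.Polymorphic using (⊤; tt)
open import Data.Vec as Vec using (Vec; []; _∷_; lookup)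
open import Data.Vec.N-ary using (N-ary; _$ⁿ_; ∀ⁿ; curryⁿ)
open import Data.Vec.Properties using (lookup-map)
open import Data.Vec.Relation.Binary.Pointwise.Inductive as Pointwise using (Pointwise; []; _∷_)
open import Function using (id)
open import Relation.Binary.Definitions using (tri<; tri≈; tri>)
open import Relation.Binary.PropositionalEquality as ≡ using (_≡_; _≢_)
open import Relation.Nullary using (¬_; Dec; yes; no; does; contradiction; ¬¬-excluded-middle)
open import Relation.Nullary.Decidable using (map′; _×-dec_)
open import Algebra.Bundles using (CommutativeRing)
open import Algebra.Morphism.Structures using (module RingMorphisms)
import Algebra.Properties.Ring as RingProperties
import Relation.Binary.Reasoning.Setoid as SetoidReasoning

-- Homomorphisms, polynomial rings and a ring solver

-- Two things obstruct a plain use of Vieta's formula. When Q = -Q the points P and -P both lie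
-- above Q, and the polynomial has repeated roots. And over the dual numbers there is no useful
-- notion of distinct points, nor a field in which to count. Both are met by comaximality: two
-- points are separated by an equation α(x - x′) + α′(y - y′) = 1, which is meaningful over every
-- ring and lifts from the field to the dual numbers. That distinct points above Q are comaximal is
-- the statement that multiplication by n is unramified, and it comes from the same displacement by
-- ε as the sum of the ordinates. The number of points is found over the field; as a length of a
-- list it carries over unchanged. The detour through ℤ[A,x,y] is forced because the inductions
-- divide by ψₙ, which vanishes at torsion points. The ordinate enters as 2ωₙ, for which no division
-- by 2 is required.

record Hom {a ℓ₁ b ℓ₂} (R : CommutativeRing a ℓ₁) (S : CommutativeRing b ℓ₂) : Set (a ⊔ ℓ₁ ⊔ b ⊔ ℓ₂) where
  private
    module R = CommutativeRing R
    module S = CommutativeRing S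
  field
    ⟨_⟩    : R.Carrier → S.Carrier
    cong   : ∀ {x y} → x R.≈ y → ⟨ x ⟩ S.≈ ⟨ y ⟩
    +-homo : ∀ x y → ⟨ x R.+ y ⟩ S.≈ ⟨ x ⟩ S.+ ⟨ y ⟩
    *-homo : ∀ x y → ⟨ x R.* y ⟩ S.≈ ⟨ x ⟩ S.* ⟨ y ⟩
    1-homo : ⟨ R.1# ⟩ S.≈ S.1#

  private
    module Sₚ = RingProperties S.ring

  0-homo : ⟨ R.0# ⟩ S.≈ S.0#
  0-homo = Sₚ.x+x≈x⇒x≈0 _ (S.trans (S.sym (+-homo _ _)) (cong (R.+-identityˡ _)))

  -‿homo : ∀ x → ⟨ R.- x ⟩ S.≈ S.- ⟨ x ⟩
  -‿homo x = Sₚ.+-inverseˡ-unique _ _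
    (S.trans (S.sym (+-homo _ _)) (S.trans (cong (R.-‿inverseˡ x)) 0-homo))

idHom : ∀ {c ℓ} (R : CommutativeRing c ℓ) → Hom R R
idHom R = record { ⟨_⟩ = id ; cong = id ; +-homo = λ _ _ → refl ; *-homo = λ _ _ → refl ; 1-homo = refl }
  where open CommutativeRing R

_∘ʰ_ : ∀ {a ℓ₁ b ℓ₂ c ℓ₃} {R : CommutativeRing a ℓ₁} {S : CommutativeRing b ℓ₂} {T : CommutativeRing c ℓ₃} →
       Hom S T → Hom R S → Hom R T
_∘ʰ_ {T = T} g f = record
  { ⟨_⟩    = λ x → g.⟨ f.⟨ x ⟩ ⟩
  ; cong   = λ e → g.cong (f.cong e)
  ; +-homo = λ x y → trans (g.cong (f.+-homo x y)) (g.+-homo _ _)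
  ; *-homo = λ x y → trans (g.cong (f.*-homo x y)) (g.*-homo _ _)
  ; 1-homo = trans (g.cong f.1-homo) g.1-homo
  }
  where
  open CommutativeRing T
  module g = Hom g
  module f = Hom f

-- Deciding whether an element vanishes serves twice: it drives the solver, and it locates the
-- lowest nonzero coefficient when the property is passed on to polynomials.
record IsDomain {c ℓ} (R : CommutativeRing c ℓ) : Set (c ⊔ ℓ) where
  open CommutativeRing R hiding (zero)
  field
    _≟0     : ∀ a → Dec (a ≈ 0#)
    *-zero  : ∀ a b → a * b ≈ 0# → ¬ (a ≈ 0#) → b ≈ 0#

module Numerals {c ℓ} (R : CommutativeRing c ℓ) where
  open CommutativeRing R hiding (zero)
  open RingProperties ring
  open SetoidReasoning setoid

  κ : ℕ → Carrier
  κ zero    = 0#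
  κ (suc n) = 1# + κ n

  κ-+ : ∀ m n → κ (m ℕ.+ n) ≈ κ m + κ n
  κ-+ zero    n = sym (+-identityˡ _)
  κ-+ (suc m) n = trans (+-congˡ (κ-+ m n)) (sym (+-assoc _ _ _))

  κ-* : ∀ m n → κ (m ℕ.* n) ≈ κ m * κ n
  κ-* zero    n = sym (zeroˡ _)
  κ-* (suc m) n = begin
    κ (n ℕ.+ m ℕ.* n)     ≈⟨ κ-+ n (m ℕ.* n) ⟩
    κ n + κ (m ℕ.* n)     ≈⟨ +-cong (sym (*-identityˡ _)) (κ-* m n) ⟩
    1# * κ n + κ m * κ n  ≈⟨ distribʳ _ _ _ ⟨
    (1# + κ m) * κ n      ∎

  κℤ : ℤ → Carrier
  κℤ (+ n)    = κ n
  κℤ -[1+ n ] = - κ (suc n)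

  κℤ-⊖ : ∀ m n → κℤ (m ℤ.⊖ n) ≈ κ m - κ n
  κℤ-⊖ m       zero    = sym (trans (+-congˡ -0#≈0#) (+-identityʳ _))
  κℤ-⊖ zero    (suc n) = sym (+-identityˡ _)
  κℤ-⊖ (suc m) (suc n) rewrite ℤₚ.[1+m]⊖[1+n]≡m⊖n m n = begin
    κℤ (m ℤ.⊖ n)                     ≈⟨ κℤ-⊖ m n ⟩
    κ m - κ n                        ≈⟨ +-congʳ (+-identityˡ _) ⟨
    0# + κ m - κ n                   ≈⟨ +-congʳ (+-congʳ (-‿inverseʳ 1#)) ⟨
    1# - 1# + κ m - κ n              ≈⟨ +-congʳ (trans (+-assoc _ _ _) (trans (+-congˡ (+-comm _ _)) (sym (+-assoc _ _ _)))) ⟩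
    1# + κ m - 1# - κ n              ≈⟨ +-assoc _ _ _ ⟩
    1# + κ m + (- 1# - κ n)          ≈⟨ +-congˡ (-‿+-comm _ _) ⟩
    (1# + κ m) - (1# + κ n)          ∎

  κℤ-neg : ∀ i → κℤ (ℤ.- i) ≈ - κℤ i
  κℤ-neg (+ zero)  = sym -0#≈0#
  κℤ-neg (+ suc n) = refl
  κℤ-neg -[1+ n ]  = sym (-‿involutive _)

  κℤ-+ : ∀ i j → κℤ (i ℤ.+ j) ≈ κℤ i + κℤ j
  κℤ-+ (+ m)    (+ n)    = κ-+ m n
  κℤ-+ (+ m)    -[1+ n ] = κℤ-⊖ m (suc n)
  κℤ-+ -[1+ m ] (+ n)    = trans (κℤ-⊖ n (suc m)) (+-comm _ _)
  κℤ-+ -[1+ m ] -[1+ n ] = begin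
    - κ (suc (suc (m ℕ.+ n)))  ≈⟨ -‿cong (+-congˡ (κ-+ (suc m) n)) ⟩
    - (1# + (κ (suc m) + κ n)) ≈⟨ -‿cong (trans (sym (+-assoc _ _ _)) (trans (+-congʳ (+-comm _ _)) (+-assoc _ _ _))) ⟩
    - (κ (suc m) + κ (suc n))  ≈⟨ -‿+-comm _ _ ⟨
    - κ (suc m) - κ (suc n)    ∎

  κℤ-* : ∀ i j → κℤ (i ℤ.* j) ≈ κℤ i * κℤ j
  κℤ-* (+ m)    (+ n)    rewrite ℤₚ.+◃n≡+n (m ℕ.* n) = κ-* m n
  κℤ-* (+ m)    -[1+ n ] rewrite ℤₚ.-◃n≡-n (m ℕ.* suc n) =
    trans (κℤ-neg (+ (m ℕ.* suc n))) (trans (-‿cong (κ-* m (suc n))) (-‿distribʳ-* _ _))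
  κℤ-* -[1+ m ] (+ n)    rewrite ℤₚ.-◃n≡-n (suc m ℕ.* n) =
    trans (κℤ-neg (+ (suc m ℕ.* n))) (trans (-‿cong (κ-* (suc m) n)) (-‿distribˡ-* _ _))
  κℤ-* -[1+ m ] -[1+ n ] = begin
    κ (suc m ℕ.* suc n)          ≈⟨ κ-* (suc m) (suc n) ⟩
    κ (suc m) * κ (suc n)        ≈⟨ -‿involutive _ ⟨
    - - (κ (suc m) * κ (suc n))  ≈⟨ -‿cong (-‿distribʳ-* _ _) ⟩
    - (κ (suc m) * - κ (suc n))  ≈⟨ -‿distribˡ-* _ _ ⟩
    - κ (suc m) * - κ (suc n)    ∎

  κℤ-hom : Hom ℤₚ.+-*-commutativeRing R
  κℤ-hom = record
    { ⟨_⟩ = κℤ ; cong = λ { ≡.refl → refl } ; +-homo = κℤ-+ ; *-homo = κℤ-* ; 1-homo = +-identityʳ 1# }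

κ-hom : ∀ {a ℓ₁ b ℓ₂} {R : CommutativeRing a ℓ₁} {S : CommutativeRing b ℓ₂} (h : Hom R S) (n : ℕ) →
        CommutativeRing._≈_ S (Hom.⟨_⟩ h (Numerals.κ R n)) (Numerals.κ S n)
κ-hom h zero    = Hom.0-homo h
κ-hom {S = S} h (suc n) = trans (Hom.+-homo h _ _) (+-cong (Hom.1-homo h) (κ-hom h n))
  where open CommutativeRing S hiding (zero)

ℤ-isDomain : IsDomain ℤₚ.+-*-commutativeRing
ℤ-isDomain = record
  { _≟0 = λ a → a ℤ.≟ + 0
  ; *-zero = λ a b e a≢0 → case (ℤₚ.i*j≡0⇒i≡0∨j≡0 a e) a≢0 }
  where
  case : ∀ {a b : ℤ} → a ≡ + 0 ⊎ b ≡ + 0 → ¬ (a ≡ + 0) → b ≡ + 0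
  case (inj₁ p) q = contradiction p q
  case (inj₂ p) _ = p

module Polynomials {c ℓ} (R : CommutativeRing c ℓ) where
  open CommutativeRing R hiding (zero)
  open RingProperties ring using (-0#≈0#)

  Poly : Set c
  Poly = List Carrier

  coeff : Poly → ℕ → Carrier
  coeff []      _       = 0#
  coeff (a ∷ p) zero    = a
  coeff (a ∷ p) (suc k) = coeff p k

  infix 4 _≈ₚ_
  -- Coefficientwise, so that lists differing by trailing zeros are identified. Without decidable
  -- equality of the coefficients such zeros cannot be stripped.
  record _≈ₚ_ (p q : Poly) : Set ℓ where
    constructor mk
    field at : ∀ k → coeff p k ≈ coeff q k
  open _≈ₚ_ public

  infixl 6 _+ₚ_
  infixl 7 _*ₚ_

  _+ₚ_ : Poly → Poly → Poly
  []      +ₚ q       = q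
  (a ∷ p) +ₚ []      = a ∷ p
  (a ∷ p) +ₚ (b ∷ q) = (a + b) ∷ (p +ₚ q)

  -ₚ_ : Poly → Poly
  -ₚ_ = map (-_)

  scale : Carrier → Poly → Poly
  scale a = map (a *_)

  _*ₚ_ : Poly → Poly → Poly
  []      *ₚ q = []
  (a ∷ p) *ₚ q = scale a q +ₚ (0# ∷ (p *ₚ q))

  constant : Carrier → Poly
  constant a = a ∷ []

  X : Poly
  X = 0# ∷ 1# ∷ []

  coeff-+ : ∀ p q k → coeff (p +ₚ q) k ≈ coeff p k + coeff q k
  coeff-+ []      q       k       = sym (+-identityˡ _)
  coeff-+ (a ∷ p) []      k       = sym (+-identityʳ _)
  coeff-+ (a ∷ p) (b ∷ q) zero    = refl
  coeff-+ (a ∷ p) (b ∷ q) (suc k) = coeff-+ p q k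

  coeff-neg : ∀ p k → coeff (-ₚ p) k ≈ - coeff p k
  coeff-neg []      k       = sym -0#≈0#
  coeff-neg (a ∷ p) zero    = refl
  coeff-neg (a ∷ p) (suc k) = coeff-neg p k

  coeff-scale : ∀ a p k → coeff (scale a p) k ≈ a * coeff p k
  coeff-scale a []      k       = sym (zeroʳ a)
  coeff-scale a (b ∷ p) zero    = refl
  coeff-scale a (b ∷ p) (suc k) = coeff-scale a p k

  ≈ₚ-refl : ∀ {p} → p ≈ₚ p
  ≈ₚ-refl = mk λ _ → refl
  ≈ₚ-sym : ∀ {p q} → p ≈ₚ q → q ≈ₚ p
  ≈ₚ-sym e = mk λ k → sym (at e k)
  ≈ₚ-trans : ∀ {p q r} → p ≈ₚ q → q ≈ₚ r → p ≈ₚ r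
  ≈ₚ-trans e f = mk λ k → trans (at e k) (at f k)

  +ₚ-cong : ∀ {p p′ q q′} → p ≈ₚ p′ → q ≈ₚ q′ → p +ₚ q ≈ₚ p′ +ₚ q′
  +ₚ-cong {p} {p′} {q} {q′} e f = mk λ k →
    trans (coeff-+ p q k) (trans (+-cong (at e k) (at f k)) (sym (coeff-+ p′ q′ k)))

  +ₚ-assoc : ∀ p q r → (p +ₚ q) +ₚ r ≈ₚ p +ₚ (q +ₚ r)
  +ₚ-assoc p q r = mk λ k → trans (coeff-+ (p +ₚ q) r k) (trans (+-congʳ (coeff-+ p q k))
    (trans (+-assoc _ _ _) (sym (trans (coeff-+ p (q +ₚ r) k) (+-congˡ (coeff-+ q r k))))))

  +ₚ-comm : ∀ p q → p +ₚ q ≈ₚ q +ₚ p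
  +ₚ-comm p q = mk λ k → trans (coeff-+ p q k) (trans (+-comm _ _) (sym (coeff-+ q p k)))

  +ₚ-identityʳ : ∀ p → p +ₚ [] ≈ₚ p
  +ₚ-identityʳ p = mk λ k → trans (coeff-+ p [] k) (+-identityʳ _)

  -ₚ-cong : ∀ {p q} → p ≈ₚ q → -ₚ p ≈ₚ -ₚ q
  -ₚ-cong {p} {q} e = mk λ k → trans (coeff-neg p k) (trans (-‿cong (at e k)) (sym (coeff-neg q k)))

  -ₚ-inverseˡ : ∀ p → (-ₚ p) +ₚ p ≈ₚ []
  -ₚ-inverseˡ p = mk λ k → trans (coeff-+ (-ₚ p) p k) (trans (+-congʳ (coeff-neg p k)) (-‿inverseˡ _))

  ∷-cong : ∀ {a b p q} → a ≈ b → p ≈ₚ q → a ∷ p ≈ₚ b ∷ q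
  ∷-cong e f = mk λ { zero → e ; (suc k) → at f k }

  0∷[] : 0# ∷ [] ≈ₚ []
  0∷[] = mk λ { zero → refl ; (suc k) → refl }

  scale-cong : ∀ {a b p q} → a ≈ b → p ≈ₚ q → scale a p ≈ₚ scale b q
  scale-cong {a} {b} {p} {q} e f = mk λ k →
    trans (coeff-scale a p k) (trans (*-cong e (at f k)) (sym (coeff-scale b q k)))

  scale-+ : ∀ a p q → scale a (p +ₚ q) ≈ₚ scale a p +ₚ scale a q
  scale-+ a p q = mk λ k → trans (coeff-scale a (p +ₚ q) k) (trans (*-congˡ (coeff-+ p q k))
    (trans (distribˡ _ _ _) (sym (trans (coeff-+ (scale a p) (scale a q) k)
      (+-cong (coeff-scale a p k) (coeff-scale a q k))))))

  scale-* : ∀ a b p → scale a (scale b p) ≈ₚ scale (a * b) p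
  scale-* a b p = mk λ k → trans (coeff-scale a (scale b p) k) (trans (*-congˡ (coeff-scale b p k))
    (trans (sym (*-assoc _ _ _)) (sym (coeff-scale (a * b) p k))))

  scale-0 : ∀ p → scale 0# p ≈ₚ []
  scale-0 p = mk λ k → trans (coeff-scale 0# p k) (zeroˡ _)

  scale-1 : ∀ p → scale 1# p ≈ₚ p
  scale-1 p = mk λ k → trans (coeff-scale 1# p k) (*-identityˡ _)

  infixr 2 _⟫_
  private
    _⟫_ = λ {p} {q} {r} → ≈ₚ-trans {p} {q} {r}

  +ₚ-swap : ∀ p q r → p +ₚ (q +ₚ r) ≈ₚ q +ₚ (p +ₚ r)
  +ₚ-swap p q r = ≈ₚ-sym (+ₚ-assoc p q r) ⟫ +ₚ-cong (+ₚ-comm p q) ≈ₚ-refl ⟫ +ₚ-assoc q p r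

  *ₚ-congˡ : ∀ p {q r} → q ≈ₚ r → p *ₚ q ≈ₚ p *ₚ r
  *ₚ-congˡ []      e = ≈ₚ-refl
  *ₚ-congˡ (a ∷ p) e = +ₚ-cong (scale-cong refl e) (∷-cong refl (*ₚ-congˡ p e))

  *ₚ-zeroʳ : ∀ p → p *ₚ [] ≈ₚ []
  *ₚ-zeroʳ []      = ≈ₚ-refl
  *ₚ-zeroʳ (a ∷ p) = ∷-cong refl (*ₚ-zeroʳ p) ⟫ 0∷[]

  *ₚ-∷ʳ : ∀ p b q → p *ₚ (b ∷ q) ≈ₚ scale b p +ₚ (0# ∷ (p *ₚ q))
  *ₚ-∷ʳ []      b q = ≈ₚ-sym 0∷[]
  *ₚ-∷ʳ (a ∷ p) b q = ∷-cong (+-congʳ (*-comm a b))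
    (+ₚ-cong ≈ₚ-refl (*ₚ-∷ʳ p b q) ⟫ +ₚ-swap (scale a q) (scale b p) _)

  *ₚ-comm : ∀ p q → p *ₚ q ≈ₚ q *ₚ p
  *ₚ-comm []      q = ≈ₚ-sym (*ₚ-zeroʳ q)
  *ₚ-comm (a ∷ p) q = +ₚ-cong ≈ₚ-refl (∷-cong refl (*ₚ-comm p q)) ⟫ ≈ₚ-sym (*ₚ-∷ʳ q a p)

  *ₚ-cong : ∀ {p p′ q q′} → p ≈ₚ p′ → q ≈ₚ q′ → p *ₚ q ≈ₚ p′ *ₚ q′
  *ₚ-cong {p} {p′} {q} {q′} e f =
    *ₚ-congˡ p f ⟫ *ₚ-comm p q′ ⟫ *ₚ-congˡ q′ e ⟫ *ₚ-comm q′ p′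

  *ₚ-distribˡ : ∀ p q r → p *ₚ (q +ₚ r) ≈ₚ p *ₚ q +ₚ p *ₚ r
  *ₚ-distribˡ []      q r = ≈ₚ-refl
  *ₚ-distribˡ (a ∷ p) q r =
    +ₚ-cong (scale-+ a q r) (∷-cong (sym (+-identityˡ 0#)) (*ₚ-distribˡ p q r))
    ⟫ +ₚ-assoc (scale a q) (scale a r) _
    ⟫ +ₚ-cong (≈ₚ-refl {scale a q}) (+ₚ-swap (scale a r) (0# ∷ (p *ₚ q)) (0# ∷ (p *ₚ r)))
    ⟫ ≈ₚ-sym (+ₚ-assoc (scale a q) (0# ∷ (p *ₚ q)) _)

  *ₚ-distribʳ : ∀ r p q → (p +ₚ q) *ₚ r ≈ₚ p *ₚ r +ₚ q *ₚ r
  *ₚ-distribʳ r p q =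
    *ₚ-comm (p +ₚ q) r ⟫ *ₚ-distribˡ r p q ⟫ +ₚ-cong (*ₚ-comm r p) (*ₚ-comm r q)

  shift-* : ∀ p q → (0# ∷ p) *ₚ q ≈ₚ 0# ∷ (p *ₚ q)
  shift-* p q = +ₚ-cong (scale-0 q) ≈ₚ-refl

  scale-*ₚ : ∀ a p q → scale a p *ₚ q ≈ₚ scale a (p *ₚ q)
  scale-*ₚ a []      q = ≈ₚ-refl
  scale-*ₚ a (b ∷ p) q =
    +ₚ-cong (≈ₚ-sym (scale-* a b q)) (∷-cong (sym (zeroʳ a)) (scale-*ₚ a p q))
    ⟫ ≈ₚ-sym (scale-+ a (scale b q) (0# ∷ (p *ₚ q)))

  *ₚ-assoc : ∀ p q r → (p *ₚ q) *ₚ r ≈ₚ p *ₚ (q *ₚ r)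
  *ₚ-assoc []      q r = ≈ₚ-refl
  *ₚ-assoc (a ∷ p) q r =
    *ₚ-distribʳ r (scale a q) (0# ∷ (p *ₚ q))
    ⟫ +ₚ-cong (scale-*ₚ a q r) (shift-* (p *ₚ q) r ⟫ ∷-cong refl (*ₚ-assoc p q r))

  *ₚ-identityˡ : ∀ p → constant 1# *ₚ p ≈ₚ p
  *ₚ-identityˡ p = +ₚ-cong (scale-1 p) 0∷[] ⟫ +ₚ-identityʳ p

  polyRing : CommutativeRing c ℓ
  polyRing = record
    { Carrier = Poly ; _≈_ = _≈ₚ_ ; _+_ = _+ₚ_ ; _*_ = _*ₚ_ ; -_ = -ₚ_ ; 0# = [] ; 1# = constant 1#
    ; isCommutativeRing = record
      { isRing = record
        { +-isAbelianGroup = record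
          { isGroup = record
            { isMonoid = record
              { isSemigroup = record
                { isMagma = record
                  { isEquivalence = record { refl = ≈ₚ-refl ; sym = ≈ₚ-sym ; trans = ≈ₚ-trans }
                  ; ∙-cong = +ₚ-cong }
                ; assoc = +ₚ-assoc }
              ; identity = (λ _ → ≈ₚ-refl) , +ₚ-identityʳ }
            ; inverse = -ₚ-inverseˡ , (λ p → +ₚ-comm p _ ⟫ -ₚ-inverseˡ p)
            ; ⁻¹-cong = -ₚ-cong }
          ; comm = +ₚ-comm }
        ; *-cong = *ₚ-cong
        ; *-assoc = *ₚ-assoc
        ; *-identity = *ₚ-identityˡ , (λ p → *ₚ-comm p _ ⟫ *ₚ-identityˡ p)
        ; distrib = *ₚ-distribˡ , *ₚ-distribʳ }
      ; *-comm = *ₚ-comm }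
    }

  constantHom : Hom R polyRing
  constantHom = record
    { ⟨_⟩ = constant ; cong = λ e → ∷-cong e ≈ₚ-refl ; +-homo = λ _ _ → ≈ₚ-refl
    ; *-homo = λ _ _ → ∷-cong (sym (+-identityʳ _)) ≈ₚ-refl ; 1-homo = ≈ₚ-refl }

  module _ (dom : IsDomain R) where
    open IsDomain dom

    poly-≟0 : ∀ p → Dec (p ≈ₚ [])
    poly-≟0 []      = yes ≈ₚ-refl
    poly-≟0 (a ∷ p) = map′
      (λ { (e , f) → mk λ { zero → e ; (suc k) → at f k } })
      (λ e → at e zero , mk λ k → at e (suc k))
      ((a ≟0) ×-dec poly-≟0 p)

    private
      tail-zero : ∀ {a p} → a ∷ p ≈ₚ [] → p ≈ₚ []
      tail-zero e = mk λ k → at e (suc k)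

    private
      -- Comparing lowest terms: a vanishing constant coefficient can be stripped off either factor.
      nonzero-constant-cancels : ∀ a p → ¬ (a ≈ 0#) → ∀ q → (a ∷ p) *ₚ q ≈ₚ [] → q ≈ₚ []
      nonzero-constant-cancels a p a≉0 []      e = ≈ₚ-refl
      nonzero-constant-cancels a p a≉0 (b ∷ q) e = ∷-cong b≈0 (nonzero-constant-cancels a p a≉0 q pq≈0) ⟫ 0∷[]
        where
        b≈0 : b ≈ 0#
        b≈0 = *-zero a b (trans (sym (+-identityʳ _)) (at e zero)) a≉0
        pq≈0 : (a ∷ p) *ₚ q ≈ₚ []
        pq≈0 = tail-zero (≈ₚ-sym (*ₚ-comm (a ∷ p) (0# ∷ q) ⟫ shift-* q (a ∷ p) ⟫ ∷-cong refl (*ₚ-comm q (a ∷ p)))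
                          ⟫ *ₚ-congˡ (a ∷ p) (∷-cong (sym b≈0) ≈ₚ-refl) ⟫ e)

    poly-*-zero : ∀ p q → p *ₚ q ≈ₚ [] → ¬ (p ≈ₚ []) → q ≈ₚ []
    poly-*-zero []      q e p≉0 = contradiction ≈ₚ-refl p≉0
    poly-*-zero (a ∷ p) q e p≉0 with a ≟0
    ... | yes a≈0 = poly-*-zero p q
          (tail-zero (≈ₚ-sym (shift-* p q) ⟫ *ₚ-cong {0# ∷ p} {a ∷ p} (∷-cong (sym a≈0) ≈ₚ-refl) (≈ₚ-refl {q}) ⟫ e))
          (λ p≈0 → p≉0 (∷-cong a≈0 p≈0 ⟫ 0∷[]))
    ... | no a≉0 = nonzero-constant-cancels a p a≉0 q e

    polyRing-isDomain : IsDomain polyRing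
    polyRing-isDomain = record { _≟0 = poly-≟0 ; *-zero = poly-*-zero }

module Evaluation {a ℓ₁ b ℓ₂} {R : CommutativeRing a ℓ₁} {S : CommutativeRing b ℓ₂}
                  (h : Hom R S) (s : CommutativeRing.Carrier S) where
  private
    module R = CommutativeRing R
    module h = Hom h
  open Polynomials R
  open CommutativeRing S hiding (zero)

  ev : Poly → Carrier
  ev []      = 0#
  ev (k ∷ p) = h.⟨ k ⟩ + s * ev p

  private
    ev-0 : ∀ p → p ≈ₚ [] → ev p ≈ 0#
    ev-0 []      e = refl
    ev-0 (k ∷ p) e = trans (+-cong (trans (h.cong (at e zero)) h.0-homo)
                              (trans (*-congˡ (ev-0 p (mk λ i → at e (suc i)))) (zeroʳ s)))
                           (+-identityˡ 0#)

  ev-cong : ∀ {p q} → p ≈ₚ q → ev p ≈ ev q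
  ev-cong {[]}    {q}     e = sym (ev-0 q (≈ₚ-sym e))
  ev-cong {k ∷ p} {[]}    e = ev-0 (k ∷ p) e
  ev-cong {k ∷ p} {l ∷ q} e =
    +-cong (h.cong (at e zero)) (*-congˡ (ev-cong {p} {q} (mk λ i → at e (suc i))))

  private
    interchange : ∀ x y z w → (x + y) + (z + w) ≈ (x + z) + (y + w)
    interchange x y z w = trans (+-assoc _ _ _) (trans (+-congˡ (trans (sym (+-assoc _ _ _))
      (trans (+-congʳ (+-comm y z)) (+-assoc _ _ _)))) (sym (+-assoc _ _ _)))

  ev-+ : ∀ p q → ev (p +ₚ q) ≈ ev p + ev q
  ev-+ []      q       = sym (+-identityˡ _)
  ev-+ (k ∷ p) []      = sym (+-identityʳ _)
  ev-+ (k ∷ p) (l ∷ q) = trans (+-cong (h.+-homo k l) (trans (*-congˡ (ev-+ p q)) (distribˡ _ _ _)))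
                               (interchange _ _ _ _)

  ev-scale : ∀ k p → ev (scale k p) ≈ h.⟨ k ⟩ * ev p
  ev-scale k []      = sym (zeroʳ _)
  ev-scale k (l ∷ p) = trans (+-cong (h.*-homo k l)
    (trans (*-congˡ (ev-scale k p)) (trans (sym (*-assoc _ _ _)) (trans (*-congʳ (*-comm _ _)) (*-assoc _ _ _)))))
    (sym (distribˡ _ _ _))

  ev-* : ∀ p q → ev (p *ₚ q) ≈ ev p * ev q
  ev-* []      q = sym (zeroˡ _)
  ev-* (k ∷ p) q = trans (ev-+ (scale k q) (R.0# ∷ (p *ₚ q)))
    (trans (+-cong (ev-scale k q)
      (trans (+-cong h.0-homo (*-congˡ (ev-* p q))) (trans (+-identityˡ _) (sym (*-assoc _ _ _)))))
      (sym (distribʳ _ _ _)))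

  ev-constant : ∀ k → ev (constant k) ≈ h.⟨ k ⟩
  ev-constant k = trans (+-congˡ (zeroʳ s)) (+-identityʳ _)

  ev-X : ev X ≈ s
  ev-X = trans (+-cong h.0-homo (trans (*-congˡ (trans (ev-constant R.1#) h.1-homo)) (*-identityʳ s)))
               (+-identityˡ s)

  evHom : Hom polyRing S
  evHom = record
    { ⟨_⟩ = ev ; cong = ev-cong ; +-homo = ev-+ ; *-homo = ev-*
    ; 1-homo = trans (ev-constant R.1#) h.1-homo }

-- The free commutative ring on n generators. It provides the normal forms of the solver and, for n
-- = 3, the ring of the generic point.
ℤ[_] : ℕ → CommutativeRing 0ℓ 0ℓ
ℤ[ zero ]  = ℤₚ.+-*-commutativeRing
ℤ[ suc n ] = Polynomials.polyRing ℤ[ n ]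

ℤ[_]-isDomain : ∀ n → IsDomain ℤ[ n ]
ℤ[ zero ]-isDomain  = ℤ-isDomain
ℤ[ suc n ]-isDomain = Polynomials.polyRing-isDomain ℤ[ n ] ℤ[ n ]-isDomain

generators : ∀ n → Vec (CommutativeRing.Carrier ℤ[ n ]) n
generators zero    = []
generators (suc n) = Polynomials.X ℤ[ n ] ∷ Vec.map (Polynomials.constant ℤ[ n ]) (generators n)

module _ {c ℓ} (R : CommutativeRing c ℓ) where
  open CommutativeRing R hiding (zero)

  evaluateAt : ∀ {n} → Vec Carrier n → Hom ℤ[ n ] R
  evaluateAt []      = Numerals.κℤ-hom R
  evaluateAt (x ∷ ρ) = Evaluation.evHom (evaluateAt ρ) x

  evaluateAt-generators : ∀ {n} (ρ : Vec Carrier n) i → Hom.⟨_⟩ (evaluateAt ρ) (lookup (generators n) i) ≈ lookup ρ i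
  evaluateAt-generators (x ∷ ρ) zero    = Evaluation.ev-X (evaluateAt ρ) x
  evaluateAt-generators {suc n} (x ∷ ρ) (suc i)
    rewrite lookup-map i (Polynomials.constant ℤ[ n ]) (generators n) =
    trans (Evaluation.ev-constant (evaluateAt ρ) x _) (evaluateAt-generators ρ i)

-- Consequences of ring equations, decided in ℤ[x₁,...,xₙ]

infixl 6 _:+_ _:-_
infixl 7 _:*_
infixr 8 _:^_ :-_

data Expr (n : ℕ) : Set where
  var       : Fin n → Expr n
  con       : ℕ → Expr n
  :1        : Expr n
  _:+_ _:*_ _:-_ : Expr n → Expr n → Expr n
  :-_       : Expr n → Expr n
  _:^_      : Expr n → ℕ → Expr n

-- An equation that is to follow from hypotheses, each given with the factor by
-- which it enters the linear combination.
infix  4 _⊜_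
infixr 3 _∙_⊜_⇒_
data Problem (n : ℕ) : Set where
  _⊜_     : Expr n → Expr n → Problem n
  _∙_⊜_⇒_ : Expr n → Expr n → Expr n → Problem n → Problem n

module Power {c ℓ} (R : CommutativeRing c ℓ) where
  open CommutativeRing R hiding (zero)

  infixr 8 _^_
  -- The separate clause for exponent 1 makes `x ^ 2` the product `x * x` itself, with no trailing
  -- factor 1.
  _^_ : Carrier → ℕ → Carrier
  x ^ zero        = 1#
  x ^ suc zero    = x
  x ^ suc (suc n) = x * x ^ suc n

module Semantics {c ℓ} (R : CommutativeRing c ℓ) where
  open CommutativeRing R hiding (zero)
  open Numerals R
  open Power R

  ⟦_⟧ : ∀ {n} → Expr n → Vec Carrier n → Carrier
  ⟦ var i ⟧  ρ = lookup ρ i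
  ⟦ con k ⟧  ρ = κ k
  ⟦ :1 ⟧     ρ = 1#
  ⟦ e :+ f ⟧ ρ = ⟦ e ⟧ ρ + ⟦ f ⟧ ρ
  ⟦ e :* f ⟧ ρ = ⟦ e ⟧ ρ * ⟦ f ⟧ ρ
  ⟦ e :- f ⟧ ρ = ⟦ e ⟧ ρ - ⟦ f ⟧ ρ
  ⟦ :- e ⟧   ρ = - ⟦ e ⟧ ρ
  ⟦ e :^ k ⟧ ρ = ⟦ e ⟧ ρ ^ k

  Holds : ∀ {n} → Problem n → Vec Carrier n → Set ℓ
  Holds (l ⊜ r)         ρ = ⟦ l ⟧ ρ ≈ ⟦ r ⟧ ρ
  Holds (k ∙ l ⊜ r ⇒ p) ρ = ⟦ l ⟧ ρ ≈ ⟦ r ⟧ ρ → Holds p ρ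

module _ {a ℓ₁ b ℓ₂} {R : CommutativeRing a ℓ₁} {S : CommutativeRing b ℓ₂} (h : Hom R S) where
  private
    module R where
      open CommutativeRing R public
      open Semantics R public
      open Power R public
  open CommutativeRing S hiding (zero)
  open Semantics S
  open Power S
  open Hom h renaming (cong to h-cong)

  ^-homo : ∀ x k → ⟨ x R.^ k ⟩ ≈ ⟨ x ⟩ ^ k
  ^-homo x zero          = 1-homo
  ^-homo x (suc zero)    = refl
  ^-homo x (suc (suc k)) = trans (*-homo _ _) (*-congˡ (^-homo x (suc k)))

  ^-cong : ∀ {x y} k → x ≈ y → x ^ k ≈ y ^ k
  ^-cong zero          e = refl
  ^-cong (suc zero)    e = e
  ^-cong (suc (suc k)) e = *-cong e (^-cong (suc k) e)

  ⟦⟧-homo : ∀ {n} (e : Expr n) {ρ : Vec R.Carrier n} {σ : Vec Carrier n} →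
            (∀ i → ⟨ lookup ρ i ⟩ ≈ lookup σ i) → ⟨ R.⟦ e ⟧ ρ ⟩ ≈ ⟦ e ⟧ σ
  ⟦⟧-homo (var i)  H = H i
  ⟦⟧-homo (con k)  H = κ-hom h k
  ⟦⟧-homo :1       H = 1-homo
  ⟦⟧-homo (e :+ f) H = trans (+-homo _ _) (+-cong (⟦⟧-homo e H) (⟦⟧-homo f H))
  ⟦⟧-homo (e :* f) H = trans (*-homo _ _) (*-cong (⟦⟧-homo e H) (⟦⟧-homo f H))
  ⟦⟧-homo (e :- f) H = trans (+-homo _ _) (+-cong (⟦⟧-homo e H) (trans (-‿homo _) (-‿cong (⟦⟧-homo f H))))
  ⟦⟧-homo (:- e)   H = trans (-‿homo _) (-‿cong (⟦⟧-homo e H))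
  ⟦⟧-homo (e :^ k) H = trans (^-homo _ k) (^-cong k (⟦⟧-homo e H))

  closed : ∀ n → N-ary n (Expr n) (Expr n) → Expr n
  closed n e = e $ⁿ Vec.tabulate var

  homo : ∀ n (e : N-ary n (Expr n) (Expr n)) {ρ : Vec R.Carrier n} {σ : Vec Carrier n} →
         Pointwise (λ a b → ⟨ a ⟩ ≈ b) ρ σ → ⟨ R.⟦ closed n e ⟧ ρ ⟩ ≈ ⟦ closed n e ⟧ σ
  homo n e H = ⟦⟧-homo (closed n e) (Pointwise.lookup H)

  transfer : ∀ n (l r : N-ary n (Expr n) (Expr n)) {ρ : Vec R.Carrier n} {σ : Vec Carrier n} →
             Pointwise (λ a b → ⟨ a ⟩ ≈ b) ρ σ →
             R.⟦ closed n l ⟧ ρ R.≈ R.⟦ closed n r ⟧ ρ → ⟦ closed n l ⟧ σ ≈ ⟦ closed n r ⟧ σ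
  transfer n l r H e = trans (sym (homo n l H)) (trans (h-cong e) (homo n r H))

curry-∀ⁿ : ∀ {a ℓ} {A : Set a} n {P : Vec A n → Set ℓ} → (∀ ρ → P ρ) → ∀ⁿ n (curryⁿ {n = n} P)
curry-∀ⁿ zero    p = p []
curry-∀ⁿ (suc n) p = λ x → curry-∀ⁿ n λ ρ → p (x ∷ ρ)

module Solver {c ℓ} (R : CommutativeRing c ℓ) where
  open CommutativeRing R hiding (zero)
  open Semantics R
  open RingProperties ring

  -- The second argument accumulates the sum of all kᵢ(lᵢ - rᵢ). If l - r minus this sum is the zero
  -- polynomial, the kᵢ are cofactors that exhibit l - r in the ideal of the hypotheses.
  residue : ∀ {n} → Problem n → Expr n → Expr n
  residue (l ⊜ r)         s = (l :- r) :- s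
  residue (k ∙ l ⊜ r ⇒ p) s = residue p (s :+ k :* (l :- r))

  Valid : ∀ {n} → Problem n → Bool
  Valid {n} p = does (IsDomain._≟0 ℤ[ n ]-isDomain (Semantics.⟦_⟧ ℤ[ n ] (residue p (con 0)) (generators n)))

  private
    fromZero : ∀ {n} (p : Problem n) s (ρ : Vec Carrier n) → ⟦ residue p s ⟧ ρ ≈ 0# → ⟦ s ⟧ ρ ≈ 0# → Holds p ρ
    fromZero (l ⊜ r) s ρ e z = x∙y⁻¹≈ε⇒x≈y _ _
      (trans (sym (+-identityʳ _)) (trans (+-congˡ (trans (sym -0#≈0#) (-‿cong (sym z)))) e))
    fromZero (k ∙ l ⊜ r ⇒ p) s ρ e z l≈r = fromZero p (s :+ k :* (l :- r)) ρ e
      (trans (+-cong z (trans (*-congˡ (trans (+-congʳ l≈r) (-‿inverseʳ _))) (zeroʳ _))) (+-identityʳ 0#))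

    toZero : ∀ {n} (e : Expr n) (ρ : Vec Carrier n) →
      (d : Dec (CommutativeRing._≈_ ℤ[ n ] (Semantics.⟦_⟧ ℤ[ n ] e (generators n)) (CommutativeRing.0# ℤ[ n ]))) →
      does d ≡ true → ⟦ e ⟧ ρ ≈ 0#
    toZero e ρ (yes z) _ =
      trans (sym (⟦⟧-homo {S = R} (evaluateAt R ρ) e {generators _} {ρ} (evaluateAt-generators R ρ)))
            (trans (Hom.cong (evaluateAt R ρ) z) (Hom.0-homo (evaluateAt R ρ)))

  -- Evaluation at `ρ` is a homomorphism from ℤ[n], so a residue that is zero at the generators is
  -- zero in every ring. Validity is a closed Boolean, established by computation.
  prove : ∀ n (f : N-ary n (Expr n) (Problem n)) →
          let p = f $ⁿ Vec.tabulate var in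
          Valid p ≡ true → ∀ⁿ n (curryⁿ {n = n} (Holds p))
  prove n f v = curry-∀ⁿ n λ ρ → fromZero p (con 0) ρ (toZero (residue p (con 0)) ρ (IsDomain._≟0 ℤ[ n ]-isDomain _) v) refl
    where p = f $ⁿ Vec.tabulate var

-- Elliptic sequences

-- Elliptic divisibility sequences over a domain.  Writing [m,n] for q_m ψ_n² - q_n ψ_m² with
-- q_n = ψ_(n+1) ψ_(n-1), both [m,n+1] [m,n-1] and [m+1,n] [m-1,n] equal an expression symmetric
-- in m and n, so the relation ψ_(m+n) ψ_(m-n) = [m,n] propagates from |m-n| ≤ 2 to all m, n.

module EllipticIdentities {c ℓ} (R : CommutativeRing c ℓ) where
  open CommutativeRing R hiding (zero)
  open Numerals R
  open Power R
  open Solver R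

  -- `m₋`, `m`, `m₁`, `m₂` stand for ψ at m-1, ..., m+2 and `mm` for ψ at m-2; likewise for n. The
  -- conclusion is [m,n+1] [m,n-1] = [m+1,n] [m-1,n]. The hypotheses, an invariant and a Somos
  -- relation for each index, eliminate the outermost terms.
  bracket-symmetry : ∀ β γ c m₂ m₁ m m₋ n₂ n₁ n n₋ mm nn →
    n₂ * n₋ ^ 2 + nn * n₁ ^ 2 + β ^ 2 * n ^ 3 ≈ c * n₋ * n * n₁ →
    n₂ * nn ≈ β ^ 2 * n₁ * n₋ - γ * n ^ 2 →
    m₂ * m₋ ^ 2 + mm * m₁ ^ 2 + β ^ 2 * m ^ 3 ≈ c * m₋ * m * m₁ →
    m₂ * mm ≈ β ^ 2 * m₁ * m₋ - γ * m ^ 2 →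
    (m₁ * m₋ * n₁ ^ 2 - n₂ * n * m ^ 2) * (m₁ * m₋ * n₋ ^ 2 - n * nn * m ^ 2)
      ≈ (m₂ * m * n ^ 2 - n₁ * n₋ * m₁ ^ 2) * (m * mm * n ^ 2 - n₁ * n₋ * m₋ ^ 2)
  bracket-symmetry = prove 13 (λ β γ c m₂ m₁ m m₋ n₂ n₁ n n₋ mm nn →
    con 0 :- m₁ :* m₋ :* m :^ 2 :* n ∙ n₂ :* n₋ :^ 2 :+ nn :* n₁ :^ 2 :+ β :^ 2 :* n :^ 3 ⊜ c :* n₋ :* n :* n₁ ⇒
    m :^ 4 :* n :^ 2 ∙ n₂ :* nn ⊜ β :^ 2 :* n₁ :* n₋ :- γ :* n :^ 2 ⇒
    n₁ :* n₋ :* n :^ 2 :* m ∙ m₂ :* m₋ :^ 2 :+ mm :* m₁ :^ 2 :+ β :^ 2 :* m :^ 3 ⊜ c :* m₋ :* m :* m₁ ⇒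
    con 0 :- n :^ 4 :* m :^ 2 ∙ m₂ :* mm ⊜ β :^ 2 :* m₁ :* m₋ :- γ :* m :^ 2 ⇒
    (m₁ :* m₋ :* n₁ :^ 2 :- n₂ :* n :* m :^ 2) :* (m₁ :* m₋ :* n₋ :^ 2 :- n :* nn :* m :^ 2)
      ⊜ (m₂ :* m :* n :^ 2 :- n₁ :* n₋ :* m₁ :^ 2) :* (m :* mm :* n :^ 2 :- n₁ :* n₋ :* m₋ :^ 2)) ≡.refl

  -- Read `a`, `b`, `c`, `d` as [m,n+1], [m,n-1], [m+1,n], [m-1,n]. With `N`, `N₋` for ψ at m+n+1,
  -- m+n-1 and `δ`, `δ₂` for ψ at m-n-1, m-n+1, three known brackets determine the fourth up to a
  -- common factor.
  bracket-step : ∀ a b c d N N₋ δ δ₂ →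
    a * b ≈ c * d →
    a ≈ N * δ →
    b ≈ N₋ * δ₂ →
    d ≈ N₋ * δ →
    δ * N₋ * (N * δ₂) ≈ δ * N₋ * c
  bracket-step = prove 8 (λ a b c d N N₋ δ δ₂ →
    :1 ∙ a :* b ⊜ c :* d ⇒
    con 0 :- b ∙ a ⊜ N :* δ ⇒
    con 0 :- N :* δ ∙ b ⊜ N₋ :* δ₂ ⇒
    c ∙ d ⊜ N₋ :* δ ⇒
    δ :* N₋ :* (N :* δ₂) ⊜ δ :* N₋ :* c) ≡.refl

  invariant-step : ∀ β γ c ψ₅ ψ₄ ψ₃ ψ₂ ψ₁ ψ₀ →
    ψ₅ * ψ₁ ≈ β ^ 2 * ψ₄ * ψ₂ - γ * ψ₃ ^ 2 →
    ψ₄ * ψ₁ ^ 2 + ψ₀ * ψ₃ ^ 2 + β ^ 2 * ψ₂ ^ 3 ≈ c * ψ₁ * ψ₂ * ψ₃ →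
    ψ₄ * ψ₀ ≈ β ^ 2 * ψ₃ * ψ₁ - γ * ψ₂ ^ 2 →
    ψ₁ * (ψ₅ * ψ₂ ^ 2 + ψ₁ * ψ₄ ^ 2 + β ^ 2 * ψ₃ ^ 3) ≈ ψ₁ * (c * ψ₂ * ψ₃ * ψ₄)
  invariant-step = prove 9 (λ β γ c ψ₅ ψ₄ ψ₃ ψ₂ ψ₁ ψ₀ →
    ψ₂ :^ 2 ∙ ψ₅ :* ψ₁ ⊜ β :^ 2 :* ψ₄ :* ψ₂ :- γ :* ψ₃ :^ 2 ⇒
    ψ₄ ∙ ψ₄ :* ψ₁ :^ 2 :+ ψ₀ :* ψ₃ :^ 2 :+ β :^ 2 :* ψ₂ :^ 3 ⊜ c :* ψ₁ :* ψ₂ :* ψ₃ ⇒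
    con 0 :- ψ₃ :^ 2 ∙ ψ₄ :* ψ₀ ⊜ β :^ 2 :* ψ₃ :* ψ₁ :- γ :* ψ₂ :^ 2 ⇒
    ψ₁ :* (ψ₅ :* ψ₂ :^ 2 :+ ψ₁ :* ψ₄ :^ 2 :+ β :^ 2 :* ψ₃ :^ 3) ⊜ ψ₁ :* (c :* ψ₂ :* ψ₃ :* ψ₄)) ≡.refl

  bracket-0 : ∀ a b o e z f →
    o ≈ 1# →
    z ≈ 0# →
    a * b ≈ a * b * o ^ 2 - e * z * f ^ 2
  bracket-0 = prove 6 (λ a b o e z f →
    con 0 :- a :* b :* (o :+ :1) ∙ o ⊜ :1 ⇒
    e :* f :^ 2 ∙ z ⊜ con 0 ⇒
    a :* b ⊜ a :* b :* o :^ 2 :- e :* z :* f :^ 2) ≡.refl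

  bracket-1 : ∀ a o e b f g →
    o ≈ 1# →
    a ≈ e * b ^ 3 - f * g ^ 3 →
    a * o ≈ e * b * b ^ 2 - g * f * g ^ 2
  bracket-1 = prove 6 (λ a o e b f g →
    a ∙ o ⊜ :1 ⇒
    :1 ∙ a ⊜ e :* b :^ 3 :- f :* g :^ 3 ⇒
    a :* o ⊜ e :* b :* b :^ 2 :- g :* f :* g :^ 2) ≡.refl

  bracket-2 : ∀ a β e b f g k →
    β * a ≈ k * (e * f ^ 2 - g * b ^ 2) →
    a * β ≈ e * k * f ^ 2 - k * g * b ^ 2
  bracket-2 = prove 7 (λ a β e b f g k →
    :1 ∙ β :* a ⊜ k :* (e :* f :^ 2 :- g :* b :^ 2) ⇒
    a :* β ⊜ e :* k :* f :^ 2 :- k :* g :* b :^ 2) ≡.refl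

  square-relation : ∀ a b β γ ψ₂ ψ₃ ψ₁ ψ₀ u v w →
    a * b ≈ u * w * ψ₂ ^ 2 - ψ₃ * ψ₁ * v ^ 2 →
    ψ₂ ≈ β →
    ψ₃ ≈ γ →
    ψ₁ ≈ 1# →
    a * b ≈ β ^ 2 * u * w - γ * v ^ 2
  square-relation = prove 11 (λ a b β γ ψ₂ ψ₃ ψ₁ ψ₀ u v w →
    :1 ∙ a :* b ⊜ u :* w :* ψ₂ :^ 2 :- ψ₃ :* ψ₁ :* v :^ 2 ⇒
    u :* w :* (ψ₂ :+ β) ∙ ψ₂ ⊜ β ⇒
    con 0 :- ψ₁ :* v :^ 2 ∙ ψ₃ ⊜ γ ⇒
    con 0 :- γ :* v :^ 2 ∙ ψ₁ ⊜ :1 ⇒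
    a :* b ⊜ β :^ 2 :* u :* w :- γ :* v :^ 2) ≡.refl

  invariant-2 : ∀ β γ c ψ₀ ψ₁ ψ₂ ψ₃ ψ₄ →
    ψ₀ ≈ 0# →
    ψ₁ ≈ 1# →
    ψ₂ ≈ β →
    ψ₃ ≈ γ →
    ψ₄ ≈ β * (c * γ - β ^ 4) →
    ψ₄ * ψ₁ ^ 2 + ψ₀ * ψ₃ ^ 2 + β ^ 2 * ψ₂ ^ 3 ≈ c * ψ₁ * ψ₂ * ψ₃
  invariant-2 = prove 8 (λ β γ c ψ₀ ψ₁ ψ₂ ψ₃ ψ₄ →
    ψ₃ :^ 2 ∙ ψ₀ ⊜ con 0 ⇒
    ψ₄ :* (ψ₁ :+ :1) :- c :* ψ₂ :* ψ₃ ∙ ψ₁ ⊜ :1 ⇒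
    β :^ 2 :* (ψ₂ :^ 2 :+ ψ₂ :* β :+ β :^ 2) :- c :* ψ₃ ∙ ψ₂ ⊜ β ⇒
    con 0 :- c :* β ∙ ψ₃ ⊜ γ ⇒
    :1 ∙ ψ₄ ⊜ β :* (c :* γ :- β :^ 4) ⇒
    ψ₄ :* ψ₁ :^ 2 :+ ψ₀ :* ψ₃ :^ 2 :+ β :^ 2 :* ψ₂ :^ 3 ⊜ c :* ψ₁ :* ψ₂ :* ψ₃) ≡.refl

module DomainProperties {c ℓ} (R : CommutativeRing c ℓ) (dom : IsDomain R) where
  open CommutativeRing R hiding (zero)
  open Solver R
  open IsDomain dom

  private
    difference : ∀ a b c →
      a * b ≈ a * c →
      a * (b - c) ≈ 0#
    difference = prove 3 (λ a b c →
      :1 ∙ a :* b ⊜ a :* c ⇒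
      a :* (b :- c) ⊜ con 0) ≡.refl
    undifference : ∀ b c →
      b - c ≈ 0# →
      b ≈ c
    undifference = prove 2 (λ b c →
      :1 ∙ b :- c ⊜ con 0 ⇒
      b ⊜ c) ≡.refl

  *-cancelˡ : ∀ a {b c} → ¬ (a ≈ 0#) → a * b ≈ a * c → b ≈ c
  *-cancelˡ a {b} {c} a≉0 e = undifference b c (*-zero a (b - c) (difference a b c e) a≉0)

  *-nonzero : ∀ {a b} → ¬ (a ≈ 0#) → ¬ (b ≈ 0#) → ¬ (a * b ≈ 0#)
  *-nonzero {a} {b} a≉0 b≉0 e = b≉0 (*-zero a b e a≉0)

record EllipticSequence {c ℓ} (R : CommutativeRing c ℓ) : Set (c ⊔ ℓ) where
  open CommutativeRing R hiding (zero)
  open Power R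
  field
    β γ c# : Carrier
    ψ      : ℕ → Carrier
    ψ-0    : ψ 0 ≈ 0#
    ψ-1    : ψ 1 ≈ 1#
    ψ-2    : ψ 2 ≈ β
    ψ-3    : ψ 3 ≈ γ
    ψ-4    : ψ 4 ≈ β * (c# * γ - β ^ 4)
    ψ-odd  : ∀ k → ψ (3 ℕ.+ (k ℕ.+ k)) ≈ ψ (3 ℕ.+ k) * ψ (1 ℕ.+ k) ^ 3 - ψ k * ψ (2 ℕ.+ k) ^ 3
    ψ-even : ∀ k → β * ψ (4 ℕ.+ (k ℕ.+ k)) ≈
                   ψ (2 ℕ.+ k) * (ψ (4 ℕ.+ k) * ψ (1 ℕ.+ k) ^ 2 - ψ k * ψ (3 ℕ.+ k) ^ 2)

  -- ψ (m + n) ψ (m - n) = [m,n] for m = 1 + t, n = 1 + k, m + n = 2 + N and m - n = d.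
  Addition : (N d t k : ℕ) → Set ℓ
  Addition N d t k =
    ψ (2 ℕ.+ N) * ψ d ≈ ψ (2 ℕ.+ t) * ψ t * ψ (1 ℕ.+ k) ^ 2 - ψ (2 ℕ.+ k) * ψ k * ψ (1 ℕ.+ t) ^ 2

  -- The conserved quantity of the Somos recursion: the left side divided by the product of the
  -- three consecutive terms is the same constant `c#` for all j.
  Invariant : ℕ → Set ℓ
  Invariant j =
    ψ (4 ℕ.+ j) * ψ (1 ℕ.+ j) ^ 2 + ψ j * ψ (3 ℕ.+ j) ^ 2 + β ^ 2 * ψ (2 ℕ.+ j) ^ 3
      ≈ c# * ψ (1 ℕ.+ j) * ψ (2 ℕ.+ j) * ψ (3 ℕ.+ j)

  Somos : ℕ → Set ℓ
  Somos j = ψ (4 ℕ.+ j) * ψ j ≈ β ^ 2 * ψ (3 ℕ.+ j) * ψ (1 ℕ.+ j) - γ * ψ (2 ℕ.+ j) ^ 2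

module EllipticRelations {c ℓ} {R : CommutativeRing c ℓ} (dom : IsDomain R) (E : EllipticSequence R)
  (ψ≉0 : ∀ n → ¬ CommutativeRing._≈_ R (EllipticSequence.ψ E (suc n)) (CommutativeRing.0# R)) where
  open CommutativeRing R hiding (zero)
  open Power R
  open EllipticIdentities R
  open DomainProperties R dom
  open EllipticSequence E

  private
    somos-from-addition : ∀ j → Addition (2 ℕ.+ j) j (1 ℕ.+ j) 1 → Somos j
    somos-from-addition j e = square-relation _ _ β γ (ψ 2) (ψ 3) (ψ 1) (ψ 0) _ _ _ e ψ-2 ψ-3 ψ-1

    -- Proved jointly because the relations feed each other: the addition formula uses the invariant
    -- and the Somos relation at smaller indices, Somos is the case n = 2 of addition, and the
    -- invariant advances by means of Somos.
    Statement : ℕ → Set ℓ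
    Statement N = (∀ d t k → t ≡ d ℕ.+ k → N ≡ t ℕ.+ k → Addition N d t k)
                × (∀ j → N ≡ 2 ℕ.+ j → Invariant j)

    module Step (N : ℕ) (IH : ∀ {M} → M ℕ.< N → Statement M) where

      <-by : ∀ {M} r → N ≡ suc (r ℕ.+ M) → M ℕ.< N
      <-by {M} r ≡.refl = s≤s (ℕₚ.m≤n+m M r)

      addition : ∀ d t k → t ≡ d ℕ.+ k → N ≡ t ℕ.+ k → Addition N d t k
      addition d t zero p q
        rewrite ≡.trans q (ℕₚ.+-identityʳ t) | ≡.trans p (ℕₚ.+-identityʳ d) =
        bracket-0 _ _ (ψ 1) (ψ 2) (ψ 0) _ ψ-1 ψ-0
      addition 0 .k k@(suc _) ≡.refl q =
        trans (*-congˡ ψ-0) (trans (zeroʳ _) (sym (-‿inverseʳ _)))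
      addition 1 .(1 ℕ.+ k) k@(suc _) ≡.refl ≡.refl = bracket-1 _ _ _ _ _ _ ψ-1 (ψ-odd k)
      addition 2 .(2 ℕ.+ k) k@(suc _) ≡.refl ≡.refl = trans (*-congˡ ψ-2) (bracket-2 _ _ _ _ _ _ _ (ψ-even k))
      -- `bracket-symmetry` is applied at m = 3 + s, n = 2 + k₀. The bracket [m,n+1] has the same
      -- m+n as the goal and a difference smaller by two, so it is a structural call on `d`; [m,n-1]
      -- and [m-1,n] belong to N - 2.
      addition (suc (suc d@(suc d₀))) t (suc k₀) p q =
        ≡.subst₂ (λ N t → Addition N (2 ℕ.+ d) t (1 ℕ.+ k₀)) (≡.sym N≡) (≡.sym t≡)
          (*-cancelˡ (ψ d * ψ (2 ℕ.+ M)) (*-nonzero (ψ≉0 d₀) (ψ≉0 (1 ℕ.+ M)))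
            (bracket-step _ _ _ _ (ψ (4 ℕ.+ M)) (ψ (2 ℕ.+ M)) (ψ d) (ψ (2 ℕ.+ d))
              (bracket-symmetry β γ c#
                (ψ (5 ℕ.+ s)) (ψ (4 ℕ.+ s)) (ψ (3 ℕ.+ s)) (ψ (2 ℕ.+ s))
                (ψ (4 ℕ.+ k₀)) (ψ (3 ℕ.+ k₀)) (ψ (2 ℕ.+ k₀)) (ψ (1 ℕ.+ k₀)) (ψ (1 ℕ.+ s)) (ψ k₀)
                (proj₂ at-n k₀ ≡.refl)
                (somos-from-addition k₀ (proj₁ at-n k₀ (1 ℕ.+ k₀) 1 (arith₁ k₀) (arith₁ (1 ℕ.+ k₀))))
                (proj₂ at-m (1 ℕ.+ s) ≡.refl)
                (somos-from-addition (1 ℕ.+ s) (proj₁ at-m (1 ℕ.+ s) (2 ℕ.+ s) 1 (arith₁ (1 ℕ.+ s)) (arith₁ (2 ℕ.+ s)))))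
              (sym (≡.subst (λ N → Addition N d (2 ℕ.+ s) (2 ℕ.+ k₀)) N≡
                (addition d (2 ℕ.+ s) (2 ℕ.+ k₀) (arith₂ d k₀) (≡.trans N≡ (arith₃ s k₀)))))
              (sym (proj₁ at-M (2 ℕ.+ d) (2 ℕ.+ s) k₀ ≡.refl ≡.refl))
              (sym (proj₁ at-M d (1 ℕ.+ s) (1 ℕ.+ k₀) (≡.sym (ℕₚ.+-suc d k₀)) (≡.cong suc (≡.sym (ℕₚ.+-suc s k₀)))))))
        where
        s M : ℕ
        s = d ℕ.+ k₀
        M = 2 ℕ.+ (s ℕ.+ k₀)
        arith₁ : ∀ j → 1 ℕ.+ j ≡ j ℕ.+ 1
        arith₁ j = ℕₚ.+-comm 1 j
        arith₂ : ∀ d k → 2 ℕ.+ (d ℕ.+ k) ≡ d ℕ.+ (2 ℕ.+ k)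
        arith₂ = solve-∀
        arith₃ : ∀ s k → 4 ℕ.+ (s ℕ.+ k) ≡ 2 ℕ.+ s ℕ.+ (2 ℕ.+ k)
        arith₃ = solve-∀
        arith₄ : ∀ s k → 4 ℕ.+ (s ℕ.+ k) ≡ suc ((1 ℕ.+ s) ℕ.+ (2 ℕ.+ k))
        arith₄ = solve-∀
        arith₅ : ∀ s k → 4 ℕ.+ (s ℕ.+ k) ≡ suc (k ℕ.+ (3 ℕ.+ s))
        arith₅ = solve-∀
        t≡ : t ≡ 3 ℕ.+ s
        t≡ = ≡.trans p (≡.cong (2 ℕ.+_) (ℕₚ.+-suc d k₀))
        N≡ : N ≡ 2 ℕ.+ M
        N≡ = ≡.trans q (≡.trans (≡.cong (ℕ._+ suc k₀) t≡) (≡.cong (3 ℕ.+_) (ℕₚ.+-suc s k₀)))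
        at-M = IH {M} (<-by 1 N≡)
        at-n = IH {2 ℕ.+ k₀} (<-by (1 ℕ.+ s) (≡.trans N≡ (arith₄ s k₀)))
        at-m = IH {3 ℕ.+ s} (<-by k₀ (≡.trans N≡ (arith₅ s k₀)))

      invariant : ∀ j → N ≡ 2 ℕ.+ j → Invariant j
      invariant 0 q = invariant-2 β γ c# _ _ _ _ _ ψ-0 ψ-1 ψ-2 ψ-3 ψ-4
      invariant (suc j) ≡.refl = *-cancelˡ (ψ (1 ℕ.+ j)) (ψ≉0 j)
        (invariant-step β γ c# (ψ (5 ℕ.+ j)) (ψ (4 ℕ.+ j)) (ψ (3 ℕ.+ j)) (ψ (2 ℕ.+ j)) (ψ (1 ℕ.+ j)) (ψ j)
          (somos-from-addition (1 ℕ.+ j) (addition (1 ℕ.+ j) (2 ℕ.+ j) 1 (ℕₚ.+-comm 1 _) (ℕₚ.+-comm 1 _)))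
          (proj₂ (IH (<-by 0 ≡.refl)) j ≡.refl)
          (somos-from-addition j (proj₁ (IH (<-by 0 ≡.refl)) j (1 ℕ.+ j) 1 (ℕₚ.+-comm 1 _) (ℕₚ.+-comm 1 _))))

    statement : ∀ N → Statement N
    statement = <-rec Statement λ N IH → Step.addition N IH , Step.invariant N IH

  invariant : ∀ j → Invariant j
  invariant j = proj₂ (statement _) j ≡.refl

  somos : ∀ j → Somos j
  somos j = somos-from-addition j (proj₁ (statement _) j (1 ℕ.+ j) 1 (ℕₚ.+-comm 1 j) (ℕₚ.+-comm 1 (suc j)))

-- Division polynomials

data Halving : ℕ → Set where
  double     : ∀ j → Halving (j ℕ.+ j)
  suc-double : ∀ j → Halving (suc (j ℕ.+ j))

halve : ∀ n → Halving n
halve zero = double zero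
halve (suc n) with halve n
... | double j     = suc-double j
... | suc-double j = ≡.subst Halving (≡.cong suc (ℕₚ.+-suc j j)) (double (suc j))

even? : ℕ → Bool
even? zero    = true
even? (suc n) = not (even? n)

even?-double : ∀ j → even? (j ℕ.+ j) ≡ true
even?-double zero    = ≡.refl
even?-double (suc j) rewrite ℕₚ.+-suc j j | even?-double j = ≡.refl

below : ∀ b k j → b ℕ.+ j ℕ.< b ℕ.+ suc k ℕ.+ (j ℕ.+ j)
below b k j = ℕₚ.+-mono-<-≤ (ℕₚ.m<m+n b (s≤s z≤n)) (ℕₚ.m≤m+n j j)

-- The recursions for indices 5 + 2j and 6 + 2j refer to 1 + j, ..., 5 + j, all strictly smaller;
-- below 5 this fails, whence five base cases.
doubling-induction : ∀ {q} (Q : ℕ → Set q) → Q 0 → Q 1 → Q 2 → Q 3 → Q 4 →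
  (∀ j → Q (1 ℕ.+ j) → Q (2 ℕ.+ j) → Q (3 ℕ.+ j) → Q (4 ℕ.+ j) → Q (5 ℕ.+ (j ℕ.+ j))) →
  (∀ j → Q (1 ℕ.+ j) → Q (2 ℕ.+ j) → Q (3 ℕ.+ j) → Q (4 ℕ.+ j) → Q (5 ℕ.+ j) → Q (6 ℕ.+ (j ℕ.+ j))) →
  ∀ n → Q n
doubling-induction Q q₀ q₁ q₂ q₃ q₄ odd even = <-rec Q step
  where
  step : ∀ n → (∀ {m} → m ℕ.< n → Q m) → Q n
  step 0 _ = q₀
  step 1 _ = q₁
  step 2 _ = q₂
  step 3 _ = q₃
  step 4 _ = q₄
  step (suc (suc (suc (suc (suc n))))) IH with halve n
  ... | double j     = odd j (IH (below 1 3 j)) (IH (below 2 2 j)) (IH (below 3 1 j)) (IH (below 4 0 j))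
  ... | suc-double j = even j (IH (below 1 4 j)) (IH (below 2 3 j)) (IH (below 3 2 j)) (IH (below 4 1 j)) (IH (below 5 0 j))

half-next : ℕ × Bool → ℕ × Bool
half-next (j , true)  = j , false
half-next (j , false) = suc j , true

-- Defined by iteration of `half-next`, so that `half (4 + j)` reduces in terms of `half j` for a
-- variable j.
half : ℕ → ℕ × Bool
half zero    = 0 , true
half (suc n) = half-next (half n)

half-double : ∀ j → half (j ℕ.+ j) ≡ (j , true)
half-double zero = ≡.refl
half-double (suc j) rewrite ℕₚ.+-suc j j | half-double j = ≡.refl

half-suc-double : ∀ j → half (suc (j ℕ.+ j)) ≡ (j , false)
half-suc-double j rewrite half-double j = ≡.refl

-- The division polynomials ψₙ of y² = x³ + A x + B at the point (x , y): p n is ψₙ for odd n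
-- and ψₙ / 2y for even n, so that it depends on x only.

module DivisionPolynomials {c ℓ} (R : CommutativeRing c ℓ) (A B x : CommutativeRing.Carrier R) where
  open CommutativeRing R hiding (zero)
  open Numerals R
  open Power R

  -- On the curve `h` is (2y)², which appears whenever two ψ of even index are multiplied. `γ` is ψ₃
  -- and `c#` is twice the derivative of `f`.
  f h γ c# : Carrier
  f  = x * x * x + A * x + B
  h  = κ 4 * f
  γ  = κ 3 * x ^ 4 + κ 6 * A * x ^ 2 + κ 12 * B * x - A ^ 2
  c# = κ 2 * (κ 3 * x ^ 2 + A)

  odd-step : Bool → (p₄ p₃ p₂ p₁ : Carrier) → Carrier
  odd-step true  p₄ p₃ p₂ p₁ = h ^ 2 * (p₄ * p₂ ^ 3) - p₁ * p₃ ^ 3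
  odd-step false p₄ p₃ p₂ p₁ = p₄ * p₂ ^ 3 - h ^ 2 * (p₁ * p₃ ^ 3)

  even-step : (p₅ p₄ p₃ p₂ p₁ : Carrier) → Carrier
  even-step p₅ p₄ p₃ p₂ p₁ = p₃ * (p₅ * p₂ ^ 2 - p₁ * p₄ ^ 2)

  private
    step : (ℕ → Carrier) → ℕ × Bool → Carrier
    step g (j , true)  = odd-step (even? j) (g (4 ℕ.+ j)) (g (3 ℕ.+ j)) (g (2 ℕ.+ j)) (g (1 ℕ.+ j))
    step g (j , false) = even-step (g (5 ℕ.+ j)) (g (4 ℕ.+ j)) (g (3 ℕ.+ j)) (g (2 ℕ.+ j)) (g (1 ℕ.+ j))

    recur : (ℕ → Carrier) → ℕ → Carrier
    recur g 0 = 0#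
    recur g 1 = 1#
    recur g 2 = 1#
    recur g 3 = γ
    recur g 4 = c# * γ - h ^ 2
    recur g (suc (suc (suc (suc (suc n))))) = step g (half n)

    -- Recursion with fuel. Each unfolding lowers the index, so every amount of fuel greater than
    -- the index gives the same result.
    approx : ℕ → ℕ → Carrier
    approx zero    _ = 0#
    approx (suc k) n = recur (approx k) n

    recur-cong : ∀ g g′ n → (∀ m → m ℕ.< n → g m ≡ g′ m) → recur g n ≡ recur g′ n
    recur-cong g g′ 0 H = ≡.refl
    recur-cong g g′ 1 H = ≡.refl
    recur-cong g g′ 2 H = ≡.refl
    recur-cong g g′ 3 H = ≡.refl
    recur-cong g g′ 4 H = ≡.refl
    recur-cong g g′ (suc (suc (suc (suc (suc n))))) H with halve n
    ... | double j
          rewrite half-double j | H _ (below 1 3 j) | H _ (below 2 2 j) | H _ (below 3 1 j) | H _ (below 4 0 j) = ≡.refl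
    ... | suc-double j
          rewrite half-suc-double j | H _ (below 1 4 j) | H _ (below 2 3 j) | H _ (below 3 2 j)
                | H _ (below 4 1 j) | H _ (below 5 0 j) = ≡.refl

    approx-stable : ∀ k l n → n ℕ.< k → n ℕ.< l → approx k n ≡ approx l n
    approx-stable (suc k) (suc l) n (s≤s n≤k) (s≤s n≤l) = recur-cong (approx k) (approx l) n
      λ m m<n → approx-stable k l m (ℕₚ.<-≤-trans m<n n≤k) (ℕₚ.<-≤-trans m<n n≤l)

  p : ℕ → Carrier
  p n = approx (suc n) n

  private
    p-recur : ∀ n → p n ≡ recur p n
    p-recur n = recur-cong (approx n) p n λ m m<n → approx-stable n (suc m) m m<n ℕₚ.≤-refl

  p-odd : ∀ j → p (5 ℕ.+ (j ℕ.+ j)) ≡ odd-step (even? j) (p (4 ℕ.+ j)) (p (3 ℕ.+ j)) (p (2 ℕ.+ j)) (p (1 ℕ.+ j))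
  p-odd j = ≡.trans (p-recur (5 ℕ.+ (j ℕ.+ j))) (≡.cong (step p) (half-double j))

  p-even : ∀ j → p (6 ℕ.+ (j ℕ.+ j)) ≡ even-step (p (5 ℕ.+ j)) (p (4 ℕ.+ j)) (p (3 ℕ.+ j)) (p (2 ℕ.+ j)) (p (1 ℕ.+ j))
  p-even j = ≡.trans (p-recur (6 ℕ.+ (j ℕ.+ j))) (≡.cong (step p) (half-suc-double j))

  -- The formula would require ψ₋₂ and ψ₋₁ at the first two indices, so these are given directly:
  -- 2ω₀ = 2, and 2ω₁ = 2y with the factor 2y split off.
  d : ℕ → Carrier
  d 0             = κ 2
  d 1             = 1#
  d (suc (suc j)) = p (4 ℕ.+ j) * p (1 ℕ.+ j) ^ 2 - p j * p (3 ℕ.+ j) ^ 2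

  module AtPoint (y : Carrier) where
    β : Carrier
    β = κ 2 * y

    twist : Bool → Carrier → Carrier
    twist true  a = β * a
    twist false a = a

    -- e n is 2ωₙ in the usual notation n (x , y) = (φₙ / ψₙ² , ωₙ / ψₙ³).
    ψ e : ℕ → Carrier
    ψ n = twist (even? n) (p n)
    e n = twist (not (even? n)) (d n)

module _ {a ℓ₁ b ℓ₂} {R : CommutativeRing a ℓ₁} {S : CommutativeRing b ℓ₂} (hom : Hom R S)
  {A B x : CommutativeRing.Carrier R} {A′ B′ x′ : CommutativeRing.Carrier S} where
  open CommutativeRing S hiding (zero)
  open Numerals S
  open Power S
  open Hom hom renaming (cong to ⟨⟩-cong)
  private
    module P = DivisionPolynomials R A B x
    module Q = DivisionPolynomials S A′ B′ x′

  module _ (A≈ : ⟨ A ⟩ ≈ A′) (B≈ : ⟨ B ⟩ ≈ B′) (x≈ : ⟨ x ⟩ ≈ x′) where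

    h-homo : ⟨ P.h ⟩ ≈ Q.h
    h-homo = homo hom 3 (λ A B x → con 4 :* (x :* x :* x :+ A :* x :+ B)) (A≈ ∷ B≈ ∷ x≈ ∷ [])

    γ-homo : ⟨ P.γ ⟩ ≈ Q.γ
    γ-homo = homo hom 3 (λ A B x → con 3 :* x :^ 4 :+ con 6 :* A :* x :^ 2 :+ con 12 :* B :* x :- A :^ 2)
                  (A≈ ∷ B≈ ∷ x≈ ∷ [])

    c-homo : ⟨ P.c# ⟩ ≈ Q.c#
    c-homo = homo hom 3 (λ A B x → con 2 :* (con 3 :* x :^ 2 :+ A)) (A≈ ∷ B≈ ∷ x≈ ∷ [])

    odd-step-homo : ∀ b {p₄ p₃ p₂ p₁ q₄ q₃ q₂ q₁} → ⟨ p₄ ⟩ ≈ q₄ → ⟨ p₃ ⟩ ≈ q₃ → ⟨ p₂ ⟩ ≈ q₂ → ⟨ p₁ ⟩ ≈ q₁ →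
                    ⟨ P.odd-step b p₄ p₃ p₂ p₁ ⟩ ≈ Q.odd-step b q₄ q₃ q₂ q₁
    odd-step-homo true  e₄ e₃ e₂ e₁ =
      homo hom 5 (λ h p₄ p₃ p₂ p₁ → h :^ 2 :* (p₄ :* p₂ :^ 3) :- p₁ :* p₃ :^ 3) (h-homo ∷ e₄ ∷ e₃ ∷ e₂ ∷ e₁ ∷ [])
    odd-step-homo false e₄ e₃ e₂ e₁ =
      homo hom 5 (λ h p₄ p₃ p₂ p₁ → p₄ :* p₂ :^ 3 :- h :^ 2 :* (p₁ :* p₃ :^ 3)) (h-homo ∷ e₄ ∷ e₃ ∷ e₂ ∷ e₁ ∷ [])

    p-homo : ∀ n → ⟨ P.p n ⟩ ≈ Q.p n
    p-homo = doubling-induction (λ n → ⟨ P.p n ⟩ ≈ Q.p n) 0-homo 1-homo 1-homo γ-homo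
      (homo hom 3 (λ c γ h → c :* γ :- h :^ 2) (c-homo ∷ γ-homo ∷ h-homo ∷ []))
      (λ j e₁ e₂ e₃ e₄ → ≡.subst₂ (λ a b → ⟨ a ⟩ ≈ b) (≡.sym (P.p-odd j)) (≡.sym (Q.p-odd j))
        (odd-step-homo (even? j) e₄ e₃ e₂ e₁))
      (λ j e₁ e₂ e₃ e₄ e₅ → ≡.subst₂ (λ a b → ⟨ a ⟩ ≈ b) (≡.sym (P.p-even j)) (≡.sym (Q.p-even j))
        (homo hom 5 (λ p₅ p₄ p₃ p₂ p₁ → p₃ :* (p₅ :* p₂ :^ 2 :- p₁ :* p₄ :^ 2)) (e₅ ∷ e₄ ∷ e₃ ∷ e₂ ∷ e₁ ∷ [])))

    d-homo : ∀ n → ⟨ P.d n ⟩ ≈ Q.d n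
    d-homo 0             = κ-hom hom 2
    d-homo 1             = 1-homo
    d-homo (suc (suc j)) = homo hom 4 (λ a b c d → a :* b :^ 2 :- c :* d :^ 2)
      (p-homo (4 ℕ.+ j) ∷ p-homo (1 ℕ.+ j) ∷ p-homo j ∷ p-homo (3 ℕ.+ j) ∷ [])

    module _ {y y′} (y≈ : ⟨ y ⟩ ≈ y′) where
      private
        module Pʸ = P.AtPoint y
        module Qʸ = Q.AtPoint y′

      β-homo : ⟨ Pʸ.β ⟩ ≈ Qʸ.β
      β-homo = homo hom 1 (λ y → con 2 :* y) (y≈ ∷ [])

      twist-homo : ∀ b {u v} → ⟨ u ⟩ ≈ v → ⟨ Pʸ.twist b u ⟩ ≈ Qʸ.twist b v
      twist-homo true  e = trans (*-homo _ _) (*-cong β-homo e)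
      twist-homo false e = e

      ψ-homo : ∀ n → ⟨ Pʸ.ψ n ⟩ ≈ Qʸ.ψ n
      ψ-homo n = twist-homo (even? n) (p-homo n)

      e-homo : ∀ n → ⟨ Pʸ.e n ⟩ ≈ Qʸ.e n
      e-homo n = twist-homo (not (even? n)) (d-homo n)

-- The smooth points of the cuspidal cubic y² = x³ form an additive group, with n(1,1) = (1/n²,
-- 1/n³); accordingly ψₙ(1,1) = n. This value shows that ψₙ is not identically zero and also gives
-- its leading coefficient, because ψₙ is weighted homogeneous in x, A, B.
module DivisionValues {c ℓ} (R : CommutativeRing c ℓ) where
  open CommutativeRing R hiding (zero)
  open Numerals R
  open Power R
  open Solver R
  open DivisionPolynomials R 0# 0# 1#

  -- κ n for odd n and κ (n / 2) for even n
  value : ℕ × Bool → Carrier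
  value (i , true)  = κ i
  value (i , false) = 1# + (κ i + κ i)

  private
    twice : ℕ × Bool → Carrier
    twice (i , true)  = κ i + κ i
    twice (i , false) = 1# + (κ i + κ i)

    suc-even-half : ∀ k t →
      k ≈ t + t →
      1# + k ≈ 1# + (t + t)
    suc-even-half = prove 2 (λ k t →
      :1 ∙ k ⊜ t :+ t ⇒
      :1 :+ k ⊜ :1 :+ (t :+ t)) ≡.refl
    suc-odd-half : ∀ k t →
      k ≈ 1# + (t + t) →
      1# + k ≈ 1# + t + (1# + t)
    suc-odd-half = prove 2 (λ k t →
      :1 ∙ k ⊜ :1 :+ (t :+ t) ⇒
      :1 :+ k ⊜ :1 :+ t :+ (:1 :+ t)) ≡.refl

    κ-half : ∀ n → κ n ≈ twice (half n)
    κ-half zero = sym (+-identityˡ 0#)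
    κ-half (suc n) with half n | κ-half n
    ... | i , true  | e = suc-even-half (κ n) (κ i) e
    ... | i , false | e = suc-odd-half (κ n) (κ i) e

    even?-half : ∀ n → even? n ≡ proj₂ (half n)
    even?-half zero = ≡.refl
    even?-half (suc n) with half n | even?-half n
    ... | i , true  | e rewrite e = ≡.refl
    ... | i , false | e rewrite e = ≡.refl

    hᵉ γᵉ cᵉ : ∀ {n} → Expr n
    hᵉ = con 4 :* (:1 :* :1 :* :1 :+ con 0 :* :1 :+ con 0)
    γᵉ = con 3 :* :1 :^ 4 :+ con 6 :* con 0 :* :1 :^ 2 :+ con 12 :* con 0 :* :1 :- con 0 :^ 2
    cᵉ = con 2 :* (con 3 :* :1 :^ 2 :+ con 0)

    odd-step-value : ∀ k hn → κ k ≈ twice hn → let next = half-next in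
      odd-step (proj₂ hn) (value (next (next (next (next hn))))) (value (next (next (next hn))))
                          (value (next (next hn))) (value (next hn))
        ≈ 1# + ((1# + (1# + κ k)) + (1# + (1# + κ k)))
    odd-step-value k (i , true) e = prove 2 (λ k t → :- con 2 ∙ k ⊜ t :+ t ⇒
      hᵉ :^ 2 :* ((:1 :+ (:1 :+ t)) :* (:1 :+ t) :^ 3)
        :- (:1 :+ (t :+ t)) :* (:1 :+ ((:1 :+ t) :+ (:1 :+ t))) :^ 3
        ⊜ :1 :+ ((:1 :+ (:1 :+ k)) :+ (:1 :+ (:1 :+ k)))) ≡.refl (κ k) (κ i) e
    odd-step-value k (i , false) e = prove 2 (λ k t → :- con 2 ∙ k ⊜ :1 :+ (t :+ t) ⇒
      (:1 :+ ((:1 :+ (:1 :+ t)) :+ (:1 :+ (:1 :+ t)))) :* (:1 :+ ((:1 :+ t) :+ (:1 :+ t))) :^ 3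
        :- hᵉ :^ 2 :* ((:1 :+ t) :* (:1 :+ (:1 :+ t)) :^ 3)
        ⊜ :1 :+ ((:1 :+ (:1 :+ k)) :+ (:1 :+ (:1 :+ k)))) ≡.refl (κ k) (κ i) e

    even-step-value : ∀ k hn → κ k ≈ twice hn → let next = half-next in
      even-step (value (next (next (next (next (next hn)))))) (value (next (next (next (next hn)))))
                (value (next (next (next hn)))) (value (next (next hn))) (value (next hn))
        ≈ 1# + (1# + (1# + κ k))
    even-step-value k (i , true) e = prove 2 (λ k t → :- :1 ∙ k ⊜ t :+ t ⇒
      (:1 :+ ((:1 :+ t) :+ (:1 :+ t))) :* ((:1 :+ ((:1 :+ (:1 :+ t)) :+ (:1 :+ (:1 :+ t)))) :* (:1 :+ t) :^ 2
        :- (:1 :+ (t :+ t)) :* (:1 :+ (:1 :+ t)) :^ 2)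
        ⊜ :1 :+ (:1 :+ (:1 :+ k))) ≡.refl (κ k) (κ i) e
    even-step-value k (i , false) e = prove 2 (λ k t → :- :1 ∙ k ⊜ :1 :+ (t :+ t) ⇒
      (:1 :+ (:1 :+ t)) :* ((:1 :+ (:1 :+ (:1 :+ t))) :* (:1 :+ ((:1 :+ t) :+ (:1 :+ t))) :^ 2
        :- (:1 :+ t) :* (:1 :+ ((:1 :+ (:1 :+ t)) :+ (:1 :+ (:1 :+ t)))) :^ 2)
        ⊜ :1 :+ (:1 :+ (:1 :+ k))) ≡.refl (κ k) (κ i) e

  p-value : ∀ n → p n ≈ value (half n)
  p-value = doubling-induction (λ n → p n ≈ value (half n))
    refl
    (prove 0 (:1 ⊜ :1 :+ (con 0 :+ con 0)) ≡.refl)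
    (prove 0 (:1 ⊜ con 1) ≡.refl)
    (prove 0 (γᵉ ⊜ :1 :+ (con 1 :+ con 1)) ≡.refl)
    (prove 0 (cᵉ :* γᵉ :- hᵉ :^ 2 ⊜ con 2) ≡.refl)
    (λ j e₁ e₂ e₃ e₄ → begin
      p (5 ℕ.+ (j ℕ.+ j)) ≡⟨ p-odd j ⟩
      odd-step (even? j) (p (4 ℕ.+ j)) (p (3 ℕ.+ j)) (p (2 ℕ.+ j)) (p (1 ℕ.+ j))
        ≡⟨ ≡.cong (λ b → odd-step b (p (4 ℕ.+ j)) (p (3 ℕ.+ j)) (p (2 ℕ.+ j)) (p (1 ℕ.+ j))) (even?-half j) ⟩
      odd-step (proj₂ (half j)) (p (4 ℕ.+ j)) (p (3 ℕ.+ j)) (p (2 ℕ.+ j)) (p (1 ℕ.+ j))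
        ≈⟨ odd-step-homo (idHom R) refl refl refl (proj₂ (half j)) e₄ e₃ e₂ e₁ ⟩
      odd-step (proj₂ (half j)) (value (half (4 ℕ.+ j))) (value (half (3 ℕ.+ j)))
                                (value (half (2 ℕ.+ j))) (value (half (1 ℕ.+ j)))
        ≈⟨ odd-step-value j (half j) (κ-half j) ⟩
      1# + (κ (2 ℕ.+ j) + κ (2 ℕ.+ j))
        ≡⟨ ≡.cong (λ hn → value (half-next (half-next (half-next (half-next (half-next hn)))))) (half-double j) ⟨
      value (half (5 ℕ.+ (j ℕ.+ j))) ∎)
    (λ j e₁ e₂ e₃ e₄ e₅ → begin
      p (6 ℕ.+ (j ℕ.+ j)) ≡⟨ p-even j ⟩
      even-step (p (5 ℕ.+ j)) (p (4 ℕ.+ j)) (p (3 ℕ.+ j)) (p (2 ℕ.+ j)) (p (1 ℕ.+ j))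
        ≈⟨ homo (idHom R) 5 (λ p₅ p₄ p₃ p₂ p₁ → p₃ :* (p₅ :* p₂ :^ 2 :- p₁ :* p₄ :^ 2)) (e₅ ∷ e₄ ∷ e₃ ∷ e₂ ∷ e₁ ∷ []) ⟩
      even-step (value (half (5 ℕ.+ j))) (value (half (4 ℕ.+ j))) (value (half (3 ℕ.+ j)))
                (value (half (2 ℕ.+ j))) (value (half (1 ℕ.+ j)))
        ≈⟨ even-step-value j (half j) (κ-half j) ⟩
      κ (3 ℕ.+ j)
        ≡⟨ ≡.cong (λ hn → value (half-next (half-next (half-next (half-next (half-next (half-next hn))))))) (half-double j) ⟨
      value (half (6 ℕ.+ (j ℕ.+ j))) ∎)
    where open SetoidReasoning setoid

  ψ-value : ∀ n → AtPoint.ψ 1# n ≈ κ n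
  ψ-value n = trans (reflexive (≡.cong (λ b → AtPoint.twist 1# b (p n)) (even?-half n)))
    (twisted (half n) (p-value n) (κ-half n))
    where
    twisted : ∀ hn {a k} → a ≈ value hn → k ≈ twice hn → AtPoint.twist 1# (proj₂ hn) a ≈ k
    twisted (i , true) {a} {k} e e′ = prove 3 (λ a k t → con 2 ∙ a ⊜ t ⇒ :- :1 ∙ k ⊜ t :+ t ⇒ con 2 :* :1 :* a ⊜ k)
      ≡.refl a k (κ i) e e′
    twisted (i , false) e e′ = trans e (sym e′)

-- Dual numbers

module DualNumbers {c ℓ} (R : CommutativeRing c ℓ) where
  open CommutativeRing R hiding (zero)
  open Solver R

  infix 4 _≈ᵈ_
  record _≈ᵈ_ (u v : Carrier × Carrier) : Set ℓ where
    constructor _&_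
    field
      standard      : proj₁ u ≈ proj₁ v
      infinitesimal : proj₂ u ≈ proj₂ v
  open _≈ᵈ_ public

  -- This takes the place of a derivation: an identity valid over all commutative rings, read over
  -- the dual numbers, contains its own derivative as the second component.
  dual : CommutativeRing c ℓ
  dual = record
    { Carrier = Carrier × Carrier
    ; _≈_ = _≈ᵈ_
    ; _+_ = λ u v → proj₁ u + proj₁ v , proj₂ u + proj₂ v
    ; _*_ = λ u v → proj₁ u * proj₁ v , proj₁ u * proj₂ v + proj₂ u * proj₁ v
    ; -_  = λ u → - proj₁ u , - proj₂ u
    ; 0#  = 0# , 0#
    ; 1#  = 1# , 0#
    ; isCommutativeRing = record
      { isRing = record
        { +-isAbelianGroup = record
          { isGroup = record
            { isMonoid = record
              { isSemigroup = record
                { isMagma = record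
                  { isEquivalence = record
                    { refl = refl & refl
                    ; sym = λ { (p & q) → sym p & sym q }
                    ; trans = λ { (p & q) (r & s) → trans p r & trans q s } }
                  ; ∙-cong = λ { (p & q) (r & s) → +-cong p r & +-cong q s } }
                ; assoc = λ _ _ _ → +-assoc _ _ _ & +-assoc _ _ _ }
              ; identity = (λ _ → +-identityˡ _ & +-identityˡ _) , (λ _ → +-identityʳ _ & +-identityʳ _) }
            ; inverse = (λ _ → -‿inverseˡ _ & -‿inverseˡ _) , (λ _ → -‿inverseʳ _ & -‿inverseʳ _)
            ; ⁻¹-cong = λ { (p & q) → -‿cong p & -‿cong q } }
          ; comm = λ _ _ → +-comm _ _ & +-comm _ _ }
        ; *-cong = λ { (p & q) (r & s) → *-cong p r & +-cong (*-cong p s) (*-cong q r) }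
        ; *-assoc = λ { (a , a′) (b , b′) (c , c′) → *-assoc _ _ _ &
            prove 6 (λ a a′ b b′ c c′ → a :* b :* c′ :+ (a :* b′ :+ a′ :* b) :* c
                       ⊜ a :* (b :* c′ :+ b′ :* c) :+ a′ :* (b :* c)) ≡.refl a a′ b b′ c c′ }
        ; *-identity = (λ { (a , a′) → *-identityˡ _ & prove 2 (λ a a′ → :1 :* a′ :+ con 0 :* a ⊜ a′) ≡.refl a a′ })
                     , (λ { (a , a′) → *-identityʳ _ & prove 2 (λ a a′ → a :* con 0 :+ a′ :* :1 ⊜ a′) ≡.refl a a′ })
        ; distrib = (λ { (a , a′) (b , b′) (c , c′) → distribˡ _ _ _ &
                       prove 6 (λ a a′ b b′ c c′ → a :* (b′ :+ c′) :+ a′ :* (b :+ c)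
                         ⊜ (a :* b′ :+ a′ :* b) :+ (a :* c′ :+ a′ :* c)) ≡.refl a a′ b b′ c c′ })
                  , (λ { (a , a′) (b , b′) (c , c′) → distribʳ _ _ _ &
                       prove 6 (λ a a′ b b′ c c′ → (b :+ c) :* a′ :+ (b′ :+ c′) :* a
                         ⊜ (b :* a′ :+ b′ :* a) :+ (c :* a′ :+ c′ :* a)) ≡.refl a a′ b b′ c c′ }) }
      ; *-comm = λ { (a , a′) (b , b′) → *-comm _ _ &
          prove 4 (λ a a′ b b′ → a :* b′ :+ a′ :* b ⊜ b :* a′ :+ b′ :* a) ≡.refl a a′ b b′ } }
    }

  standardHom : Hom dual R
  standardHom = record
    { ⟨_⟩ = proj₁ ; cong = standard ; +-homo = λ _ _ → refl ; *-homo = λ _ _ → refl ; 1-homo = refl }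

  κ-dual : ∀ n → Numerals.κ dual n ≈ᵈ (Numerals.κ R n , 0#)
  κ-dual zero    = refl & refl
  κ-dual (suc n) = +-congˡ (standard (κ-dual n)) & trans (+-identityˡ _) (infinitesimal (κ-dual n))

dualHom : ∀ {a ℓ₁ b ℓ₂} {R : CommutativeRing a ℓ₁} {S : CommutativeRing b ℓ₂} →
          Hom R S → Hom (DualNumbers.dual R) (DualNumbers.dual S)
dualHom {S = S} h = record
  { ⟨_⟩    = λ u → ⟨ proj₁ u ⟩ , ⟨ proj₂ u ⟩
  ; cong   = λ e → h-cong (DualNumbers.standard e) & h-cong (DualNumbers.infinitesimal e)
  ; +-homo = λ _ _ → +-homo _ _ & +-homo _ _
  ; *-homo = λ _ _ → *-homo _ _ & trans (+-homo _ _) (+-cong (*-homo _ _) (*-homo _ _))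
  ; 1-homo = 1-homo & 0-homo
  }
  where
  open Hom h renaming (cong to h-cong)
  open CommutativeRing S hiding (zero)
  open DualNumbers S using (_&_)

IsPoint : ∀ {c ℓ} (R : CommutativeRing c ℓ) (A B x y : CommutativeRing.Carrier R) → Set ℓ
IsPoint R A B x y = y * y ≈ x * x * x + A * x + B
  where open CommutativeRing R

module TwistIdentities {c ℓ} (R : CommutativeRing c ℓ) where
  open CommutativeRing R hiding (zero)
  open Numerals R
  open Power R
  open Solver R

  h-is-β² : ∀ f y →
    y * y ≈ f →
    κ 4 * f ≈ (κ 2 * y) ^ 2
  h-is-β² = prove 2 (λ f y →
    con 0 :- con 4 ∙ y :* y ⊜ f ⇒
    con 4 :* f ⊜ (con 2 :* y) :^ 2) ≡.refl

  ψ₄-twist : ∀ β h c γ →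
    h ≈ β ^ 2 →
    β * (c * γ - h ^ 2) ≈ β * (c * γ - β ^ 4)
  ψ₄-twist = prove 4 (λ β h c γ →
    con 0 :- β :* (h :+ β :^ 2) ∙ h ⊜ β :^ 2 ⇒
    β :* (c :* γ :- h :^ 2) ⊜ β :* (c :* γ :- β :^ 4)) ≡.refl

  odd-twist-true : ∀ β h p₄ p₃ p₂ p₁ →
    h ≈ β ^ 2 →
    h ^ 2 * (p₄ * p₂ ^ 3) - p₁ * p₃ ^ 3 ≈ β * p₄ * (β * p₂) ^ 3 - p₁ * p₃ ^ 3
  odd-twist-true = prove 6 (λ β h p₄ p₃ p₂ p₁ →
    (h :+ β :^ 2) :* p₄ :* p₂ :^ 3 ∙ h ⊜ β :^ 2 ⇒
    h :^ 2 :* (p₄ :* p₂ :^ 3) :- p₁ :* p₃ :^ 3 ⊜ β :* p₄ :* (β :* p₂) :^ 3 :- p₁ :* p₃ :^ 3) ≡.refl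

  odd-twist-false : ∀ β h p₄ p₃ p₂ p₁ →
    h ≈ β ^ 2 →
    p₄ * p₂ ^ 3 - h ^ 2 * (p₁ * p₃ ^ 3) ≈ p₄ * p₂ ^ 3 - β * p₁ * (β * p₃) ^ 3
  odd-twist-false = prove 6 (λ β h p₄ p₃ p₂ p₁ →
    con 0 :- (h :+ β :^ 2) :* p₁ :* p₃ :^ 3 ∙ h ⊜ β :^ 2 ⇒
    p₄ :* p₂ :^ 3 :- h :^ 2 :* (p₁ :* p₃ :^ 3) ⊜ p₄ :* p₂ :^ 3 :- β :* p₁ :* (β :* p₃) :^ 3) ≡.refl

  even-twist-true : ∀ β p₅ p₄ p₃ p₂ p₁ →
    β * (β * (p₃ * (p₅ * p₂ ^ 2 - p₁ * p₄ ^ 2))) ≈ p₃ * (p₅ * (β * p₂) ^ 2 - p₁ * (β * p₄) ^ 2)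
  even-twist-true = prove 6 (λ β p₅ p₄ p₃ p₂ p₁ →
    β :* (β :* (p₃ :* (p₅ :* p₂ :^ 2 :- p₁ :* p₄ :^ 2))) ⊜ p₃ :* (p₅ :* (β :* p₂) :^ 2 :- p₁ :* (β :* p₄) :^ 2)) ≡.refl

  even-twist-false : ∀ β p₅ p₄ p₃ p₂ p₁ →
    β * (β * (p₃ * (p₅ * p₂ ^ 2 - p₁ * p₄ ^ 2))) ≈ β * p₃ * (β * p₅ * p₂ ^ 2 - β * p₁ * p₄ ^ 2)
  even-twist-false = prove 6 (λ β p₅ p₄ p₃ p₂ p₁ →
    β :* (β :* (p₃ :* (p₅ :* p₂ :^ 2 :- p₁ :* p₄ :^ 2))) ⊜ β :* p₃ :* (β :* p₅ :* p₂ :^ 2 :- β :* p₁ :* p₄ :^ 2)) ≡.refl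

  e-twist-true : ∀ β p₄ p₃ p₁ p₀ →
    β * (p₄ * p₁ ^ 2 - p₀ * p₃ ^ 2) ≈ β * p₄ * p₁ ^ 2 - β * p₀ * p₃ ^ 2
  e-twist-true = prove 5 (λ β p₄ p₃ p₁ p₀ →
    β :* (p₄ :* p₁ :^ 2 :- p₀ :* p₃ :^ 2) ⊜ β :* p₄ :* p₁ :^ 2 :- β :* p₀ :* p₃ :^ 2) ≡.refl

  e-twist-false : ∀ β p₄ p₃ p₁ p₀ →
    β * (β * (p₄ * p₁ ^ 2 - p₀ * p₃ ^ 2)) ≈ p₄ * (β * p₁) ^ 2 - p₀ * (β * p₃) ^ 2
  e-twist-false = prove 5 (λ β p₄ p₃ p₁ p₀ →
    β :* (β :* (p₄ :* p₁ :^ 2 :- p₀ :* p₃ :^ 2)) ⊜ p₄ :* (β :* p₁) :^ 2 :- p₀ :* (β :* p₃) :^ 2) ≡.refl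

module Twisted {c ℓ} (R : CommutativeRing c ℓ) (A B x y : CommutativeRing.Carrier R)
  (on-curve : IsPoint R A B x y) where
  open CommutativeRing R hiding (zero)
  open Power R
  open TwistIdentities R
  open DivisionPolynomials R A B x
  open AtPoint y

  h≈β² : h ≈ β ^ 2
  h≈β² = h-is-β² f y on-curve

  -- The classical 4y ωₙ = ψₙ₊₂ ψₙ₋₁² - ψₙ₋₂ ψₙ₊₁² for n = 2 + j.
  βe : ∀ j → β * e (2 ℕ.+ j) ≈ ψ (4 ℕ.+ j) * ψ (1 ℕ.+ j) ^ 2 - ψ j * ψ (3 ℕ.+ j) ^ 2
  βe j = cases (even? j) (p (4 ℕ.+ j)) (p (3 ℕ.+ j)) (p (1 ℕ.+ j)) (p j)
    where
    cases : ∀ b p₄ p₃ p₁ p₀ → β * twist (not (not (not b))) (p₄ * p₁ ^ 2 - p₀ * p₃ ^ 2)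
      ≈ twist (not (not (not (not b)))) p₄ * twist (not b) p₁ ^ 2 - twist b p₀ * twist (not (not (not b))) p₃ ^ 2
    cases true  = e-twist-true β
    cases false = e-twist-false β

  private
    odd-cases : ∀ b p₄ p₃ p₂ p₁ → odd-step b p₄ p₃ p₂ p₁ ≈
      twist (not (not (not (not b)))) p₄ * twist (not (not b)) p₂ ^ 3 - twist (not b) p₁ * twist (not (not (not b))) p₃ ^ 3
    odd-cases true  p₄ p₃ p₂ p₁ = odd-twist-true β h p₄ p₃ p₂ p₁ h≈β²
    odd-cases false p₄ p₃ p₂ p₁ = odd-twist-false β h p₄ p₃ p₂ p₁ h≈β²

    even-cases : ∀ b p₅ p₄ p₃ p₂ p₁ → β * (β * even-step p₅ p₄ p₃ p₂ p₁) ≈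
      twist (not (not (not b))) p₃ * (twist (not (not (not (not (not b))))) p₅ * twist (not (not b)) p₂ ^ 2
        - twist (not b) p₁ * twist (not (not (not (not b)))) p₄ ^ 2)
    even-cases true  = even-twist-true β
    even-cases false = even-twist-false β

  ellipticSequence : EllipticSequence R
  ellipticSequence = record
    { β = β ; γ = γ ; c# = c# ; ψ = ψ
    ; ψ-0 = zeroʳ β
    ; ψ-1 = refl
    ; ψ-2 = *-identityʳ β
    ; ψ-3 = refl
    ; ψ-4 = ψ₄-twist β h c# γ h≈β²
    ; ψ-odd = odd
    ; ψ-even = even }
    where
    open Solver R
    odd : ∀ k → ψ (3 ℕ.+ (k ℕ.+ k)) ≈ ψ (3 ℕ.+ k) * ψ (1 ℕ.+ k) ^ 3 - ψ k * ψ (2 ℕ.+ k) ^ 3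
    odd zero = prove 2 (λ γ β → γ ⊜ γ :* :1 :^ 3 :- (β :* con 0) :* (β :* :1) :^ 3) ≡.refl γ β
    odd (suc j) rewrite ℕₚ.+-suc j j | even?-double j | p-odd j =
      odd-cases (even? j) (p (4 ℕ.+ j)) (p (3 ℕ.+ j)) (p (2 ℕ.+ j)) (p (1 ℕ.+ j))
    even : ∀ k → β * ψ (4 ℕ.+ (k ℕ.+ k)) ≈ ψ (2 ℕ.+ k) * (ψ (4 ℕ.+ k) * ψ (1 ℕ.+ k) ^ 2 - ψ k * ψ (3 ℕ.+ k) ^ 2)
    even zero = prove 3 (λ β γ t → β :* (β :* t) ⊜ (β :* :1) :* ((β :* t) :* :1 :^ 2 :- (β :* con 0) :* γ :^ 2)) ≡.refl β γ (p 4)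
    even (suc j) rewrite ℕₚ.+-suc j j | even?-double j | p-even j =
      even-cases (even? j) (p (5 ℕ.+ j)) (p (4 ℕ.+ j)) (p (3 ℕ.+ j)) (p (2 ℕ.+ j)) (p (1 ℕ.+ j))

-- The group law in terms of division polynomials

module CurveIdentities {c ℓ} (R : CommutativeRing c ℓ) where
  open CommutativeRing R hiding (zero)
  open Numerals R
  open Power R
  open Solver R

  discriminant-relation : ∀ A B x y →
    y * y ≈ x * x * x + A * x + B →
    κ 12 * x * (κ 2 * y) ^ 2 ≈ (κ 2 * (κ 3 * x ^ 2 + A)) ^ 2 + κ 4 * (κ 3 * x ^ 4 + κ 6 * A * x ^ 2 + κ 12 * B * x - A ^ 2)
  discriminant-relation = prove 4 (λ A B x y →
    con 12 :* x :* con 4 ∙ y :* y ⊜ x :* x :* x :+ A :* x :+ B ⇒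
    con 12 :* x :* (con 2 :* y) :^ 2
      ⊜ (con 2 :* (con 3 :* x :^ 2 :+ A)) :^ 2 :+ con 4 :* (con 3 :* x :^ 4 :+ con 6 :* A :* x :^ 2 :+ con 12 :* B :* x :- A :^ 2)) ≡.refl

  curve-1 : ∀ β c x ψ₂ →
    (β * 1#) ^ 2
      ≈ β ^ 2 * 1# ^ 6 - κ 2 * c * (ψ₂ * (β * 0#)) * 1# ^ 4 + κ 12 * x * (ψ₂ * (β * 0#)) ^ 2 * 1# ^ 2 - κ 4 * (ψ₂ * (β * 0#)) ^ 3
  curve-1 = prove 4 (λ β c x ψ₂ →
    (β :* :1) :^ 2
      ⊜ β :^ 2 :* :1 :^ 6 :- con 2 :* c :* (ψ₂ :* (β :* con 0)) :* :1 :^ 4 :+ con 12 :* x :* (ψ₂ :* (β :* con 0)) :^ 2 :* :1 :^ 2 :- con 4 :* (ψ₂ :* (β :* con 0)) :^ 3) ≡.refl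

  curve-step : ∀ β γ c x e ψ₄ ψ₃ ψ₂ ψ₁ ψ₀ →
    β * e ≈ ψ₄ * ψ₁ ^ 2 - ψ₀ * ψ₃ ^ 2 →
    ψ₄ * ψ₁ ^ 2 + ψ₀ * ψ₃ ^ 2 + β ^ 2 * ψ₂ ^ 3 ≈ c * ψ₁ * ψ₂ * ψ₃ →
    ψ₄ * ψ₀ ≈ β ^ 2 * ψ₃ * ψ₁ - γ * ψ₂ ^ 2 →
    κ 12 * x * β ^ 2 ≈ c ^ 2 + κ 4 * γ →
    β ^ 2 * e ^ 2
      ≈ β ^ 2 * (β ^ 2 * ψ₂ ^ 6 - κ 2 * c * (ψ₃ * ψ₁) * ψ₂ ^ 4 + κ 12 * x * (ψ₃ * ψ₁) ^ 2 * ψ₂ ^ 2 - κ 4 * (ψ₃ * ψ₁) ^ 3)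
  curve-step = prove 10 (λ β γ c x e ψ₄ ψ₃ ψ₂ ψ₁ ψ₀ →
    β :* e :+ (ψ₄ :* ψ₁ :^ 2 :- ψ₀ :* ψ₃ :^ 2) ∙ β :* e ⊜ ψ₄ :* ψ₁ :^ 2 :- ψ₀ :* ψ₃ :^ 2 ⇒
    ψ₄ :* ψ₁ :^ 2 :+ ψ₀ :* ψ₃ :^ 2 :+ c :* ψ₁ :* ψ₂ :* ψ₃ :- β :^ 2 :* ψ₂ :^ 3
      ∙ ψ₄ :* ψ₁ :^ 2 :+ ψ₀ :* ψ₃ :^ 2 :+ β :^ 2 :* ψ₂ :^ 3 ⊜ c :* ψ₁ :* ψ₂ :* ψ₃ ⇒
    con 0 :- con 4 :* (ψ₃ :* ψ₁) :^ 2 ∙ ψ₄ :* ψ₀ ⊜ β :^ 2 :* ψ₃ :* ψ₁ :- γ :* ψ₂ :^ 2 ⇒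
    con 0 :- (ψ₃ :* ψ₁) :^ 2 :* ψ₂ :^ 2 ∙ con 12 :* x :* β :^ 2 ⊜ c :^ 2 :+ con 4 :* γ ⇒
    β :^ 2 :* e :^ 2
      ⊜ β :^ 2 :* (β :^ 2 :* ψ₂ :^ 6 :- con 2 :* c :* (ψ₃ :* ψ₁) :* ψ₂ :^ 4 :+ con 12 :* x :* (ψ₃ :* ψ₁) :^ 2 :* ψ₂ :^ 2 :- con 4 :* (ψ₃ :* ψ₁) :^ 3)) ≡.refl

  slope-1 : ∀ β e ψ₂ ψ₃ →
    (e + β * ψ₂ ^ 3) * (β * 0#) ≈ (β * 1# ^ 3 - β * 1#) * ψ₃
  slope-1 = prove 4 (λ β e ψ₂ ψ₃ →
    (e :+ β :* ψ₂ :^ 3) :* (β :* con 0) ⊜ (β :* :1 :^ 3 :- β :* :1) :* ψ₃) ≡.refl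

  slope-step : ∀ β γ e₃ e₂ ψ₅ ψ₄ ψ₃ ψ₂ ψ₁ ψ₀ →
    β * e₃ ≈ ψ₅ * ψ₂ ^ 2 - ψ₁ * ψ₄ ^ 2 →
    β * e₂ ≈ ψ₄ * ψ₁ ^ 2 - ψ₀ * ψ₃ ^ 2 →
    ψ₅ * ψ₁ ≈ β ^ 2 * ψ₄ * ψ₂ - γ * ψ₃ ^ 2 →
    ψ₄ * ψ₀ ≈ β ^ 2 * ψ₃ * ψ₁ - γ * ψ₂ ^ 2 →
    β * ((e₃ + β * ψ₃ ^ 3) * ψ₁) ≈ β * ((β * ψ₂ ^ 3 - e₂) * ψ₄)
  slope-step = prove 10 (λ β γ e₃ e₂ ψ₅ ψ₄ ψ₃ ψ₂ ψ₁ ψ₀ →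
    ψ₁ ∙ β :* e₃ ⊜ ψ₅ :* ψ₂ :^ 2 :- ψ₁ :* ψ₄ :^ 2 ⇒
    ψ₄ ∙ β :* e₂ ⊜ ψ₄ :* ψ₁ :^ 2 :- ψ₀ :* ψ₃ :^ 2 ⇒
    ψ₂ :^ 2 ∙ ψ₅ :* ψ₁ ⊜ β :^ 2 :* ψ₄ :* ψ₂ :- γ :* ψ₃ :^ 2 ⇒
    con 0 :- ψ₃ :^ 2 ∙ ψ₄ :* ψ₀ ⊜ β :^ 2 :* ψ₃ :* ψ₁ :- γ :* ψ₂ :^ 2 ⇒
    β :* ((e₃ :+ β :* ψ₃ :^ 3) :* ψ₁) ⊜ β :* ((β :* ψ₂ :^ 3 :- e₂) :* ψ₄)) ≡.refl

  chord-1 : ∀ β x ψ₂ ψ₃ →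
    (β * 1# - β * 1# ^ 3) ^ 2 - κ 4 * (κ 2 * x * 1# ^ 2 - ψ₂ * (β * 0#)) * (ψ₂ * (β * 0#)) ^ 2
      ≈ κ 4 * (x * ψ₂ ^ 2 - ψ₃ * 1#) * (1# ^ 2 * (β * 0#) ^ 2)
  chord-1 = prove 4 (λ β x ψ₂ ψ₃ →
    (β :* :1 :- β :* :1 :^ 3) :^ 2 :- con 4 :* (con 2 :* x :* :1 :^ 2 :- ψ₂ :* (β :* con 0)) :* (ψ₂ :* (β :* con 0)) :^ 2
      ⊜ con 4 :* (x :* ψ₂ :^ 2 :- ψ₃ :* :1) :* (:1 :^ 2 :* (β :* con 0) :^ 2)) ≡.refl

  chord-step : ∀ β c x e ψ₄ ψ₃ ψ₂ ψ₁ ψ₀ →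
    β * e ≈ ψ₄ * ψ₁ ^ 2 - ψ₀ * ψ₃ ^ 2 →
    ψ₄ * ψ₁ ^ 2 + ψ₀ * ψ₃ ^ 2 + β ^ 2 * ψ₂ ^ 3 ≈ c * ψ₁ * ψ₂ * ψ₃ →
    e ^ 2 ≈ β ^ 2 * ψ₂ ^ 6 - κ 2 * c * (ψ₃ * ψ₁) * ψ₂ ^ 4 + κ 12 * x * (ψ₃ * ψ₁) ^ 2 * ψ₂ ^ 2 - κ 4 * (ψ₃ * ψ₁) ^ 3 →
    (e - β * ψ₂ ^ 3) ^ 2 - κ 4 * (κ 2 * x * ψ₂ ^ 2 - ψ₃ * ψ₁) * (ψ₃ * ψ₁) ^ 2 ≈ κ 4 * (x * ψ₃ ^ 2 - ψ₄ * ψ₂) * (ψ₂ ^ 2 * ψ₁ ^ 2)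
  chord-step = prove 9 (λ β c x e ψ₄ ψ₃ ψ₂ ψ₁ ψ₀ →
    con 0 :- con 2 :* ψ₂ :^ 3 ∙ β :* e ⊜ ψ₄ :* ψ₁ :^ 2 :- ψ₀ :* ψ₃ :^ 2 ⇒
    con 2 :* ψ₂ :^ 3 ∙ ψ₄ :* ψ₁ :^ 2 :+ ψ₀ :* ψ₃ :^ 2 :+ β :^ 2 :* ψ₂ :^ 3 ⊜ c :* ψ₁ :* ψ₂ :* ψ₃ ⇒
    :1
      ∙ e :^ 2 ⊜ β :^ 2 :* ψ₂ :^ 6 :- con 2 :* c :* (ψ₃ :* ψ₁) :* ψ₂ :^ 4 :+ con 12 :* x :* (ψ₃ :* ψ₁) :^ 2 :* ψ₂ :^ 2 :- con 4 :* (ψ₃ :* ψ₁) :^ 3 ⇒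
    (e :- β :* ψ₂ :^ 3) :^ 2 :- con 4 :* (con 2 :* x :* ψ₂ :^ 2 :- ψ₃ :* ψ₁) :* (ψ₃ :* ψ₁) :^ 2
      ⊜ con 4 :* (x :* ψ₃ :^ 2 :- ψ₄ :* ψ₂) :* (ψ₂ :^ 2 :* ψ₁ :^ 2)) ≡.refl

module Relations {c ℓ} (R : CommutativeRing c ℓ) (A B x y : CommutativeRing.Carrier R) where
  open CommutativeRing R hiding (zero)
  open Numerals R
  open Power R
  open DivisionPolynomials R A B x
  open AtPoint y

  q : ℕ → Carrier
  q k = ψ (2 ℕ.+ k) * ψ k

  -- Let n = 1 + k and φₙ = x ψₙ² - `q k`. Cleared of denominators, `Curve` says that n(x,y)
  -- satisfies the Weierstrass equation, `Slope` that P, nP and -(n+1)P are collinear, and `Chord`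
  -- that the abscissa of (n+1)P is λ² minus the abscissas of P and nP.
  Invariant Somos Curve Slope Chord : ℕ → Set ℓ
  Invariant j =
    ψ (4 ℕ.+ j) * ψ (1 ℕ.+ j) ^ 2 + ψ j * ψ (3 ℕ.+ j) ^ 2 + β ^ 2 * ψ (2 ℕ.+ j) ^ 3
      ≈ c# * ψ (1 ℕ.+ j) * ψ (2 ℕ.+ j) * ψ (3 ℕ.+ j)
  Somos j = ψ (4 ℕ.+ j) * ψ j ≈ β ^ 2 * ψ (3 ℕ.+ j) * ψ (1 ℕ.+ j) - γ * ψ (2 ℕ.+ j) ^ 2
  Curve k = e (1 ℕ.+ k) ^ 2 ≈ β ^ 2 * ψ (1 ℕ.+ k) ^ 6 - κ 2 * c# * q k * ψ (1 ℕ.+ k) ^ 4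
    + κ 12 * x * q k ^ 2 * ψ (1 ℕ.+ k) ^ 2 - κ 4 * q k ^ 3
  Slope k = (e (2 ℕ.+ k) + β * ψ (2 ℕ.+ k) ^ 3) * ψ k ≈ (β * ψ (1 ℕ.+ k) ^ 3 - e (1 ℕ.+ k)) * ψ (3 ℕ.+ k)
  Chord k = (e (1 ℕ.+ k) - β * ψ (1 ℕ.+ k) ^ 3) ^ 2 - κ 4 * (κ 2 * x * ψ (1 ℕ.+ k) ^ 2 - q k) * q k ^ 2
    ≈ κ 4 * (x * ψ (2 ℕ.+ k) ^ 2 - ψ (3 ℕ.+ k) * ψ (1 ℕ.+ k)) * (ψ (1 ℕ.+ k) ^ 2 * ψ k ^ 2)

module GenericPoint {c ℓ} (R : CommutativeRing c ℓ) (dom : IsDomain R) (A B x y : CommutativeRing.Carrier R)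
  (on-curve : IsPoint R A B x y)
  (ψ≉0 : ∀ n → ¬ CommutativeRing._≈_ R (DivisionPolynomials.AtPoint.ψ R A B x y (suc n)) (CommutativeRing.0# R)) where
  open CommutativeRing R hiding (zero)
  open Power R
  open CurveIdentities R
  open DomainProperties R dom
  open DivisionPolynomials R A B x
  open AtPoint y
  open Twisted R A B x y on-curve
  open Relations R A B x y
  open EllipticRelations dom ellipticSequence ψ≉0 public using (somos; invariant)

  β≉0 : ¬ (β ≈ 0#)
  β≉0 β≈0 = ψ≉0 1 (trans (*-identityʳ β) β≈0)

  β²≉0 : ¬ (β ^ 2 ≈ 0#)
  β²≉0 = *-nonzero β≉0 β≉0

  curve : ∀ k → Curve k
  curve zero    = curve-1 β c# x (ψ 2)
  curve (suc j) = *-cancelˡ (β ^ 2) β²≉0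
    (curve-step β γ c# x (e (2 ℕ.+ j)) _ _ _ _ _ (βe j) (invariant j) (somos j) (discriminant-relation A B x y on-curve))

  slope : ∀ k → Slope k
  slope zero    = slope-1 β (e 2) (ψ 2) (ψ 3)
  slope (suc j) = *-cancelˡ β β≉0
    (slope-step β γ (e (3 ℕ.+ j)) (e (2 ℕ.+ j)) _ _ _ _ _ _ (βe (suc j)) (βe j) (somos (suc j)) (somos j))

-- The generic point over ℤ[A,x,y]

module Universal where

  -- Abstract, so that no computation in the polynomial ring is ever attempted.
  abstract
    ℤ⟦_⟧ : ℕ → CommutativeRing 0ℓ 0ℓ
    ℤ⟦ n ⟧ = ℤ[ n ]

    ℤ⟦_⟧-isDomain : ∀ n → IsDomain ℤ⟦ n ⟧
    ℤ⟦ n ⟧-isDomain = ℤ[ n ]-isDomain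

    indeterminate : ∀ {n} → Fin n → CommutativeRing.Carrier ℤ⟦ n ⟧
    indeterminate {n} = lookup (generators n)

    substitute : ∀ {c ℓ} (R : CommutativeRing c ℓ) {n} → Vec (CommutativeRing.Carrier R) n → Hom ℤ⟦ n ⟧ R
    substitute R ρ = evaluateAt R ρ

    substitute-indeterminate : ∀ {c ℓ} (R : CommutativeRing c ℓ) {n} (ρ : Vec (CommutativeRing.Carrier R) n) i →
      CommutativeRing._≈_ R (Hom.⟨_⟩ (substitute R ρ) (indeterminate i)) (lookup ρ i)
    substitute-indeterminate R ρ = evaluateAt-generators R ρ

  𝕌 : CommutativeRing 0ℓ 0ℓ
  𝕌 = ℤ⟦ 3 ⟧

  Aᵤ xᵤ yᵤ : CommutativeRing.Carrier 𝕌
  Aᵤ = indeterminate zero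
  xᵤ = indeterminate (suc zero)
  yᵤ = indeterminate (suc (suc zero))

  open CommutativeRing 𝕌 hiding (zero)
  open Solver 𝕌

  -- B is solved for in the equation of the curve. The universal point then lives over a polynomial
  -- ring, which is a domain without further argument.
  Bᵤ : Carrier
  Bᵤ = yᵤ * yᵤ - xᵤ * xᵤ * xᵤ - Aᵤ * xᵤ

  on-curveᵤ : IsPoint 𝕌 Aᵤ Bᵤ xᵤ yᵤ
  on-curveᵤ = prove 3 (λ A x y → y :* y ⊜ x :* x :* x :+ A :* x :+ (y :* y :- x :* x :* x :- A :* x)) ≡.refl Aᵤ xᵤ yᵤ

  module Specialisation {c ℓ} (R : CommutativeRing c ℓ) (A B x y : CommutativeRing.Carrier R)
    (on-curve : IsPoint R A B x y) where
    private
      module R = CommutativeRing R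
    open Solver R using () renaming (prove to proveᴿ)

    specialise : Hom 𝕌 R
    specialise = substitute R (A ∷ x ∷ y ∷ [])
    open Hom specialise using (⟨_⟩)

    A≈ : ⟨ Aᵤ ⟩ R.≈ A
    A≈ = substitute-indeterminate R (A ∷ x ∷ y ∷ []) zero
    x≈ : ⟨ xᵤ ⟩ R.≈ x
    x≈ = substitute-indeterminate R (A ∷ x ∷ y ∷ []) (suc zero)
    y≈ : ⟨ yᵤ ⟩ R.≈ y
    y≈ = substitute-indeterminate R (A ∷ x ∷ y ∷ []) (suc (suc zero))
    B≈ : ⟨ Bᵤ ⟩ R.≈ B
    B≈ = R.trans (homo specialise 3 (λ A x y → y :* y :- x :* x :* x :- A :* x) (A≈ ∷ x≈ ∷ y≈ ∷ []))
      (proveᴿ 4 (λ A B x y → :1 ∙ y :* y ⊜ x :* x :* x :+ A :* x :+ B ⇒ y :* y :- x :* x :* x :- A :* x ⊜ B)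
         ≡.refl A B x y on-curve)

  open DivisionPolynomials 𝕌 Aᵤ Bᵤ xᵤ
  open AtPoint yᵤ

  κ-ℤ : ∀ n → Numerals.κ ℤₚ.+-*-commutativeRing n ≡ + n
  κ-ℤ zero    = ≡.refl
  κ-ℤ (suc n) rewrite κ-ℤ n = ≡.refl

  module _ {c ℓ} (R : CommutativeRing c ℓ) where
    private
      module R = CommutativeRing R
    open Solver R using () renaming (prove to proveᴿ)
    open Specialisation R R.0# R.0# R.1# R.1#
      (proveᴿ 0 (:1 :* :1 ⊜ :1 :* :1 :* :1 :+ con 0 :* :1 :+ con 0) ≡.refl)

    ψ-unit-point : ∀ n → Hom.⟨_⟩ (substitute R (R.0# ∷ R.1# ∷ R.1# ∷ [])) (ψ n) R.≈ Numerals.κ R n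
    ψ-unit-point n = R.trans (ψ-homo specialise A≈ B≈ x≈ y≈ n) (DivisionValues.ψ-value R n)

  unit-point : Hom 𝕌 ℤₚ.+-*-commutativeRing
  unit-point = substitute ℤₚ.+-*-commutativeRing (+ 0 ∷ + 1 ∷ + 1 ∷ [])

  -- Specialised at A = B = 0, x = y = 1 it becomes the positive integer 1 + n.
  ψ≉0 : ∀ n → ¬ (ψ (suc n) ≈ 0#)
  ψ≉0 n e with ≡.trans (≡.sym (κ-ℤ (suc n))) (≡.trans (≡.sym (ψ-unit-point ℤₚ.+-*-commutativeRing (suc n)))
                 (≡.trans (Hom.cong unit-point e) (Hom.0-homo unit-point)))
  ... | ()

module PointRelations {c ℓ} (R : CommutativeRing c ℓ) (A B x y : CommutativeRing.Carrier R)
  (on-curve : IsPoint R A B x y) where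
  open CommutativeRing R hiding (zero)
  open Power R
  open CurveIdentities R
  open DivisionPolynomials R A B x
  open AtPoint y
  open Twisted R A B x y on-curve public using (βe; h≈β²)
  open Relations R A B x y
  private
    module U = Universal
    module G = GenericPoint U.𝕌 U.ℤ⟦ 3 ⟧-isDomain U.Aᵤ U.Bᵤ U.xᵤ U.yᵤ U.on-curveᵤ U.ψ≉0
    open Universal.Specialisation R A B x y on-curve

    ψ≈ = ψ-homo specialise A≈ B≈ x≈ y≈
    e≈ = e-homo specialise A≈ B≈ x≈ y≈
    β≈ = β-homo specialise A≈ B≈ x≈ y≈
    γ≈ = γ-homo specialise A≈ B≈ x≈
    c≈ = c-homo specialise A≈ B≈ x≈

  somos : ∀ j → Somos j
  somos j = transfer specialise 7
    (λ ψ₄ ψ₃ ψ₂ ψ₁ ψ₀ β γ → ψ₄ :* ψ₀) (λ ψ₄ ψ₃ ψ₂ ψ₁ ψ₀ β γ → β :^ 2 :* ψ₃ :* ψ₁ :- γ :* ψ₂ :^ 2)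
    (ψ≈ (4 ℕ.+ j) ∷ ψ≈ (3 ℕ.+ j) ∷ ψ≈ (2 ℕ.+ j) ∷ ψ≈ (1 ℕ.+ j) ∷ ψ≈ j ∷ β≈ ∷ γ≈ ∷ [])
    (G.somos j)

  invariant : ∀ j → Invariant j
  invariant j = transfer specialise 7
    (λ ψ₄ ψ₃ ψ₂ ψ₁ ψ₀ β c → ψ₄ :* ψ₁ :^ 2 :+ ψ₀ :* ψ₃ :^ 2 :+ β :^ 2 :* ψ₂ :^ 3)
    (λ ψ₄ ψ₃ ψ₂ ψ₁ ψ₀ β c → c :* ψ₁ :* ψ₂ :* ψ₃)
    (ψ≈ (4 ℕ.+ j) ∷ ψ≈ (3 ℕ.+ j) ∷ ψ≈ (2 ℕ.+ j) ∷ ψ≈ (1 ℕ.+ j) ∷ ψ≈ j ∷ β≈ ∷ c≈ ∷ [])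
    (G.invariant j)

  curve : ∀ k → Curve k
  curve k = transfer specialise 7
    (λ ψ₂ ψ₁ ψ₀ β c x e → e :^ 2)
    (λ ψ₂ ψ₁ ψ₀ β c x e → β :^ 2 :* ψ₁ :^ 6 :- con 2 :* c :* (ψ₂ :* ψ₀) :* ψ₁ :^ 4
       :+ con 12 :* x :* (ψ₂ :* ψ₀) :^ 2 :* ψ₁ :^ 2 :- con 4 :* (ψ₂ :* ψ₀) :^ 3)
    (ψ≈ (2 ℕ.+ k) ∷ ψ≈ (1 ℕ.+ k) ∷ ψ≈ k ∷ β≈ ∷ c≈ ∷ x≈ ∷ e≈ (1 ℕ.+ k) ∷ [])
    (G.curve k)

  slope : ∀ k → Slope k
  slope k = transfer specialise 7
    (λ ψ₃ ψ₂ ψ₁ ψ₀ β e₂ e₁ → (e₂ :+ β :* ψ₂ :^ 3) :* ψ₀)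
    (λ ψ₃ ψ₂ ψ₁ ψ₀ β e₂ e₁ → (β :* ψ₁ :^ 3 :- e₁) :* ψ₃)
    (ψ≈ (3 ℕ.+ k) ∷ ψ≈ (2 ℕ.+ k) ∷ ψ≈ (1 ℕ.+ k) ∷ ψ≈ k ∷ β≈ ∷ e≈ (2 ℕ.+ k) ∷ e≈ (1 ℕ.+ k) ∷ [])
    (G.slope k)

  chord : ∀ k → Chord k
  chord zero    = chord-1 β x (ψ 2) (ψ 3)
  chord (suc j) = chord-step β c# x (e (2 ℕ.+ j)) _ _ _ _ _ (βe j) (invariant j) (curve (suc j))

-- Derivatives of division polynomials

module DerivativeIdentities {c ℓ} (R : CommutativeRing c ℓ) where
  open CommutativeRing R hiding (zero)
  open Numerals R
  open Power R
  open Solver R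

  tangent-on-curve : ∀ A x y →
    y * (κ 3 * x ^ 2 + A) + (κ 3 * x ^ 2 + A) * y
      ≈ x * x * (κ 2 * y) + (x * (κ 2 * y) + κ 2 * y * x) * x + (A * (κ 2 * y) + 0# * x) + 0#
  tangent-on-curve = prove 3 (λ A x y →
    y :* (con 3 :* x :^ 2 :+ A) :+ (con 3 :* x :^ 2 :+ A) :* y
      ⊜ x :* x :* (con 2 :* y) :+ (x :* (con 2 :* y) :+ con 2 :* y :* x) :* x :+ (A :* (con 2 :* y) :+ con 0 :* x) :+ con 0) ≡.refl

  β-derivative : ∀ A x y κ2′ →
    κ2′ ≈ 0# →
    κ 2 * (κ 3 * x ^ 2 + A) + κ2′ * y ≈ κ 2 * (κ 3 * x ^ 2 + A)
  β-derivative = prove 4 (λ A x y κ2′ →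
    y ∙ κ2′ ⊜ con 0 ⇒
    con 2 :* (con 3 :* x :^ 2 :+ A) :+ κ2′ :* y ⊜ con 2 :* (con 3 :* x :^ 2 :+ A)) ≡.refl

  c-derivative : ∀ A x y κ2′ κ3′ →
    κ2′ ≈ 0# →
    κ3′ ≈ 0# →
    κ 2 * (κ 3 * (x * (κ 2 * y) + κ 2 * y * x) + κ3′ * (x * x) + 0#) + κ2′ * (κ 3 * (x * x) + A) ≈ κ 12 * x * (κ 2 * y)
  c-derivative = prove 5 (λ A x y κ2′ κ3′ →
    con 3 :* (x :* x) :+ A ∙ κ2′ ⊜ con 0 ⇒
    con 2 :* (x :* x) ∙ κ3′ ⊜ con 0 ⇒
    con 2 :* (con 3 :* (x :* (con 2 :* y) :+ con 2 :* y :* x) :+ κ3′ :* (x :* x) :+ con 0) :+ κ2′ :* (con 3 :* (x :* x) :+ A)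
      ⊜ con 12 :* x :* (con 2 :* y)) ≡.refl

  γ-derivative : ∀ A B x y κ3′ κ6′ κ12′ →
    κ3′ ≈ 0# →
    κ6′ ≈ 0# →
    κ12′ ≈ 0# →
    y * y ≈ x * x * x + A * x + B →
    κ 3 * (x * (x * (x * (κ 2 * y) + κ 2 * y * x) + κ 2 * y * (x * x)) + κ 2 * y * (x * (x * x))) + κ3′ * (x * (x * (x * x))) + (κ 6 * A * (x * (κ 2 * y) + κ 2 * y * x) + (κ 6 * 0# + κ6′ * A) * (x * x)) + (κ 12 * B * (κ 2 * y) + (κ 12 * 0# + κ12′ * B) * x) + (- (A * 0# + 0# * A))
      ≈ κ 3 * (κ 2 * y) ^ 3
  γ-derivative = prove 7 (λ A B x y κ3′ κ6′ κ12′ →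
    x :^ 4 ∙ κ3′ ⊜ con 0 ⇒
    A :* x :^ 2 ∙ κ6′ ⊜ con 0 ⇒
    B :* x ∙ κ12′ ⊜ con 0 ⇒
    con 0 :- con 12 :* (con 2 :* y) ∙ y :* y ⊜ x :* x :* x :+ A :* x :+ B ⇒
    con 3 :* (x :* (x :* (x :* (con 2 :* y) :+ con 2 :* y :* x) :+ con 2 :* y :* (x :* x)) :+ con 2 :* y :* (x :* (x :* x))) :+ κ3′ :* (x :* (x :* (x :* x))) :+ (con 6 :* A :* (x :* (con 2 :* y) :+ con 2 :* y :* x) :+ (con 6 :* con 0 :+ κ6′ :* A) :* (x :* x)) :+ (con 12 :* B :* (con 2 :* y) :+ (con 12 :* con 0 :+ κ12′ :* B) :* x) :+ (:- (A :* con 0 :+ con 0 :* A))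
      ⊜ con 3 :* (con 2 :* y) :^ 3) ≡.refl

  slope-sum : ∀ β c e₃ e₂ e₁ ψ₄ ψ₃ ψ₂ ψ₁ ψ₀ →
    (e₃ + β * ψ₃ ^ 3) * ψ₁ ≈ (β * ψ₂ ^ 3 - e₂) * ψ₄ →
    (e₂ + β * ψ₂ ^ 3) * ψ₀ ≈ (β * ψ₁ ^ 3 - e₁) * ψ₃ →
    β * e₂ ≈ ψ₄ * ψ₁ ^ 2 - ψ₀ * ψ₃ ^ 2 →
    ψ₄ * ψ₁ ^ 2 + ψ₀ * ψ₃ ^ 2 + β ^ 2 * ψ₂ ^ 3 ≈ c * ψ₁ * ψ₂ * ψ₃ →
    κ 2 * (e₃ * ψ₁ ^ 3 + e₁ * ψ₃ ^ 3) ≈ κ 2 * e₂ * (κ 2 * β ^ 2 * ψ₂ ^ 3 - c * (ψ₃ * ψ₁) * ψ₂)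
  slope-sum = prove 10 (λ β c e₃ e₂ e₁ ψ₄ ψ₃ ψ₂ ψ₁ ψ₀ →
    con 2 :* ψ₁ :^ 2 ∙ (e₃ :+ β :* ψ₃ :^ 3) :* ψ₁ ⊜ (β :* ψ₂ :^ 3 :- e₂) :* ψ₄ ⇒
    con 2 :* ψ₃ :^ 2 ∙ (e₂ :+ β :* ψ₂ :^ 3) :* ψ₀ ⊜ (β :* ψ₁ :^ 3 :- e₁) :* ψ₃ ⇒
    con 0 :- con 2 :* β :* ψ₂ :^ 3 ∙ β :* e₂ ⊜ ψ₄ :* ψ₁ :^ 2 :- ψ₀ :* ψ₃ :^ 2 ⇒
    con 0 :- con 2 :* e₂ ∙ ψ₄ :* ψ₁ :^ 2 :+ ψ₀ :* ψ₃ :^ 2 :+ β :^ 2 :* ψ₂ :^ 3 ⊜ c :* ψ₁ :* ψ₂ :* ψ₃ ⇒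
    con 2 :* (e₃ :* ψ₁ :^ 3 :+ e₁ :* ψ₃ :^ 3) ⊜ con 2 :* e₂ :* (con 2 :* β :^ 2 :* ψ₂ :^ 3 :- c :* (ψ₃ :* ψ₁) :* ψ₂)) ≡.refl

  slope-difference : ∀ β e₃ e₂ e₁ ψ₄ ψ₃ ψ₂ ψ₁ ψ₀ →
    (e₃ + β * ψ₃ ^ 3) * ψ₁ ≈ (β * ψ₂ ^ 3 - e₂) * ψ₄ →
    (e₂ + β * ψ₂ ^ 3) * ψ₀ ≈ (β * ψ₁ ^ 3 - e₁) * ψ₃ →
    β * e₂ ≈ ψ₄ * ψ₁ ^ 2 - ψ₀ * ψ₃ ^ 2 →
    κ 2 * (e₃ * ψ₁ ^ 3 - e₁ * ψ₃ ^ 3)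
      ≈ κ 2 * β * ψ₂ ^ 3 * (ψ₄ * ψ₁ ^ 2 + ψ₀ * ψ₃ ^ 2) - κ 2 * β * e₂ ^ 2 - κ 4 * β * (ψ₃ * ψ₁) ^ 3
  slope-difference = prove 9 (λ β e₃ e₂ e₁ ψ₄ ψ₃ ψ₂ ψ₁ ψ₀ →
    con 2 :* ψ₁ :^ 2 ∙ (e₃ :+ β :* ψ₃ :^ 3) :* ψ₁ ⊜ (β :* ψ₂ :^ 3 :- e₂) :* ψ₄ ⇒
    con 0 :- con 2 :* ψ₃ :^ 2 ∙ (e₂ :+ β :* ψ₂ :^ 3) :* ψ₀ ⊜ (β :* ψ₁ :^ 3 :- e₁) :* ψ₃ ⇒
    con 2 :* e₂ ∙ β :* e₂ ⊜ ψ₄ :* ψ₁ :^ 2 :- ψ₀ :* ψ₃ :^ 2 ⇒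
    con 2 :* (e₃ :* ψ₁ :^ 3 :- e₁ :* ψ₃ :^ 3)
      ⊜ con 2 :* β :* ψ₂ :^ 3 :* (ψ₄ :* ψ₁ :^ 2 :+ ψ₀ :* ψ₃ :^ 2) :- con 2 :* β :* e₂ :^ 2 :- con 4 :* β :* (ψ₃ :* ψ₁) :^ 3) ≡.refl

  -- Passage to index n+1 from n-1 and n, by differentiating the invariant. The terms in ωₙ₊₁ and
  -- ωₙ₋₁ carry the factors n+1 and n-1, and (n+1)a + (n-1)b = n(a+b) + (a-b); hence the two
  -- hypotheses on the sum and the difference of `e₃ * ψ₁ ^ 3` and `e₁ * ψ₃ ^ 3`.
  derivative-step : ∀ β c x t e₃ e₂ e₁ ψ₄ ψ₃ ψ₂ ψ₁ ψ₀ β′ c′ ψ₄′ ψ₃′ ψ₂′ ψ₁′ ψ₀′ →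
    ψ₄ * ψ₁ ^ 2 + ψ₀ * ψ₃ ^ 2 + β ^ 2 * ψ₂ ^ 3 ≈ c * ψ₁ * ψ₂ * ψ₃ →
    ψ₄ * (ψ₁ * ψ₁′ + ψ₁′ * ψ₁) + ψ₄′ * ψ₁ ^ 2 + (ψ₀ * (ψ₃ * ψ₃′ + ψ₃′ * ψ₃) + ψ₀′ * ψ₃ ^ 2) + (β ^ 2 * (ψ₂ * (ψ₂ * ψ₂′ + ψ₂′ * ψ₂) + ψ₂′ * ψ₂ ^ 2) + (β * β′ + β′ * β) * ψ₂ ^ 3)
      ≈ c * ψ₁ * ψ₂ * ψ₃′ + (c * ψ₁ * ψ₂′ + (c * ψ₁′ + c′ * ψ₁) * ψ₂) * ψ₃ →
    β′ ≈ c →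
    c′ ≈ κ 12 * x * β →
    β * ψ₁ ^ 3 - (ψ₂ * ψ₀′ + ψ₂′ * ψ₀) * ψ₁ + κ 2 * (ψ₂ * ψ₀) * ψ₁′ ≈ (1# + t) * e₁ →
    β * ψ₂ ^ 3 - (ψ₃ * ψ₁′ + ψ₃′ * ψ₁) * ψ₂ + κ 2 * (ψ₃ * ψ₁) * ψ₂′ ≈ (1# + (1# + t)) * e₂ →
    κ 2 * (e₃ * ψ₁ ^ 3 + e₁ * ψ₃ ^ 3) ≈ κ 2 * e₂ * (κ 2 * β ^ 2 * ψ₂ ^ 3 - c * (ψ₃ * ψ₁) * ψ₂) →
    κ 2 * (e₃ * ψ₁ ^ 3 - e₁ * ψ₃ ^ 3)
      ≈ κ 2 * β * ψ₂ ^ 3 * (ψ₄ * ψ₁ ^ 2 + ψ₀ * ψ₃ ^ 2) - κ 2 * β * e₂ ^ 2 - κ 4 * β * (ψ₃ * ψ₁) ^ 3 →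
    e₂ ^ 2 ≈ β ^ 2 * ψ₂ ^ 6 - κ 2 * c * (ψ₃ * ψ₁) * ψ₂ ^ 4 + κ 12 * x * (ψ₃ * ψ₁) ^ 2 * ψ₂ ^ 2 - κ 4 * (ψ₃ * ψ₁) ^ 3 →
    κ 2 * ψ₁ ^ 3 * (β * ψ₃ ^ 3 - (ψ₄ * ψ₂′ + ψ₄′ * ψ₂) * ψ₃ + κ 2 * (ψ₄ * ψ₂) * ψ₃′)
      ≈ κ 2 * ψ₁ ^ 3 * ((1# + (1# + (1# + t))) * e₃)
  derivative-step = prove 19 (λ β c x t e₃ e₂ e₁ ψ₄ ψ₃ ψ₂ ψ₁ ψ₀ β′ c′ ψ₄′ ψ₃′ ψ₂′ ψ₁′ ψ₀′ →
    con 2 :* (con 2 :* ψ₂ :* (ψ₃ :* ψ₁′ :+ ψ₃′ :* ψ₁) :- ψ₃ :* ψ₁ :* ψ₂′) :- con 2 :* β :* ψ₂ :^ 3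
      ∙ ψ₄ :* ψ₁ :^ 2 :+ ψ₀ :* ψ₃ :^ 2 :+ β :^ 2 :* ψ₂ :^ 3 ⊜ c :* ψ₁ :* ψ₂ :* ψ₃ ⇒
    con 0 :- con 2 :* ψ₃ :* ψ₁ :* ψ₂
      ∙ ψ₄ :* (ψ₁ :* ψ₁′ :+ ψ₁′ :* ψ₁) :+ ψ₄′ :* ψ₁ :^ 2 :+ (ψ₀ :* (ψ₃ :* ψ₃′ :+ ψ₃′ :* ψ₃) :+ ψ₀′ :* ψ₃ :^ 2) :+ (β :^ 2 :* (ψ₂ :* (ψ₂ :* ψ₂′ :+ ψ₂′ :* ψ₂) :+ ψ₂′ :* ψ₂ :^ 2) :+ (β :* β′ :+ β′ :* β) :* ψ₂ :^ 3) ⊜ c :* ψ₁ :* ψ₂ :* ψ₃′ :+ (c :* ψ₁ :* ψ₂′ :+ (c :* ψ₁′ :+ c′ :* ψ₁) :* ψ₂) :* ψ₃ ⇒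
    con 4 :* β :* ψ₃ :* ψ₁ :* ψ₂ :^ 4 ∙ β′ ⊜ c ⇒
    con 0 :- con 2 :* (ψ₃ :* ψ₁) :^ 2 :* ψ₂ :^ 2 ∙ c′ ⊜ con 12 :* x :* β ⇒
    con 0 :- con 2 :* ψ₃ :^ 3 ∙ β :* ψ₁ :^ 3 :- (ψ₂ :* ψ₀′ :+ ψ₂′ :* ψ₀) :* ψ₁ :+ con 2 :* (ψ₂ :* ψ₀) :* ψ₁′ ⊜ (:1 :+ t) :* e₁ ⇒
    con 0 :- con 2 :* (c :* ψ₃ :* ψ₁ :* ψ₂ :- con 2 :* β :^ 2 :* ψ₂ :^ 3)
      ∙ β :* ψ₂ :^ 3 :- (ψ₃ :* ψ₁′ :+ ψ₃′ :* ψ₁) :* ψ₂ :+ con 2 :* (ψ₃ :* ψ₁) :* ψ₂′ ⊜ (:1 :+ (:1 :+ t)) :* e₂ ⇒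
    con 0 :- (con 2 :+ t)
      ∙ con 2 :* (e₃ :* ψ₁ :^ 3 :+ e₁ :* ψ₃ :^ 3) ⊜ con 2 :* e₂ :* (con 2 :* β :^ 2 :* ψ₂ :^ 3 :- c :* (ψ₃ :* ψ₁) :* ψ₂) ⇒
    con 0 :- :1
      ∙ con 2 :* (e₃ :* ψ₁ :^ 3 :- e₁ :* ψ₃ :^ 3) ⊜ con 2 :* β :* ψ₂ :^ 3 :* (ψ₄ :* ψ₁ :^ 2 :+ ψ₀ :* ψ₃ :^ 2) :- con 2 :* β :* e₂ :^ 2 :- con 4 :* β :* (ψ₃ :* ψ₁) :^ 3 ⇒
    con 2 :* β
      ∙ e₂ :^ 2 ⊜ β :^ 2 :* ψ₂ :^ 6 :- con 2 :* c :* (ψ₃ :* ψ₁) :* ψ₂ :^ 4 :+ con 12 :* x :* (ψ₃ :* ψ₁) :^ 2 :* ψ₂ :^ 2 :- con 4 :* (ψ₃ :* ψ₁) :^ 3 ⇒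
    con 2 :* ψ₁ :^ 3 :* (β :* ψ₃ :^ 3 :- (ψ₄ :* ψ₂′ :+ ψ₄′ :* ψ₂) :* ψ₃ :+ con 2 :* (ψ₄ :* ψ₂) :* ψ₃′)
      ⊜ con 2 :* ψ₁ :^ 3 :* ((:1 :+ (:1 :+ (:1 :+ t))) :* e₃)) ≡.refl

  derivative-of-e : ∀ β c x t e ψ₂ ψ₁ ψ₀ e′ ψ₂′ ψ₁′ ψ₀′ β′ c′ x′ κ2′ κ12′ κ4′ →
    e * e′ + e′ * e
      ≈ β ^ 2 * (ψ₁ * (ψ₁ * (ψ₁ * (ψ₁ * (ψ₁ * ψ₁′ + ψ₁′ * ψ₁) + ψ₁′ * ψ₁ ^ 2) + ψ₁′ * ψ₁ ^ 3) + ψ₁′ * ψ₁ ^ 4) + ψ₁′ * ψ₁ ^ 5) + (β * β′ + β′ * β) * ψ₁ ^ 6 - (κ 2 * c * (ψ₂ * ψ₀) * (ψ₁ * (ψ₁ * (ψ₁ * ψ₁′ + ψ₁′ * ψ₁) + ψ₁′ * ψ₁ ^ 2) + ψ₁′ * ψ₁ ^ 3) + (κ 2 * c * (ψ₂ * ψ₀′ + ψ₂′ * ψ₀) + (κ 2 * c′ + κ2′ * c) * (ψ₂ * ψ₀)) * ψ₁ ^ 4) + (κ 12 * x * (ψ₂ * ψ₀) ^ 2 * (ψ₁ * ψ₁′ + ψ₁′ * ψ₁) + (κ 12 * x * (ψ₂ * ψ₀ * (ψ₂ * ψ₀′ + ψ₂′ * ψ₀) + (ψ₂ * ψ₀′ +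 ψ₂′ * ψ₀) * (ψ₂ * ψ₀)) + (κ 12 * x′ + κ12′ * x) * (ψ₂ * ψ₀) ^ 2) * ψ₁ ^ 2) - (κ 4 * (ψ₂ * ψ₀ * (ψ₂ * ψ₀ * (ψ₂ * ψ₀′ + ψ₂′ * ψ₀) + (ψ₂ * ψ₀′ + ψ₂′ * ψ₀) * (ψ₂ * ψ₀)) + (ψ₂ * ψ₀′ + ψ₂′ * ψ₀) * (ψ₂ * ψ₀) ^ 2) + κ4′ * (ψ₂ * ψ₀) ^ 3) →
    e ^ 2 ≈ β ^ 2 * ψ₁ ^ 6 - κ 2 * c * (ψ₂ * ψ₀) * ψ₁ ^ 4 + κ 12 * x * (ψ₂ * ψ₀) ^ 2 * ψ₁ ^ 2 - κ 4 * (ψ₂ * ψ₀) ^ 3 →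
    β * ψ₁ ^ 3 - (ψ₂ * ψ₀′ + ψ₂′ * ψ₀) * ψ₁ + κ 2 * (ψ₂ * ψ₀) * ψ₁′ ≈ t * e →
    β′ ≈ c →
    c′ ≈ κ 12 * x * β →
    x′ ≈ β →
    κ2′ ≈ 0# →
    κ12′ ≈ 0# →
    κ4′ ≈ 0# →
    κ 2 * e * (ψ₁ * e′ - κ 3 * e * ψ₁′) ≈ κ 2 * e * (t * (c * ψ₁ ^ 4 - κ 12 * x * (ψ₂ * ψ₀) * ψ₁ ^ 2 + κ 6 * (ψ₂ * ψ₀) ^ 2))
  derivative-of-e = prove 18 (λ β c x t e ψ₂ ψ₁ ψ₀ e′ ψ₂′ ψ₁′ ψ₀′ β′ c′ x′ κ2′ κ12′ κ4′ →
    ψ₁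
      ∙ e :* e′ :+ e′ :* e ⊜ β :^ 2 :* (ψ₁ :* (ψ₁ :* (ψ₁ :* (ψ₁ :* (ψ₁ :* ψ₁′ :+ ψ₁′ :* ψ₁) :+ ψ₁′ :* ψ₁ :^ 2) :+ ψ₁′ :* ψ₁ :^ 3) :+ ψ₁′ :* ψ₁ :^ 4) :+ ψ₁′ :* ψ₁ :^ 5) :+ (β :* β′ :+ β′ :* β) :* ψ₁ :^ 6 :- (con 2 :* c :* (ψ₂ :* ψ₀) :* (ψ₁ :* (ψ₁ :* (ψ₁ :* ψ₁′ :+ ψ₁′ :* ψ₁) :+ ψ₁′ :* ψ₁ :^ 2) :+ ψ₁′ :* ψ₁ :^ 3) :+ (con 2 :* c :* (ψ₂ :* ψ₀′ :+ ψ₂′ :* ψ₀) :+ (con 2 :* c′ :+ κ2′ :* c) :* (ψ₂ :* ψ₀)) :* ψ₁ :^ 4) :+ (con 12 :* x :* (ψ₂ :* ψ₀) :^ 2 :* (ψ₁ :* ψ₁′ :+ ψ₁′ :* ψ₁) :+ (con 12 :* x :* (ψ₂ :* ψ₀ :* (ψ₂ :* ψ₀′ :+ ψ₂′ :* ψ₀) :+ (ψ₂ :* ψ₀′ :+ ψ₂′ :* ψ₀) :* (ψ₂ :* ψ₀)) :+ (con 12 :* x′ :+ κ12′ :* x) :* (ψ₂ :* ψ₀) :^ 2) :* ψ₁ :^ 2) :- (con 4 :* (ψ₂ :* ψ₀ :* (ψ₂ :* ψ₀ :* (ψ₂ :* ψ₀′ :+ ψ₂′ :* ψ₀) :+ (ψ₂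 :* ψ₀′ :+ ψ₂′ :* ψ₀) :* (ψ₂ :* ψ₀)) :+ (ψ₂ :* ψ₀′ :+ ψ₂′ :* ψ₀) :* (ψ₂ :* ψ₀) :^ 2) :+ κ4′ :* (ψ₂ :* ψ₀) :^ 3) ⇒
    con 0 :- con 6 :* ψ₁′
      ∙ e :^ 2 ⊜ β :^ 2 :* ψ₁ :^ 6 :- con 2 :* c :* (ψ₂ :* ψ₀) :* ψ₁ :^ 4 :+ con 12 :* x :* (ψ₂ :* ψ₀) :^ 2 :* ψ₁ :^ 2 :- con 4 :* (ψ₂ :* ψ₀) :^ 3 ⇒
    con 2 :* c :* ψ₁ :^ 4 :- con 24 :* x :* (ψ₂ :* ψ₀) :* ψ₁ :^ 2 :+ con 12 :* (ψ₂ :* ψ₀) :^ 2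
      ∙ β :* ψ₁ :^ 3 :- (ψ₂ :* ψ₀′ :+ ψ₂′ :* ψ₀) :* ψ₁ :+ con 2 :* (ψ₂ :* ψ₀) :* ψ₁′ ⊜ t :* e ⇒
    con 2 :* β :* ψ₁ :^ 7 ∙ β′ ⊜ c ⇒
    con 0 :- con 2 :* ψ₂ :* ψ₀ :* ψ₁ :^ 5 ∙ c′ ⊜ con 12 :* x :* β ⇒
    con 12 :* (ψ₂ :* ψ₀) :^ 2 :* ψ₁ :^ 3 ∙ x′ ⊜ β ⇒
    con 0 :- c :* ψ₂ :* ψ₀ :* ψ₁ :^ 5 ∙ κ2′ ⊜ con 0 ⇒
    x :* (ψ₂ :* ψ₀) :^ 2 :* ψ₁ :^ 3 ∙ κ12′ ⊜ con 0 ⇒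
    con 0 :- (ψ₂ :* ψ₀) :^ 3 :* ψ₁ ∙ κ4′ ⊜ con 0 ⇒
    con 2 :* e :* (ψ₁ :* e′ :- con 3 :* e :* ψ₁′)
      ⊜ con 2 :* e :* (t :* (c :* ψ₁ :^ 4 :- con 12 :* x :* (ψ₂ :* ψ₀) :* ψ₁ :^ 2 :+ con 6 :* (ψ₂ :* ψ₀) :^ 2))) ≡.refl

-- The point (x , y) displaced by ε along the invariant vector field 2y ∂/∂x + (3x² + A) ∂/∂y.
module Tangent {c ℓ} (R : CommutativeRing c ℓ) (A B x y : CommutativeRing.Carrier R)
  (on-curve : IsPoint R A B x y) where
  open CommutativeRing R hiding (zero)
  open Numerals R
  open Power R
  open DualNumbers R
  open DerivativeIdentities R
  open DivisionPolynomials R A B x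
  open AtPoint y

  Aᵈ Bᵈ xᵈ yᵈ : Carrier × Carrier
  Aᵈ = A , 0#
  Bᵈ = B , 0#
  xᵈ = x , κ 2 * y
  yᵈ = y , κ 3 * x ^ 2 + A

  on-curveᵈ : IsPoint dual Aᵈ Bᵈ xᵈ yᵈ
  on-curveᵈ = on-curve & tangent-on-curve A x y

  module Dᵈ = DivisionPolynomials dual Aᵈ Bᵈ xᵈ
  module Pᵈ = Dᵈ.AtPoint yᵈ
  module Relᵈ = PointRelations dual Aᵈ Bᵈ xᵈ yᵈ on-curveᵈ

  ψ° ψ′ e° e′ : ℕ → Carrier
  ψ° n = proj₁ (Pᵈ.ψ n)
  ψ′ n = proj₂ (Pᵈ.ψ n)
  e° n = proj₁ (Pᵈ.e n)
  e′ n = proj₂ (Pᵈ.e n)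

  ψ°≈ψ : ∀ n → ψ° n ≈ ψ n
  ψ°≈ψ n = ψ-homo standardHom refl refl refl refl n

  e°≈e : ∀ n → e° n ≈ e n
  e°≈e n = e-homo standardHom refl refl refl refl n

  β′≈c : proj₂ Pᵈ.β ≈ c#
  β′≈c = β-derivative A x y _ (infinitesimal (κ-dual 2))

  c′≈ : proj₂ Dᵈ.c# ≈ κ 12 * x * β
  c′≈ = c-derivative A x y _ _ (infinitesimal (κ-dual 2)) (infinitesimal (κ-dual 3))

  γ′≈ : proj₂ Dᵈ.γ ≈ κ 3 * β ^ 3
  γ′≈ = γ-derivative A B x y _ _ _ (infinitesimal (κ-dual 3)) (infinitesimal (κ-dual 6)) (infinitesimal (κ-dual 12)) on-curve

  -- For n = 1 + k the abscissa xₙ = φₙ/ψₙ² and the ordinate yₙ = ωₙ/ψₙ³ of nP have derivatives 2n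
  -- yₙ and n(3xₙ² + A) along the invariant field. These formulas, multiplied by ψₙ³ and by 2ψₙ⁴,
  -- are the two equations.
  Derivative DerivativeOfE : ℕ → Set ℓ
  Derivative k = β * ψ° (1 ℕ.+ k) ^ 3 - (ψ° (2 ℕ.+ k) * ψ′ k + ψ′ (2 ℕ.+ k) * ψ° k) * ψ° (1 ℕ.+ k)
    + κ 2 * (ψ° (2 ℕ.+ k) * ψ° k) * ψ′ (1 ℕ.+ k) ≈ κ (1 ℕ.+ k) * e° (1 ℕ.+ k)
  DerivativeOfE k = ψ° (1 ℕ.+ k) * e′ (1 ℕ.+ k) - κ 3 * e° (1 ℕ.+ k) * ψ′ (1 ℕ.+ k) ≈
    κ (1 ℕ.+ k) * (c# * ψ° (1 ℕ.+ k) ^ 4 - κ 12 * x * (ψ° (2 ℕ.+ k) * ψ° k) * ψ° (1 ℕ.+ k) ^ 2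
      + κ 6 * (ψ° (2 ℕ.+ k) * ψ° k) ^ 2)

module GenericDerivative {c ℓ} (R : CommutativeRing c ℓ) (dom : IsDomain R) (A B x y : CommutativeRing.Carrier R)
  (on-curve : IsPoint R A B x y)
  (ψ≉0 : ∀ n → ¬ CommutativeRing._≈_ R (DivisionPolynomials.AtPoint.ψ R A B x y (suc n)) (CommutativeRing.0# R))
  (e≉0 : ∀ n → ¬ CommutativeRing._≈_ R (DivisionPolynomials.AtPoint.e R A B x y (suc n)) (CommutativeRing.0# R))
  (2≉0 : ¬ CommutativeRing._≈_ R (Numerals.κ R 2) (CommutativeRing.0# R)) where
  open CommutativeRing R hiding (zero)
  open Numerals R
  open Power R
  open Solver R
  open DualNumbers R
  open DerivativeIdentities R
  open DomainProperties R dom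
  open DivisionPolynomials R A B x
  open AtPoint y
  open Tangent R A B x y on-curve

  private
    base₁ : Derivative 0
    base₁ = prove 4 (λ β ψ₂ ψ₂′ β′ →
        β :* :1 :^ 3 :- (ψ₂ :* (β :* con 0 :+ β′ :* con 0) :+ ψ₂′ :* (β :* con 0)) :* :1
          :+ con 2 :* (ψ₂ :* (β :* con 0)) :* con 0 ⊜ con 1 :* (β :* :1)) ≡.refl β (ψ° 2) (ψ′ 2) (proj₂ Pᵈ.β)

    base₂ : Derivative 1
    base₂ = prove 6 (λ β γ c h β′ γ′ → con 2 :* γ :* :1 :^ 2 ∙ β′ ⊜ c ⇒ :- β ∙ γ′ ⊜ con 3 :* β :^ 3 ⇒
        con 2 :* (h :+ β :^ 2) ∙ h ⊜ β :^ 2 ⇒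
        β :* (β :* :1) :^ 3 :- (γ :* con 0 :+ γ′ :* :1) :* (β :* :1)
          :+ con 2 :* (γ :* :1) :* (β :* con 0 :+ β′ :* :1)
          ⊜ con 2 :* ((c :* γ :- h :^ 2) :* :1 :^ 2 :- con 0 :* γ :^ 2)) ≡.refl
        β γ c# h (proj₂ Pᵈ.β) (proj₂ Dᵈ.γ) β′≈c γ′≈ (Twisted.h≈β² R A B x y on-curve)

  ψ°≉0 : ∀ n → ¬ (ψ° (suc n) ≈ 0#)
  ψ°≉0 n z = ψ≉0 n (trans (sym (ψ°≈ψ (suc n))) z)

  derivative-next : ∀ j → Derivative j → Derivative (1 ℕ.+ j) → Derivative (2 ℕ.+ j)
  derivative-next j d₁ d₂ = *-cancelˡ (κ 2 * ψ° (1 ℕ.+ j) ^ 3)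
    (*-nonzero 2≉0 (*-nonzero (ψ°≉0 j) (*-nonzero (ψ°≉0 j) (ψ°≉0 j))))
    (derivative-step β c# x (κ j) (e° (3 ℕ.+ j)) (e° (2 ℕ.+ j)) (e° (1 ℕ.+ j))
      (ψ° (4 ℕ.+ j)) (ψ° (3 ℕ.+ j)) (ψ° (2 ℕ.+ j)) (ψ° (1 ℕ.+ j)) (ψ° j)
      (proj₂ Pᵈ.β) (proj₂ Dᵈ.c#) (ψ′ (4 ℕ.+ j)) (ψ′ (3 ℕ.+ j)) (ψ′ (2 ℕ.+ j)) (ψ′ (1 ℕ.+ j)) (ψ′ j)
      invariant (infinitesimal (Relᵈ.invariant j)) β′≈c c′≈ d₁ d₂
      (slope-sum β c# _ _ _ _ _ _ _ _ slope₂ slope₁ βe invariant)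
      (slope-difference β _ _ _ _ _ _ _ _ slope₂ slope₁ βe)
      (standard (Relᵈ.curve (1 ℕ.+ j))))
    where
    invariant = standard (Relᵈ.invariant j)
    slope₂    = standard (Relᵈ.slope (1 ℕ.+ j))
    slope₁    = standard (Relᵈ.slope j)
    βe        = standard (Relᵈ.βe j)

  derivatives : ∀ k → Derivative k × Derivative (suc k)
  derivatives zero    = base₁ , base₂
  derivatives (suc k) = proj₂ (derivatives k) , derivative-next k (proj₁ (derivatives k)) (proj₂ (derivatives k))

  derivative : ∀ k → Derivative k
  derivative k = proj₁ (derivatives k)

  derivative-e : ∀ k → DerivativeOfE k
  derivative-e k = *-cancelˡ (κ 2 * e° (1 ℕ.+ k)) (*-nonzero 2≉0 (λ z → e≉0 k (trans (sym (e°≈e (suc k))) z)))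
    (derivative-of-e β c# x (κ (1 ℕ.+ k)) (e° (1 ℕ.+ k)) (ψ° (2 ℕ.+ k)) (ψ° (1 ℕ.+ k)) (ψ° k)
      (e′ (1 ℕ.+ k)) (ψ′ (2 ℕ.+ k)) (ψ′ (1 ℕ.+ k)) (ψ′ k) (proj₂ Pᵈ.β) (proj₂ Dᵈ.c#) (κ 2 * y) _ _ _
      (infinitesimal (Relᵈ.curve k)) (standard (Relᵈ.curve k)) (derivative k) β′≈c c′≈ refl
      (infinitesimal (κ-dual 2)) (infinitesimal (κ-dual 12)) (infinitesimal (κ-dual 4)))

module UniversalDerivative where
  open Universal
  open CommutativeRing 𝕌 hiding (zero)
  open DivisionPolynomials 𝕌 Aᵤ Bᵤ xᵤ
  open AtPoint yᵤ

  open Power 𝕌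

  module _ {c ℓ} (R : CommutativeRing c ℓ) where
    private
      module R = CommutativeRing R
    open Numerals R
    open Solver R
    private
      at-unit-point : Hom 𝕌 R
      at-unit-point = substitute R (R.0# ∷ R.1# ∷ R.1# ∷ [])

    -- On the cuspidal cubic n(1,1) = (1/n², 1/n³), so ωₙ = 1 and 2y · 2ωₙ = 4 at this point; for n
    -- = 1 the value 2ωₙ = 2 is read off directly.
    e-unit-point : ∀ n → e (suc n) ≈ 0# → (κ 2 R.≈ R.0#) ⊎ (κ 4 R.≈ R.0#)
    e-unit-point zero z = inj₁ (R.trans (R.sym (ψ-unit-point R 2)) (R.trans (Hom.cong at-unit-point z) (Hom.0-homo at-unit-point)))
    e-unit-point (suc j) z = inj₂ (R.trans
      (prove 1 (λ t → con 4 ⊜ (:1 :+ (:1 :+ (:1 :+ (:1 :+ t)))) :* (:1 :+ t) :^ 2 :- t :* (:1 :+ (:1 :+ (:1 :+ t))) :^ 2) ≡.refl (κ j))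
      (R.trans (R.sym (homo at-unit-point 4 (λ a b c d → a :* b :^ 2 :- c :* d :^ 2)
          (ψ-unit-point R (4 ℕ.+ j) ∷ ψ-unit-point R (1 ℕ.+ j) ∷ ψ-unit-point R j ∷ ψ-unit-point R (3 ℕ.+ j) ∷ [])))
        (R.trans (Hom.cong at-unit-point (trans (sym (Twisted.βe 𝕌 Aᵤ Bᵤ xᵤ yᵤ on-curveᵤ j)) (trans (*-congˡ z) (zeroʳ β))))
          (Hom.0-homo at-unit-point))))

  e≉0 : ∀ n → ¬ (e (suc n) ≈ 0#)
  e≉0 n z with e-unit-point ℤₚ.+-*-commutativeRing n z
  ... | inj₁ ()
  ... | inj₂ ()

  2≉0 : ¬ (Numerals.κ 𝕌 2 ≈ 0#)
  2≉0 z with ≡.trans (≡.sym (κ-hom unit-point 2)) (≡.trans (Hom.cong unit-point z) (Hom.0-homo unit-point))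
  ... | ()

module PointDerivatives {c ℓ} (R : CommutativeRing c ℓ) (A B x y : CommutativeRing.Carrier R)
  (on-curve : IsPoint R A B x y) where
  open CommutativeRing R hiding (zero)
  open Numerals R
  open Power R
  open DualNumbers R
  open DivisionPolynomials R A B x
  open AtPoint y
  open Tangent R A B x y on-curve public
  private
    module U = Universal
    module Uᵗ = Tangent U.𝕌 U.Aᵤ U.Bᵤ U.xᵤ U.yᵤ U.on-curveᵤ
    module G = GenericDerivative U.𝕌 U.ℤ⟦ 3 ⟧-isDomain U.Aᵤ U.Bᵤ U.xᵤ U.yᵤ U.on-curveᵤ U.ψ≉0
                 UniversalDerivative.e≉0 UniversalDerivative.2≉0
    open Universal.Specialisation R A B x y on-curve

    specialiseᵈ : Hom (DualNumbers.dual U.𝕌) dual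
    specialiseᵈ = dualHom {R = U.𝕌} {S = R} specialise
    x′≈ = homo specialise 1 (λ y → con 2 :* y) (y≈ ∷ [])
    y′≈ = homo specialise 2 (λ A x → con 3 :* x :^ 2 :+ A) (A≈ ∷ x≈ ∷ [])
    0≈  = Hom.0-homo specialise

    ψᵈ≈ = ψ-homo specialiseᵈ {Uᵗ.Aᵈ} {Uᵗ.Bᵈ} {Uᵗ.xᵈ} {Aᵈ} {Bᵈ} {xᵈ} (A≈ & 0≈) (B≈ & 0≈) (x≈ & x′≈) {Uᵗ.yᵈ} {yᵈ} (y≈ & y′≈)
    eᵈ≈ = e-homo specialiseᵈ {Uᵗ.Aᵈ} {Uᵗ.Bᵈ} {Uᵗ.xᵈ} {Aᵈ} {Bᵈ} {xᵈ} (A≈ & 0≈) (B≈ & 0≈) (x≈ & x′≈) {Uᵗ.yᵈ} {yᵈ} (y≈ & y′≈)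
    ψ≈  = λ n → standard (ψᵈ≈ n)
    ψ′≈ = λ n → infinitesimal (ψᵈ≈ n)
    e≈  = λ n → standard (eᵈ≈ n)
    e′≈ = λ n → infinitesimal (eᵈ≈ n)
    β≈ = β-homo specialise A≈ B≈ x≈ y≈
    c≈ = c-homo specialise A≈ B≈ x≈

  derivative : ∀ k → Derivative k
  derivative k = transfer specialise 9
    (λ β ψ₂ ψ₁ ψ₀ ψ₂′ ψ₁′ ψ₀′ n e → β :* ψ₁ :^ 3 :- (ψ₂ :* ψ₀′ :+ ψ₂′ :* ψ₀) :* ψ₁ :+ con 2 :* (ψ₂ :* ψ₀) :* ψ₁′)
    (λ β ψ₂ ψ₁ ψ₀ ψ₂′ ψ₁′ ψ₀′ n e → n :* e)
    (β≈ ∷ ψ≈ (2 ℕ.+ k) ∷ ψ≈ (1 ℕ.+ k) ∷ ψ≈ k ∷ ψ′≈ (2 ℕ.+ k) ∷ ψ′≈ (1 ℕ.+ k) ∷ ψ′≈ k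
      ∷ κ-hom specialise (1 ℕ.+ k) ∷ e≈ (1 ℕ.+ k) ∷ [])
    (G.derivative k)

  derivative-e : ∀ k → DerivativeOfE k
  derivative-e k = transfer specialise 9
    (λ c x ψ₂ ψ₁ ψ₀ ψ₁′ n e e′ → ψ₁ :* e′ :- con 3 :* e :* ψ₁′)
    (λ c x ψ₂ ψ₁ ψ₀ ψ₁′ n e e′ → n :* (c :* ψ₁ :^ 4 :- con 12 :* x :* (ψ₂ :* ψ₀) :* ψ₁ :^ 2 :+ con 6 :* (ψ₂ :* ψ₀) :^ 2))
    (c≈ ∷ x≈ ∷ ψ≈ (2 ℕ.+ k) ∷ ψ≈ (1 ℕ.+ k) ∷ ψ≈ k ∷ ψ′≈ (1 ℕ.+ k)
      ∷ κ-hom specialise (1 ℕ.+ k) ∷ e≈ (1 ℕ.+ k) ∷ e′≈ (1 ℕ.+ k) ∷ [])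
    (G.derivative-e k)

-- Multiples of a point

module MultipleIdentities {c ℓ} (R : CommutativeRing c ℓ) where
  open CommutativeRing R hiding (zero)
  open Numerals R
  open Power R
  open Solver R

  unit-cancel : ∀ u v a b →
    u * v ≈ 1# →
    u * a ≈ u * b →
    b ≈ a
  unit-cancel = prove 4 (λ u v a b →
    a :- b ∙ u :* v ⊜ :1 ⇒
    con 0 :- v ∙ u :* a ⊜ u :* b ⇒
    b ⊜ a) ≡.refl

  -- With f = x³ + Ax + B, p = x³ + Ax - B and q = 9x⁴ + 15Ax² + 4A², the discriminant is Δ = q f′ -
  -- 27 p f. Squaring and substituting f′² = 12xf - ψ₃ leaves Δ² = (729 p² f - 54 p q f′ + 12x q²) f
  -- - q² ψ₃. Since 4f = (2y)², multiplication by 4 gives the cofactors.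
  singular-free-step : ∀ A B x y t →
    t * (κ 2 * y) ^ 2 ≈ 0# →
    t * (κ 3 * x ^ 4 + κ 6 * A * x ^ 2 + κ 12 * B * x - A ^ 2) ≈ 0# →
    y * y ≈ x * x * x + A * x + B →
    (κ 2 * (κ 4 * (A * (A * A)) + κ 27 * (B * B))) ^ 2 * t ≈ (κ 2 * (κ 4 * (A * (A * A)) + κ 27 * (B * B))) ^ 2 * 0#
  singular-free-step = prove 5 (λ A B x y t →
    con 729 :* (x :^ 3 :+ A :* x :- B) :^ 2 :* (x :^ 3 :+ A :* x :+ B) :- con 54 :* (x :^ 3 :+ A :* x :- B) :* (con 9 :* x :^ 4 :+ con 15 :* A :* x :^ 2 :+ con 4 :* A :^ 2) :* (con 3 :* x :^ 2 :+ A) :+ con 12 :* x :* (con 9 :* x :^ 4 :+ con 15 :* A :* x :^ 2 :+ con 4 :* A :^ 2) :^ 2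
      ∙ t :* (con 2 :* y) :^ 2 ⊜ con 0 ⇒
    con 0 :- con 4 :* (con 9 :* x :^ 4 :+ con 15 :* A :* x :^ 2 :+ con 4 :* A :^ 2) :^ 2
      ∙ t :* (con 3 :* x :^ 4 :+ con 6 :* A :* x :^ 2 :+ con 12 :* B :* x :- A :^ 2) ⊜ con 0 ⇒
    con 0 :- con 4 :* t :* (con 729 :* (x :^ 3 :+ A :* x :- B) :^ 2 :* (x :^ 3 :+ A :* x :+ B) :- con 54 :* (x :^ 3 :+ A :* x :- B) :* (con 9 :* x :^ 4 :+ con 15 :* A :* x :^ 2 :+ con 4 :* A :^ 2) :* (con 3 :* x :^ 2 :+ A) :+ con 12 :* x :* (con 9 :* x :^ 4 :+ con 15 :* A :* x :^ 2 :+ con 4 :* A :^ 2) :^ 2)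
      ∙ y :* y ⊜ x :* x :* x :+ A :* x :+ B ⇒
    (con 2 :* (con 4 :* (A :* (A :* A)) :+ con 27 :* (B :* B))) :^ 2 :* t
      ⊜ (con 2 :* (con 4 :* (A :* (A :* A)) :+ con 27 :* (B :* B))) :^ 2 :* con 0) ≡.refl

  at-infinity-square : ∀ β x e g d ψ b →
    (e - β * ψ ^ 3) ^ 2 - κ 4 * (κ 2 * x * ψ ^ 2 - d * b) * (d * b) ^ 2 ≈ κ 4 * (x * d ^ 2 - g * ψ) * (ψ ^ 2 * b ^ 2) →
    b ≈ 0# →
    (e - β * ψ ^ 3) ^ 2 ≈ 0#
  at-infinity-square = prove 7 (λ β x e g d ψ b →
    :1
      ∙ (e :- β :* ψ :^ 3) :^ 2 :- con 4 :* (con 2 :* x :* ψ :^ 2 :- d :* b) :* (d :* b) :^ 2 ⊜ con 4 :* (x :* d :^ 2 :- g :* ψ) :* (ψ :^ 2 :* b :^ 2) ⇒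
    con 4 :* (con 2 :* x :* ψ :^ 2 :- d :* b) :* d :^ 2 :* b :+ con 4 :* (x :* d :^ 2 :- g :* ψ) :* ψ :^ 2 :* b ∙ b ⊜ con 0 ⇒
    (e :- β :* ψ :^ 3) :^ 2 ⊜ con 0) ≡.refl

  at-infinity-β : ∀ β c x e d ψ b →
    e ^ 2 ≈ β ^ 2 * ψ ^ 6 - κ 2 * c * (d * b) * ψ ^ 4 + κ 12 * x * (d * b) ^ 2 * ψ ^ 2 - κ 4 * (d * b) ^ 3 →
    (e - β * ψ ^ 3) ^ 2 ≈ 0# →
    b ≈ 0# →
    κ 2 * ψ ^ 3 * ((e - β * ψ ^ 3) * β) ≈ κ 2 * ψ ^ 3 * 0#
  at-infinity-β = prove 7 (λ β c x e d ψ b →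
    :1
      ∙ e :^ 2 ⊜ β :^ 2 :* ψ :^ 6 :- con 2 :* c :* (d :* b) :* ψ :^ 4 :+ con 12 :* x :* (d :* b) :^ 2 :* ψ :^ 2 :- con 4 :* (d :* b) :^ 3 ⇒
    con 0 :- :1 ∙ (e :- β :* ψ :^ 3) :^ 2 ⊜ con 0 ⇒
    con 0 :- con 2 :* c :* d :* ψ :^ 4 :+ con 12 :* x :* d :^ 2 :* b :* ψ :^ 2 :- con 4 :* d :^ 3 :* b :^ 2 ∙ b ⊜ con 0 ⇒
    con 2 :* ψ :^ 3 :* ((e :- β :* ψ :^ 3) :* β) ⊜ con 2 :* ψ :^ 3 :* con 0) ≡.refl

  at-infinity-γ : ∀ β γ e₃ e g d ψ b a →
    g * a ≈ β ^ 2 * d * b - γ * ψ ^ 2 →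
    (e₃ + β * d ^ 3) * b ≈ (β * ψ ^ 3 - e) * g →
    b ≈ 0# →
    ψ ^ 2 * ((e - β * ψ ^ 3) * γ) ≈ ψ ^ 2 * 0#
  at-infinity-γ = prove 9 (λ β γ e₃ e g d ψ b a →
    e :- β :* ψ :^ 3 ∙ g :* a ⊜ β :^ 2 :* d :* b :- γ :* ψ :^ 2 ⇒
    con 0 :- a ∙ (e₃ :+ β :* d :^ 3) :* b ⊜ (β :* ψ :^ 3 :- e) :* g ⇒
    (e :- β :* ψ :^ 3) :* β :^ 2 :* d :+ a :* (e₃ :+ β :* d :^ 3) ∙ b ⊜ con 0 ⇒
    ψ :^ 2 :* ((e :- β :* ψ :^ 3) :* γ) ⊜ ψ :^ 2 :* con 0) ≡.refl

  β-square : ∀ t β →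
    t * β ≈ 0# →
    t * β ^ 2 ≈ 0#
  β-square = prove 2 (λ t β →
    β ∙ t :* β ⊜ con 0 ⇒
    t :* β :^ 2 ⊜ con 0) ≡.refl

  from-infinity-x : ∀ x xS ψ₂ ψ₁ ψ₀ →
    ψ₀ ≈ 0# →
    xS ≈ x →
    x * ψ₁ ^ 2 - ψ₂ * ψ₀ ≈ xS * ψ₁ ^ 2
  from-infinity-x = prove 5 (λ x xS ψ₂ ψ₁ ψ₀ →
    con 0 :- ψ₂ ∙ ψ₀ ⊜ con 0 ⇒
    con 0 :- ψ₁ :^ 2 ∙ xS ⊜ x ⇒
    x :* ψ₁ :^ 2 :- ψ₂ :* ψ₀ ⊜ xS :* ψ₁ :^ 2) ≡.refl

  from-infinity-e : ∀ y yS e ψ →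
    e - κ 2 * y * ψ ^ 3 ≈ 0# →
    yS ≈ y →
    e ≈ κ 2 * yS * ψ ^ 3
  from-infinity-e = prove 4 (λ y yS e ψ →
    :1 ∙ e :- con 2 :* y :* ψ :^ 3 ⊜ con 0 ⇒
    con 0 :- con 2 :* ψ :^ 3 ∙ yS ⊜ y ⇒
    e ⊜ con 2 :* yS :* ψ :^ 3) ≡.refl

  chord-unit : ∀ x xS ψ₂ ψ₁ ψ₀ v i →
    x * ψ₁ ^ 2 - ψ₂ * ψ₀ ≈ xS * ψ₁ ^ 2 →
    (x - xS) * v ≈ 1# →
    ψ₁ * i ≈ 1# →
    ψ₂ * (ψ₀ * (v * i ^ 2)) ≈ 1#
  chord-unit = prove 7 (λ x xS ψ₂ ψ₁ ψ₀ v i →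
    con 0 :- v :* i :^ 2 ∙ x :* ψ₁ :^ 2 :- ψ₂ :* ψ₀ ⊜ xS :* ψ₁ :^ 2 ⇒
    ψ₁ :^ 2 :* i :^ 2 ∙ (x :- xS) :* v ⊜ :1 ⇒
    ψ₁ :* i :+ :1 ∙ ψ₁ :* i ⊜ :1 ⇒
    ψ₂ :* (ψ₀ :* (v :* i :^ 2)) ⊜ :1) ≡.refl

  chord-x : ∀ x y xS yS x₃ λ′ e ψ₃ ψ₂ ψ₁ ψ₀ →
    (e - κ 2 * y * ψ₁ ^ 3) ^ 2 - κ 4 * (κ 2 * x * ψ₁ ^ 2 - ψ₂ * ψ₀) * (ψ₂ * ψ₀) ^ 2
      ≈ κ 4 * (x * ψ₂ ^ 2 - ψ₃ * ψ₁) * (ψ₁ ^ 2 * ψ₀ ^ 2) →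
    e ≈ κ 2 * yS * ψ₁ ^ 3 →
    λ′ * (x - xS) ≈ y - yS →
    x * ψ₁ ^ 2 - ψ₂ * ψ₀ ≈ xS * ψ₁ ^ 2 →
    x₃ ≈ λ′ * λ′ - xS - x →
    κ 4 * (ψ₁ ^ 2 * ψ₀ ^ 2) * (x * ψ₂ ^ 2 - ψ₃ * ψ₁) ≈ κ 4 * (ψ₁ ^ 2 * ψ₀ ^ 2) * (x₃ * ψ₂ ^ 2)
  chord-x = prove 11 (λ x y xS yS x₃ λ′ e ψ₃ ψ₂ ψ₁ ψ₀ →
    con 0 :- :1
      ∙ (e :- con 2 :* y :* ψ₁ :^ 3) :^ 2 :- con 4 :* (con 2 :* x :* ψ₁ :^ 2 :- ψ₂ :* ψ₀) :* (ψ₂ :* ψ₀) :^ 2 ⊜ con 4 :* (x :* ψ₂ :^ 2 :- ψ₃ :* ψ₁) :* (ψ₁ :^ 2 :* ψ₀ :^ 2) ⇒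
    e :- con 2 :* y :* ψ₁ :^ 3 :+ (con 2 :* yS :* ψ₁ :^ 3 :- con 2 :* y :* ψ₁ :^ 3) ∙ e ⊜ con 2 :* yS :* ψ₁ :^ 3 ⇒
    con 0 :- con 4 :* ψ₁ :^ 6 :* (λ′ :* (x :- xS) :+ (y :- yS)) ∙ λ′ :* (x :- xS) ⊜ y :- yS ⇒
    con 4 :* ψ₁ :^ 2 :* λ′ :^ 2 :* ((x :- xS) :* ψ₁ :^ 2 :+ ψ₂ :* ψ₀) :- con 4 :* (ψ₂ :* ψ₀) :^ 2
      ∙ x :* ψ₁ :^ 2 :- ψ₂ :* ψ₀ ⊜ xS :* ψ₁ :^ 2 ⇒
    con 0 :- con 4 :* ψ₁ :^ 2 :* ψ₀ :^ 2 :* ψ₂ :^ 2 ∙ x₃ ⊜ λ′ :* λ′ :- xS :- x ⇒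
    con 4 :* (ψ₁ :^ 2 :* ψ₀ :^ 2) :* (x :* ψ₂ :^ 2 :- ψ₃ :* ψ₁) ⊜ con 4 :* (ψ₁ :^ 2 :* ψ₀ :^ 2) :* (x₃ :* ψ₂ :^ 2)) ≡.refl

  chord-e : ∀ x y xS yS x₃ y₃ λ′ e₂ e ψ₃ ψ₂ ψ₁ ψ₀ →
    (e₂ + κ 2 * y * ψ₂ ^ 3) * ψ₀ ≈ (κ 2 * y * ψ₁ ^ 3 - e) * ψ₃ →
    e ≈ κ 2 * yS * ψ₁ ^ 3 →
    λ′ * (x - xS) ≈ y - yS →
    x * ψ₁ ^ 2 - ψ₂ * ψ₀ ≈ xS * ψ₁ ^ 2 →
    x * ψ₂ ^ 2 - ψ₃ * ψ₁ ≈ x₃ * ψ₂ ^ 2 →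
    y₃ ≈ λ′ * (xS - x₃) - yS →
    ψ₀ * e₂ ≈ ψ₀ * (κ 2 * y₃ * ψ₂ ^ 3)
  chord-e = prove 13 (λ x y xS yS x₃ y₃ λ′ e₂ e ψ₃ ψ₂ ψ₁ ψ₀ →
    :1 ∙ (e₂ :+ con 2 :* y :* ψ₂ :^ 3) :* ψ₀ ⊜ (con 2 :* y :* ψ₁ :^ 3 :- e) :* ψ₃ ⇒
    con 0 :- ψ₃ ∙ e ⊜ con 2 :* yS :* ψ₁ :^ 3 ⇒
    con 0 :- con 2 :* ψ₁ :^ 3 :* ψ₃ :+ con 2 :* ψ₀ :* ψ₂ :^ 3 ∙ λ′ :* (x :- xS) ⊜ y :- yS ⇒
    con 2 :* λ′ :* ψ₁ :* ψ₃ ∙ x :* ψ₁ :^ 2 :- ψ₂ :* ψ₀ ⊜ xS :* ψ₁ :^ 2 ⇒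
    con 0 :- con 2 :* λ′ :* ψ₂ :* ψ₀ ∙ x :* ψ₂ :^ 2 :- ψ₃ :* ψ₁ ⊜ x₃ :* ψ₂ :^ 2 ⇒
    con 0 :- con 2 :* ψ₀ :* ψ₂ :^ 3 ∙ y₃ ⊜ λ′ :* (xS :- x₃) :- yS ⇒
    ψ₀ :* e₂ ⊜ ψ₀ :* (con 2 :* y₃ :* ψ₂ :^ 3)) ≡.refl

  coincident-q : ∀ x xS ψ₂ ψ₁ ψ₀ →
    x * ψ₁ ^ 2 - ψ₂ * ψ₀ ≈ xS * ψ₁ ^ 2 →
    xS ≈ x →
    ψ₂ * ψ₀ ≈ 0#
  coincident-q = prove 5 (λ x xS ψ₂ ψ₁ ψ₀ →
    con 0 :- :1 ∙ x :* ψ₁ :^ 2 :- ψ₂ :* ψ₀ ⊜ xS :* ψ₁ :^ 2 ⇒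
    con 0 :- ψ₁ :^ 2 ∙ xS ⊜ x ⇒
    ψ₂ :* ψ₀ ⊜ con 0) ≡.refl

  coincident-e : ∀ y yS e ψ →
    e ≈ κ 2 * yS * ψ ^ 3 →
    yS ≈ y →
    e ≈ κ 2 * y * ψ ^ 3
  coincident-e = prove 4 (λ y yS e ψ →
    :1 ∙ e ⊜ con 2 :* yS :* ψ :^ 3 ⇒
    con 2 :* ψ :^ 3 ∙ yS ⊜ y ⇒
    e ⊜ con 2 :* y :* ψ :^ 3) ≡.refl

  tangent-unit : ∀ β c e g d ψ b a i s →
    g * b ^ 2 + a * d ^ 2 + β ^ 2 * ψ ^ 3 ≈ c * b * ψ * d →
    β * e ≈ g * b ^ 2 - a * d ^ 2 →
    e ≈ β * ψ ^ 3 →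
    d * b ≈ 0# →
    β * s ≈ 1# →
    ψ * i ≈ 1# →
    κ 2 * (d * (0# - a * d * (s ^ 2 * i ^ 3))) ≈ κ 2 * 1#
  tangent-unit = prove 10 (λ β c e g d ψ b a i s →
    con 0 :- s :^ 2 :* i :^ 3 ∙ g :* b :^ 2 :+ a :* d :^ 2 :+ β :^ 2 :* ψ :^ 3 ⊜ c :* b :* ψ :* d ⇒
    con 0 :- s :^ 2 :* i :^ 3 ∙ β :* e ⊜ g :* b :^ 2 :- a :* d :^ 2 ⇒
    s :^ 2 :* i :^ 3 :* β ∙ e ⊜ β :* ψ :^ 3 ⇒
    con 0 :- s :^ 2 :* i :^ 3 :* c :* ψ ∙ d :* b ⊜ con 0 ⇒
    con 2 :* ψ :^ 3 :* i :^ 3 :* (β :* s :+ :1) ∙ β :* s ⊜ :1 ⇒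
    con 2 :* ((ψ :* i) :^ 2 :+ ψ :* i :+ :1) ∙ ψ :* i ⊜ :1 ⇒
    con 2 :* (d :* (con 0 :- a :* d :* (s :^ 2 :* i :^ 3))) ⊜ con 2 :* :1) ≡.refl

  tangent-slope : ∀ A x y xS yS λ′ →
    λ′ * (κ 2 * yS) ≈ κ 3 * xS * xS + A →
    yS ≈ y →
    xS ≈ x →
    λ′ * (κ 2 * y) ≈ κ 3 * x ^ 2 + A
  tangent-slope = prove 6 (λ A x y xS yS λ′ →
    :1 ∙ λ′ :* (con 2 :* yS) ⊜ con 3 :* xS :* xS :+ A ⇒
    con 0 :- con 2 :* λ′ ∙ yS ⊜ y ⇒
    con 3 :* (xS :+ x) ∙ xS ⊜ x ⇒
    λ′ :* (con 2 :* y) ⊜ con 3 :* x :^ 2 :+ A) ≡.refl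

  tangent-x : ∀ A B x y xS x₃ λ′ ψ₄ ψ₃ ψ₂ ψ₁ ψ₀ →
    ψ₄ * ψ₀ ≈ (κ 2 * y) ^ 2 * ψ₃ * ψ₁ - (κ 3 * x ^ 4 + κ 6 * A * x ^ 2 + κ 12 * B * x - A ^ 2) * ψ₂ ^ 2 →
    ψ₀ ≈ 0# →
    x₃ ≈ λ′ * λ′ - xS - x →
    xS ≈ x →
    λ′ * (κ 2 * y) ≈ κ 3 * x ^ 2 + A →
    y * y ≈ x * x * x + A * x + B →
    (κ 2 * y) ^ 2 * (x * ψ₂ ^ 2 - ψ₃ * ψ₁) ≈ (κ 2 * y) ^ 2 * (x₃ * ψ₂ ^ 2)
  tangent-x = prove 12 (λ A B x y xS x₃ λ′ ψ₄ ψ₃ ψ₂ ψ₁ ψ₀ →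
    :1
      ∙ ψ₄ :* ψ₀ ⊜ (con 2 :* y) :^ 2 :* ψ₃ :* ψ₁ :- (con 3 :* x :^ 4 :+ con 6 :* A :* x :^ 2 :+ con 12 :* B :* x :- A :^ 2) :* ψ₂ :^ 2 ⇒
    con 0 :- ψ₄ ∙ ψ₀ ⊜ con 0 ⇒
    con 0 :- (con 2 :* y) :^ 2 :* ψ₂ :^ 2 ∙ x₃ ⊜ λ′ :* λ′ :- xS :- x ⇒
    (con 2 :* y) :^ 2 :* ψ₂ :^ 2 ∙ xS ⊜ x ⇒
    con 0 :- ψ₂ :^ 2 :* (λ′ :* (con 2 :* y) :+ (con 3 :* x :^ 2 :+ A)) ∙ λ′ :* (con 2 :* y) ⊜ con 3 :* x :^ 2 :+ A ⇒
    con 12 :* x :* ψ₂ :^ 2 ∙ y :* y ⊜ x :* x :* x :+ A :* x :+ B ⇒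
    (con 2 :* y) :^ 2 :* (x :* ψ₂ :^ 2 :- ψ₃ :* ψ₁) ⊜ (con 2 :* y) :^ 2 :* (x₃ :* ψ₂ :^ 2)) ≡.refl

  tangent-e : ∀ A x y xS yS x₃ y₃ λ′ e₂ ψ₄ ψ₃ ψ₂ ψ₁ ψ₀ →
    κ 2 * y * e₂ ≈ ψ₄ * ψ₁ ^ 2 - ψ₀ * ψ₃ ^ 2 →
    ψ₄ * ψ₁ ^ 2 + ψ₀ * ψ₃ ^ 2 + (κ 2 * y) ^ 2 * ψ₂ ^ 3 ≈ κ 2 * (κ 3 * x ^ 2 + A) * ψ₁ * ψ₂ * ψ₃ →
    ψ₀ ≈ 0# →
    x * ψ₂ ^ 2 - ψ₃ * ψ₁ ≈ x₃ * ψ₂ ^ 2 →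
    y₃ ≈ λ′ * (xS - x₃) - yS →
    xS ≈ x →
    yS ≈ y →
    λ′ * (κ 2 * y) ≈ κ 3 * x ^ 2 + A →
    κ 2 * y * e₂ ≈ κ 2 * y * (κ 2 * y₃ * ψ₂ ^ 3)
  tangent-e = prove 14 (λ A x y xS yS x₃ y₃ λ′ e₂ ψ₄ ψ₃ ψ₂ ψ₁ ψ₀ →
    :1 ∙ con 2 :* y :* e₂ ⊜ ψ₄ :* ψ₁ :^ 2 :- ψ₀ :* ψ₃ :^ 2 ⇒
    :1 ∙ ψ₄ :* ψ₁ :^ 2 :+ ψ₀ :* ψ₃ :^ 2 :+ (con 2 :* y) :^ 2 :* ψ₂ :^ 3 ⊜ con 2 :* (con 3 :* x :^ 2 :+ A) :* ψ₁ :* ψ₂ :* ψ₃ ⇒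
    con 0 :- con 2 :* ψ₃ :^ 2 ∙ ψ₀ ⊜ con 0 ⇒
    con 0 :- con 2 :* (con 3 :* x :^ 2 :+ A) :* ψ₂ ∙ x :* ψ₂ :^ 2 :- ψ₃ :* ψ₁ ⊜ x₃ :* ψ₂ :^ 2 ⇒
    con 0 :- con 2 :* (con 2 :* y) :* ψ₂ :^ 3 ∙ y₃ ⊜ λ′ :* (xS :- x₃) :- yS ⇒
    con 0 :- con 2 :* (con 2 :* y) :* ψ₂ :^ 3 :* λ′ ∙ xS ⊜ x ⇒
    con 2 :* (con 2 :* y) :* ψ₂ :^ 3 ∙ yS ⊜ y ⇒
    con 0 :- con 2 :* (x :- x₃) :* ψ₂ :^ 3 ∙ λ′ :* (con 2 :* y) ⊜ con 3 :* x :^ 2 :+ A ⇒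
    con 2 :* y :* e₂ ⊜ con 2 :* y :* (con 2 :* y₃ :* ψ₂ :^ 3)) ≡.refl

  opposite-1 : ∀ y yS →
    κ 2 * y * 1# ≈ κ 2 * yS * 1# ^ 3 →
    yS ≈ - y →
    κ 2 * (κ 2 * y * 1#) ≈ κ 2 * 0#
  opposite-1 = prove 2 (λ y yS →
    :1 ∙ con 2 :* y :* :1 ⊜ con 2 :* yS :* :1 :^ 3 ⇒
    con 2 ∙ yS ⊜ :- y ⇒
    con 2 :* (con 2 :* y :* :1) ⊜ con 2 :* con 0) ≡.refl

  opposite-e : ∀ y yS e₂ e₁ d ψ b a →
    (e₂ + κ 2 * y * ψ ^ 3) * a ≈ (κ 2 * y * b ^ 3 - e₁) * d →
    e₂ ≈ κ 2 * yS * ψ ^ 3 →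
    yS ≈ - y →
    d * b ≈ 0# →
    d * e₁ ≈ 0#
  opposite-e = prove 8 (λ y yS e₂ e₁ d ψ b a →
    :1 ∙ (e₂ :+ con 2 :* y :* ψ :^ 3) :* a ⊜ (con 2 :* y :* b :^ 3 :- e₁) :* d ⇒
    con 0 :- a ∙ e₂ ⊜ con 2 :* yS :* ψ :^ 3 ⇒
    con 0 :- con 2 :* ψ :^ 3 :* a ∙ yS ⊜ :- y ⇒
    con 2 :* y :* b :^ 2 ∙ d :* b ⊜ con 0 ⇒
    d :* e₁ ⊜ con 0) ≡.refl

  opposite-cube : ∀ β c x e d ψ b a →
    e ^ 2 ≈ β ^ 2 * b ^ 6 - κ 2 * c * (ψ * a) * b ^ 4 + κ 12 * x * (ψ * a) ^ 2 * b ^ 2 - κ 4 * (ψ * a) ^ 3 →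
    d * e ≈ 0# →
    d * b ≈ 0# →
    κ 4 * ψ ^ 3 * (d * a ^ 3) ≈ κ 4 * ψ ^ 3 * 0#
  opposite-cube = prove 8 (λ β c x e d ψ b a →
    d
      ∙ e :^ 2 ⊜ β :^ 2 :* b :^ 6 :- con 2 :* c :* (ψ :* a) :* b :^ 4 :+ con 12 :* x :* (ψ :* a) :^ 2 :* b :^ 2 :- con 4 :* (ψ :* a) :^ 3 ⇒
    con 0 :- e ∙ d :* e ⊜ con 0 ⇒
    β :^ 2 :* b :^ 5 :- con 2 :* c :* (ψ :* a) :* b :^ 3 :+ con 12 :* x :* (ψ :* a) :^ 2 :* b ∙ d :* b ⊜ con 0 ⇒
    con 4 :* ψ :^ 3 :* (d :* a :^ 3) ⊜ con 4 :* ψ :^ 3 :* con 0) ≡.refl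

  coprime-β³ : ∀ β c t g d ψ b a →
    d * b ^ 2 + a * ψ ^ 2 + β ^ 2 * g ^ 3 ≈ c * b * g * ψ →
    t * d ≈ 0# →
    t * ψ ≈ 0# →
    t * g ^ 3 * β ^ 2 ≈ 0#
  coprime-β³ = prove 8 (λ β c t g d ψ b a →
    t ∙ d :* b :^ 2 :+ a :* ψ :^ 2 :+ β :^ 2 :* g :^ 3 ⊜ c :* b :* g :* ψ ⇒
    con 0 :- b :^ 2 ∙ t :* d ⊜ con 0 ⇒
    c :* b :* g :- a :* ψ ∙ t :* ψ ⊜ con 0 ⇒
    t :* g :^ 3 :* β :^ 2 ⊜ con 0) ≡.refl

  coprime-γ³ : ∀ β γ t g d ψ b a →
    d * a ≈ β ^ 2 * ψ * b - γ * g ^ 2 →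
    t * d ≈ 0# →
    t * ψ ≈ 0# →
    t * g ^ 3 * γ ≈ 0#
  coprime-γ³ = prove 8 (λ β γ t g d ψ b a →
    t :* g ∙ d :* a ⊜ β :^ 2 :* ψ :* b :- γ :* g :^ 2 ⇒
    con 0 :- g :* a ∙ t :* d ⊜ con 0 ⇒
    g :* β :^ 2 :* b ∙ t :* ψ ⊜ con 0 ⇒
    t :* g :^ 3 :* γ ⊜ con 0) ≡.refl

  coprime-cube : ∀ t g →
    t * g ^ 3 ≈ 0# →
    t * g ^ 2 * g ≈ 0#
  coprime-cube = prove 2 (λ t g →
    :1 ∙ t :* g :^ 3 ⊜ con 0 ⇒
    t :* g :^ 2 :* g ⊜ con 0) ≡.refl

  times-zero : ∀ s t u →
    t * u ≈ 0# →
    t * s * u ≈ 0#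
  times-zero = prove 3 (λ s t u →
    s ∙ t :* u ⊜ con 0 ⇒
    t :* s :* u ⊜ con 0) ≡.refl

module Units {c ℓ} (R : CommutativeRing c ℓ) where
  open CommutativeRing R hiding (zero)
  open Power R
  open Solver R
  open MultipleIdentities R using (unit-cancel)

  IsUnit : Carrier → Set (c ⊔ ℓ)
  IsUnit u = ∃ λ v → u * v ≈ 1#

  unit-product : ∀ u u′ v v′ →
    u * u′ ≈ 1# →
    v * v′ ≈ 1# →
    u * v * (u′ * v′) ≈ 1#
  unit-product = prove 4 (λ u u′ v v′ →
    v :* v′ ∙ u :* u′ ⊜ :1 ⇒
    :1 ∙ v :* v′ ⊜ :1 ⇒
    u :* v :* (u′ :* v′) ⊜ :1) ≡.refl

  unit-* : ∀ {u v} → IsUnit u → IsUnit v → IsUnit (u * v)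
  unit-* {u} {v} (u′ , p) (v′ , q) = u′ * v′ , unit-product u u′ v v′ p q

  unit-^ : ∀ {u} n → IsUnit u → IsUnit (u ^ n)
  unit-^ zero          p = 1# , *-identityˡ 1#
  unit-^ (suc zero)    p = p
  unit-^ (suc (suc n)) p = unit-* p (unit-^ (suc n) p)

  unit-cancelˡ : ∀ {u a b} → IsUnit u → u * a ≈ u * b → a ≈ b
  unit-cancelˡ {u} {a} {b} (v , p) e = sym (unit-cancel u v a b p e)

  unit-≈ : ∀ {u v} → u ≈ v → IsUnit u → IsUnit v
  unit-≈ e (w , p) = w , trans (*-congʳ (sym e)) p

-- Invertibility instead of nonvanishing, so that the notion passes to dual numbers and to other
-- rings.
record Nonsingular {c ℓ} (R : CommutativeRing c ℓ) (A B : CommutativeRing.Carrier R) : Set (c ⊔ ℓ) where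
  open CommutativeRing R hiding (zero)
  open Numerals R
  open Units R
  field
    2-unit : IsUnit (κ 2)
    Δ-unit : IsUnit (κ 4 * (A * (A * A)) + κ 27 * (B * B))

module Smooth {c ℓ} (R : CommutativeRing c ℓ) {A B : CommutativeRing.Carrier R} (nonsingular : Nonsingular R A B)
  {x y : CommutativeRing.Carrier R} (on-curve : IsPoint R A B x y) where
  open CommutativeRing R hiding (zero)
  open Numerals R
  open Power R
  open Units R
  open Nonsingular nonsingular
  open MultipleIdentities R
  open DivisionPolynomials R A B x
  open AtPoint y
  open PointRelations R A B x y on-curve

  4-unit : IsUnit (κ 4)
  4-unit = unit-≈ (prove 0 (con 2 :* con 2 ⊜ con 4) ≡.refl) (unit-* 2-unit 2-unit)
    where open Solver R

  -- The elements (2y)² and ψ₃ generate the unit ideal: a point killed by both 2 and 3 is O, and the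
  -- discriminant witnesses this. It is phrased with annihilators so that no case distinction is
  -- involved.
  singular-free : ∀ t → t * β ^ 2 ≈ 0# → t * γ ≈ 0# → t ≈ 0#
  singular-free t tβ²≈0 tγ≈0 = unit-cancelˡ (unit-^ 2 (unit-* 2-unit Δ-unit))
    (singular-free-step A B x y t tβ²≈0 tγ≈0 on-curve)

  mutual
    -- If t annihilates ψₖ and ψₖ₊₁ then it annihilates ψₖ₋₁³, and the induction hypothesis applies in
    -- turn to t ψₖ₋₁², t ψₖ₋₁ and t.
    consecutive-coprime : ∀ k t → t * ψ k ≈ 0# → t * ψ (suc k) ≈ 0# → t ≈ 0#
    consecutive-coprime 0 t _ tψ₁≈0 = trans (sym (*-identityʳ t)) tψ₁≈0
    consecutive-coprime 1 t tψ₁≈0 _ = trans (sym (*-identityʳ t)) tψ₁≈0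
    consecutive-coprime 2 t tψ₂≈0 tψ₃≈0 =
      singular-free t (β-square t β (trans (*-congˡ (sym (*-identityʳ β))) tψ₂≈0)) tψ₃≈0
    consecutive-coprime (suc k@(suc (suc j))) t tψ≈0 tψ₊≈0 = consecutive-coprime³ k t tψ≈0
      (singular-free (t * ψ (2 ℕ.+ j) ^ 3)
        (coprime-β³ β c# t (ψ (2 ℕ.+ j)) (ψ (4 ℕ.+ j)) (ψ (3 ℕ.+ j)) (ψ (1 ℕ.+ j)) (ψ j) (invariant j) tψ₊≈0 tψ≈0)
        (coprime-γ³ β γ t (ψ (2 ℕ.+ j)) (ψ (4 ℕ.+ j)) (ψ (3 ℕ.+ j)) (ψ (1 ℕ.+ j)) (ψ j) (somos j) tψ₊≈0 tψ≈0))

    consecutive-coprime³ : ∀ k t → t * ψ (suc k) ≈ 0# → t * ψ k ^ 3 ≈ 0# → t ≈ 0#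
    consecutive-coprime³ k t tψ₊≈0 tψ³≈0 = consecutive-coprime k t tψ≈0 tψ₊≈0
      where
      tψ²≈0 : t * ψ k ^ 2 ≈ 0#
      tψ²≈0 = consecutive-coprime k (t * ψ k ^ 2) (coprime-cube t (ψ k) tψ³≈0) (times-zero (ψ k ^ 2) t _ tψ₊≈0)
      tψ≈0 : t * ψ k ≈ 0#
      tψ≈0 = consecutive-coprime k (t * ψ k) (trans (*-assoc _ _ _) tψ²≈0) (times-zero (ψ k) t _ tψ₊≈0)

-- The affine point (xₛ , yₛ) is (1 + k) (x , y), in terms of division polynomials.
record IsMultiple {c ℓ} (R : CommutativeRing c ℓ) (A B x y : CommutativeRing.Carrier R)
  (k : ℕ) (xₛ yₛ : CommutativeRing.Carrier R) : Set (c ⊔ ℓ) where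
  open CommutativeRing R hiding (zero)
  open Numerals R
  open Power R
  open Units R
  open DivisionPolynomials R A B x
  open AtPoint y
  field
    ψ-unit : IsUnit (ψ (1 ℕ.+ k))
    x-eq   : x * ψ (1 ℕ.+ k) ^ 2 - ψ (2 ℕ.+ k) * ψ k ≈ xₛ * ψ (1 ℕ.+ k) ^ 2
    e-eq   : e (1 ℕ.+ k) ≈ κ 2 * yₛ * ψ (1 ℕ.+ k) ^ 3

module FieldMultiples {c ℓ} (F : Field c ℓ) (A B : Field.Carrier F)
  (nonsingular : Nonsingular (Field.commutativeRing F) A B) where
  open Field F hiding (zero)
  private
    R = commutativeRing
  open Numerals R
  open Power R
  open Units R
  open Nonsingular nonsingular
  open MultipleIdentities R
  open Weierstrass F A B

  module _ {x y : Carrier} (h : OnCurve x y) where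
    open Smooth R nonsingular {x} {y} h
    open DivisionPolynomials R A B x hiding (h)
    open AtPoint y
    open PointRelations R A B x y h renaming (chord to chord-relation)

    Claim : ℕ → Point → Set (c ⊔ ℓ)
    Claim n       O             = Lift c (ψ n ≈ 0#)
    Claim zero    (aff _ _ _)   = Lift (c ⊔ ℓ) ⊥
    Claim (suc k) (aff xₛ yₛ _) = IsMultiple R A B x y k xₛ yₛ

    -- If mP = O then (m+1)P = P, so the ordinate should be y. The defect is annihilated by 2y,
    -- through the equation of the curve, and by ψ₃, through the Somos and slope relations; at a
    -- smooth point it is therefore zero.
    e-after-infinity : ∀ m → ψ m ≈ 0# → IsUnit (ψ (1 ℕ.+ m)) → e (1 ℕ.+ m) - κ 2 * y * ψ (1 ℕ.+ m) ^ 3 ≈ 0#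
    e-after-infinity zero    _   _ = prove 1 (λ y → (con 2 :* y) :* :1 :- con 2 :* y :* :1 :^ 3 ⊜ con 0) ≡.refl y
      where open Solver R
    e-after-infinity (suc j) ψ≈0 u = singular-free t (β-square t β tβ≈0) tγ≈0
      where
      t = e (2 ℕ.+ j) - κ 2 * y * ψ (2 ℕ.+ j) ^ 3
      tβ≈0 : t * β ≈ 0#
      tβ≈0 = unit-cancelˡ (unit-* 2-unit (unit-^ 3 u))
        (at-infinity-β β c# x (e (2 ℕ.+ j)) (ψ (3 ℕ.+ j)) (ψ (2 ℕ.+ j)) (ψ (1 ℕ.+ j)) (curve (1 ℕ.+ j))
          (at-infinity-square β x (e (2 ℕ.+ j)) (ψ (4 ℕ.+ j)) (ψ (3 ℕ.+ j)) (ψ (2 ℕ.+ j)) (ψ (1 ℕ.+ j)) (chord-relation (1 ℕ.+ j)) ψ≈0)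
          ψ≈0)
      tγ≈0 : t * γ ≈ 0#
      tγ≈0 = unit-cancelˡ (unit-^ 2 u)
        (at-infinity-γ β γ (e (3 ℕ.+ j)) (e (2 ℕ.+ j)) (ψ (4 ℕ.+ j)) (ψ (3 ℕ.+ j)) (ψ (2 ℕ.+ j)) (ψ (1 ℕ.+ j)) (ψ j)
          (somos j) (slope (1 ℕ.+ j)) ψ≈0)

    claim-step : ∀ m {S R} → Claim m S → Add S (aff x y h) R → Claim (suc m) R
    claim-step m {O} {O} _ (O-left (lift ()))
    claim-step m {O} {aff x₃ y₃ _} (lift ψ≈0) (O-left (x≈ , y≈)) = record
      { ψ-unit = ψ-unit
      ; x-eq   = from-infinity-x x x₃ _ _ _ ψ≈0 x≈
      ; e-eq   = from-infinity-e y y₃ _ _ (e-after-infinity m ψ≈0 ψ-unit) y≈ }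
      where
      ψ-unit : IsUnit (ψ (1 ℕ.+ m))
      ψ-unit = inverse _ λ ψ₊≈0 → 1≉0
        (consecutive-coprime m 1# (trans (*-identityˡ _) ψ≈0) (trans (*-identityˡ _) ψ₊≈0))
    claim-step zero {aff _ _ _} (lift ()) _
    claim-step (suc zero) {aff xₛ yₛ _} M (opposite x≈ y≈) = lift
      (unit-cancelˡ 2-unit (opposite-1 y yₛ (IsMultiple.e-eq M) y≈))
    -- Equal abscissas give only a vanishing product ψ₃₊ⱼ ψ₁₊ⱼ, which does not tell which factor
    -- vanishes. The opposite ordinates add that ψ₃₊ⱼ annihilates ψⱼ³, and coprimality of ψⱼ and
    -- ψ₁₊ⱼ then leaves ψ₃₊ⱼ = 0.
    claim-step (suc (suc j)) {aff xₛ yₛ _} M (opposite x≈ y≈) = lift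
      (consecutive-coprime³ j (ψ (3 ℕ.+ j)) q≈0
        (unit-cancelˡ (unit-* 4-unit (unit-^ 3 ψ-unit))
          (opposite-cube β c# x (e (1 ℕ.+ j)) (ψ (3 ℕ.+ j)) (ψ (2 ℕ.+ j)) (ψ (1 ℕ.+ j)) (ψ j) (curve j)
            (opposite-e y yₛ (e (2 ℕ.+ j)) (e (1 ℕ.+ j)) _ _ _ _ (slope j) e-eq y≈ q≈0) q≈0)))
      where
      open IsMultiple M
      q≈0 : ψ (3 ℕ.+ j) * ψ (1 ℕ.+ j) ≈ 0#
      q≈0 = coincident-q x xₛ _ _ _ x-eq x≈
    claim-step (suc k) {aff xₛ yₛ _} {aff x₃ y₃ _} M (chord λ′ x≉ slope-eq x₃-eq y₃-eq) = record
      { ψ-unit = ψ k * (v * i ^ 2) , ψ₊-unit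
      ; x-eq   = x₃-mult
      ; e-eq   = unit-cancelˡ ψ₋-unit
          (chord-e x y xₛ yₛ x₃ y₃ λ′ (e (2 ℕ.+ k)) (e (1 ℕ.+ k)) (ψ (3 ℕ.+ k)) (ψ (2 ℕ.+ k)) (ψ (1 ℕ.+ k)) (ψ k)
            (slope k) e-eq slope-eq x-eq x₃-mult y₃-eq) }
      where
      open IsMultiple M
      i = proj₁ ψ-unit
      difference-unit : IsUnit (x - xₛ)
      difference-unit = inverse _ λ z → x≉ (sym (x∙y⁻¹≈ε⇒x≈y x xₛ z))
        where open import Algebra.Properties.Ring ring
      v = proj₁ difference-unit
      ψ₊-unit = chord-unit x xₛ (ψ (2 ℕ.+ k)) (ψ (1 ℕ.+ k)) (ψ k) v i x-eq (proj₂ difference-unit) (proj₂ ψ-unit)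
      ψ₋-unit : IsUnit (ψ k)
      ψ₋-unit = ψ (2 ℕ.+ k) * (v * i ^ 2) , prove 3 (λ a b c → :1 ∙ a :* (b :* c) ⊜ :1 ⇒ b :* (a :* c) ⊜ :1)
                                              ≡.refl _ _ _ ψ₊-unit
        where open Solver R
      x₃-mult : x * ψ (2 ℕ.+ k) ^ 2 - ψ (3 ℕ.+ k) * ψ (1 ℕ.+ k) ≈ x₃ * ψ (2 ℕ.+ k) ^ 2
      x₃-mult = unit-cancelˡ (unit-* 4-unit (unit-* (unit-^ 2 ψ-unit) (unit-^ 2 ψ₋-unit)))
        (chord-x x y xₛ yₛ x₃ λ′ (e (1 ℕ.+ k)) (ψ (3 ℕ.+ k)) (ψ (2 ℕ.+ k)) (ψ (1 ℕ.+ k)) (ψ k)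
          (chord-relation k) e-eq slope-eq x-eq x₃-eq)
    claim-step (suc k) {aff xₛ yₛ _} {aff x₃ y₃ _} M (tangent λ′ x≈ y≈ y≉0 slope-eq x₃-eq y₃-eq) = record
      { ψ-unit = ψ₊-unit k M q≈0
      ; x-eq   = x₃-mult
      ; e-eq   = unit-cancelˡ β-unit
          (tangent-e A x y xₛ yₛ x₃ y₃ λ′ (e (2 ℕ.+ k)) (ψ (4 ℕ.+ k)) (ψ (3 ℕ.+ k)) (ψ (2 ℕ.+ k)) (ψ (1 ℕ.+ k)) (ψ k)
            (βe k) (invariant k) ψ₋≈0 x₃-mult y₃-eq x≈ y≈ slope′) }
      where
      open IsMultiple M
      β-unit : IsUnit β
      β-unit = unit-* 2-unit (inverse y λ z → y≉0 (trans y≈ z))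
      slope′ = tangent-slope A x y xₛ yₛ λ′ slope-eq y≈ x≈
      q≈0 : ψ (2 ℕ.+ k) * ψ k ≈ 0#
      q≈0 = coincident-q x xₛ _ _ _ x-eq x≈
      -- For k = 1 + j, equal abscissas and ordinates reduce `invariant` and `βe` to ψⱼ ψ₃₊ⱼ² =
      -- -(2y)² ψ₂₊ⱼ³, up to a factor 2. The right side is a unit, hence so is ψ₃₊ⱼ.
      ψ₊-unit : ∀ k → IsMultiple R A B x y k xₛ yₛ → ψ (2 ℕ.+ k) * ψ k ≈ 0# → IsUnit (ψ (2 ℕ.+ k))
      ψ₊-unit zero    M _   = unit-≈ (sym (*-identityʳ β)) β-unit
      ψ₊-unit (suc j) M q≈0 = _ , unit-cancelˡ 2-unit
        (tangent-unit β c# (e (2 ℕ.+ j)) (ψ (4 ℕ.+ j)) (ψ (3 ℕ.+ j)) (ψ (2 ℕ.+ j)) (ψ (1 ℕ.+ j)) (ψ j)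
          (proj₁ (IsMultiple.ψ-unit M)) (proj₁ β-unit) (invariant j) (βe j)
          (coincident-e y yₛ _ _ (IsMultiple.e-eq M) y≈) q≈0 (proj₂ β-unit) (proj₂ (IsMultiple.ψ-unit M)))
      ψ₋≈0 : ψ k ≈ 0#
      ψ₋≈0 = unit-cancelˡ (ψ₊-unit k M q≈0) (trans q≈0 (sym (zeroʳ _)))
      x₃-mult : x * ψ (2 ℕ.+ k) ^ 2 - ψ (3 ℕ.+ k) * ψ (1 ℕ.+ k) ≈ x₃ * ψ (2 ℕ.+ k) ^ 2
      x₃-mult = unit-cancelˡ (unit-^ 2 β-unit)
        (tangent-x A B x y xₛ x₃ λ′ (ψ (4 ℕ.+ k)) (ψ (3 ℕ.+ k)) (ψ (2 ℕ.+ k)) (ψ (1 ℕ.+ k)) (ψ k)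
          (somos k) ψ₋≈0 x₃-eq x≈ slope′ h)

    claim : ∀ n {S} → Mul n (aff x y h) S → Claim n S
    claim zero    {O}         _             = lift (zeroʳ β)
    claim zero    {aff _ _ _} (lift (lift ()))
    claim (suc n) (S , M , a) = claim-step n {S} (claim n M) a

-- The coordinate ring and the fibre of multiplication by n

module XOnly {c ℓ} (R : CommutativeRing c ℓ) (A B x : CommutativeRing.Carrier R) where
  open CommutativeRing R hiding (zero)
  open Power R
  open DivisionPolynomials R A B x

  -- A product of two ψ whose indices have the same parity, or of two ω, contains 2y to an even
  -- power. Replacing (2y)² by `h` turns it into an expression in x alone.
  untwist : Bool → Carrier → Carrier
  untwist true  a = h * a
  untwist false a = a

  ψ² : ℕ → Carrier
  ψ² n = untwist (even? n) (p n * p n)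

  ψψ : ℕ → Carrier
  ψψ k = untwist (even? k) (p (2 ℕ.+ k) * p k)

  φ : ℕ → Carrier
  φ k = x * ψ² (1 ℕ.+ k) - ψψ k

  e² : ℕ → Carrier
  e² n = untwist (not (even? n)) (d n * d n)

  module _ {y : Carrier} (on-curve : IsPoint R A B x y) where
    open AtPoint y
    open Twisted R A B x y on-curve using (h≈β²)
    open Solver R

    private
      product-twist : ∀ β h a b →
        h ≈ β ^ 2 →
        β * a * (β * b) ≈ h * (a * b)
      product-twist = prove 4 (λ β h a b →
        con 0 :- a :* b ∙ h ⊜ β :^ 2 ⇒
        β :* a :* (β :* b) ⊜ h :* (a :* b)) ≡.refl

      twisted : ∀ b u v → twist b u * twist b v ≈ untwist b (u * v)
      twisted true  u v = product-twist β h u v h≈β²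
      twisted false u v = refl

      twisted₂ : ∀ b u v → twist (not (not b)) u * twist b v ≈ untwist b (u * v)
      twisted₂ true  = twisted true
      twisted₂ false = twisted false

    ψ²≈ : ∀ n → ψ n ^ 2 ≈ ψ² n
    ψ²≈ n = twisted (even? n) (p n) (p n)

    e²≈ : ∀ n → e n ^ 2 ≈ e² n
    e²≈ n = twisted (not (even? n)) (d n) (d n)

    ψψ≈ : ∀ k → ψ (2 ℕ.+ k) * ψ k ≈ ψψ k
    ψψ≈ k = twisted₂ (even? k) (p (2 ℕ.+ k)) (p k)

module _ {a ℓ₁ b ℓ₂} {R : CommutativeRing a ℓ₁} {S : CommutativeRing b ℓ₂} (hom : Hom R S)
  {A B x : CommutativeRing.Carrier R} {A′ B′ x′ : CommutativeRing.Carrier S} where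
  open CommutativeRing S hiding (zero)
  open Hom hom renaming (cong to ⟨⟩-cong)
  private
    module P = XOnly R A B x
    module Q = XOnly S A′ B′ x′

  module _ (A≈ : ⟨ A ⟩ ≈ A′) (B≈ : ⟨ B ⟩ ≈ B′) (x≈ : ⟨ x ⟩ ≈ x′) where
    untwist-homo : ∀ b {u v} → ⟨ u ⟩ ≈ v → ⟨ P.untwist b u ⟩ ≈ Q.untwist b v
    untwist-homo true  e = trans (*-homo _ _) (*-cong (h-homo hom A≈ B≈ x≈) e)
    untwist-homo false e = e

    private
      p≈ = p-homo hom A≈ B≈ x≈

    ψ²-homo : ∀ n → ⟨ P.ψ² n ⟩ ≈ Q.ψ² n
    ψ²-homo n = untwist-homo (even? n) (trans (*-homo _ _) (*-cong (p≈ n) (p≈ n)))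

    e²-homo : ∀ n → ⟨ P.e² n ⟩ ≈ Q.e² n
    e²-homo n = untwist-homo (not (even? n)) (trans (*-homo _ _) (*-cong (d-homo hom A≈ B≈ x≈ n) (d-homo hom A≈ B≈ x≈ n)))

    φ-homo : ∀ k → ⟨ P.φ k ⟩ ≈ Q.φ k
    φ-homo k = homo hom 3 (λ x a b → x :* a :- b) (x≈ ∷ ψ²-homo (1 ℕ.+ k)
      ∷ untwist-homo (even? k) (trans (*-homo _ _) (*-cong (p≈ (2 ℕ.+ k)) (p≈ k))) ∷ [])

-- What the divisibility argument uses of R[X,Y]/(Y² - X³ - AX - B). The last field is descent of
-- divisibility to R[X]; it holds because the ring is free over R[X] with 1 in a basis.
record CoordinateRing {c ℓ} (R : CommutativeRing c ℓ) (A B : CommutativeRing.Carrier R) : Set (Level.suc (c ⊔ ℓ)) where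
  field
    E : CommutativeRing c ℓ
    ι : Hom R E
    X Y : CommutativeRing.Carrier E
  private
    module R = CommutativeRing R
    module E = CommutativeRing E
    module ι = Hom ι
  field
    on-curve : IsPoint E ι.⟨ A ⟩ ι.⟨ B ⟩ X Y
    at       : ∀ {x y} → IsPoint R A B x y → Hom E R
    at-ι     : ∀ {x y} (P : IsPoint R A B x y) a → Hom.⟨_⟩ (at P) ι.⟨ a ⟩ R.≈ a
    at-X     : ∀ {x y} (P : IsPoint R A B x y) → Hom.⟨_⟩ (at P) X R.≈ x
    at-Y     : ∀ {x y} (P : IsPoint R A B x y) → Hom.⟨_⟩ (at P) Y R.≈ y
    kernel   : ∀ {x y} (P : IsPoint R A B x y) g → Hom.⟨_⟩ (at P) g R.≈ R.0# →
               ∃ λ u → ∃ λ v → g E.≈ (X E.- ι.⟨ x ⟩) E.* u E.+ (Y E.- ι.⟨ y ⟩) E.* v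
  private
    module RX = CommutativeRing (Polynomials.polyRing R)
  field
    inX     : Hom (Polynomials.polyRing R) E
    inX-ι   : ∀ a → Hom.⟨_⟩ inX (Polynomials.constant R a) E.≈ ι.⟨ a ⟩
    inX-X   : Hom.⟨_⟩ inX (Polynomials.X R) E.≈ X
    inX-injective : ∀ {g g′} → Hom.⟨_⟩ inX g E.≈ Hom.⟨_⟩ inX g′ → g RX.≈ g′
    divides : ∀ g π H → Hom.⟨_⟩ inX g E.≈ Hom.⟨_⟩ inX π E.* H → ∃ λ h → g RX.≈ π RX.* h

module FactorIdentities {c ℓ} (R : CommutativeRing c ℓ) where
  open CommutativeRing R hiding (zero)
  open Numerals R
  open Power R
  open Solver R

  ideal-scale : ∀ s X Y x y g u v →
    g ≈ (X - x) * u + (Y - y) * v →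
    s * g ≈ (X - x) * (s * u) + (Y - y) * (s * v)
  ideal-scale = prove 8 (λ s X Y x y g u v →
    s ∙ g ⊜ (X :- x) :* u :+ (Y :- y) :* v ⇒
    s :* g ⊜ (X :- x) :* (s :* u) :+ (Y :- y) :* (s :* v)) ≡.refl

  ideal-sum : ∀ X Y x y g g′ u v u′ v′ →
    g ≈ (X - x) * u + (Y - y) * v →
    g′ ≈ (X - x) * u′ + (Y - y) * v′ →
    g + g′ ≈ (X - x) * (u + u′) + (Y - y) * (v + v′)
  ideal-sum = prove 10 (λ X Y x y g g′ u v u′ v′ →
    :1 ∙ g ⊜ (X :- x) :* u :+ (Y :- y) :* v ⇒
    :1 ∙ g′ ⊜ (X :- x) :* u′ :+ (Y :- y) :* v′ ⇒
    g :+ g′ ⊜ (X :- x) :* (u :+ u′) :+ (Y :- y) :* (v :+ v′)) ≡.refl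

  ideal-multiple : ∀ X Y x y α α′ z →
    (α * (X - x) + α′ * (Y - y)) * z ≈ (X - x) * (α * z) + (Y - y) * (α′ * z)
  ideal-multiple = prove 7 (λ X Y x y α α′ z →
    (α :* (X :- x) :+ α′ :* (Y :- y)) :* z ⊜ (X :- x) :* (α :* z) :+ (Y :- y) :* (α′ :* z)) ≡.refl

  ideal-insert : ∀ X Y x y g z u v u′ v′ →
    g ≈ (X - x) * u + (Y - y) * v →
    1# - z ≈ (X - x) * u′ + (Y - y) * v′ →
    g ≈ (X - x) * (z * u + g * u′) + (Y - y) * (z * v + g * v′)
  ideal-insert = prove 10 (λ X Y x y g z u v u′ v′ →
    z ∙ g ⊜ (X :- x) :* u :+ (Y :- y) :* v ⇒
    g ∙ :1 :- z ⊜ (X :- x) :* u′ :+ (Y :- y) :* v′ ⇒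
    g ⊜ (X :- x) :* (z :* u :+ g :* u′) :+ (Y :- y) :* (z :* v :+ g :* v′)) ≡.refl

  -- The ideals of (x,y) and (x,-y) multiply into the principal ideal of X - x, since by the two
  -- curve equations (Y - y)(Y + y) = (X - x)(X² + Xx + x² + A).
  conjugate-product : ∀ A B X Y x y y⁻ g g′ u v u′ v′ Π h₁ h₂ h₃ h₄ →
    g ≈ (X - x) * u + (Y - y) * v →
    g′ ≈ (X - x) * u′ + (Y - y⁻) * v′ →
    y⁻ ≈ - y →
    u * u′ ≈ Π * h₁ →
    u * v′ ≈ Π * h₂ →
    v * u′ ≈ Π * h₃ →
    v * v′ ≈ Π * h₄ →
    Y * Y ≈ X * X * X + A * X + B →
    y * y ≈ x * x * x + A * x + B →
    g * g′ ≈ (X - x) * Π * ((X - x) * h₁ + (Y + y) * h₂ + (Y - y) * h₃ + (X * X + X * x + x * x + A) * h₄)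
  conjugate-product = prove 18 (λ A B X Y x y y⁻ g g′ u v u′ v′ Π h₁ h₂ h₃ h₄ →
    g′ ∙ g ⊜ (X :- x) :* u :+ (Y :- y) :* v ⇒
    (X :- x) :* u :+ (Y :- y) :* v ∙ g′ ⊜ (X :- x) :* u′ :+ (Y :- y⁻) :* v′ ⇒
    con 0 :- ((X :- x) :* u :+ (Y :- y) :* v) :* v′ ∙ y⁻ ⊜ :- y ⇒
    (X :- x) :* (X :- x) ∙ u :* u′ ⊜ Π :* h₁ ⇒
    (X :- x) :* (Y :+ y) ∙ u :* v′ ⊜ Π :* h₂ ⇒
    (X :- x) :* (Y :- y) ∙ v :* u′ ⊜ Π :* h₃ ⇒
    (X :- x) :* (X :* X :+ X :* x :+ x :* x :+ A) ∙ v :* v′ ⊜ Π :* h₄ ⇒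
    v :* v′ ∙ Y :* Y ⊜ X :* X :* X :+ A :* X :+ B ⇒
    con 0 :- v :* v′ ∙ y :* y ⊜ x :* x :* x :+ A :* x :+ B ⇒
    g :* g′
      ⊜ (X :- x) :* Π :* ((X :- x) :* h₁ :+ (Y :+ y) :* h₂ :+ (Y :- y) :* h₃ :+ (X :* X :+ X :* x :+ x :* x :+ A) :* h₄)) ≡.refl

  -- Both sides compare the cubic, made homogeneous, at φₙ and at x_Q ψₙ². Their difference is
  -- divisible by F = φₙ - x_Q ψₙ², and the last factor is the rest of the Taylor expansion about
  -- x_Q ψₙ².
  norm-factors : ∀ A B x y xQ yQ e ψ q F →
    e ^ 2 ≈ (κ 2 * y) ^ 2 * ψ ^ 6 - κ 2 * (κ 2 * (κ 3 * x ^ 2 + A)) * q * ψ ^ 4 + κ 12 * x * q ^ 2 * ψ ^ 2 - κ 4 * q ^ 3 →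
    y * y ≈ x * x * x + A * x + B →
    yQ * yQ ≈ xQ * xQ * xQ + A * xQ + B →
    F ≈ x * ψ ^ 2 - q - xQ * ψ ^ 2 →
    (e - κ 2 * yQ * ψ ^ 3) * (e + κ 2 * yQ * ψ ^ 3) ≈ κ 4 * F * (F ^ 2 + κ 3 * F * xQ * ψ ^ 2 + (κ 3 * xQ ^ 2 + A) * ψ ^ 4)
  norm-factors = prove 10 (λ A B x y xQ yQ e ψ q F →
    :1
      ∙ e :^ 2 ⊜ (con 2 :* y) :^ 2 :* ψ :^ 6 :- con 2 :* (con 2 :* (con 3 :* x :^ 2 :+ A)) :* q :* ψ :^ 4 :+ con 12 :* x :* q :^ 2 :* ψ :^ 2 :- con 4 :* q :^ 3 ⇒
    con 4 :* ψ :^ 6 ∙ y :* y ⊜ x :* x :* x :+ A :* x :+ B ⇒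
    con 0 :- con 4 :* ψ :^ 6 ∙ yQ :* yQ ⊜ xQ :* xQ :* xQ :+ A :* xQ :+ B ⇒
    con 0 :- con 4 :* (F :^ 2 :+ F :* (x :* ψ :^ 2 :- q :- xQ :* ψ :^ 2) :+ (x :* ψ :^ 2 :- q :- xQ :* ψ :^ 2) :^ 2) :- con 4 :* (F :+ (x :* ψ :^ 2 :- q :- xQ :* ψ :^ 2)) :* con 3 :* xQ :* ψ :^ 2 :- con 4 :* (con 3 :* xQ :^ 2 :+ A) :* ψ :^ 4
      ∙ F ⊜ x :* ψ :^ 2 :- q :- xQ :* ψ :^ 2 ⇒
    (e :- con 2 :* yQ :* ψ :^ 3) :* (e :+ con 2 :* yQ :* ψ :^ 3)
      ⊜ con 4 :* F :* (F :^ 2 :+ con 3 :* F :* xQ :* ψ :^ 2 :+ (con 3 :* xQ :^ 2 :+ A) :* ψ :^ 4)) ≡.refl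

  -- The difference of the first two products is -4 y_Q ψ³ F. The norm, after removal of multiples
  -- of F², is 4(3x_Q² + A) ψ⁴ F. The weights 27(x_Q³ + A x_Q - B) and 9x_Q⁴ + 15A x_Q² + 4A² are
  -- those that express the discriminant by y_Q² and 3x_Q² + A.
  discriminant-combination : ∀ A B xQ yQ e ψ F Π h₁ h₂ h₃ h₄ →
    (e - κ 2 * yQ * ψ ^ 3) * F ≈ Π * h₁ →
    F * (e + κ 2 * yQ * ψ ^ 3) ≈ Π * h₂ →
    F * F ≈ Π * h₃ →
    (e - κ 2 * yQ * ψ ^ 3) * (e + κ 2 * yQ * ψ ^ 3) ≈ Π * h₄ →
    (e - κ 2 * yQ * ψ ^ 3) * (e + κ 2 * yQ * ψ ^ 3) ≈ κ 4 * F * (F ^ 2 + κ 3 * F * xQ * ψ ^ 2 + (κ 3 * xQ ^ 2 + A) * ψ ^ 4) →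
    yQ * yQ ≈ xQ * xQ * xQ + A * xQ + B →
    κ 4 * (κ 4 * (A * (A * A)) + κ 27 * (B * B)) * (F * ψ ^ 6)
      ≈ Π * (κ 27 * (xQ ^ 3 + A * xQ - B) * yQ * ψ ^ 3 * (h₁ - h₂) + (κ 9 * xQ ^ 4 + κ 15 * A * xQ ^ 2 + κ 4 * A ^ 2) * ψ ^ 2 * (h₄ - κ 4 * (F + κ 3 * xQ * ψ ^ 2) * h₃))
  discriminant-combination = prove 12 (λ A B xQ yQ e ψ F Π h₁ h₂ h₃ h₄ →
    con 27 :* (xQ :^ 3 :+ A :* xQ :- B) :* yQ :* ψ :^ 3 ∙ (e :- con 2 :* yQ :* ψ :^ 3) :* F ⊜ Π :* h₁ ⇒
    con 0 :- con 27 :* (xQ :^ 3 :+ A :* xQ :- B) :* yQ :* ψ :^ 3 ∙ F :* (e :+ con 2 :* yQ :* ψ :^ 3) ⊜ Π :* h₂ ⇒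
    con 0 :- con 4 :* (con 9 :* xQ :^ 4 :+ con 15 :* A :* xQ :^ 2 :+ con 4 :* A :^ 2) :* ψ :^ 2 :* (F :+ con 3 :* xQ :* ψ :^ 2)
      ∙ F :* F ⊜ Π :* h₃ ⇒
    (con 9 :* xQ :^ 4 :+ con 15 :* A :* xQ :^ 2 :+ con 4 :* A :^ 2) :* ψ :^ 2
      ∙ (e :- con 2 :* yQ :* ψ :^ 3) :* (e :+ con 2 :* yQ :* ψ :^ 3) ⊜ Π :* h₄ ⇒
    con 0 :- (con 9 :* xQ :^ 4 :+ con 15 :* A :* xQ :^ 2 :+ con 4 :* A :^ 2) :* ψ :^ 2
      ∙ (e :- con 2 :* yQ :* ψ :^ 3) :* (e :+ con 2 :* yQ :* ψ :^ 3) ⊜ con 4 :* F :* (F :^ 2 :+ con 3 :* F :* xQ :* ψ :^ 2 :+ (con 3 :* xQ :^ 2 :+ A) :* ψ :^ 4) ⇒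
    con 4 :* con 27 :* (xQ :^ 3 :+ A :* xQ :- B) :* F :* ψ :^ 6 ∙ yQ :* yQ ⊜ xQ :* xQ :* xQ :+ A :* xQ :+ B ⇒
    con 4 :* (con 4 :* (A :* (A :* A)) :+ con 27 :* (B :* B)) :* (F :* ψ :^ 6)
      ⊜ Π :* (con 27 :* (xQ :^ 3 :+ A :* xQ :- B) :* yQ :* ψ :^ 3 :* (h₁ :- h₂) :+ (con 9 :* xQ :^ 4 :+ con 15 :* A :* xQ :^ 2 :+ con 4 :* A :^ 2) :* ψ :^ 2 :* (h₄ :- con 4 :* (F :+ con 3 :* xQ :* ψ :^ 2) :* h₃))) ≡.refl

  cancel-unit-multiple : ∀ u v a Π h →
    u * v ≈ 1# →
    u * a ≈ Π * h →
    a ≈ Π * (v * h)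
  cancel-unit-multiple = prove 5 (λ u v a Π h →
    con 0 :- a ∙ u :* v ⊜ :1 ⇒
    v ∙ u :* a ⊜ Π :* h ⇒
    a ⊜ Π :* (v :* h)) ≡.refl

  vanishing-F : ∀ x xQ V q →
    x * V - q ≈ xQ * V →
    x * V - q - xQ * V ≈ 0#
  vanishing-F = prove 4 (λ x xQ V q →
    :1 ∙ x :* V :- q ⊜ xQ :* V ⇒
    x :* V :- q :- xQ :* V ⊜ con 0) ≡.refl
  vanishing-G : ∀ e yQ ψ →
    e ≈ κ 2 * yQ * ψ ^ 3 →
    e - κ 2 * yQ * ψ ^ 3 ≈ 0#
  vanishing-G = prove 3 (λ e yQ ψ →
    :1 ∙ e ⊜ con 2 :* yQ :* ψ :^ 3 ⇒
    e :- con 2 :* yQ :* ψ :^ 3 ⊜ con 0) ≡.refl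
  vanishing-G⁻-even : ∀ y yQ d p →
    d ≈ κ 2 * yQ * (κ 2 * y * p) ^ 3 →
    d + κ 2 * yQ * (κ 2 * (- y) * p) ^ 3 ≈ 0#
  vanishing-G⁻-even = prove 4 (λ y yQ d p →
    :1 ∙ d ⊜ con 2 :* yQ :* (con 2 :* y :* p) :^ 3 ⇒
    d :+ con 2 :* yQ :* (con 2 :* (:- y) :* p) :^ 3 ⊜ con 0) ≡.refl
  vanishing-G⁻-odd : ∀ y yQ d p →
    κ 2 * y * d ≈ κ 2 * yQ * p ^ 3 →
    κ 2 * (- y) * d + κ 2 * yQ * p ^ 3 ≈ 0#
  vanishing-G⁻-odd = prove 4 (λ y yQ d p →
    con 0 :- :1 ∙ con 2 :* y :* d ⊜ con 2 :* yQ :* p :^ 3 ⇒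
    con 2 :* (:- y) :* d :+ con 2 :* yQ :* p :^ 3 ⊜ con 0) ≡.refl

  negative-point : ∀ x y A B →
    y * y ≈ x * x * x + A * x + B →
    (- y) * (- y) ≈ x * x * x + A * x + B
  negative-point = prove 4 (λ x y A B →
    :1 ∙ y :* y ⊜ x :* x :* x :+ A :* x :+ B ⇒
    (:- y) :* (:- y) ⊜ x :* x :* x :+ A :* x :+ B) ≡.refl

  comaximal-negative : ∀ α α′ x x′ y y′ →
    α * (x - x′) + α′ * (y - y′) ≈ 1# →
    α * (x - x′) + (- α′) * (- y - (- y′)) ≈ 1#
  comaximal-negative = prove 6 (λ α α′ x x′ y y′ →
    :1 ∙ α :* (x :- x′) :+ α′ :* (y :- y′) ⊜ :1 ⇒
    α :* (x :- x′) :+ (:- α′) :* (:- y :- (:- y′)) ⊜ :1) ≡.refl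

-- Products of the ideals of points

module IdealProducts {c ℓ} (R : CommutativeRing c ℓ) {A B : CommutativeRing.Carrier R} (C : CoordinateRing R A B) where
  open CoordinateRing C
  private
    module R = CommutativeRing R
    module ι = Hom ι
    module FR = FactorIdentities R
  open CommutativeRing E hiding (zero)
  open FactorIdentities E

  Pt : Set (c ⊔ ℓ)
  Pt = Σ (R.Carrier × R.Carrier) λ { (x , y) → IsPoint R A B x y }

  xOf yOf : Pt → R.Carrier
  xOf ((x , y) , _) = x
  yOf ((x , y) , _) = y

  negate : Pt → Pt
  negate ((x , y) , P) = (x , R.- y) , FR.negative-point x y A B P

  evaluate : Pt → Carrier → R.Carrier
  evaluate (_ , P) = Hom.⟨_⟩ (at P)

  -- The ideals of the two points generate the unit ideal: evaluated at the first point, the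
  -- generators of the second ideal combine to 1.
  Comaximal : Pt → Pt → Set (c ⊔ ℓ)
  Comaximal P P′ = ∃ λ α → ∃ λ α′ → α R.* (xOf P R.- xOf P′) R.+ α′ R.* (yOf P R.- yOf P′) R.≈ R.1#

  -- membership in the product of the ideals (X - x , Y - y)
  InProduct : List Pt → Carrier → Set (c ⊔ ℓ)
  InProduct []      g = ⊤
  InProduct (P ∷ L) g = ∃ λ u → ∃ λ v → InProduct L u × InProduct L v ×
    g ≈ (X - ι.⟨ xOf P ⟩) * u + (Y - ι.⟨ yOf P ⟩) * v

  scale-in : ∀ L {g} s → InProduct L g → InProduct L (s * g)
  scale-in []      s _ = tt
  scale-in (P ∷ L) s (u , v , U , V , e) =
    s * u , s * v , scale-in L s U , scale-in L s V , ideal-scale s X Y _ _ _ u v e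

  sum-in : ∀ L {g g′} → InProduct L g → InProduct L g′ → InProduct L (g + g′)
  sum-in []      _ _ = tt
  sum-in (P ∷ L) (u , v , U , V , e) (u′ , v′ , U′ , V′ , e′) =
    u + u′ , v + v′ , sum-in L U U′ , sum-in L V V′ , ideal-sum X Y _ _ _ _ u v u′ v′ e e′

  -- As in the Chinese remainder theorem: for each other point, a combination of its generators with
  -- value 1 at `P` enters as a factor.
  separating : ∀ P L → All (Comaximal P) L → ∃ λ z → InProduct L z × evaluate P z R.≈ R.1#
  separating P []       []       = 1# , tt , Hom.1-homo (at (proj₂ P))
  separating P (P′ ∷ L) ((α , α′ , e) ∷ cs) with separating P L cs
  ... | z , Z , z≈1 =
    (ι.⟨ α ⟩ * (X - ι.⟨ xOf P′ ⟩) + ι.⟨ α′ ⟩ * (Y - ι.⟨ yOf P′ ⟩)) * z ,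
    (ι.⟨ α ⟩ * z , ι.⟨ α′ ⟩ * z , scale-in L _ Z , scale-in L _ Z , ideal-multiple X Y _ _ _ _ z) ,
    R.trans
      (homo (at (proj₂ P)) 7 (λ α α′ X Y x y z → (α :* (X :- x) :+ α′ :* (Y :- y)) :* z)
        (at-ι (proj₂ P) α ∷ at-ι (proj₂ P) α′ ∷ at-X (proj₂ P) ∷ at-Y (proj₂ P)
         ∷ at-ι (proj₂ P) (xOf P′) ∷ at-ι (proj₂ P) (yOf P′) ∷ z≈1 ∷ []))
      (R.trans (R.*-identityʳ _) e)

  -- Write g = zg + (1 - z)g with `z` from `separating`. In the first term g lies in the ideal of
  -- `P` and z in the remaining product; in the second 1 - z and g exchange these roles.
  insert : ∀ P L {g} → All (Comaximal P) L → evaluate P g R.≈ R.0# → InProduct L g → InProduct (P ∷ L) g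
  insert P L {g} cs g≈0 G with separating P L cs
  ... | z , Z , z≈1 with kernel (proj₂ P) g g≈0
                       | kernel (proj₂ P) (1# - z) (R.trans
                           (homo (at (proj₂ P)) 1 (λ z → :1 :- z) (z≈1 ∷ [])) (R.-‿inverseʳ R.1#))
  ... | u , v , e | u′ , v′ , e′ =
    z * u + g * u′ , z * v + g * v′ ,
    sum-in L (resp L (*-comm u z) (scale-in L u Z)) (resp L (*-comm u′ g) (scale-in L u′ G)) ,
    sum-in L (resp L (*-comm v z) (scale-in L v Z)) (resp L (*-comm v′ g) (scale-in L v′ G)) ,
    ideal-insert X Y _ _ g z u v u′ v′ e e′
    where
    resp : ∀ L {g g′} → g ≈ g′ → InProduct L g → InProduct L g′
    resp []      _  _ = tt
    resp (P ∷ L) e″ (u , v , U , V , e) = u , v , U , V , trans (sym e″) e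

  vanishing-in : ∀ L {g} → AllPairs Comaximal L → All (λ P → evaluate P g R.≈ R.0#) L → InProduct L g
  vanishing-in []      []       []       = tt
  vanishing-in (P ∷ L) (c ∷ cs) (z ∷ zs) = insert P L c z (vanishing-in L cs zs)

  Π : List Pt → Carrier
  Π []      = 1#
  Π (P ∷ L) = (X - ι.⟨ xOf P ⟩) * Π L

  conjugate-divides : ∀ L {g g′} → InProduct L g → InProduct (map negate L) g′ → ∃ λ h → g * g′ ≈ Π L * h
  conjugate-divides []      _ _ = _ , sym (*-identityˡ _)
  conjugate-divides (P@(_ , on-curveₚ) ∷ L) {g} {g′} (u , v , U , V , e) (u′ , v′ , U′ , V′ , e′)
    with conjugate-divides L U U′ | conjugate-divides L U V′ | conjugate-divides L V U′ | conjugate-divides L V V′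
  ... | h₁ , e₁ | h₂ , e₂ | h₃ , e₃ | h₄ , e₄ = _ ,
    conjugate-product ι.⟨ A ⟩ ι.⟨ B ⟩ X Y ι.⟨ xOf P ⟩ ι.⟨ yOf P ⟩ ι.⟨ R.- yOf P ⟩ g g′ u v u′ v′ (Π L) h₁ h₂ h₃ h₄
      e e′ (ι.-‿homo _) e₁ e₂ e₃ e₄ on-curve
      (transfer ι 4 (λ A B x y → y :* y) (λ A B x y → x :* x :* x :+ A :* x :+ B)
        (refl ∷ refl ∷ refl ∷ refl ∷ []) on-curveₚ)

  negate-comaximal : ∀ {P P′} → Comaximal P P′ → Comaximal (negate P) (negate P′)
  negate-comaximal {P} {P′} (α , α′ , e) =
    α , R.- α′ , FR.comaximal-negative α α′ (xOf P) (xOf P′) (yOf P) (yOf P′) e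

  negate-pairs : ∀ {L} → AllPairs Comaximal L → AllPairs Comaximal (map negate L)
  negate-pairs {[]}    []       = []
  negate-pairs {P ∷ L} (c ∷ cs) = Allₚ.map⁺ (All.map (λ {P′} → negate-comaximal {P} {P′}) c) ∷ negate-pairs cs

module FibreDivisibility {c ℓ} (R : CommutativeRing c ℓ) {A B : CommutativeRing.Carrier R}
  (nonsingular : Nonsingular R A B) (C : CoordinateRing R A B)
  (k : ℕ) {xQ yQ : CommutativeRing.Carrier R} (on-curveQ : IsPoint R A B xQ yQ) where
  open CoordinateRing C
  open IdealProducts R C
  private
    module R where
      open CommutativeRing R public
      open Numerals R public
      open Power R public
    module ι = Hom ι
    module FR = FactorIdentities R
  open CommutativeRing E hiding (zero)
  open Numerals E
  open Power E
  open Units E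
  open FactorIdentities E
  open XOnly E ι.⟨ A ⟩ ι.⟨ B ⟩ X
  open DivisionPolynomials.AtPoint E ι.⟨ A ⟩ ι.⟨ B ⟩ X Y

  -- Numerators of x(nP) - x_Q and of 2(y(nP) ∓ y_Q) at the generic point (X,Y) of the curve. For P
  -- above Q, `F` vanishes at P and -P, `G₊` at P and `G₋` at -P.
  F G₊ G₋ : Carrier
  F  = φ k - ι.⟨ xQ ⟩ * ψ² (1 ℕ.+ k)
  G₊ = e (1 ℕ.+ k) - κ 2 * ι.⟨ yQ ⟩ * ψ (1 ℕ.+ k) ^ 3
  G₋ = e (1 ℕ.+ k) + κ 2 * ι.⟨ yQ ⟩ * ψ (1 ℕ.+ k) ^ 3

  Lies : Pt → Set (c ⊔ ℓ)
  Lies P = IsMultiple R A B (xOf P) (yOf P) k xQ yQ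

  private
    F-at : ∀ P → evaluate P F R.≈ XOnly.φ R A B (xOf P) k R.- xQ R.* XOnly.ψ² R A B (xOf P) (1 ℕ.+ k)
    F-at (_ , P) = homo (at P) 3 (λ a b c → a :- b :* c)
      (φ-homo (at P) (at-ι P A) (at-ι P B) (at-X P) k ∷ at-ι P xQ ∷ ψ²-homo (at P) (at-ι P A) (at-ι P B) (at-X P) (1 ℕ.+ k) ∷ [])

    F-zero : ∀ P → Lies P → XOnly.φ R A B (xOf P) k R.- xQ R.* XOnly.ψ² R A B (xOf P) (1 ℕ.+ k) R.≈ R.0#
    F-zero (_ , P) M = FR.vanishing-F _ xQ _ _
      (R.trans (R.+-cong (R.*-congˡ (R.sym (XOnly.ψ²≈ R A B _ P (1 ℕ.+ k)))) (R.-‿cong (R.sym (XOnly.ψψ≈ R A B _ P k))))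
        (R.trans (IsMultiple.x-eq M) (R.*-congˡ (XOnly.ψ²≈ R A B _ P (1 ℕ.+ k)))))

    G₊-zero : ∀ P → Lies P → evaluate P G₊ R.≈ R.0#
    G₊-zero (_ , P) M = R.trans (homo (at P) 3 (λ e y ψ → e :- con 2 :* y :* ψ :^ 3)
      (e-homo (at P) (at-ι P A) (at-ι P B) (at-X P) (at-Y P) (1 ℕ.+ k) ∷ at-ι P yQ
       ∷ ψ-homo (at P) (at-ι P A) (at-ι P B) (at-X P) (at-Y P) (1 ℕ.+ k) ∷ []))
      (FR.vanishing-G _ yQ _ (IsMultiple.e-eq M))

    -- The multiplication polynomials have definite parity in y.
    G₋-zero : ∀ P → Lies P → evaluate (negate P) G₋ R.≈ R.0#
    G₋-zero P@((x , y) , _) M = R.trans (homo (at P⁻) 3 (λ e y ψ → e :+ con 2 :* y :* ψ :^ 3)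
      (e-homo (at P⁻) (at-ι P⁻ A) (at-ι P⁻ B) (at-X P⁻) (at-Y P⁻) (1 ℕ.+ k) ∷ at-ι P⁻ yQ
       ∷ ψ-homo (at P⁻) (at-ι P⁻ A) (at-ι P⁻ B) (at-X P⁻) (at-Y P⁻) (1 ℕ.+ k) ∷ []))
      (parity (even? (1 ℕ.+ k)) _ _ (IsMultiple.e-eq M))
      where
      P⁻ = proj₂ (negate P)
      module D = DivisionPolynomials R A B x
      parity : ∀ b d p → D.AtPoint.twist y (not b) d R.≈ R.κ 2 R.* yQ R.* D.AtPoint.twist y b p R.^ 3 →
        D.AtPoint.twist (R.- y) (not b) d R.+ R.κ 2 R.* yQ R.* D.AtPoint.twist (R.- y) b p R.^ 3 R.≈ R.0#
      parity true  d p = FR.vanishing-G⁻-even y yQ d p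
      parity false d p = FR.vanishing-G⁻-odd y yQ d p

    F≈ : F ≈ X * ψ (1 ℕ.+ k) ^ 2 - ψ (2 ℕ.+ k) * ψ k - ι.⟨ xQ ⟩ * ψ (1 ℕ.+ k) ^ 2
    F≈ = +-cong (+-cong (*-congˡ (sym (ψ²≈ on-curve (1 ℕ.+ k)))) (-‿cong (sym (ψψ≈ on-curve k))))
                (-‿cong (*-congˡ (sym (ψ²≈ on-curve (1 ℕ.+ k)))))

    on-curveQᴱ : IsPoint E ι.⟨ A ⟩ ι.⟨ B ⟩ ι.⟨ xQ ⟩ ι.⟨ yQ ⟩
    on-curveQᴱ = transfer ι 4 (λ A B x y → y :* y) (λ A B x y → x :* x :* x :+ A :* x :+ B)
      (refl ∷ refl ∷ refl ∷ refl ∷ []) on-curveQ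

    unit-image : ∀ {u} → Units.IsUnit R u → IsUnit ι.⟨ u ⟩
    unit-image (v , e) = ι.⟨ v ⟩ , trans (sym (ι.*-homo _ _)) (trans (ι.cong e) ι.1-homo)

    4Δ-unit : IsUnit (κ 4 * (κ 4 * (ι.⟨ A ⟩ * (ι.⟨ A ⟩ * ι.⟨ A ⟩)) + κ 27 * (ι.⟨ B ⟩ * ι.⟨ B ⟩)))
    4Δ-unit = unit-≈ (homo ι 2 (λ A B → con 2 :* con 2 :* (con 4 :* (A :* (A :* A)) :+ con 27 :* (B :* B))) (refl ∷ refl ∷ []))
        (unit-image (Units.unit-* R (Units.unit-* R 2-unit 2-unit) Δ-unit)) ▹ four
      where
      open Nonsingular nonsingular
      open Solver E
      four : ∀ {a} → κ 2 * κ 2 * a ≈ κ 4 * a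
      four {a} = prove 1 (λ a → con 2 :* con 2 :* a ⊜ con 4 :* a) ≡.refl a
      _▹_ : ∀ {u v} → IsUnit u → u ≈ v → IsUnit v
      p ▹ e = unit-≈ e p

  norm : G₊ * G₋ ≈ κ 4 * F * (F ^ 2 + κ 3 * F * ι.⟨ xQ ⟩ * ψ (1 ℕ.+ k) ^ 2 + (κ 3 * ι.⟨ xQ ⟩ ^ 2 + ι.⟨ A ⟩) * ψ (1 ℕ.+ k) ^ 4)
  norm = norm-factors ι.⟨ A ⟩ ι.⟨ B ⟩ X Y ι.⟨ xQ ⟩ ι.⟨ yQ ⟩ (e (1 ℕ.+ k)) (ψ (1 ℕ.+ k)) (ψ (2 ℕ.+ k) * ψ k) F
    (PointRelations.curve E ι.⟨ A ⟩ ι.⟨ B ⟩ X Y on-curve k) on-curve on-curveQᴱ F≈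

  -- Each of the four products pairs an element for the list with one for the negated list, so it is
  -- divisible by ∏ (X - x). `F` may stand on either side because it is even in Y. The power of ψ is
  -- removed only after descent to R[X].
  fibre-divides : ∀ L → AllPairs Comaximal L → All Lies L → ∃ λ H → F * ψ (1 ℕ.+ k) ^ 6 ≈ Π L * H
  fibre-divides L pairs lies = _ , cancel-unit-multiple _ (proj₁ 4Δ-unit) _ (Π L) _ (proj₂ 4Δ-unit)
    (discriminant-combination ι.⟨ A ⟩ ι.⟨ B ⟩ ι.⟨ xQ ⟩ ι.⟨ yQ ⟩ (e (1 ℕ.+ k)) (ψ (1 ℕ.+ k)) F (Π L)
      (proj₁ h₁) (proj₁ h₂) (proj₁ h₃) (proj₁ h₄) (proj₂ h₁) (proj₂ h₂) (proj₂ h₃) (proj₂ h₄)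
      norm on-curveQᴱ)
    where
    F-in : InProduct L F
    F-in = vanishing-in L pairs (All.map (λ {P} M → R.trans (F-at P) (F-zero P M)) lies)
    F-in⁻ : InProduct (map negate L) F
    F-in⁻ = vanishing-in _ (negate-pairs pairs) (Allₚ.map⁺ (All.map (λ {P} M → R.trans (F-at (negate P)) (F-zero P M)) lies))
    G₊-in : InProduct L G₊
    G₊-in = vanishing-in L pairs (All.map (λ {P} → G₊-zero P) lies)
    G₋-in : InProduct (map negate L) G₋
    G₋-in = vanishing-in _ (negate-pairs pairs) (Allₚ.map⁺ (All.map (λ {P} → G₋-zero P) lies))
    h₁ = conjugate-divides L G₊-in F-in⁻
    h₂ = conjugate-divides L F-in G₋-in
    h₃ = conjugate-divides L F-in F-in⁻
    h₄ = conjugate-divides L G₊-in G₋-in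

-- The coordinate ring as a quadratic extension of R[X]

module QuadraticExtension {c ℓ} (S : CommutativeRing c ℓ) (D : CommutativeRing.Carrier S) where
  open CommutativeRing S hiding (zero)
  open Solver S

  infix 4 _≈ᵠ_
  record _≈ᵠ_ (u v : Carrier × Carrier) : Set ℓ where
    constructor _&_
    field
      rational   : proj₁ u ≈ proj₁ v
      irrational : proj₂ u ≈ proj₂ v
  open _≈ᵠ_ public

  quadratic : CommutativeRing c ℓ
  quadratic = record
    { Carrier = Carrier × Carrier
    ; _≈_ = _≈ᵠ_
    ; _+_ = λ u v → proj₁ u + proj₁ v , proj₂ u + proj₂ v
    ; _*_ = λ u v → proj₁ u * proj₁ v + D * (proj₂ u * proj₂ v) , proj₁ u * proj₂ v + proj₂ u * proj₁ v
    ; -_  = λ u → - proj₁ u , - proj₂ u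
    ; 0#  = 0# , 0#
    ; 1#  = 1# , 0#
    ; isCommutativeRing = record
      { isRing = record
        { +-isAbelianGroup = record
          { isGroup = record
            { isMonoid = record
              { isSemigroup = record
                { isMagma = record
                  { isEquivalence = record
                    { refl = refl & refl
                    ; sym = λ e → sym (rational e) & sym (irrational e)
                    ; trans = λ e f → trans (rational e) (rational f) & trans (irrational e) (irrational f) }
                  ; ∙-cong = λ e f → +-cong (rational e) (rational f) & +-cong (irrational e) (irrational f) }
                ; assoc = λ _ _ _ → +-assoc _ _ _ & +-assoc _ _ _ }
              ; identity = (λ _ → +-identityˡ _ & +-identityˡ _) , (λ _ → +-identityʳ _ & +-identityʳ _) }
            ; inverse = (λ _ → -‿inverseˡ _ & -‿inverseˡ _) , (λ _ → -‿inverseʳ _ & -‿inverseʳ _)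
            ; ⁻¹-cong = λ e → -‿cong (rational e) & -‿cong (irrational e) }
          ; comm = λ _ _ → +-comm _ _ & +-comm _ _ }
        ; *-cong = λ e f →
            +-cong (*-cong (rational e) (rational f)) (*-congˡ (*-cong (irrational e) (irrational f)))
            & +-cong (*-cong (rational e) (irrational f)) (*-cong (irrational e) (rational f))
        ; *-assoc = λ { (a , a′) (b , b′) (c , c′) →
            prove 7 (λ D a a′ b b′ c c′ → (a :* b :+ D :* (a′ :* b′)) :* c :+ D :* ((a :* b′ :+ a′ :* b) :* c′)
                       ⊜ a :* (b :* c :+ D :* (b′ :* c′)) :+ D :* (a′ :* (b :* c′ :+ b′ :* c))) ≡.refl D a a′ b b′ c c′
            & prove 7 (λ D a a′ b b′ c c′ → (a :* b :+ D :* (a′ :* b′)) :* c′ :+ (a :* b′ :+ a′ :* b) :* c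
                       ⊜ a :* (b :* c′ :+ b′ :* c) :+ a′ :* (b :* c :+ D :* (b′ :* c′))) ≡.refl D a a′ b b′ c c′ }
        ; *-identity =
            (λ { (a , a′) → prove 3 (λ D a a′ → :1 :* a :+ D :* (con 0 :* a′) ⊜ a) ≡.refl D a a′
                          & prove 3 (λ D a a′ → :1 :* a′ :+ con 0 :* a ⊜ a′) ≡.refl D a a′ })
          , (λ { (a , a′) → prove 3 (λ D a a′ → a :* :1 :+ D :* (a′ :* con 0) ⊜ a) ≡.refl D a a′
                          & prove 3 (λ D a a′ → a :* con 0 :+ a′ :* :1 ⊜ a′) ≡.refl D a a′ })
        ; distrib =
            (λ { (a , a′) (b , b′) (c , c′) →
                 prove 7 (λ D a a′ b b′ c c′ → a :* (b :+ c) :+ D :* (a′ :* (b′ :+ c′))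
                   ⊜ (a :* b :+ D :* (a′ :* b′)) :+ (a :* c :+ D :* (a′ :* c′))) ≡.refl D a a′ b b′ c c′
                 & prove 7 (λ D a a′ b b′ c c′ → a :* (b′ :+ c′) :+ a′ :* (b :+ c)
                   ⊜ (a :* b′ :+ a′ :* b) :+ (a :* c′ :+ a′ :* c)) ≡.refl D a a′ b b′ c c′ })
          , (λ { (a , a′) (b , b′) (c , c′) →
                 prove 7 (λ D a a′ b b′ c c′ → (b :+ c) :* a :+ D :* ((b′ :+ c′) :* a′)
                   ⊜ (b :* a :+ D :* (b′ :* a′)) :+ (c :* a :+ D :* (c′ :* a′))) ≡.refl D a a′ b b′ c c′
                 & prove 7 (λ D a a′ b b′ c c′ → (b :+ c) :* a′ :+ (b′ :+ c′) :* a
                   ⊜ (b :* a′ :+ b′ :* a) :+ (c :* a′ :+ c′ :* a)) ≡.refl D a a′ b b′ c c′ }) }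
      ; *-comm = λ { (a , a′) (b , b′) →
          prove 5 (λ D a a′ b b′ → a :* b :+ D :* (a′ :* b′) ⊜ b :* a :+ D :* (b′ :* a′)) ≡.refl D a a′ b b′
          & prove 5 (λ D a a′ b b′ → a :* b′ :+ a′ :* b ⊜ b :* a′ :+ b′ :* a) ≡.refl D a a′ b b′ } }
    }

  embed : Hom S quadratic
  embed = record
    { ⟨_⟩    = λ a → a , 0#
    ; cong   = λ e → e & refl
    ; +-homo = λ _ _ → refl & sym (+-identityˡ 0#)
    ; *-homo = λ a b → prove 3 (λ D a b → a :* b ⊜ a :* b :+ D :* (con 0 :* con 0)) ≡.refl D a b
                     & prove 2 (λ a b → con 0 ⊜ a :* con 0 :+ con 0 :* b) ≡.refl a b
    ; 1-homo = refl & refl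
    }

  √D : Carrier × Carrier
  √D = 0# , 1#

  √D-square : CommutativeRing._≈_ quadratic (CommutativeRing._*_ quadratic √D √D) (Hom.⟨_⟩ embed D)
  √D-square = prove 1 (λ D → con 0 :* con 0 :+ D :* (:1 :* :1) ⊜ D) ≡.refl D
            & prove 1 (λ D → con 0 :* :1 :+ :1 :* con 0 ⊜ con 0) ≡.refl D

  extend : ∀ {a ℓ′} {T : CommutativeRing a ℓ′} (h : Hom S T) (t : CommutativeRing.Carrier T) →
           CommutativeRing._≈_ T (CommutativeRing._*_ T t t) (Hom.⟨_⟩ h D) → Hom quadratic T
  extend {T = T} h t t²≈D = record
    { ⟨_⟩    = λ u → ⟨ proj₁ u ⟩ T.+ t T.* ⟨ proj₂ u ⟩
    ; cong   = λ e → T.+-cong (h-cong (rational e)) (T.*-congˡ (h-cong (irrational e)))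
    ; +-homo = λ { (a , a′) (b , b′) → T.trans
        (T.+-cong (h-+ _ _) (T.*-congˡ (h-+ _ _)))
        (Tˢ.prove 5 (λ t a a′ b b′ → (a :+ b) :+ t :* (a′ :+ b′) ⊜ (a :+ t :* a′) :+ (b :+ t :* b′)) ≡.refl
          t ⟨ a ⟩ ⟨ a′ ⟩ ⟨ b ⟩ ⟨ b′ ⟩) }
    ; *-homo = λ { (a , a′) (b , b′) → T.trans
        (T.+-cong (homo h 5 (λ D a a′ b b′ → a :* b :+ D :* (a′ :* b′)) (T.refl ∷ T.refl ∷ T.refl ∷ T.refl ∷ T.refl ∷ []))
                  (T.*-congˡ (homo h 4 (λ a a′ b b′ → a :* b′ :+ a′ :* b) (T.refl ∷ T.refl ∷ T.refl ∷ T.refl ∷ []))))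
        (Tˢ.prove 6 (λ t D a a′ b b′ → :- (a′ :* b′) ∙ t :* t ⊜ D ⇒
            (a :* b :+ D :* (a′ :* b′)) :+ t :* (a :* b′ :+ a′ :* b) ⊜ (a :+ t :* a′) :* (b :+ t :* b′)) ≡.refl
          t ⟨ D ⟩ ⟨ a ⟩ ⟨ a′ ⟩ ⟨ b ⟩ ⟨ b′ ⟩ t²≈D) }
    ; 1-homo = T.trans (T.+-cong 1-homo (T.trans (T.*-congˡ 0-homo) (T.zeroʳ t))) (T.+-identityʳ T.1#)
    }
    where
    module T = CommutativeRing T
    module Tˢ = Solver T
    open Hom h renaming (cong to h-cong; +-homo to h-+)

module SyntheticDivision {c ℓ} (R : CommutativeRing c ℓ) where
  open CommutativeRing R using (Carrier)
  open Polynomials R hiding (X)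
  private
    module PR = CommutativeRing polyRing
    module R = CommutativeRing R
    X = Polynomials.X R

  infix 4 _≣_
  _≣_ = PR._≈_

  evalAt : Carrier → Hom polyRing R
  evalAt x = Evaluation.evHom (idHom R) x

  ∷-as-sum : ∀ a p → (a ∷ p) ≣ constant a PR.+ X PR.* p
  ∷-as-sum a p = PR.sym (PR.trans (PR.+-congˡ {constant a} (PR.trans (shift-* (constant R.1#) p) (∷-cong R.refl (*ₚ-identityˡ p))))
    (∷-cong (R.+-identityʳ a) PR.refl))

  private
    horner : ∀ k x X q v p → p ≣ (X PR.- x) PR.* q PR.+ v →
      k PR.+ X PR.* p ≣ (X PR.- x) PR.* (X PR.* q PR.+ v) PR.+ (k PR.+ x PR.* v)
    horner = Solver.prove polyRing 6 (λ k x X q v p → X ∙ p ⊜ (X :- x) :* q :+ v ⇒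
      k :+ X :* p ⊜ (X :- x) :* (X :* q :+ v) :+ (k :+ x :* v)) ≡.refl

  divide : ∀ x p → ∃ λ q → p ≣ (X PR.- constant x) PR.* q PR.+ constant (Hom.⟨_⟩ (evalAt x) p)
  divide x [] = [] , PR.sym (PR.trans (PR.+-cong (*ₚ-zeroʳ (X PR.- constant x)) 0∷[]) (PR.+-identityˡ []))
  divide x (k ∷ p) with divide x p
  ... | q , e = X PR.* q PR.+ constant v ,
    PR.trans (∷-as-sum k p) (PR.trans (horner (constant k) (constant x) X q (constant v) p e)
      (PR.+-congˡ {(X PR.- constant x) PR.* (X PR.* q PR.+ constant v)}
        (PR.trans (PR.+-congˡ {constant k} (PR.sym (Hom.*-homo constantHom x v))) (PR.sym (Hom.+-homo constantHom k (x R.* v))))))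
    where v = Hom.⟨_⟩ (evalAt x) p

module _ {c ℓ} (R : CommutativeRing c ℓ) (A B : CommutativeRing.Carrier R) where
  private
    module R = CommutativeRing R
    module RX where
      open Polynomials R public
      open CommutativeRing (Polynomials.polyRing R) public
    cubic : RX.Carrier
    cubic = RX.X RX.* RX.X RX.* RX.X RX.+ RX.constant A RX.* RX.X RX.+ RX.constant B
  open QuadraticExtension (Polynomials.polyRing R) cubic
  open SyntheticDivision R
  private
    module E = CommutativeRing quadratic
    module embed = Hom embed
    S = Polynomials.polyRing R

    inCurve : Hom R quadratic
    inCurve = _∘ʰ_ {R = R} {S = S} {T = quadratic} embed (Polynomials.constantHom R)

    cubic-at : ∀ x → Hom.⟨_⟩ (evalAt x) cubic R.≈ x R.* x R.* x R.+ A R.* x R.+ B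
    cubic-at x = homo (evalAt x) 3 (λ A B X → X :* X :* X :+ A :* X :+ B)
      {RX.constant A ∷ RX.constant B ∷ RX.X ∷ []} {A ∷ B ∷ x ∷ []}
      (Evaluation.ev-constant (idHom R) x A ∷ Evaluation.ev-constant (idHom R) x B ∷ Evaluation.ev-X (idHom R) x ∷ [])

    evaluateAtPoint : ∀ {x y} → IsPoint R A B x y → Hom quadratic R
    evaluateAtPoint {x} {y} P = extend {T = R} (evalAt x) y (R.trans P (R.sym (cubic-at x)))

    at-embed : ∀ {x y} (P : IsPoint R A B x y) p → Hom.⟨_⟩ (evaluateAtPoint P) embed.⟨ p ⟩ R.≈ Hom.⟨_⟩ (evalAt x) p
    at-embed {x} {y} P p = R.trans (R.+-congˡ (R.zeroʳ y)) (R.+-identityʳ _)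

    component₁ : ∀ X x a q b q′ s a₀ b₀ y → a RX.≈ (X RX.- x) RX.* q RX.+ a₀ → b RX.≈ (X RX.- x) RX.* q′ RX.+ b₀ →
      a₀ RX.+ y RX.* b₀ RX.≈ RX.0# →
      a RX.≈ ((X RX.- x) RX.* q RX.+ s RX.* ((RX.0# RX.+ RX.- RX.0#) RX.* q′))
             RX.+ ((RX.0# RX.- y) RX.* b₀ RX.+ s RX.* ((RX.1# RX.+ RX.- RX.0#) RX.* RX.0#))
    component₁ = Solver.prove S 10 (λ X x a q b q′ s a₀ b₀ y →
      :1 ∙ a ⊜ (X :- x) :* q :+ a₀ ⇒ con 0 ∙ b ⊜ (X :- x) :* q′ :+ b₀ ⇒ :1 ∙ a₀ :+ y :* b₀ ⊜ con 0 ⇒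
      a ⊜ ((X :- x) :* q :+ s :* ((con 0 :- con 0) :* q′)) :+ ((con 0 :- y) :* b₀ :+ s :* ((:1 :- con 0) :* con 0))) ≡.refl

    component₂ : ∀ X x q b q′ b₀ y → b RX.≈ (X RX.- x) RX.* q′ RX.+ b₀ →
      b RX.≈ ((X RX.- x) RX.* q′ RX.+ (RX.0# RX.+ RX.- RX.0#) RX.* q)
             RX.+ ((RX.0# RX.- y) RX.* RX.0# RX.+ (RX.1# RX.+ RX.- RX.0#) RX.* b₀)
    component₂ = Solver.prove S 7 (λ X x q b q′ b₀ y → :1 ∙ b ⊜ (X :- x) :* q′ :+ b₀ ⇒
      b ⊜ ((X :- x) :* q′ :+ (con 0 :- con 0) :* q) :+ ((con 0 :- y) :* con 0 :+ (:1 :- con 0) :* b₀)) ≡.refl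

    -- Divide both components of a + bY by X - x. The remainders satisfy a₀ + y b₀ = 0, so what is
    -- left is b₀(Y - y).
    kernelAtPoint : ∀ {x y} (P : IsPoint R A B x y) g → Hom.⟨_⟩ (evaluateAtPoint P) g R.≈ R.0# →
      ∃ λ u → ∃ λ v → g E.≈ (embed.⟨ RX.X ⟩ E.- Hom.⟨_⟩ inCurve x) E.* u E.+ (√D E.- Hom.⟨_⟩ inCurve y) E.* v
    kernelAtPoint {x} {y} P (a , b) g≈0 with divide x a | divide x b
    ... | q , e | q′ , e′ = (q , q′) , embed.⟨ RX.constant b₀ ⟩ ,
      (component₁ RX.X (RX.constant x) a q b q′ cubic (RX.constant a₀) (RX.constant b₀) (RX.constant y) e e′
         (RX.trans (RX.sym (homo RX.constantHom 3 (λ a y b → a :+ y :* b) {a₀ ∷ y ∷ b₀ ∷ []} (RX.refl ∷ RX.refl ∷ RX.refl ∷ [])))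
                   (RX.trans (Hom.cong RX.constantHom g≈0) (Hom.0-homo RX.constantHom)))
       & component₂ RX.X (RX.constant x) q b q′ (RX.constant b₀) (RX.constant y) e′)
      where
      a₀ = Hom.⟨_⟩ (evalAt x) a
      b₀ = Hom.⟨_⟩ (evalAt x) b

    first-component : ∀ (π h₀ D h₁ : RX.Carrier) → π RX.* h₀ RX.+ D RX.* (RX.0# RX.* h₁) RX.≈ π RX.* h₀
    first-component = Solver.prove S 4 (λ π h₀ D h₁ → π :* h₀ :+ D :* (con 0 :* h₁) ⊜ π :* h₀) ≡.refl

  coordinateRing : CoordinateRing R A B
  coordinateRing = record
    { E = quadratic
    ; ι = inCurve
    ; X = embed.⟨ RX.X ⟩
    ; Y = √D
    ; on-curve = E.trans √D-square (homo embed 3 (λ A B X → X :* X :* X :+ A :* X :+ B)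
        {RX.constant A ∷ RX.constant B ∷ RX.X ∷ []} (E.refl ∷ E.refl ∷ E.refl ∷ []))
    ; at = evaluateAtPoint
    ; at-ι = λ {x} P a → R.trans (at-embed P (RX.constant a)) (Evaluation.ev-constant (idHom R) x a)
    ; at-X = λ {x} P → R.trans (at-embed P RX.X) (Evaluation.ev-X (idHom R) x)
    ; at-Y = λ {x} {y} P → R.trans (R.+-identityˡ _)
        (R.trans (R.*-congˡ (Evaluation.ev-constant (idHom R) x R.1#)) (R.*-identityʳ y))
    ; kernel = kernelAtPoint
    ; inX = embed
    ; inX-ι = λ a → E.refl
    ; inX-X = E.refl
    ; inX-injective = rational
    ; divides = λ g π H e → proj₁ H , RX.trans (rational e) (first-component π (proj₁ H) cubic (proj₂ H))
    }

-- Factorisation of the fibre polynomial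

module PolynomialFactors {c ℓ} (R : CommutativeRing c ℓ) where
  open CommutativeRing R using (Carrier)
  open Polynomials R hiding (X)
  open SyntheticDivision R
  private
    module R = CommutativeRing R
    X = Polynomials.X R
  open CommutativeRing polyRing hiding (zero; Carrier)
  open Solver polyRing

  ∏ : List Carrier → Poly
  ∏ []       = 1#
  ∏ (x ∷ xs) = (X - constant x) * ∏ xs

  private
    coprime-factor : ∀ V i d q v →
      V ≈ d * q + v →
      v * i ≈ 1# →
      V * i + d * (- (q * i)) ≈ 1#
    coprime-factor = prove 5 (λ V i d q v →
      i ∙ V ⊜ d :* q :+ v ⇒
      :1 ∙ v :* i ⊜ :1 ⇒
      V :* i :+ d :* (:- (q :* i)) ⊜ :1) ≡.refl

    coprime-product : ∀ V d π s t s′ t′ →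
      V * s + d * t ≈ 1# →
      V * s′ + π * t′ ≈ 1# →
      V * (s * (V * s′ + π * t′) + d * t * s′) + d * π * (t * t′) ≈ 1#
    coprime-product = prove 7 (λ V d π s t s′ t′ →
      V :* s′ :+ π :* t′ ∙ V :* s :+ d :* t ⊜ :1 ⇒
      :1 ∙ V :* s′ :+ π :* t′ ⊜ :1 ⇒
      V :* (s :* (V :* s′ :+ π :* t′) :+ d :* t :* s′) :+ d :* π :* (t :* t′) ⊜ :1) ≡.refl

    coprime-divides : ∀ F W π h s t →
      W * s + π * t ≈ 1# →
      F * W ≈ π * h →
      F ≈ π * (h * s + F * t)
    coprime-divides = prove 6 (λ F W π h s t →
      con 0 :- F ∙ W :* s :+ π :* t ⊜ :1 ⇒
      s ∙ F :* W ⊜ π :* h ⇒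
      F ⊜ π :* (h :* s :+ F :* t)) ≡.refl

  -- A polynomial with unit value at x is comaximal with X - x by division with remainder, and
  -- comaximality is multiplicative.
  coprime : ∀ W xs → All (λ x → Units.IsUnit R (Hom.⟨_⟩ (evalAt x) W)) xs → ∃ λ s → ∃ λ t → W * s + ∏ xs * t ≈ 1#
  coprime W []       []             = 0# , 1# , prove 1 (λ W → W :* con 0 :+ :1 :* :1 ⊜ :1) ≡.refl W
  coprime W (x ∷ xs) ((i , e) ∷ us) with divide x W | coprime W xs us
  ... | q , W≈ | s′ , t′ , e′ = _ , _ ,
    coprime-product W (X - constant x) (∏ xs) (constant i) (- (q * constant i)) s′ t′
      (coprime-factor W (constant i) (X - constant x) q (constant (Hom.⟨_⟩ (evalAt x) W)) W≈
        (trans (sym (Hom.*-homo constantHom (Hom.⟨_⟩ (evalAt x) W) i)) (∷-cong e refl)))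
      e′

  cancel-coprime : ∀ F W xs {h} → All (λ x → Units.IsUnit R (Hom.⟨_⟩ (evalAt x) W)) xs → F * W ≈ ∏ xs * h →
                   ∃ λ h′ → F ≈ ∏ xs * h′
  cancel-coprime F W xs {h} us e with coprime W xs us
  ... | s , t , e′ = _ , coprime-divides F W (∏ xs) h s t e′ e

module FibreFactors {c ℓ} (R : CommutativeRing c ℓ) {A B : CommutativeRing.Carrier R}
  (nonsingular : Nonsingular R A B) (C : CoordinateRing R A B)
  (k : ℕ) {xQ yQ : CommutativeRing.Carrier R} (on-curveQ : IsPoint R A B xQ yQ) where
  open Polynomials R using (constant; polyRing) renaming (X to 𝕏)
  open PolynomialFactors R
  open SyntheticDivision R using (evalAt)
  open CoordinateRing C
  open IdealProducts R C
  open FibreDivisibility R nonsingular C k on-curveQ using (Lies; fibre-divides)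
  private
    module FD = FibreDivisibility R nonsingular C k on-curveQ
    module R = CommutativeRing R
    module E where
      open CommutativeRing E public
      open Power E public
    module ι = Hom ι
    module inX = Hom inX
  open CommutativeRing polyRing hiding (zero)
  open Power polyRing
  open XOnly polyRing (constant A) (constant B) 𝕏

  fibre : Carrier
  fibre = φ k - constant xQ * ψ² (1 ℕ.+ k)

  private
    fibre-image : inX.⟨ fibre ⟩ E.≈ FD.F
    fibre-image = homo inX 3 (λ a b c → a :- b :* c) {φ k ∷ constant xQ ∷ ψ² (1 ℕ.+ k) ∷ []}
      (φ-homo inX (inX-ι A) (inX-ι B) inX-X k ∷ inX-ι xQ ∷ ψ²-homo inX (inX-ι A) (inX-ι B) inX-X (1 ℕ.+ k) ∷ [])

    ∏-image : ∀ L → inX.⟨ ∏ (map xOf L) ⟩ E.≈ Π L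
    ∏-image []      = inX.1-homo
    ∏-image (P ∷ L) = homo inX 3 (λ X x π → (X :- x) :* π) {𝕏 ∷ constant (xOf P) ∷ ∏ (map xOf L) ∷ []}
      (inX-X ∷ inX-ι (xOf P) ∷ ∏-image L ∷ [])

    sixth-power : ∀ a → (a E.^ 2) E.^ 3 E.≈ a E.^ 6
    sixth-power = Solver.prove E 1 (λ a → (a :^ 2) :^ 3 ⊜ a :^ 6) ≡.refl

    weight-image : inX.⟨ ψ² (1 ℕ.+ k) ^ 3 ⟩ E.≈ _ E.^ 6
    weight-image = E.trans (homo inX 1 (λ a → a :^ 3) {ψ² (1 ℕ.+ k) ∷ []}
        (E.trans (ψ²-homo inX (inX-ι A) (inX-ι B) inX-X (1 ℕ.+ k))
                 (E.sym (XOnly.ψ²≈ E ι.⟨ A ⟩ ι.⟨ B ⟩ X on-curve (1 ℕ.+ k))) ∷ []))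
      (sixth-power _)

    weight-unit : ∀ P → Lies P → Units.IsUnit R (Hom.⟨_⟩ (evalAt (xOf P)) (ψ² (1 ℕ.+ k) ^ 3))
    weight-unit ((x , y) , P) M = Units.unit-≈ R
      (R.sym (homo (evalAt x) 1 (λ a → a :^ 3) {ψ² (1 ℕ.+ k) ∷ []} {XOnly.ψ² R A B x (1 ℕ.+ k) ∷ []}
        (ψ²-homo (evalAt x) (Evaluation.ev-constant (idHom R) x A) (Evaluation.ev-constant (idHom R) x B)
          (Evaluation.ev-X (idHom R) x) (1 ℕ.+ k) ∷ [])))
      (Units.unit-^ R 3 (Units.unit-≈ R (XOnly.ψ²≈ R A B x P (1 ℕ.+ k)) (Units.unit-^ R 2 (IsMultiple.ψ-unit M))))

  -- At the abscissa of a point with nP = Q finite, ψₙ² is a unit. Its cube is therefore coprime to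
  -- the product of linear factors and can be cancelled.
  fibre-factors : ∀ L → AllPairs Comaximal L → All Lies L → ∃ λ h → fibre ≈ ∏ (map xOf L) * h
  fibre-factors L pairs lies = cancel-coprime fibre (ψ² (1 ℕ.+ k) ^ 3) (map xOf L) {proj₁ divided}
    (Allₚ.map⁺ (All.map (λ {P} → weight-unit P) lies)) (proj₂ divided)
    where
    divided : ∃ λ h → fibre * ψ² (1 ℕ.+ k) ^ 3 ≈ ∏ (map xOf L) * h
    divided = divides (fibre * ψ² (1 ℕ.+ k) ^ 3) (∏ (map xOf L)) _
      (E.trans (inX.*-homo fibre (ψ² (1 ℕ.+ k) ^ 3)) (E.trans (E.*-cong fibre-image weight-image)
        (E.trans (proj₂ (fibre-divides L pairs lies)) (E.*-congʳ (E.sym (∏-image L))))))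

  -- For y_Q = 0 both factors of the norm are 2ωₙ, so (2ωₙ)² is a multiple of the fibre polynomial.
  -- This bounds the multiplicities of its roots when Q = -Q.
  2-torsion-norm : yQ R.≈ R.0# → ∃ λ W → e² (1 ℕ.+ k) ≈ fibre * W
  2-torsion-norm yQ≈0 = κ 4 * (fibre ^ 2 + κ 3 * fibre * constant xQ * v + (κ 3 * constant xQ ^ 2 + constant A) * v ^ 2) ,
    inX-injective (E.trans (e²-homo inX (inX-ι A) (inX-ι B) inX-X (1 ℕ.+ k))
      (E.trans (E.sym (XOnly.e²≈ E ι.⟨ A ⟩ ι.⟨ B ⟩ X on-curve (1 ℕ.+ k)))
        (E.trans (Solver.prove E 3 (λ e y ψ → :- ((con 2 :* ψ :^ 3) :^ 2 :* y :+ con 0) :* (:- :1) ∙ y ⊜ con 0 ⇒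
              e :^ 2 ⊜ (e :- con 2 :* y :* ψ :^ 3) :* (e :+ con 2 :* y :* ψ :^ 3)) ≡.refl _ ι.⟨ yQ ⟩ _
              (E.trans (ι.cong yQ≈0) ι.0-homo))
          (E.trans FD.norm (E.sym (E.trans
            (homo inX 4 (λ F x v A → F :* (con 4 :* (F :^ 2 :+ con 3 :* F :* x :* v :+ (con 3 :* x :^ 2 :+ A) :* v :^ 2)))
              {fibre ∷ constant xQ ∷ v ∷ constant A ∷ []}
              (fibre-image ∷ inX-ι xQ ∷ E.trans (ψ²-homo inX (inX-ι A) (inX-ι B) inX-X (1 ℕ.+ k))
                 (E.sym (XOnly.ψ²≈ E ι.⟨ A ⟩ ι.⟨ B ⟩ X on-curve (1 ℕ.+ k))) ∷ inX-ι A ∷ []))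
            (Solver.prove E 4 (λ F x ψ A → F :* (con 4 :* (F :^ 2 :+ con 3 :* F :* x :* ψ :^ 2 :+ (con 3 :* x :^ 2 :+ A) :* (ψ :^ 2) :^ 2))
               ⊜ con 4 :* F :* (F :^ 2 :+ con 3 :* F :* x :* ψ :^ 2 :+ (con 3 :* x :^ 2 :+ A) :* ψ :^ 4)) ≡.refl FD.F ι.⟨ xQ ⟩ _ ι.⟨ A ⟩)))))))
    where
    open Numerals polyRing
    v = ψ² (1 ℕ.+ k)

-- Degrees

-- Leading terms of polynomials whose second coefficient vanishes.
module LeadingTerms {c ℓ} (R : CommutativeRing c ℓ) where
  open CommutativeRing R hiding (zero)
  open Polynomials R
  private
    module RX = CommutativeRing polyRing

  -- degree at most d - 2
  Below : ℕ → Poly → Set ℓ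
  Below d r = ∀ k → d ℕ.≤ suc k → coeff r k ≈ 0#

  monomial : ℕ → Carrier → Poly
  monomial zero    a = a ∷ []
  monomial (suc d) a = 0# ∷ monomial d a

  -- Give x, A, B the weights 1, 2, 3. The polynomials in question are homogeneous and no parameter
  -- has weight 1, so the coefficient next to the leading one vanishes. `a` may be zero, which makes
  -- the predicate stable under sums without any test.
  Top : ℕ → Carrier → Poly → Set (c ⊔ ℓ)
  Top d a p = ∃ λ r → Below d r × p ≈ₚ monomial d a +ₚ r

  Below-≈ : ∀ {d p q} → p ≈ₚ q → Below d p → Below d q
  Below-≈ e b k d≤ = trans (sym (at e k)) (b k d≤)

  Below-+ : ∀ {d p q} → Below d p → Below d q → Below d (p +ₚ q)
  Below-+ {d} {p} {q} b b′ k d≤ = trans (coeff-+ p q k) (trans (+-cong (b k d≤) (b′ k d≤)) (+-identityˡ 0#))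

  Below-scale : ∀ {d p} a → Below d p → Below d (scale a p)
  Below-scale {d} {p} a b k d≤ = trans (coeff-scale a p k) (trans (*-congˡ (b k d≤)) (zeroʳ a))

  Below-mono : ∀ {d e p} → d ℕ.≤ e → Below d p → Below e p
  Below-mono d≤e b k e≤ = b k (ℕₚ.≤-trans d≤e e≤)

  Below-shift : ∀ {d p} → Below d p → Below (suc d) (0# ∷ p)
  Below-shift b zero    _         = refl
  Below-shift b (suc k) (s≤s d≤) = b k d≤

  Below-* : ∀ {d e} r s → Below d r → Below e s → Below (d ℕ.+ e) (r *ₚ s)
  Below-* []      s _ _  k _ = refl
  Below-* {zero} {e} r@(_ ∷ _) s b b′ k _ =
    at (RX.trans (*ₚ-cong {r} {[]} {s} {s} (mk λ i → b i z≤n) ≈ₚ-refl) ≈ₚ-refl) k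
  Below-* {suc d} {e} (a ∷ r) s b b′ =
    Below-+ {suc (d ℕ.+ e)} {scale a s} {0# ∷ (r *ₚ s)}
      (Below-mono {e} {p = scale a s} (ℕₚ.m≤n+m e (suc d)) (Below-scale {e} {s} a b′))
      (Below-shift {d ℕ.+ e} {r *ₚ s} (Below-* {d} {e} r s (λ k d≤ → b (suc k) (s≤s d≤)) b′))

  Below-monomial-* : ∀ d {e} a s → Below e s → Below (d ℕ.+ e) (monomial d a *ₚ s)
  Below-monomial-* zero    {e} a s b = Below-≈ {e} {scale a s}
    (RX.sym (RX.trans (RX.+-congˡ {scale a s} 0∷[]) (RX.+-identityʳ (scale a s)))) (Below-scale {e} {s} a b)
  Below-monomial-* (suc d) {e} a s b = Below-≈ {suc (d ℕ.+ e)} {0# ∷ (monomial d a *ₚ s)}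
    (RX.sym (shift-* (monomial d a) s)) (Below-shift {d ℕ.+ e} {monomial d a *ₚ s} (Below-monomial-* d a s b))

  monomial-scale : ∀ e a b → scale a (monomial e b) ≈ₚ monomial e (a * b)
  monomial-scale zero    a b = ≈ₚ-refl
  monomial-scale (suc e) a b = ∷-cong (zeroʳ a) (monomial-scale e a b)

  monomial-* : ∀ d e a b → monomial d a *ₚ monomial e b ≈ₚ monomial (d ℕ.+ e) (a * b)
  monomial-* zero    e a b = RX.trans (RX.+-congˡ {scale a (monomial e b)} 0∷[])
    (RX.trans (RX.+-identityʳ (scale a (monomial e b))) (monomial-scale e a b))
  monomial-* (suc d) e a b = RX.trans (shift-* (monomial d a) (monomial e b)) (∷-cong refl (monomial-* d e a b))

  monomial-+ : ∀ d a b → monomial d a +ₚ monomial d b ≈ₚ monomial d (a + b)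
  monomial-+ zero    a b = ≈ₚ-refl
  monomial-+ (suc d) a b = ∷-cong (+-identityˡ 0#) (monomial-+ d a b)

  monomial-cong : ∀ d {a b} → a ≈ b → monomial d a ≈ₚ monomial d b
  monomial-cong zero    e = ∷-cong e ≈ₚ-refl
  monomial-cong (suc d) e = ∷-cong refl (monomial-cong d e)

  monomial-0 : ∀ d → monomial d 0# ≈ₚ []
  monomial-0 zero    = 0∷[]
  monomial-0 (suc d) = RX.trans (∷-cong refl (monomial-0 d)) 0∷[]

  monomial-coeff : ∀ d a → coeff (monomial d a) d ≈ a
  monomial-coeff zero    a = refl
  monomial-coeff (suc d) a = monomial-coeff d a

  monomial-above : ∀ d a k → d ℕ.< k → coeff (monomial d a) k ≈ 0#
  monomial-above zero    a (suc k) _         = refl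
  monomial-above (suc d) a (suc k) (s≤s d<k) = monomial-above d a k d<k

  monomial-below : ∀ d a k → k ℕ.< d → coeff (monomial d a) k ≈ 0#
  monomial-below (suc d) a zero    _         = refl
  monomial-below (suc d) a (suc k) (s≤s k<d) = monomial-below d a k k<d

  private
    expand : ∀ (m n r s mn p q : Poly) → p ≈ₚ m +ₚ r → q ≈ₚ n +ₚ s → m *ₚ n ≈ₚ mn →
             p *ₚ q ≈ₚ mn +ₚ (m *ₚ s +ₚ (n *ₚ r +ₚ r *ₚ s))
    expand = Solver.prove polyRing 7 (λ m n r s mn p q → q ∙ p ⊜ m :+ r ⇒ m :+ r ∙ q ⊜ n :+ s ⇒ :1 ∙ m :* n ⊜ mn ⇒
      p :* q ⊜ mn :+ (m :* s :+ (n :* r :+ r :* s))) ≡.refl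

    collect : ∀ (m n r s mn p q : Poly) → p ≈ₚ m +ₚ r → q ≈ₚ n +ₚ s → m +ₚ n ≈ₚ mn → p +ₚ q ≈ₚ mn +ₚ (r +ₚ s)
    collect = Solver.prove polyRing 7 (λ m n r s mn p q → :1 ∙ p ⊜ m :+ r ⇒ :1 ∙ q ⊜ n :+ s ⇒ :1 ∙ m :+ n ⊜ mn ⇒
      p :+ q ⊜ mn :+ (r :+ s)) ≡.refl

  Top-* : ∀ {d e a b} p q → Top d a p → Top e b q → Top (d ℕ.+ e) (a * b) (p *ₚ q)
  Top-* {d} {e} {a} {b} p q (r , br , p≈) (s , bs , q≈) = _ ,
    Below-+ {d ℕ.+ e} {monomial d a *ₚ s} {monomial e b *ₚ r +ₚ r *ₚ s} (Below-monomial-* d a s bs)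
      (Below-+ {d ℕ.+ e} {monomial e b *ₚ r} {r *ₚ s}
        (≡.subst (λ n → Below n (monomial e b *ₚ r)) (ℕₚ.+-comm e d) (Below-monomial-* e b r br))
        (Below-* {d} {e} r s br bs)) ,
    expand (monomial d a) (monomial e b) r s _ p q p≈ q≈ (monomial-* d e a b)

  Top-+ : ∀ {d a b} p q → Top d a p → Top d b q → Top d (a + b) (p +ₚ q)
  Top-+ {d} {a} {b} p q (r , br , p≈) (s , bs , q≈) = r +ₚ s , Below-+ {d} {r} {s} br bs ,
    collect (monomial d a) (monomial d b) r s _ p q p≈ q≈ (monomial-+ d a b)

  Top-≈ : ∀ {d a b p q} → a ≈ b → p ≈ₚ q → Top d a p → Top d b q
  Top-≈ {d} e f (r , br , p≈) = r , br , RX.trans (RX.sym f) (RX.trans p≈ (RX.+-congʳ (monomial-cong d e)))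

  Top-constant : ∀ a → Top 0 a (constant a)
  Top-constant a = [] , (λ _ _ → refl) , ≈ₚ-refl

  Top-X : Top 1 1# X
  Top-X = [] , (λ _ _ → refl) , ≈ₚ-refl

  Top-κ : ∀ n → Top 0 (Numerals.κ R n) (Numerals.κ polyRing n)
  Top-κ n = Top-≈ refl (κ-hom constantHom n) (Top-constant (Numerals.κ R n))

  Top-0 : ∀ d → Top d 0# []
  Top-0 d = [] , (λ _ _ → refl) , RX.sym (RX.trans (RX.+-identityʳ _) (monomial-0 d))

  Top-neg : ∀ {d a} p → Top d a p → Top d (- a) (-ₚ p)
  Top-neg {d} {a} p t = Top-≈
    (Solver.prove R 1 (λ a → (con 0 :- :1) :* a ⊜ :- a) ≡.refl a)
    (Solver.prove polyRing 1 (λ a → (con 0 :- :1) :* a ⊜ :- a) ≡.refl p)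
    (Top-* (-ₚ constant 1#) p (Top-≈ (sym (+-identityˡ (- 1#))) ≈ₚ-refl (Top-constant (- 1#))) t)

  -- A term at least two degrees lower can be absorbed in the remainder; this disposes of every term
  -- containing A or B.
  Top-raise : ∀ {e b} j q → Top e b q → Top (2 ℕ.+ j ℕ.+ e) 0# q
  Top-raise {e} {b} j q (s , bs , q≈) = q , q-below ,
    RX.sym (RX.trans (RX.+-congʳ (monomial-0 (2 ℕ.+ j ℕ.+ e))) (RX.+-identityˡ q))
    where
    q-below : Below (2 ℕ.+ j ℕ.+ e) q
    q-below k (s≤s le) = trans (at q≈ k) (trans (coeff-+ (monomial e b) s k)
      (trans (+-cong (monomial-above e b k e<k) (bs k (ℕₚ.≤-trans (ℕₚ.<⇒≤ e<k) (ℕₚ.n≤1+n k)))) (+-identityˡ 0#)))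
      where
      e<k : e ℕ.< k
      e<k = ℕₚ.≤-trans (s≤s (ℕₚ.m≤n+m e j)) le

  top-coeff : ∀ {d a p} → Top d a p → coeff p d ≈ a
  top-coeff {d} {a} (r , br , p≈) = trans (at p≈ d) (trans (coeff-+ (monomial d a) r d)
    (trans (+-cong (monomial-coeff d a) (br d (ℕₚ.n≤1+n d))) (+-identityʳ a)))

  above-top : ∀ {d a p} k → d ℕ.< k → Top d a p → coeff p k ≈ 0#
  above-top {d} {a} k d<k (r , br , p≈) = trans (at p≈ k) (trans (coeff-+ (monomial d a) r k)
    (trans (+-cong (monomial-above d a k d<k) (br k (ℕₚ.≤-trans (ℕₚ.<⇒≤ d<k) (ℕₚ.n≤1+n k)))) (+-identityʳ 0#)))

  second-coeff : ∀ {d a p} → Top (suc d) a p → coeff p d ≈ 0#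
  second-coeff {d} {a} (r , br , p≈) = trans (at p≈ d) (trans (coeff-+ (monomial (suc d) a) r d)
    (trans (+-cong (monomial-below (suc d) a d ℕₚ.≤-refl) (br d ℕₚ.≤-refl)) (+-identityʳ 0#)))

-- Twice the degree is n² - 1 for odd n and n² - 4 for even n > 0.
module Degrees where

  private
    e₅ : ∀ i → 6 ℕ.+ (2 ℕ.* (suc i ℕ.* (2 ℕ.+ suc i)) ℕ.+ (2 ℕ.* (i ℕ.* (2 ℕ.+ i)) ℕ.+ (2 ℕ.* (i ℕ.* (2 ℕ.+ i)) ℕ.+ 2 ℕ.* (i ℕ.* (2 ℕ.+ i)))))
        ≡ 2 ℕ.* ((2 ℕ.+ (i ℕ.+ i)) ℕ.* suc (2 ℕ.+ (i ℕ.+ i)))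
    e₅ = solve-∀
    e₅′ : ∀ i → 2 ℕ.* (i ℕ.* suc i) ℕ.+ (2 ℕ.* (suc i ℕ.* suc (suc i)) ℕ.+ (2 ℕ.* (suc i ℕ.* suc (suc i)) ℕ.+ 2 ℕ.* (suc i ℕ.* suc (suc i))))
        ≡ 2 ℕ.* ((2 ℕ.+ (i ℕ.+ i)) ℕ.* suc (2 ℕ.+ (i ℕ.+ i)))
    e₅′ = solve-∀
    e₇ : ∀ i → 2 ℕ.* (suc (suc i) ℕ.* suc (suc (suc i))) ℕ.+ (2 ℕ.* (suc i ℕ.* suc (suc i)) ℕ.+ (2 ℕ.* (suc i ℕ.* suc (suc i)) ℕ.+ 2 ℕ.* (suc i ℕ.* suc (suc i))))
        ≡ 2 ℕ.* ((3 ℕ.+ (i ℕ.+ i)) ℕ.* suc (3 ℕ.+ (i ℕ.+ i)))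
    e₇ = solve-∀
    e₇′ : ∀ i → 6 ℕ.+ (2 ℕ.* (i ℕ.* (2 ℕ.+ i)) ℕ.+ (2 ℕ.* (suc i ℕ.* (2 ℕ.+ suc i)) ℕ.+ (2 ℕ.* (suc i ℕ.* (2 ℕ.+ suc i)) ℕ.+ 2 ℕ.* (suc i ℕ.* (2 ℕ.+ suc i)))))
        ≡ 2 ℕ.* ((3 ℕ.+ (i ℕ.+ i)) ℕ.* suc (3 ℕ.+ (i ℕ.+ i)))
    e₇′ = solve-∀
    e₆′ : ∀ i → 2 ℕ.* (suc (suc i) ℕ.* suc (suc (suc i))) ℕ.+ (2 ℕ.* (i ℕ.* (2 ℕ.+ i)) ℕ.+ 2 ℕ.* (i ℕ.* (2 ℕ.+ i)))
      ≡ 2 ℕ.* (i ℕ.* suc i) ℕ.+ (2 ℕ.* (suc i ℕ.* (2 ℕ.+ suc i)) ℕ.+ 2 ℕ.* (suc i ℕ.* (2 ℕ.+ suc i)))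
    e₆′ = solve-∀
    e₆ : ∀ i → 2 ℕ.* (suc i ℕ.* suc (suc i)) ℕ.+ (2 ℕ.* (suc (suc i) ℕ.* suc (suc (suc i))) ℕ.+ (2 ℕ.* (i ℕ.* (2 ℕ.+ i)) ℕ.+ 2 ℕ.* (i ℕ.* (2 ℕ.+ i))))
      ≡ 2 ℕ.* ((2 ℕ.+ (i ℕ.+ i)) ℕ.* (2 ℕ.+ (2 ℕ.+ (i ℕ.+ i))))
    e₆ = solve-∀
    e₈′ : ∀ i → 2 ℕ.* (suc (suc i) ℕ.* (2 ℕ.+ suc (suc i))) ℕ.+ (2 ℕ.* (suc i ℕ.* suc (suc i)) ℕ.+ 2 ℕ.* (suc i ℕ.* suc (suc i)))
      ≡ 2 ℕ.* (i ℕ.* (2 ℕ.+ i)) ℕ.+ (2 ℕ.* (suc (suc i) ℕ.* suc (suc (suc i))) ℕ.+ 2 ℕ.* (suc (suc i) ℕ.* suc (suc (suc i))))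
    e₈′ = solve-∀
    e₈ : ∀ i → 2 ℕ.* (suc i ℕ.* (2 ℕ.+ suc i)) ℕ.+ (2 ℕ.* (suc (suc i) ℕ.* (2 ℕ.+ suc (suc i))) ℕ.+ (2 ℕ.* (suc i ℕ.* suc (suc i)) ℕ.+ 2 ℕ.* (suc i ℕ.* suc (suc i))))
      ≡ 2 ℕ.* ((3 ℕ.+ (i ℕ.+ i)) ℕ.* (2 ℕ.+ (3 ℕ.+ (i ℕ.+ i))))
    e₈ = solve-∀
    o : ∀ i → suc (2 ℕ.* (suc i ℕ.* suc (suc i)) ℕ.+ 2 ℕ.* (suc i ℕ.* suc (suc i))) ≡ suc (suc i ℕ.+ suc i) ℕ.* suc (suc i ℕ.+ suc i)
    o = solve-∀
    o′ : ∀ i → 3 ℕ.+ (2 ℕ.* (suc i ℕ.* (2 ℕ.+ suc i)) ℕ.+ 2 ℕ.* (i ℕ.* (2 ℕ.+ i))) ≡ suc (suc i ℕ.+ suc i) ℕ.* suc (suc i ℕ.+ suc i)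
    o′ = solve-∀
    v : ∀ i → suc (3 ℕ.+ (2 ℕ.* (i ℕ.* (2 ℕ.+ i)) ℕ.+ 2 ℕ.* (i ℕ.* (2 ℕ.+ i)))) ≡ suc (suc (i ℕ.+ i)) ℕ.* suc (suc (i ℕ.+ i))
    v = solve-∀
    v′ : ∀ i → 2 ℕ.* (suc i ℕ.* suc (suc i)) ℕ.+ 2 ℕ.* (i ℕ.* suc i) ≡ suc (suc (i ℕ.+ i)) ℕ.* suc (suc (i ℕ.+ i))
    v′ = solve-∀

  abstract
    degree : ℕ × Bool → ℕ
    degree (i     , false) = 2 ℕ.* (i ℕ.* suc i)
    degree (zero  , true)  = 0
    degree (suc i , true)  = 2 ℕ.* (i ℕ.* (2 ℕ.+ i))

    degree-0 : degree (0 , true) ≡ 0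
    degree-0 = ≡.refl
    degree-1 : degree (0 , false) ≡ 0
    degree-1 = ≡.refl
    degree-2 : degree (1 , true) ≡ 0
    degree-2 = ≡.refl
    degree-3 : degree (1 , false) ≡ 4
    degree-3 = ≡.refl
    degree-4 : degree (2 , true) ≡ 6
    degree-4 = ≡.refl

    degree-5+4i : ∀ i → 6 ℕ.+ (degree (suc (suc i) , true) ℕ.+ (degree (suc i , true) ℕ.+ (degree (suc i , true) ℕ.+ degree (suc i , true))))
      ≡ degree (2 ℕ.+ (i ℕ.+ i) , false)
    degree-5+4i = e₅
    degree-5+4i′ : ∀ i → degree (i , false) ℕ.+ (degree (suc i , false) ℕ.+ (degree (suc i , false) ℕ.+ degree (suc i , false)))
      ≡ degree (2 ℕ.+ (i ℕ.+ i) , false)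
    degree-5+4i′ = e₅′
    degree-7+4i : ∀ i → degree (suc (suc i) , false) ℕ.+ (degree (suc i , false) ℕ.+ (degree (suc i , false) ℕ.+ degree (suc i , false)))
      ≡ degree (3 ℕ.+ (i ℕ.+ i) , false)
    degree-7+4i = e₇
    degree-7+4i′ : ∀ i → 6 ℕ.+ (degree (suc i , true) ℕ.+ (degree (suc (suc i) , true) ℕ.+ (degree (suc (suc i) , true) ℕ.+ degree (suc (suc i) , true))))
      ≡ degree (3 ℕ.+ (i ℕ.+ i) , false)
    degree-7+4i′ = e₇′
    degree-6+4i′ : ∀ i → degree (suc (suc i) , false) ℕ.+ (degree (suc i , true) ℕ.+ degree (suc i , true))
      ≡ degree (i , false) ℕ.+ (degree (suc (suc i) , true) ℕ.+ degree (suc (suc i) , true))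
    degree-6+4i′ = e₆′
    degree-6+4i : ∀ i → degree (suc i , false) ℕ.+ (degree (suc (suc i) , false) ℕ.+ (degree (suc i , true) ℕ.+ degree (suc i , true)))
      ≡ degree (3 ℕ.+ (i ℕ.+ i) , true)
    degree-6+4i = e₆
    degree-8+4i′ : ∀ i → degree (suc (suc (suc i)) , true) ℕ.+ (degree (suc i , false) ℕ.+ degree (suc i , false))
      ≡ degree (suc i , true) ℕ.+ (degree (suc (suc i) , false) ℕ.+ degree (suc (suc i) , false))
    degree-8+4i′ = e₈′
    degree-8+4i : ∀ i → degree (suc (suc i) , true) ℕ.+ (degree (suc (suc (suc i)) , true) ℕ.+ (degree (suc i , false) ℕ.+ degree (suc i , false)))
      ≡ degree (4 ℕ.+ (i ℕ.+ i) , true)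
    degree-8+4i = e₈
    degree-odd : ∀ i → suc (degree (suc i , false) ℕ.+ degree (suc i , false)) ≡ suc (suc i ℕ.+ suc i) ℕ.* suc (suc i ℕ.+ suc i)
    degree-odd = o
    degree-odd′ : ∀ i → 3 ℕ.+ (degree (suc (suc i) , true) ℕ.+ degree (suc i , true)) ≡ suc (suc i ℕ.+ suc i) ℕ.* suc (suc i ℕ.+ suc i)
    degree-odd′ = o′
    degree-even : ∀ i → suc (3 ℕ.+ (degree (suc i , true) ℕ.+ degree (suc i , true))) ≡ suc (suc (i ℕ.+ i)) ℕ.* suc (suc (i ℕ.+ i))
    degree-even = v
    degree-even′ : ∀ i → degree (suc i , false) ℕ.+ degree (i , false) ≡ suc (suc (i ℕ.+ i)) ℕ.* suc (suc (i ℕ.+ i))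
    degree-even′ = v′

module DivisionDegrees {c ℓ} (R : CommutativeRing c ℓ) (A B : CommutativeRing.Carrier R) where
  open CommutativeRing R hiding (zero)
  open Numerals R
  open Polynomials R
  open LeadingTerms R
  open Degrees
  open DivisionPolynomials polyRing (constant A) (constant B) X
  open XOnly polyRing (constant A) (constant B) X
  open Solver R
  private
    module RX where
      open CommutativeRing polyRing public
      open Power polyRing public
      open Numerals polyRing public
    open Power R
    -- The leading coefficients obey the recursion of the values at x = 1 for A = B = 0.
    module V = DivisionPolynomials R 0# 0# 1#

  Top-² : ∀ {d a} p → Top d a p → Top (d ℕ.+ d) (a ^ 2) (p RX.^ 2)
  Top-² p t = Top-* p p t t

  Top-³ : ∀ {d a} p → Top d a p → Top (d ℕ.+ (d ℕ.+ d)) (a ^ 3) (p RX.^ 3)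
  Top-³ p t = Top-* p (p RX.^ 2) t (Top-² p t)

  h-top : Top 3 V.h h
  h-top = Top-* (RX.κ 4) f (Top-κ 4)
    (Top-+ (X RX.* X RX.* X RX.+ constant A RX.* X) (constant B)
      (Top-+ (X RX.* X RX.* X) (constant A RX.* X)
        (Top-* (X RX.* X) X (Top-* X X Top-X Top-X) Top-X)
        (Top-≈ (sym (zeroˡ 1#)) RX.refl (Top-raise 0 (constant A RX.* X) (Top-* (constant A) X (Top-constant A) Top-X))))
      (Top-raise 1 (constant B) (Top-constant B)))

  γ-top : Top 4 V.γ γ
  γ-top = Top-+ (RX.κ 3 RX.* X RX.^ 4 RX.+ RX.κ 6 RX.* constant A RX.* X RX.^ 2 RX.+ RX.κ 12 RX.* constant B RX.* X) (RX.- (constant A RX.^ 2))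
    (Top-+ (RX.κ 3 RX.* X RX.^ 4 RX.+ RX.κ 6 RX.* constant A RX.* X RX.^ 2) (RX.κ 12 RX.* constant B RX.* X)
      (Top-+ (RX.κ 3 RX.* X RX.^ 4) (RX.κ 6 RX.* constant A RX.* X RX.^ 2)
        (Top-* (RX.κ 3) (X RX.^ 4) (Top-κ 3) (Top-* X (X RX.^ 3) Top-X (Top-³ X Top-X)))
        (Top-≈ (prove 0 (con 0 ⊜ con 6 :* con 0 :* :1 :^ 2) ≡.refl) RX.refl
          (Top-raise 0 (RX.κ 6 RX.* constant A RX.* X RX.^ 2)
            (Top-* (RX.κ 6 RX.* constant A) (X RX.^ 2) (Top-* (RX.κ 6) (constant A) (Top-κ 6) (Top-constant A)) (Top-² X Top-X)))))
      (Top-≈ (prove 0 (con 0 ⊜ con 12 :* con 0 :* :1) ≡.refl) RX.refl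
        (Top-raise 1 (RX.κ 12 RX.* constant B RX.* X)
          (Top-* (RX.κ 12 RX.* constant B) X (Top-* (RX.κ 12) (constant B) (Top-κ 12) (Top-constant B)) Top-X))))
    (Top-≈ (prove 0 (con 0 ⊜ :- (con 0 :^ 2)) ≡.refl) RX.refl
      (Top-raise 2 (RX.- (constant A RX.^ 2)) (Top-neg (constant A RX.^ 2) (Top-² (constant A) (Top-constant A)))))

  c-top : Top 2 V.c# c#
  c-top = Top-* (RX.κ 2) (RX.κ 3 RX.* X RX.^ 2 RX.+ constant A) (Top-κ 2)
    (Top-+ (RX.κ 3 RX.* X RX.^ 2) (constant A) (Top-* (RX.κ 3) (X RX.^ 2) (Top-κ 3) (Top-² X Top-X))
      (Top-raise 0 (constant A) (Top-constant A)))

  Top-degree : ∀ {d e a} p → d ≡ e → Top d a p → Top e a p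
  Top-degree p ≡.refl t = t

  Top-difference : ∀ {d e a b} p q → d ≡ e → Top d a p → Top e b q → Top d (a - b) (p RX.- q)
  Top-difference p q ≡.refl s t = Top-+ p (RX.- q) s (Top-neg q t)

  Leading : ℕ → Set (c ⊔ ℓ)
  Leading n = Top (degree (half n)) (V.p n) (p n)

  private
    odd-true : ∀ i {a₄ a₃ a₂ a₁} p₄ p₃ p₂ p₁ → Top (degree (suc (suc i) , true)) a₄ p₄ → Top (degree (suc i , false)) a₃ p₃ →
      Top (degree (suc i , true)) a₂ p₂ → Top (degree (i , false)) a₁ p₁ →
      Top (degree (2 ℕ.+ (i ℕ.+ i) , false)) (V.odd-step true a₄ a₃ a₂ a₁) (odd-step true p₄ p₃ p₂ p₁)
    odd-true i p₄ p₃ p₂ p₁ t₄ t₃ t₂ t₁ = Top-degree (odd-step true p₄ p₃ p₂ p₁) (degree-5+4i i)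
      (Top-difference (h RX.^ 2 RX.* (p₄ RX.* p₂ RX.^ 3)) (p₁ RX.* p₃ RX.^ 3) (≡.trans (degree-5+4i i) (≡.sym (degree-5+4i′ i)))
        (Top-* (h RX.^ 2) (p₄ RX.* p₂ RX.^ 3) (Top-² h h-top) (Top-* p₄ (p₂ RX.^ 3) t₄ (Top-³ p₂ t₂)))
        (Top-* p₁ (p₃ RX.^ 3) t₁ (Top-³ p₃ t₃)))

    odd-false : ∀ i {a₄ a₃ a₂ a₁} p₄ p₃ p₂ p₁ → Top (degree (suc (suc i) , false)) a₄ p₄ → Top (degree (suc (suc i) , true)) a₃ p₃ →
      Top (degree (suc i , false)) a₂ p₂ → Top (degree (suc i , true)) a₁ p₁ →
      Top (degree (3 ℕ.+ (i ℕ.+ i) , false)) (V.odd-step false a₄ a₃ a₂ a₁) (odd-step false p₄ p₃ p₂ p₁)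
    odd-false i p₄ p₃ p₂ p₁ t₄ t₃ t₂ t₁ = Top-degree (odd-step false p₄ p₃ p₂ p₁) (degree-7+4i i)
      (Top-difference (p₄ RX.* p₂ RX.^ 3) (h RX.^ 2 RX.* (p₁ RX.* p₃ RX.^ 3)) (≡.trans (degree-7+4i i) (≡.sym (degree-7+4i′ i)))
        (Top-* p₄ (p₂ RX.^ 3) t₄ (Top-³ p₂ t₂))
        (Top-* (h RX.^ 2) (p₁ RX.* p₃ RX.^ 3) (Top-² h h-top) (Top-* p₁ (p₃ RX.^ 3) t₁ (Top-³ p₃ t₃))))

    even-top : ∀ {d₅ d₄ d₃ d₂ d₁ d a₅ a₄ a₃ a₂ a₁} p₅ p₄ p₃ p₂ p₁ → d₅ ℕ.+ (d₂ ℕ.+ d₂) ≡ d₁ ℕ.+ (d₄ ℕ.+ d₄) →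
      d₃ ℕ.+ (d₅ ℕ.+ (d₂ ℕ.+ d₂)) ≡ d →
      Top d₅ a₅ p₅ → Top d₄ a₄ p₄ → Top d₃ a₃ p₃ → Top d₂ a₂ p₂ → Top d₁ a₁ p₁ →
      Top d (V.even-step a₅ a₄ a₃ a₂ a₁) (even-step p₅ p₄ p₃ p₂ p₁)
    even-top p₅ p₄ p₃ p₂ p₁ same total t₅ t₄ t₃ t₂ t₁ = Top-degree (even-step p₅ p₄ p₃ p₂ p₁) total
      (Top-* p₃ (p₅ RX.* p₂ RX.^ 2 RX.- p₁ RX.* p₄ RX.^ 2) t₃
        (Top-difference (p₅ RX.* p₂ RX.^ 2) (p₁ RX.* p₄ RX.^ 2) same (Top-* p₅ (p₂ RX.^ 2) t₅ (Top-² p₂ t₂)) (Top-* p₁ (p₄ RX.^ 2) t₁ (Top-² p₄ t₄))))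

    next₁ next₂ next₃ next₄ next₅ : ℕ × Bool → ℕ × Bool
    next₁ = half-next
    next₂ hn = half-next (next₁ hn)
    next₃ hn = half-next (next₂ hn)
    next₄ hn = half-next (next₃ hn)
    next₅ hn = half-next (next₄ hn)

    odd-core : ∀ j → Halving j → ∀ {a₄ a₃ a₂ a₁} p₄ p₃ p₂ p₁ →
      Top (degree (next₁ (half j))) a₁ p₁ → Top (degree (next₂ (half j))) a₂ p₂ →
      Top (degree (next₃ (half j))) a₃ p₃ → Top (degree (next₄ (half j))) a₄ p₄ →
      Top (degree (2 ℕ.+ j , false)) (V.odd-step (even? j) a₄ a₃ a₂ a₁) (odd-step (even? j) p₄ p₃ p₂ p₁)
    odd-core .(i ℕ.+ i) (double i) = go (half-double i) (even?-double i)
      where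
      go : ∀ {hn b} → hn ≡ (i , true) → b ≡ true → ∀ {a₄ a₃ a₂ a₁} p₄ p₃ p₂ p₁ →
        Top (degree (next₁ hn)) a₁ p₁ → Top (degree (next₂ hn)) a₂ p₂ →
        Top (degree (next₃ hn)) a₃ p₃ → Top (degree (next₄ hn)) a₄ p₄ →
        Top (degree (2 ℕ.+ (i ℕ.+ i) , false)) (V.odd-step b a₄ a₃ a₂ a₁) (odd-step b p₄ p₃ p₂ p₁)
      go ≡.refl ≡.refl p₄ p₃ p₂ p₁ t₁ t₂ t₃ t₄ = odd-true i p₄ p₃ p₂ p₁ t₄ t₃ t₂ t₁
    odd-core .(suc (i ℕ.+ i)) (suc-double i) = go (half-suc-double i) (≡.cong not (even?-double i))
      where
      go : ∀ {hn b} → hn ≡ (i , false) → b ≡ false → ∀ {a₄ a₃ a₂ a₁} p₄ p₃ p₂ p₁ →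
        Top (degree (next₁ hn)) a₁ p₁ → Top (degree (next₂ hn)) a₂ p₂ →
        Top (degree (next₃ hn)) a₃ p₃ → Top (degree (next₄ hn)) a₄ p₄ →
        Top (degree (3 ℕ.+ (i ℕ.+ i) , false)) (V.odd-step b a₄ a₃ a₂ a₁) (odd-step b p₄ p₃ p₂ p₁)
      go ≡.refl ≡.refl p₄ p₃ p₂ p₁ t₁ t₂ t₃ t₄ = odd-false i p₄ p₃ p₂ p₁ t₄ t₃ t₂ t₁

    even-core : ∀ j → Halving j → ∀ {a₅ a₄ a₃ a₂ a₁} p₅ p₄ p₃ p₂ p₁ →
      Top (degree (next₁ (half j))) a₁ p₁ → Top (degree (next₂ (half j))) a₂ p₂ → Top (degree (next₃ (half j))) a₃ p₃ →
      Top (degree (next₄ (half j))) a₄ p₄ → Top (degree (next₅ (half j))) a₅ p₅ →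
      Top (degree (3 ℕ.+ j , true)) (V.even-step a₅ a₄ a₃ a₂ a₁) (even-step p₅ p₄ p₃ p₂ p₁)
    even-core .(i ℕ.+ i) (double i) = go (half-double i)
      where
      go : ∀ {hn} → hn ≡ (i , true) → ∀ {a₅ a₄ a₃ a₂ a₁} p₅ p₄ p₃ p₂ p₁ →
        Top (degree (next₁ hn)) a₁ p₁ → Top (degree (next₂ hn)) a₂ p₂ → Top (degree (next₃ hn)) a₃ p₃ →
        Top (degree (next₄ hn)) a₄ p₄ → Top (degree (next₅ hn)) a₅ p₅ →
        Top (degree (3 ℕ.+ (i ℕ.+ i) , true)) (V.even-step a₅ a₄ a₃ a₂ a₁) (even-step p₅ p₄ p₃ p₂ p₁)
      go ≡.refl p₅ p₄ p₃ p₂ p₁ t₁ t₂ t₃ t₄ t₅ = even-top p₅ p₄ p₃ p₂ p₁ (degree-6+4i′ i) (degree-6+4i i) t₅ t₄ t₃ t₂ t₁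
    even-core .(suc (i ℕ.+ i)) (suc-double i) = go (half-suc-double i)
      where
      go : ∀ {hn} → hn ≡ (i , false) → ∀ {a₅ a₄ a₃ a₂ a₁} p₅ p₄ p₃ p₂ p₁ →
        Top (degree (next₁ hn)) a₁ p₁ → Top (degree (next₂ hn)) a₂ p₂ → Top (degree (next₃ hn)) a₃ p₃ →
        Top (degree (next₄ hn)) a₄ p₄ → Top (degree (next₅ hn)) a₅ p₅ →
        Top (degree (4 ℕ.+ (i ℕ.+ i) , true)) (V.even-step a₅ a₄ a₃ a₂ a₁) (even-step p₅ p₄ p₃ p₂ p₁)
      go ≡.refl p₅ p₄ p₃ p₂ p₁ t₁ t₂ t₃ t₄ t₅ = even-top p₅ p₄ p₃ p₂ p₁ (degree-8+4i′ i) (degree-8+4i i) t₅ t₄ t₃ t₂ t₁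

    odd-leading : ∀ j → Leading (1 ℕ.+ j) → Leading (2 ℕ.+ j) → Leading (3 ℕ.+ j) → Leading (4 ℕ.+ j) → Leading (5 ℕ.+ (j ℕ.+ j))
    odd-leading j t₁ t₂ t₃ t₄ = Top-degree (p (5 ℕ.+ (j ℕ.+ j))) (≡.cong (λ hn → degree (next₅ hn)) (≡.sym (half-double j)))
      (≡.subst₂ (Top (degree (2 ℕ.+ j , false))) (≡.sym (V.p-odd j)) (≡.sym (p-odd j))
        (odd-core j (halve j) (p (4 ℕ.+ j)) (p (3 ℕ.+ j)) (p (2 ℕ.+ j)) (p (1 ℕ.+ j)) t₁ t₂ t₃ t₄))

    even-leading : ∀ j → Leading (1 ℕ.+ j) → Leading (2 ℕ.+ j) → Leading (3 ℕ.+ j) → Leading (4 ℕ.+ j) → Leading (5 ℕ.+ j) →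
                   Leading (6 ℕ.+ (j ℕ.+ j))
    even-leading j t₁ t₂ t₃ t₄ t₅ = Top-degree (p (6 ℕ.+ (j ℕ.+ j))) (≡.cong (λ hn → degree (half-next (next₅ hn))) (≡.sym (half-double j)))
      (≡.subst₂ (Top (degree (3 ℕ.+ j , true))) (≡.sym (V.p-even j)) (≡.sym (p-even j))
        (even-core j (halve j) (p (5 ℕ.+ j)) (p (4 ℕ.+ j)) (p (3 ℕ.+ j)) (p (2 ℕ.+ j)) (p (1 ℕ.+ j)) t₁ t₂ t₃ t₄ t₅))

  leading : ∀ n → Leading n
  leading = doubling-induction Leading
    (Top-degree (p 0) (≡.sym degree-0) (Top-0 0))
    (Top-degree (p 1) (≡.sym degree-1) (Top-constant 1#))
    (Top-degree (p 2) (≡.sym degree-2) (Top-constant 1#))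
    (Top-degree γ (≡.sym degree-3) γ-top)
    (Top-degree (p 4) (≡.sym degree-4) (Top-difference (c# RX.* γ) (h RX.^ 2) ≡.refl (Top-* c# γ c-top γ-top) (Top-² h h-top)))
    odd-leading even-leading

  open DivisionValues R using (value; p-value)

  leading-value : ∀ n → Top (degree (half n)) (value (half n)) (p n)
  leading-value n = Top-≈ (p-value n) RX.refl (leading n)

  private
    Tops : ℕ → Set (c ⊔ ℓ)
    Tops k = (∃ λ M → suc M ≡ suc k ℕ.* suc k × Top M (κ (suc k ℕ.* suc k)) (ψ² (suc k)))
           × Top (suc k ℕ.* suc k) 1# (φ k)

    odd-square : ∀ t k →
      k ≈ t + t →
      (1# + (t + t)) * (1# + (t + t)) ≈ (1# + k) * (1# + k)
    odd-square = prove 2 (λ t k →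
      con 0 :- (:1 :+ k) :- (:1 :+ t :+ t) ∙ k ⊜ t :+ t ⇒
      (:1 :+ (t :+ t)) :* (:1 :+ (t :+ t)) ⊜ (:1 :+ k) :* (:1 :+ k)) ≡.refl

    even-square : ∀ t k →
      k ≈ 1# + (t + t) →
      κ 4 * (1# * 1# * 1# + 0# * 1# + 0#) * ((1# + t) * (1# + t)) ≈ (1# + k) * (1# + k)
    even-square = prove 2 (λ t k →
      con 0 :- (:1 :+ k) :- (con 2 :+ t :+ t) ∙ k ⊜ :1 :+ (t :+ t) ⇒
      con 4 :* (:1 :* :1 :* :1 :+ con 0 :* :1 :+ con 0) :* ((:1 :+ t) :* (:1 :+ t)) ⊜ (:1 :+ k) :* (:1 :+ k)) ≡.refl

    -- With n = 1 + k, the leading coefficient of φₙ is n² - (n+1)(n-1) = 1. For even index `value`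
    -- is halved, and the 4 in `h` compensates for it.
    tops : ∀ k → Halving k → Tops k
    tops .(0 ℕ.+ 0) (double 0) =
      (0 , ≡.refl , Top-≈ (prove 0 (:1 :* :1 ⊜ con 1) ≡.refl) RX.refl (Top-* (p 1) (p 1) (Top-constant 1#) (Top-constant 1#))) ,
      Top-≈ refl (Solver.prove polyRing 2 (λ X h → X ⊜ X :* (:1 :* :1) :- h :* (:1 :* con 0)) ≡.refl X h) Top-X
    tops .(suc i ℕ.+ suc i) (double (suc i)) = go (half-double (suc i)) (even?-double (suc i))
        (leading-value k) (leading-value (1 ℕ.+ k)) (leading-value (2 ℕ.+ k))
      where
      k = suc i ℕ.+ suc i
      go : ∀ {hn b} → hn ≡ (suc i , true) → b ≡ true → Top (degree hn) (value hn) (p k) →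
        Top (degree (next₁ hn)) (value (next₁ hn)) (p (1 ℕ.+ k)) → Top (degree (next₂ hn)) (value (next₂ hn)) (p (2 ℕ.+ k)) →
        (∃ λ M → suc M ≡ suc k ℕ.* suc k × Top M (κ (suc k ℕ.* suc k)) (untwist (not b) (p (1 ℕ.+ k) RX.* p (1 ℕ.+ k))))
        × Top (suc k ℕ.* suc k) 1# (X RX.* untwist (not b) (p (1 ℕ.+ k) RX.* p (1 ℕ.+ k)) RX.- untwist b (p (2 ℕ.+ k) RX.* p k))
      go ≡.refl ≡.refl t₀ t₁ t₂ = (_ , degree-odd i , square) ,
        Top-≈ (prove 1 (λ t → :1 :* ((:1 :+ (t :+ t)) :* (:1 :+ (t :+ t))) :- (con 4 :* (:1 :* :1 :* :1 :+ con 0 :* :1 :+ con 0)) :* ((:1 :+ t) :* t) ⊜ :1) ≡.refl (κ (suc i)))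
          RX.refl
          (Top-degree (X RX.* (p (1 ℕ.+ k) RX.* p (1 ℕ.+ k)) RX.- h RX.* (p (2 ℕ.+ k) RX.* p k)) (degree-odd i)
            (Top-difference (X RX.* (p (1 ℕ.+ k) RX.* p (1 ℕ.+ k))) (h RX.* (p (2 ℕ.+ k) RX.* p k)) (≡.trans (degree-odd i) (≡.sym (degree-odd′ i)))
              (Top-* X (p (1 ℕ.+ k) RX.* p (1 ℕ.+ k)) Top-X (Top-* (p (1 ℕ.+ k)) (p (1 ℕ.+ k)) t₁ t₁))
              (Top-* h (p (2 ℕ.+ k) RX.* p k) h-top (Top-* (p (2 ℕ.+ k)) (p k) t₂ t₀))))
        where
        square = Top-≈ (trans (odd-square (κ (suc i)) (κ k) (κ-+ (suc i) (suc i))) (sym (κ-* (suc k) (suc k)))) RX.refl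
          (Top-* (p (1 ℕ.+ k)) (p (1 ℕ.+ k)) t₁ t₁)
    tops .(suc (i ℕ.+ i)) (suc-double i) = go (half-suc-double i) (≡.cong not (even?-double i))
        (leading-value k) (leading-value (1 ℕ.+ k)) (leading-value (2 ℕ.+ k))
      where
      k = suc (i ℕ.+ i)
      go : ∀ {hn b} → hn ≡ (i , false) → b ≡ false → Top (degree hn) (value hn) (p k) →
        Top (degree (next₁ hn)) (value (next₁ hn)) (p (1 ℕ.+ k)) → Top (degree (next₂ hn)) (value (next₂ hn)) (p (2 ℕ.+ k)) →
        (∃ λ M → suc M ≡ suc k ℕ.* suc k × Top M (κ (suc k ℕ.* suc k)) (untwist (not b) (p (1 ℕ.+ k) RX.* p (1 ℕ.+ k))))
        × Top (suc k ℕ.* suc k) 1# (X RX.* untwist (not b) (p (1 ℕ.+ k) RX.* p (1 ℕ.+ k)) RX.- untwist b (p (2 ℕ.+ k) RX.* p k))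
      go ≡.refl ≡.refl t₀ t₁ t₂ = (_ , degree-even i , square) ,
        Top-≈ (prove 1 (λ t → :1 :* ((con 4 :* (:1 :* :1 :* :1 :+ con 0 :* :1 :+ con 0)) :* ((:1 :+ t) :* (:1 :+ t))) :- (:1 :+ ((:1 :+ t) :+ (:1 :+ t))) :* (:1 :+ (t :+ t)) ⊜ :1) ≡.refl (κ i))
          RX.refl
          (Top-degree (X RX.* (h RX.* (p (1 ℕ.+ k) RX.* p (1 ℕ.+ k))) RX.- p (2 ℕ.+ k) RX.* p k) (degree-even i)
            (Top-difference (X RX.* (h RX.* (p (1 ℕ.+ k) RX.* p (1 ℕ.+ k)))) (p (2 ℕ.+ k) RX.* p k) (≡.trans (degree-even i) (≡.sym (degree-even′ i)))
              (Top-* X (h RX.* (p (1 ℕ.+ k) RX.* p (1 ℕ.+ k))) Top-X (Top-* h (p (1 ℕ.+ k) RX.* p (1 ℕ.+ k)) h-top (Top-* (p (1 ℕ.+ k)) (p (1 ℕ.+ k)) t₁ t₁)))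
              (Top-* (p (2 ℕ.+ k)) (p k) t₂ t₀)))
        where
        square = Top-≈ (trans (even-square (κ i) (κ k) (+-congˡ (κ-+ i i))) (sym (κ-* (suc k) (suc k)))) RX.refl
          (Top-* h (p (1 ℕ.+ k) RX.* p (1 ℕ.+ k)) h-top (Top-* (p (1 ℕ.+ k)) (p (1 ℕ.+ k)) t₁ t₁))

  ψ²-top : ∀ k → ∃ λ M → suc M ≡ suc k ℕ.* suc k × Top M (κ (suc k ℕ.* suc k)) (ψ² (suc k))
  ψ²-top k = proj₁ (tops k (halve k))

  φ-top : ∀ k → Top (suc k ℕ.* suc k) 1# (φ k)
  φ-top k = proj₂ (tops k (halve k))

-- Multiplication by n is unramified

module DisplacementIdentities {c ℓ} (R : CommutativeRing c ℓ) where
  open CommutativeRing R hiding (zero)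
  open Numerals R
  open Power R
  open Solver R

  dual-inverse : ∀ u v u′ →
    u * v ≈ 1# →
    u * (- (v * u′ * v)) + u′ * v ≈ 0#
  dual-inverse = prove 3 (λ u v u′ →
    con 0 :- v :* u′ ∙ u :* v ⊜ :1 ⇒
    u :* (:- (v :* u′ :* v)) :+ u′ :* v ⊜ con 0) ≡.refl

  displaced-on-curve : ∀ A x y t →
    y * (t * (κ 3 * x ^ 2 + A)) + t * (κ 3 * x ^ 2 + A) * y
      ≈ x * x * (t * (κ 2 * y)) + (x * (t * (κ 2 * y)) + t * (κ 2 * y) * x) * x + (A * (t * (κ 2 * y)) + 0# * x) + 0#
  displaced-on-curve = prove 4 (λ A x y t →
    y :* (t :* (con 3 :* x :^ 2 :+ A)) :+ t :* (con 3 :* x :^ 2 :+ A) :* y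
      ⊜ x :* x :* (t :* (con 2 :* y)) :+ (x :* (t :* (con 2 :* y)) :+ t :* (con 2 :* y) :* x) :* x :+ (A :* (t :* (con 2 :* y)) :+ con 0 :* x) :+ con 0) ≡.refl

  displaced-x : ∀ x y xQ yQ n e ψ₂ ψ₁ ψ₀ ψ₂′ ψ₁′ ψ₀′ →
    x * ψ₁ ^ 2 - ψ₂ * ψ₀ ≈ xQ * ψ₁ ^ 2 →
    e ≈ κ 2 * yQ * ψ₁ ^ 3 →
    κ 2 * y * ψ₁ ^ 3 - (ψ₂ * ψ₀′ + ψ₂′ * ψ₀) * ψ₁ + κ 2 * (ψ₂ * ψ₀) * ψ₁′ ≈ n * e →
    ψ₁ * (x * (ψ₁ * ψ₁′ + ψ₁′ * ψ₁) + κ 2 * y * (ψ₁ * ψ₁) - (ψ₂ * ψ₀′ + ψ₂′ * ψ₀))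
      ≈ ψ₁ * (xQ * (ψ₁ * ψ₁′ + ψ₁′ * ψ₁) + n * (κ 2 * yQ) * (ψ₁ * ψ₁))
  displaced-x = prove 12 (λ x y xQ yQ n e ψ₂ ψ₁ ψ₀ ψ₂′ ψ₁′ ψ₀′ →
    con 2 :* ψ₁′ ∙ x :* ψ₁ :^ 2 :- ψ₂ :* ψ₀ ⊜ xQ :* ψ₁ :^ 2 ⇒
    n ∙ e ⊜ con 2 :* yQ :* ψ₁ :^ 3 ⇒
    :1 ∙ con 2 :* y :* ψ₁ :^ 3 :- (ψ₂ :* ψ₀′ :+ ψ₂′ :* ψ₀) :* ψ₁ :+ con 2 :* (ψ₂ :* ψ₀) :* ψ₁′ ⊜ n :* e ⇒
    ψ₁ :* (x :* (ψ₁ :* ψ₁′ :+ ψ₁′ :* ψ₁) :+ con 2 :* y :* (ψ₁ :* ψ₁) :- (ψ₂ :* ψ₀′ :+ ψ₂′ :* ψ₀))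
      ⊜ ψ₁ :* (xQ :* (ψ₁ :* ψ₁′ :+ ψ₁′ :* ψ₁) :+ n :* (con 2 :* yQ) :* (ψ₁ :* ψ₁))) ≡.refl

  displaced-e : ∀ A x xQ yQ n κ2′ e e′ ψ₂ ψ₁ ψ₀ ψ₁′ →
    x * ψ₁ ^ 2 - ψ₂ * ψ₀ ≈ xQ * ψ₁ ^ 2 →
    e ≈ κ 2 * yQ * ψ₁ ^ 3 →
    ψ₁ * e′ - κ 3 * e * ψ₁′ ≈ n * (κ 2 * (κ 3 * x ^ 2 + A) * ψ₁ ^ 4 - κ 12 * x * (ψ₂ * ψ₀) * ψ₁ ^ 2 + κ 6 * (ψ₂ * ψ₀) ^ 2) →
    κ2′ ≈ 0# →
    ψ₁ * e′
      ≈ ψ₁ * (κ 2 * yQ * (ψ₁ * (ψ₁ * ψ₁′ + ψ₁′ * ψ₁) + ψ₁′ * (ψ₁ * ψ₁)) + (κ 2 * (n * (κ 3 * xQ ^ 2 + A)) + κ2′ * yQ) * (ψ₁ * (ψ₁ * ψ₁)))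
  displaced-e = prove 12 (λ A x xQ yQ n κ2′ e e′ ψ₂ ψ₁ ψ₀ ψ₁′ →
    con 6 :* n :* (x :* ψ₁ :^ 2 :- ψ₂ :* ψ₀ :+ xQ :* ψ₁ :^ 2) ∙ x :* ψ₁ :^ 2 :- ψ₂ :* ψ₀ ⊜ xQ :* ψ₁ :^ 2 ⇒
    con 3 :* ψ₁′ ∙ e ⊜ con 2 :* yQ :* ψ₁ :^ 3 ⇒
    :1
      ∙ ψ₁ :* e′ :- con 3 :* e :* ψ₁′ ⊜ n :* (con 2 :* (con 3 :* x :^ 2 :+ A) :* ψ₁ :^ 4 :- con 12 :* x :* (ψ₂ :* ψ₀) :* ψ₁ :^ 2 :+ con 6 :* (ψ₂ :* ψ₀) :^ 2) ⇒
    con 0 :- yQ :* ψ₁ :^ 4 ∙ κ2′ ⊜ con 0 ⇒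
    ψ₁ :* e′
      ⊜ ψ₁ :* (con 2 :* yQ :* (ψ₁ :* (ψ₁ :* ψ₁′ :+ ψ₁′ :* ψ₁) :+ ψ₁′ :* (ψ₁ :* ψ₁)) :+ (con 2 :* (n :* (con 3 :* xQ :^ 2 :+ A)) :+ κ2′ :* yQ) :* (ψ₁ :* (ψ₁ :* ψ₁)))) ≡.refl

  -- Here `w` is the inverse of the discriminant Δ = (9x⁴ + 15Ax² + 4A²) f′ - 27(x³ + Ax - B) f.
  -- With f = y² this says that the tangent vector (2y, f′) is unimodular.
  smooth-combination : ∀ A B x y w ½ →
    κ 2 * ½ ≈ 1# →
    (κ 4 * (A * (A * A)) + κ 27 * (B * B)) * w ≈ 1# →
    y * y ≈ x * x * x + A * x + B →
    (0# - κ 27 * (x ^ 3 + A * x - B) * w * y * ½) * (κ 2 * y) + (κ 9 * x ^ 4 + κ 15 * A * x ^ 2 + κ 4 * A ^ 2) * w * (κ 3 * x ^ 2 + A)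
      ≈ 1#
  smooth-combination = prove 6 (λ A B x y w ½ →
    con 0 :- con 27 :* (x :^ 3 :+ A :* x :- B) :* w :* y :* y ∙ con 2 :* ½ ⊜ :1 ⇒
    :1 ∙ (con 4 :* (A :* (A :* A)) :+ con 27 :* (B :* B)) :* w ⊜ :1 ⇒
    con 0 :- con 27 :* (x :^ 3 :+ A :* x :- B) :* w ∙ y :* y ⊜ x :* x :* x :+ A :* x :+ B ⇒
    (con 0 :- con 27 :* (x :^ 3 :+ A :* x :- B) :* w :* y :* ½) :* (con 2 :* y) :+ (con 9 :* x :^ 4 :+ con 15 :* A :* x :^ 2 :+ con 4 :* A :^ 2) :* w :* (con 3 :* x :^ 2 :+ A)
      ⊜ :1) ≡.refl

module _ {c ℓ} (R : CommutativeRing c ℓ) where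
  open CommutativeRing R hiding (zero)
  open DualNumbers R
  open DisplacementIdentities R

  dual-unit : ∀ {u} → Units.IsUnit R (proj₁ u) → Units.IsUnit dual u
  dual-unit {u , u′} (v , e) = (v , - (v * u′ * v)) , (e & dual-inverse u v u′ e)

module Displacement {c ℓ} (R : CommutativeRing c ℓ) (A B : CommutativeRing.Carrier R) where
  open CommutativeRing R hiding (zero)
  open Numerals R
  open Power R
  open DualNumbers R
  open DisplacementIdentities R

  module _ {x y} (on-curve : IsPoint R A B x y) (t : Carrier) where
    displaced : IsPoint dual (A , 0#) (B , 0#) (x , t * (κ 2 * y)) (y , t * (κ 3 * x ^ 2 + A))
    displaced = on-curve & displaced-on-curve A x y t

  module _ {x y} (on-curve : IsPoint R A B x y) {k xQ yQ} (M : IsMultiple R A B x y k xQ yQ) where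
    open PointDerivatives R A B x y on-curve
    open IsMultiple M
    open Units R
    private
      n = κ (1 ℕ.+ k)

      unit° : IsUnit (ψ° (1 ℕ.+ k))
      unit° = unit-≈ (sym (ψ°≈ψ (1 ℕ.+ k))) ψ-unit

      x-eq° : x * ψ° (1 ℕ.+ k) ^ 2 - ψ° (2 ℕ.+ k) * ψ° k ≈ xQ * ψ° (1 ℕ.+ k) ^ 2
      x-eq° = trans (+-cong (*-congˡ (*-cong (ψ°≈ψ (1 ℕ.+ k)) (ψ°≈ψ (1 ℕ.+ k)))) (-‿cong (*-cong (ψ°≈ψ (2 ℕ.+ k)) (ψ°≈ψ k))))
        (trans x-eq (*-congˡ (sym (*-cong (ψ°≈ψ (1 ℕ.+ k)) (ψ°≈ψ (1 ℕ.+ k))))))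

      e-eq° : e° (1 ℕ.+ k) ≈ κ 2 * yQ * ψ° (1 ℕ.+ k) ^ 3
      e-eq° = trans (e°≈e (1 ℕ.+ k)) (trans e-eq (*-congˡ (sym (*-cong (ψ°≈ψ (1 ℕ.+ k)) (*-cong (ψ°≈ψ (1 ℕ.+ k)) (ψ°≈ψ (1 ℕ.+ k)))))))

    -- The ε-parts of `x-eq` and `e-eq`, once multiplied by the unit ψₙ, are consequences of the two
    -- derivative formulas.
    displaced-multiple : IsMultiple dual (A , 0#) (B , 0#) (x , κ 2 * y) (y , κ 3 * x ^ 2 + A) k
                           (xQ , n * (κ 2 * yQ)) (yQ , n * (κ 3 * xQ ^ 2 + A))
    displaced-multiple = record
      { ψ-unit = dual-unit R unit°
      ; x-eq   = x-eq° & unit-cancelˡ unit°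
          (displaced-x x y xQ yQ n (e° (1 ℕ.+ k)) (ψ° (2 ℕ.+ k)) (ψ° (1 ℕ.+ k)) (ψ° k) (ψ′ (2 ℕ.+ k)) (ψ′ (1 ℕ.+ k)) (ψ′ k)
            x-eq° e-eq° (derivative k))
      ; e-eq   = e-eq° & unit-cancelˡ unit°
          (displaced-e A x xQ yQ n _ (e° (1 ℕ.+ k)) (e′ (1 ℕ.+ k)) (ψ° (2 ℕ.+ k)) (ψ° (1 ℕ.+ k)) (ψ° k) (ψ′ (1 ℕ.+ k))
            x-eq° e-eq° (derivative-e k) (infinitesimal (κ-dual 2)))
      }

module _ {a ℓ₁ b ℓ₂} {R : CommutativeRing a ℓ₁} {S : CommutativeRing b ℓ₂} (hom : Hom R S)
  where
  open CommutativeRing S hiding (zero)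
  open Hom hom renaming (cong to ⟨⟩-cong)

  unit-homo : ∀ {u} → Units.IsUnit R u → Units.IsUnit S ⟨ u ⟩
  unit-homo (v , e) = ⟨ v ⟩ , trans (sym (*-homo _ _)) (trans (⟨⟩-cong e) 1-homo)

  module _ {A B x y : CommutativeRing.Carrier R} {A′ B′ x′ y′ : Carrier}
    (A≈ : ⟨ A ⟩ ≈ A′) (B≈ : ⟨ B ⟩ ≈ B′) (x≈ : ⟨ x ⟩ ≈ x′) (y≈ : ⟨ y ⟩ ≈ y′) where
    private
      ψ≈ = ψ-homo hom A≈ B≈ x≈ y≈
      e≈ = e-homo hom A≈ B≈ x≈ y≈

    multiple-homo : ∀ {k xQ yQ xQ′ yQ′} → ⟨ xQ ⟩ ≈ xQ′ → ⟨ yQ ⟩ ≈ yQ′ →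
      IsMultiple R A B x y k xQ yQ → IsMultiple S A′ B′ x′ y′ k xQ′ yQ′
    multiple-homo {k} {xQ} {yQ} {xQ′} {yQ′} xQ≈ yQ≈ M = record
      { ψ-unit = Units.unit-≈ S (ψ≈ (1 ℕ.+ k)) (unit-homo (IsMultiple.ψ-unit M))
      ; x-eq   = transfer hom 5 (λ x ψ₂ ψ₁ ψ₀ xQ → x :* ψ₁ :^ 2 :- ψ₂ :* ψ₀) (λ x ψ₂ ψ₁ ψ₀ xQ → xQ :* ψ₁ :^ 2)
          {σ = x′ ∷ _ ∷ _ ∷ _ ∷ xQ′ ∷ []}
          (x≈ ∷ ψ≈ (2 ℕ.+ k) ∷ ψ≈ (1 ℕ.+ k) ∷ ψ≈ k ∷ xQ≈ ∷ []) (IsMultiple.x-eq M)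
      ; e-eq   = transfer hom 3 (λ e y ψ → e) (λ e y ψ → con 2 :* y :* ψ :^ 3)
          (e≈ (1 ℕ.+ k) ∷ yQ≈ ∷ ψ≈ (1 ℕ.+ k) ∷ []) (IsMultiple.e-eq M)
      }

record Ideal {c ℓ} (R : CommutativeRing c ℓ) : Set (Level.suc (c ⊔ ℓ)) where
  open CommutativeRing R hiding (zero)
  field
    _∈J   : Carrier → Set (c ⊔ ℓ)
    resp  : ∀ {a b} → a ≈ b → a ∈J → b ∈J
    +-in  : ∀ {a b} → a ∈J → b ∈J → (a + b) ∈J
    *-in  : ∀ {a} r → a ∈J → (r * a) ∈J
    0-in  : 0# ∈J

module Quotient {c ℓ} (R : CommutativeRing c ℓ) (J : Ideal R) where
  open CommutativeRing R hiding (zero)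
  open Ideal J
  open Solver R

  infix 4 _≈ᴶ_
  record _≈ᴶ_ (a b : Carrier) : Set (c ⊔ ℓ) where
    constructor mod
    field difference : (a - b) ∈J
  open _≈ᴶ_ public

  weaken : ∀ {a b} → a ≈ b → a ≈ᴶ b
  weaken {a} {b} e = mod (resp (sym (trans (+-congʳ e) (-‿inverseʳ b))) 0-in)

  private
    symᴶ : ∀ {a b} → a ≈ᴶ b → b ≈ᴶ a
    symᴶ {a} {b} (mod e) = mod (resp (prove 2 (λ a b → (con 0 :- :1) :* (a :- b) ⊜ b :- a) ≡.refl a b) (*-in (0# - 1#) e))
    transᴶ : ∀ {a b d} → a ≈ᴶ b → b ≈ᴶ d → a ≈ᴶ d
    transᴶ {a} {b} {d} (mod e) (mod f) = mod (resp (prove 3 (λ a b d → (a :- b) :+ (b :- d) ⊜ a :- d) ≡.refl a b d) (+-in e f))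
    +-congᴶ : ∀ {a a′ b b′} → a ≈ᴶ a′ → b ≈ᴶ b′ → a + b ≈ᴶ a′ + b′
    +-congᴶ {a} {a′} {b} {b′} (mod e) (mod f) = mod (resp
      (prove 4 (λ a a′ b b′ → (a :- a′) :+ (b :- b′) ⊜ (a :+ b) :- (a′ :+ b′)) ≡.refl a a′ b b′) (+-in e f))
    *-congᴶ : ∀ {a a′ b b′} → a ≈ᴶ a′ → b ≈ᴶ b′ → a * b ≈ᴶ a′ * b′
    *-congᴶ {a} {a′} {b} {b′} (mod e) (mod f) = mod (resp
      (prove 4 (λ a a′ b b′ → b :* (a :- a′) :+ a′ :* (b :- b′) ⊜ a :* b :- a′ :* b′) ≡.refl a a′ b b′) (+-in (*-in b e) (*-in a′ f)))
    -‿congᴶ : ∀ {a a′} → a ≈ᴶ a′ → - a ≈ᴶ - a′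
    -‿congᴶ {a} {a′} (mod e) = mod (resp (prove 2 (λ a b → (con 0 :- :1) :* (a :- b) ⊜ :- a :- :- b) ≡.refl a a′) (*-in (0# - 1#) e))

  quotient : CommutativeRing c (c ⊔ ℓ)
  quotient = record
    { Carrier = Carrier ; _≈_ = _≈ᴶ_ ; _+_ = _+_ ; _*_ = _*_ ; -_ = -_ ; 0# = 0# ; 1# = 1#
    ; isCommutativeRing = record
      { isRing = record
        { +-isAbelianGroup = record
          { isGroup = record
            { isMonoid = record
              { isSemigroup = record
                { isMagma = record
                  { isEquivalence = record { refl = weaken refl ; sym = symᴶ ; trans = transᴶ }
                  ; ∙-cong = +-congᴶ }
                ; assoc = λ a b d → weaken (+-assoc a b d) }
              ; identity = (λ a → weaken (+-identityˡ a)) , (λ a → weaken (+-identityʳ a)) }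
            ; inverse = (λ a → weaken (-‿inverseˡ a)) , (λ a → weaken (-‿inverseʳ a))
            ; ⁻¹-cong = -‿congᴶ }
          ; comm = λ a b → weaken (+-comm a b) }
        ; *-cong = *-congᴶ
        ; *-assoc = λ a b d → weaken (*-assoc a b d)
        ; *-identity = (λ a → weaken (*-identityˡ a)) , (λ a → weaken (*-identityʳ a))
        ; distrib = (λ a b d → weaken (distribˡ a b d)) , (λ a b d → weaken (distribʳ a b d)) }
      ; *-comm = λ a b → weaken (*-comm a b) }
    }

  projection : Hom R quotient
  projection = record
    { ⟨_⟩ = λ a → a ; cong = weaken
    ; +-homo = λ _ _ → weaken refl ; *-homo = λ _ _ → weaken refl ; 1-homo = weaken refl }

module UnramifiedIdentities {c ℓ} (R : CommutativeRing c ℓ) where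
  open CommutativeRing R hiding (zero)
  open Numerals R
  open Power R
  open Solver R

  -- Let a = x′ - x and b = y′ - y. Modulo products of two differences the curve equations give 2y b
  -- = f′ a, so s · 2y + t f′ = 1 yields a = 2y(sa + tb). The left side lists the quadratic terms
  -- that were dropped; `tangent-y-mod` does the same for b = f′(sa + tb).
  tangent-x-mod : ∀ A B x y x′ y′ s t →
    s * (κ 2 * y) + t * (κ 3 * x ^ 2 + A) ≈ 1# →
    y * y ≈ x * x * x + A * x + B →
    y′ * y′ ≈ x′ * x′ * x′ + A * x′ + B →
    (0# - t * (κ 3 * x + (x′ - x))) * ((x′ - x) * (x′ - x)) + 0# * ((x′ - x) * (y′ - y)) + t * ((y′ - y) * (y′ - y))
      ≈ x′ - (x + κ 2 * y * (s * (x′ - x) + t * (y′ - y)))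
  tangent-x-mod = prove 8 (λ A B x y x′ y′ s t →
    x′ :- x ∙ s :* (con 2 :* y) :+ t :* (con 3 :* x :^ 2 :+ A) ⊜ :1 ⇒
    con 0 :- t ∙ y :* y ⊜ x :* x :* x :+ A :* x :+ B ⇒
    t ∙ y′ :* y′ ⊜ x′ :* x′ :* x′ :+ A :* x′ :+ B ⇒
    (con 0 :- t :* (con 3 :* x :+ (x′ :- x))) :* ((x′ :- x) :* (x′ :- x)) :+ con 0 :* ((x′ :- x) :* (y′ :- y)) :+ t :* ((y′ :- y) :* (y′ :- y))
      ⊜ x′ :- (x :+ con 2 :* y :* (s :* (x′ :- x) :+ t :* (y′ :- y)))) ≡.refl

  tangent-y-mod : ∀ A B x y x′ y′ s t →
    s * (κ 2 * y) + t * (κ 3 * x ^ 2 + A) ≈ 1# →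
    y * y ≈ x * x * x + A * x + B →
    y′ * y′ ≈ x′ * x′ * x′ + A * x′ + B →
    s * (κ 3 * x + (x′ - x)) * ((x′ - x) * (x′ - x)) + 0# * ((x′ - x) * (y′ - y)) + (0# - s) * ((y′ - y) * (y′ - y))
      ≈ y′ - (y + (κ 3 * x ^ 2 + A) * (s * (x′ - x) + t * (y′ - y)))
  tangent-y-mod = prove 8 (λ A B x y x′ y′ s t →
    y′ :- y ∙ s :* (con 2 :* y) :+ t :* (con 3 :* x :^ 2 :+ A) ⊜ :1 ⇒
    s ∙ y :* y ⊜ x :* x :* x :+ A :* x :+ B ⇒
    con 0 :- s ∙ y′ :* y′ ⊜ x′ :* x′ :* x′ :+ A :* x′ :+ B ⇒
    s :* (con 3 :* x :+ (x′ :- x)) :* ((x′ :- x) :* (x′ :- x)) :+ con 0 :* ((x′ :- x) :* (y′ :- y)) :+ (con 0 :- s) :* ((y′ :- y) :* (y′ :- y))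
      ⊜ y′ :- (y :+ (con 3 :* x :^ 2 :+ A) :* (s :* (x′ :- x) :+ t :* (y′ :- y)))) ≡.refl

  dual-product : ∀ δ r r′ q q′ →
    r′ * q′ * (δ * δ) ≈ (r + r′ * δ) * (q + q′ * δ) - (r * q + (r * q′ + r′ * q) * δ)
  dual-product = prove 5 (λ δ r r′ q q′ →
    r′ :* q′ :* (δ :* δ) ⊜ (r :+ r′ :* δ) :* (q :+ q′ :* δ) :- (r :* q :+ (r :* q′ :+ r′ :* q) :* δ)) ≡.refl

  cancel-displacement : ∀ n n′ s t y g δ →
    n * n′ ≈ 1# →
    s * (κ 2 * y) + t * g ≈ 1# →
    n′ * (s * (n * (κ 2 * y) * δ) + t * (n * g * δ)) ≈ δ
  cancel-displacement = prove 7 (λ n n′ s t y g δ →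
    s :* (con 2 :* y) :* δ :+ t :* g :* δ ∙ n :* n′ ⊜ :1 ⇒
    δ ∙ s :* (con 2 :* y) :+ t :* g ⊜ :1 ⇒
    n′ :* (s :* (n :* (con 2 :* y) :* δ) :+ t :* (n :* g :* δ)) ⊜ δ) ≡.refl

  -- The determinant trick. The hypotheses have the form v = Mv for v = (a,b) and a 2 × 2 matrix M
  -- with entries in the ideal (a,b), so det(1 - M) annihilates v. `E` is 1 - det(1 - M), written as
  -- a combination of a and b.
  idempotent-a : ∀ a b u₁ u₂ u₃ v₁ v₂ v₃ E →
    a ≈ u₁ * (a * a) + u₂ * (a * b) + u₃ * (b * b) →
    b ≈ v₁ * (a * a) + v₂ * (a * b) + v₃ * (b * b) →
    E ≈ 0# →
    (u₁ - u₁ * v₃ * b + u₃ * b * v₁) * a + (u₂ + v₃ - u₂ * v₃ * b + u₃ * v₂ * b) * b ≈ E →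
    a ≈ 0#
  idempotent-a = prove 9 (λ a b u₁ u₂ u₃ v₁ v₂ v₃ E →
    :1 :- v₃ :* b ∙ a ⊜ u₁ :* (a :* a) :+ u₂ :* (a :* b) :+ u₃ :* (b :* b) ⇒
    u₃ :* b ∙ b ⊜ v₁ :* (a :* a) :+ v₂ :* (a :* b) :+ v₃ :* (b :* b) ⇒
    a ∙ E ⊜ con 0 ⇒
    a ∙ (u₁ :- u₁ :* v₃ :* b :+ u₃ :* b :* v₁) :* a :+ (u₂ :+ v₃ :- u₂ :* v₃ :* b :+ u₃ :* v₂ :* b) :* b ⊜ E ⇒
    a ⊜ con 0) ≡.refl

  idempotent-b : ∀ a b u₁ u₂ u₃ v₁ v₂ v₃ E →
    a ≈ u₁ * (a * a) + u₂ * (a * b) + u₃ * (b * b) →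
    b ≈ v₁ * (a * a) + v₂ * (a * b) + v₃ * (b * b) →
    E ≈ 0# →
    (u₁ - u₁ * v₃ * b + u₃ * b * v₁) * a + (u₂ + v₃ - u₂ * v₃ * b + u₃ * v₂ * b) * b ≈ E →
    b ≈ 0#
  idempotent-b = prove 9 (λ a b u₁ u₂ u₃ v₁ v₂ v₃ E →
    v₁ :* a :+ v₂ :* b ∙ a ⊜ u₁ :* (a :* a) :+ u₂ :* (a :* b) :+ u₃ :* (b :* b) ⇒
    :1 :- (u₁ :* a :+ u₂ :* b) ∙ b ⊜ v₁ :* (a :* a) :+ v₂ :* (a :* b) :+ v₃ :* (b :* b) ⇒
    b ∙ E ⊜ con 0 ⇒
    b ∙ (u₁ :- u₁ :* v₃ :* b :+ u₃ :* b :* v₁) :* a :+ (u₂ :+ v₃ :- u₂ :* v₃ :* b :+ u₃ :* v₂ :* b) :* b ⊜ E ⇒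
    b ⊜ con 0) ≡.refl

  comaximal-from-unit : ∀ α α′ x y x′ y′ E v →
    α * (x′ - x) + α′ * (y′ - y) ≈ E →
    E * v ≈ 1# →
    (0# - α * v) * (x - x′) + (0# - α′ * v) * (y - y′) ≈ 1#
  comaximal-from-unit = prove 8 (λ α α′ x y x′ y′ E v →
    v ∙ α :* (x′ :- x) :+ α′ :* (y′ :- y) ⊜ E ⇒
    :1 ∙ E :* v ⊜ :1 ⇒
    (con 0 :- α :* v) :* (x :- x′) :+ (con 0 :- α′ :* v) :* (y :- y′) ⊜ :1) ≡.refl

module DisplacedMultiples {c ℓ} (R : CommutativeRing c ℓ) {A B : CommutativeRing.Carrier R}
  {ℓ′} (T : CommutativeRing c ℓ′) (π : Hom R T) (θ : Hom (DualNumbers.dual R) T) (δ : CommutativeRing.Carrier T) where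
  private
    module R where
      open CommutativeRing R public
      open Numerals R public
      open Power R public
    module π = Hom π
    module θ = Hom θ
  open CommutativeRing T hiding (zero)
  open Numerals T
  open Power T
  open Units T
  open Displacement R A B
  open Solver T

  module _ (θ≈ : ∀ r r′ → θ.⟨ (r , r′) ⟩ ≈ π.⟨ r ⟩ + π.⟨ r′ ⟩ * δ) (2-unit : Units.IsUnit R (R.κ 2))
    {k : ℕ} {x y x′ y′ xQ yQ : R.Carrier} (on-curve : IsPoint R A B x y)
    (x≈ : θ.⟨ (x , R.κ 2 R.* y) ⟩ ≈ π.⟨ x′ ⟩) (y≈ : θ.⟨ (y , R.κ 3 R.* x R.^ 2 R.+ A) ⟩ ≈ π.⟨ y′ ⟩)
    (M : IsMultiple R A B x y k xQ yQ) (M′ : IsMultiple R A B x′ y′ k xQ yQ) where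
    private
      n = R.κ (1 ℕ.+ k)

      standard-part : ∀ r → θ.⟨ (r , R.0#) ⟩ ≈ π.⟨ r ⟩
      standard-part r = trans (θ≈ r R.0#) (trans (+-congˡ (trans (*-congʳ π.0-homo) (zeroˡ δ))) (+-identityʳ _))

      displaced-image : IsMultiple T π.⟨ A ⟩ π.⟨ B ⟩ π.⟨ x′ ⟩ π.⟨ y′ ⟩ k
        (π.⟨ xQ ⟩ + π.⟨ n R.* (R.κ 2 R.* yQ) ⟩ * δ) (π.⟨ yQ ⟩ + π.⟨ n R.* (R.κ 3 R.* xQ R.^ 2 R.+ A) ⟩ * δ)
      displaced-image = multiple-homo θ (standard-part A) (standard-part B) x≈ y≈ (θ≈ _ _) (θ≈ _ _) (displaced-multiple on-curve M)

      image : IsMultiple T π.⟨ A ⟩ π.⟨ B ⟩ π.⟨ x′ ⟩ π.⟨ y′ ⟩ k π.⟨ xQ ⟩ π.⟨ yQ ⟩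
      image = multiple-homo π refl refl refl refl refl refl M′

      module I = IsMultiple image
      module D = IsMultiple displaced-image

      difference : ∀ {r q} → r + q ≈ r → q ≈ 0#
      difference {r} {q} = prove 2 (λ r q → :1 ∙ r :+ q ⊜ r ⇒ q ⊜ con 0) ≡.refl r q

    -- One and the same point over `T` is the image of the displaced (x,y) and of (x′,y′). Its
    -- n-fold multiple is thus both Q displaced by nδ and Q, and as ψₙ is a unit the abscissas may
    -- be compared.
    displacement-x : π.⟨ n R.* (R.κ 2 R.* yQ) ⟩ * δ ≈ 0#
    displacement-x = difference (unit-cancelˡ (unit-^ 2 I.ψ-unit)
      (trans (*-comm _ _) (trans (trans (sym D.x-eq) I.x-eq) (*-comm _ _))))

    displacement-y : π.⟨ n R.* (R.κ 3 R.* xQ R.^ 2 R.+ A) ⟩ * δ ≈ 0#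
    displacement-y = difference (unit-cancelˡ (unit-≈ (κ-hom π 2) (unit-homo π 2-unit))
      (unit-cancelˡ (unit-^ 3 I.ψ-unit) (trans (*-comm _ _) (trans (trans (sym D.e-eq) I.e-eq) (*-comm _ _)))))

-- Two points with the same multiple Q: modulo the square of the ideal (x′ - x , y′ - y) they differ by
-- an infinitesimal displacement δ, which multiplies by n, so that δ = 0.  Hence that ideal is idempotent.
module Unramified {c ℓ} (R : CommutativeRing c ℓ) {A B : CommutativeRing.Carrier R} (nonsingular : Nonsingular R A B)
  (k : ℕ) (n-unit : Units.IsUnit R (Numerals.κ R (1 ℕ.+ k)))
  {xQ yQ : CommutativeRing.Carrier R} (on-curveQ : IsPoint R A B xQ yQ)
  {x y x′ y′ : CommutativeRing.Carrier R} (on-curve : IsPoint R A B x y) (on-curve′ : IsPoint R A B x′ y′)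
  (M : IsMultiple R A B x y k xQ yQ) (M′ : IsMultiple R A B x′ y′ k xQ yQ) where
  open CommutativeRing R hiding (zero)
  open Numerals R
  open Power R
  open Solver R
  open DualNumbers R
  open DisplacementIdentities R
  open UnramifiedIdentities R
  open Nonsingular nonsingular

  private
    a b : Carrier
    a = x′ - x
    b = y′ - y

  Quadratic : Carrier → Set (c ⊔ ℓ)
  Quadratic r = ∃ λ u → ∃ λ v → ∃ λ w → u * (a * a) + v * (a * b) + w * (b * b) ≈ r

  square : Ideal R
  square = record
    { _∈J  = Quadratic
    ; resp = λ { e (u , v , w , p) → u , v , w , trans p e }
    ; +-in = λ { (u , v , w , p) (u′ , v′ , w′ , p′) → u + u′ , v + v′ , w + w′ , trans
        (prove 9 (λ u v w u′ v′ w′ A B C → (u :+ u′) :* A :+ (v :+ v′) :* B :+ (w :+ w′) :* C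
          ⊜ (u :* A :+ v :* B :+ w :* C) :+ (u′ :* A :+ v′ :* B :+ w′ :* C)) ≡.refl u v w u′ v′ w′ (a * a) (a * b) (b * b))
        (+-cong p p′) }
    ; *-in = λ { r (u , v , w , p) → r * u , r * v , r * w , trans
        (prove 7 (λ r u v w A B C → (r :* u) :* A :+ (r :* v) :* B :+ (r :* w) :* C ⊜ r :* (u :* A :+ v :* B :+ w :* C))
          ≡.refl r u v w (a * a) (a * b) (b * b))
        (*-congˡ p) }
    ; 0-in = 0# , 0# , 0# , prove 3 (λ A B C → con 0 :* A :+ con 0 :* B :+ con 0 :* C ⊜ con 0) ≡.refl (a * a) (a * b) (b * b)
    }

  open Quotient R square
  open Ideal square
  private
    module T = CommutativeRing quotient

    s t δ : Carrier
    s = 0# - κ 27 * (x ^ 3 + A * x - B) * proj₁ Δ-unit * y * proj₁ 2-unit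
    t = (κ 9 * x ^ 4 + κ 15 * A * x ^ 2 + κ 4 * A ^ 2) * proj₁ Δ-unit
    δ = s * a + t * b

    smooth : s * (κ 2 * y) + t * (κ 3 * x ^ 2 + A) ≈ 1#
    smooth = smooth-combination A B x y (proj₁ Δ-unit) (proj₁ 2-unit) (proj₂ 2-unit) (proj₂ Δ-unit) on-curve

    δ²-in : Quadratic (δ * δ)
    δ²-in = s * s , κ 2 * s * t , t * t , prove 4 (λ s t a b → (s :* s) :* (a :* a) :+ (con 2 :* s :* t) :* (a :* b) :+ (t :* t) :* (b :* b)
      ⊜ (s :* a :+ t :* b) :* (s :* a :+ t :* b)) ≡.refl s t a b

    x-mod : Quadratic (x′ - (x + (κ 2 * y) * δ))
    x-mod = _ , _ , _ , tangent-x-mod A B x y x′ y′ s t smooth on-curve on-curve′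

    y-mod : Quadratic (y′ - (y + (κ 3 * x ^ 2 + A) * δ))
    y-mod = _ , _ , _ , tangent-y-mod A B x y x′ y′ s t smooth on-curve on-curve′

    -- ε may be sent to δ = s(x′ - x) + t(y′ - y), because δ² lies in the square of the ideal.
    displace : Hom dual quotient
    displace = record
      { ⟨_⟩    = λ u → proj₁ u + proj₂ u * δ
      ; cong   = λ e → weaken (+-cong (standard e) (*-congʳ (infinitesimal e)))
      ; +-homo = λ { (r , r′) (q , q′) → weaken
          (prove 5 (λ δ r r′ q q′ → (r :+ q) :+ (r′ :+ q′) :* δ ⊜ (r :+ r′ :* δ) :+ (q :+ q′ :* δ)) ≡.refl δ r r′ q q′) }
      ; *-homo = λ { (r , r′) (q , q′) → T.sym (mod (resp (dual-product δ r r′ q q′) (*-in (r′ * q′) δ²-in))) }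
      ; 1-homo = weaken (prove 1 (λ δ → :1 :+ con 0 :* δ ⊜ :1) ≡.refl δ)
      }

    n = κ (1 ℕ.+ k)

    module D = DisplacedMultiples R {A} {B} quotient projection displace δ

    difference-zero : ∀ {q} → q ≈ᴶ 0# → Quadratic q
    difference-zero {q} (mod e) = resp (prove 1 (λ q → q :- con 0 ⊜ q) ≡.refl q) e

    x-in : Quadratic ((n * (κ 2 * yQ)) * δ)
    x-in = difference-zero (D.displacement-x (λ _ _ → weaken refl) 2-unit {k} {x} {y} {x′} {y′} {xQ} {yQ} on-curve
      (T.sym (mod x-mod)) (T.sym (mod y-mod)) M M′)

    y-in : Quadratic ((n * (κ 3 * xQ ^ 2 + A)) * δ)
    y-in = difference-zero (D.displacement-y (λ _ _ → weaken refl) 2-unit {k} {x} {y} {x′} {y′} {xQ} {yQ} on-curve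
      (T.sym (mod x-mod)) (T.sym (mod y-mod)) M M′)

    sQ tQ : Carrier
    sQ = 0# - κ 27 * (xQ ^ 3 + A * xQ - B) * proj₁ Δ-unit * yQ * proj₁ 2-unit
    tQ = (κ 9 * xQ ^ 4 + κ 15 * A * xQ ^ 2 + κ 4 * A ^ 2) * proj₁ Δ-unit

    δ-in : Quadratic δ
    δ-in = resp (cancel-displacement n (proj₁ n-unit) sQ tQ yQ (κ 3 * xQ ^ 2 + A) δ (proj₂ n-unit)
        (smooth-combination A B xQ yQ (proj₁ Δ-unit) (proj₁ 2-unit) (proj₂ 2-unit) (proj₂ Δ-unit) on-curveQ))
      (*-in (proj₁ n-unit) (+-in (*-in sQ x-in) (*-in tQ y-in)))

    a-in : Quadratic a
    a-in = resp (prove 4 (λ x′ x u δ → (x′ :- (x :+ u :* δ)) :+ u :* δ ⊜ x′ :- x) ≡.refl x′ x (κ 2 * y) δ) (+-in x-mod (*-in (κ 2 * y) δ-in))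

    b-in : Quadratic b
    b-in = resp (prove 4 (λ x′ x u δ → (x′ :- (x :+ u :* δ)) :+ u :* δ ⊜ x′ :- x) ≡.refl y′ y (κ 3 * x ^ 2 + A) δ)
      (+-in y-mod (*-in (κ 3 * x ^ 2 + A) δ-in))

    generated-by-idempotent : ∀ a b → (∃ λ u → ∃ λ v → ∃ λ w → u * (a * a) + v * (a * b) + w * (b * b) ≈ a) →
      (∃ λ u → ∃ λ v → ∃ λ w → u * (a * a) + v * (a * b) + w * (b * b) ≈ b) →
      ∃ λ α → ∃ λ α′ → (α * a + α′ * b ≈ 0# → a ≈ 0# × b ≈ 0#)
    generated-by-idempotent a b (u₁ , u₂ , u₃ , e) (v₁ , v₂ , v₃ , e′) =
      u₁ - u₁ * v₃ * b + u₃ * b * v₁ , u₂ + v₃ - u₂ * v₃ * b + u₃ * v₂ * b , λ z →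
        idempotent-a a b u₁ u₂ u₃ v₁ v₂ v₃ _ (sym e) (sym e′) z refl ,
        idempotent-b a b u₁ u₂ u₃ v₁ v₂ v₃ _ (sym e) (sym e′) z refl

  -- Whether the points coincide is not decided. One explicit element of the ideal controls both
  -- differences; over a field it is nonzero, hence invertible, as soon as the points differ.
  idempotent : ∃ λ α → ∃ λ α′ → (α * (x′ - x) + α′ * (y′ - y) ≈ 0# → x′ - x ≈ 0# × y′ - y ≈ 0#)
  idempotent = generated-by-idempotent a b a-in b-in

module FieldUnramified {c ℓ} (F : Field c ℓ) {A B : Field.Carrier F}
  (nonsingular : Nonsingular (Field.commutativeRing F) A B)
  (k : ℕ) (n-unit : Units.IsUnit (Field.commutativeRing F) (Numerals.κ (Field.commutativeRing F) (1 ℕ.+ k)))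
  {xQ yQ : Field.Carrier F} (on-curveQ : IsPoint (Field.commutativeRing F) A B xQ yQ) where
  open Field F hiding (zero)

  distinct⇒comaximal : ∀ {x y x′ y′} (P : IsPoint commutativeRing A B x y) (P′ : IsPoint commutativeRing A B x′ y′) →
    IsMultiple commutativeRing A B x y k xQ yQ → IsMultiple commutativeRing A B x′ y′ k xQ yQ →
    ¬ (x ≈ x′ × y ≈ y′) → ∃ λ α → ∃ λ α′ → α * (x - x′) + α′ * (y - y′) ≈ 1#
  distinct⇒comaximal {x} {y} {x′} {y′} P P′ M M′ distinct =
    conclude (Unramified.idempotent commutativeRing nonsingular k n-unit on-curveQ P P′ M M′)
    where
    open Solver commutativeRing
    equal : ∀ {r q} → q - r ≈ 0# → r ≈ q
    equal {r} {q} = prove 2 (λ r q → (con 0 :- :1) ∙ q :- r ⊜ con 0 ⇒ r ⊜ q) ≡.refl r q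
    conclude : (∃ λ α → ∃ λ α′ → (α * (x′ - x) + α′ * (y′ - y) ≈ 0# → x′ - x ≈ 0# × y′ - y ≈ 0#)) →
               ∃ λ α → ∃ λ α′ → α * (x - x′) + α′ * (y - y′) ≈ 1#
    conclude (α , α′ , zero⇒equal) = _ , _ , UnramifiedIdentities.comaximal-from-unit commutativeRing α α′ x y x′ y′ _ (proj₁ unit) refl (proj₂ unit)
      where
      unit : ∃ λ v → (α * (x′ - x) + α′ * (y′ - y)) * v ≈ 1#
      unit = inverse _ λ z → distinct (equal (proj₁ (zero⇒equal z)) , equal (proj₂ (zero⇒equal z)))

-- Sums over the fibre

module LinearFactors {c ℓ} (R : CommutativeRing c ℓ) where
  open CommutativeRing R hiding (zero)
  open Polynomials R
  open PolynomialFactors R using (∏)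
  open Solver R
  private
    module RX = CommutativeRing polyRing

  Bounded : ℕ → Poly → Set ℓ
  Bounded b p = ∀ k → b ℕ.≤ k → coeff p k ≈ 0#

  linear-coeff-0 : ∀ x q → coeff ((X RX.- constant x) RX.* q) 0 ≈ - (x * coeff q 0)
  linear-coeff-0 x q = trans (coeff-+ (scale (0# - x) q) (0# ∷ _) 0) (trans (+-identityʳ _) (trans (coeff-scale (0# - x) q 0)
    (prove 2 (λ x a → (con 0 :- x) :* a ⊜ :- (x :* a)) ≡.refl x (coeff q 0))))

  linear-coeff-suc : ∀ x q k → coeff ((X RX.- constant x) RX.* q) (suc k) ≈ coeff q k - x * coeff q (suc k)
  linear-coeff-suc x q k = trans (coeff-+ (scale (0# - x) q) (0# ∷ (constant 1# RX.* q)) (suc k))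
    (trans (+-cong (coeff-scale (0# - x) q (suc k)) (at (*ₚ-identityˡ q) k))
      (prove 3 (λ x a b → (con 0 :- x) :* b :+ a ⊜ a :- x :* b) ≡.refl x (coeff q k) (coeff q (suc k))))

  private
    beyond-length : ∀ q k → length q ℕ.≤ k → coeff q k ≈ 0#
    beyond-length []      k       _         = refl
    beyond-length (a ∷ q) (suc k) (s≤s l≤k) = beyond-length q k l≤k

  -- The coefficient of the product at k+1 is qₖ - x qₖ₊₁. Beyond the length of the list the
  -- coefficients of `q` are zero, and the relation carries this down to `b`, with no leading
  -- coefficient to be found.
  peel : ∀ x q b → Bounded (suc b) ((X RX.- constant x) RX.* q) → Bounded b q
  peel x q b bounded k b≤k = go (length q) k (ℕₚ.m≤m+n (length q) k) b≤k
    where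
    go : ∀ m k → length q ℕ.≤ m ℕ.+ k → b ℕ.≤ k → coeff q k ≈ 0#
    go zero    k l≤ b≤ = beyond-length q k l≤
    go (suc m) k l≤ b≤ = prove 3 (λ x a b → :1 ∙ a :- x :* b ⊜ con 0 ⇒ x ∙ b ⊜ con 0 ⇒ a ⊜ con 0) ≡.refl x (coeff q k) (coeff q (suc k))
      (trans (sym (linear-coeff-suc x q k)) (bounded (suc k) (s≤s b≤)))
      (go m (suc k) (ℕₚ.≤-trans l≤ (ℕₚ.≤-reflexive (≡.sym (ℕₚ.+-suc m k)))) (ℕₚ.≤-trans b≤ (ℕₚ.n≤1+n k)))

  Bounded-≈ : ∀ {b p q} → p ≈ₚ q → Bounded b p → Bounded b q
  Bounded-≈ e bounded k b≤k = trans (sym (at e k)) (bounded k b≤k)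

  peel-∏ : ∀ xs h b → Bounded (length xs ℕ.+ b) (∏ xs RX.* h) → Bounded b h
  peel-∏ []       h b bounded = Bounded-≈ {b} (RX.*-identityˡ h) bounded
  peel-∏ (x ∷ xs) h b bounded = peel-∏ xs h b (peel x (∏ xs RX.* h) (length xs ℕ.+ b)
    (Bounded-≈ {suc (length xs ℕ.+ b)} (RX.*-assoc (X RX.- constant x) (∏ xs) h) bounded))

  linear-cancel : ∀ x p q → (X RX.- constant x) RX.* p ≈ₚ (X RX.- constant x) RX.* q → p ≈ₚ q
  linear-cancel x p q e = Solver.prove polyRing 2 (λ p q → :1 ∙ p :- q ⊜ con 0 ⇒ p ⊜ q) ≡.refl p q
    (mk λ k → peel x (p RX.- q) 0 (λ k _ → at
      (Solver.prove polyRing 3 (λ d p q → :1 ∙ d :* p ⊜ d :* q ⇒ d :* (p :- q) ⊜ con 0) ≡.refl (X RX.- constant x) p q e) k) k z≤n)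

  product-bounded : ∀ xs h b → Bounded (suc b) h → Bounded (suc (length xs ℕ.+ b)) (∏ xs RX.* h)
  product-bounded []       h b bounded = Bounded-≈ {suc b} (RX.sym (RX.*-identityˡ h)) bounded
  product-bounded (x ∷ xs) h b bounded (suc k) (s≤s le) = trans (at (RX.*-assoc (X RX.- constant x) (∏ xs) h) (suc k))
    (trans (linear-coeff-suc x (∏ xs RX.* h) k)
      (prove 3 (λ x a b → :1 ∙ a ⊜ con 0 ⇒ :- x ∙ b ⊜ con 0 ⇒ a :- x :* b ⊜ con 0) ≡.refl x _ _
        (product-bounded xs h b bounded k le) (product-bounded xs h b bounded (suc k) (ℕₚ.≤-trans le (ℕₚ.n≤1+n k)))))

  leading-product : ∀ xs h b → Bounded (suc b) h → coeff (∏ xs RX.* h) (length xs ℕ.+ b) ≈ coeff h b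
  leading-product []       h b bounded = at (RX.*-identityˡ h) b
  leading-product (x ∷ xs) h b bounded = trans (at (RX.*-assoc (X RX.- constant x) (∏ xs) h) (suc (length xs ℕ.+ b)))
    (trans (linear-coeff-suc x (∏ xs RX.* h) (length xs ℕ.+ b))
      (prove 4 (λ x a b c → :1 ∙ a ⊜ c ⇒ :- x ∙ b ⊜ con 0 ⇒ a :- x :* b ⊜ c) ≡.refl x _ _ (coeff h b)
        (leading-product xs h b bounded) (product-bounded xs h b bounded (suc (length xs ℕ.+ b)) ℕₚ.≤-refl)))

  total : List Carrier → Carrier
  total []       = 0#
  total (x ∷ xs) = x + total xs

  private
    one-bounded : Bounded 1 (constant 1#)
    one-bounded (suc k) _ = refl

    ∏-top : ∀ xs → coeff (∏ xs) (length xs) ≈ 1#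
    ∏-top xs = trans (at (RX.sym (RX.*-identityʳ (∏ xs))) (length xs))
      (≡.subst (λ i → coeff (∏ xs RX.* constant 1#) i ≈ 1#) (ℕₚ.+-identityʳ (length xs)) (leading-product xs (constant 1#) 0 one-bounded))

    ∏-second : ∀ x xs → coeff (∏ (x ∷ xs)) (length xs) ≈ - total (x ∷ xs)
    ∏-second x []        = trans (linear-coeff-0 x (constant 1#)) (prove 1 (λ x → :- (x :* :1) ⊜ :- (x :+ con 0)) ≡.refl x)
    ∏-second x (x′ ∷ xs) = trans (linear-coeff-suc x (∏ (x′ ∷ xs)) (length xs))
      (prove 4 (λ x a b s → :1 ∙ a ⊜ :- s ⇒ :- x ∙ b ⊜ :1 ⇒ a :- x :* b ⊜ :- (x :+ s)) ≡.refl x _ _ (total (x′ ∷ xs))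
        (∏-second x′ xs) (∏-top (x′ ∷ xs)))

    constant-coeff : ∀ a p k → coeff (constant a RX.* p) k ≈ a * coeff p k
    constant-coeff a p k = trans (coeff-+ (scale a p) (0# ∷ []) k)
      (trans (+-cong (coeff-scale a p k) (at 0∷[] k)) (+-identityʳ _))

  sum-of-roots : ∀ {N} xs F h → length xs ≡ suc N → F ≈ₚ ∏ xs RX.* h →
    Bounded (suc (suc N)) F → coeff F (suc N) ≈ 1# → total xs ≈ - coeff F N
  sum-of-roots {N} (x ∷ xs) F h ≡.refl F≈ bounded monic = prove 4 (λ c t s f → c ∙ t ⊜ :- s ⇒ :1 ∙ f ⊜ c :* t ⇒ :- s ∙ c ⊜ :1 ⇒ s ⊜ :- f)
      ≡.refl c₀ (coeff (∏ (x ∷ xs)) N) (total (x ∷ xs)) (coeff F N) (∏-second x xs) (F-coeff N)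
      (trans (sym (*-identityʳ c₀)) (trans (*-congˡ (sym (∏-top (x ∷ xs)))) (trans (sym (F-coeff (suc N))) monic)))
    where
    c₀ = coeff h 0
    h-bounded : Bounded 1 h
    h-bounded = peel-∏ (x ∷ xs) h 1 (≡.subst (λ b → Bounded b (∏ (x ∷ xs) RX.* h)) (ℕₚ.+-comm 1 (suc N)) (Bounded-≈ {suc (suc N)} F≈ bounded))
    h≈ : h ≈ₚ constant c₀
    h≈ = mk λ { zero → refl ; (suc k) → h-bounded (suc k) (s≤s z≤n) }
    F-coeff : ∀ k → coeff F k ≈ c₀ * coeff (∏ (x ∷ xs)) k
    F-coeff k = trans (at (RX.trans F≈ (RX.trans (RX.*-congˡ {∏ (x ∷ xs)} h≈) (RX.*-comm (∏ (x ∷ xs)) (constant c₀)))) k)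
      (constant-coeff c₀ (∏ (x ∷ xs)) k)

module FibreSum {c ℓ} (R : CommutativeRing c ℓ) {A B : CommutativeRing.Carrier R}
  (nonsingular : Nonsingular R A B) (k : ℕ) {xQ yQ : CommutativeRing.Carrier R} (on-curveQ : IsPoint R A B xQ yQ) where
  open CommutativeRing R hiding (zero)
  open Numerals R
  open Polynomials R
  open LeadingTerms R using (Top; top-coeff; above-top; second-coeff)
  open DivisionDegrees R A B using (φ-top; ψ²-top)
  open XOnly polyRing (constant A) (constant B) X
  open LinearFactors R public
  open PolynomialFactors R using (∏)
  open FibreFactors R nonsingular (coordinateRing R A B) k on-curveQ public using (fibre; fibre-factors; 2-torsion-norm)
  open IdealProducts R (coordinateRing R A B) public using (Pt; xOf; Comaximal)
  open FibreDivisibility R nonsingular (coordinateRing R A B) k on-curveQ public using (Lies)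
  open Solver R

  private
    fibre-coeff : ∀ f g i → coeff (f +ₚ (-ₚ (constant xQ *ₚ g))) i ≈ coeff f i - xQ * coeff g i
    fibre-coeff f g i = trans (coeff-+ f (-ₚ (constant xQ *ₚ g)) i)
      (+-congˡ (trans (coeff-neg (constant xQ *ₚ g) i) (-‿cong (trans (coeff-+ (scale xQ g) (0# ∷ []) i)
        (trans (+-cong (coeff-scale xQ g i) (at 0∷[] i)) (+-identityʳ _))))))

    shape : ∀ f g {N S} → suc N ≡ S → Top N (κ S) g → Top S 1# f → let F = f +ₚ (-ₚ (constant xQ *ₚ g)) in
      Bounded (suc S) F × coeff F S ≈ 1# × coeff F N ≈ - (xQ * κ S)
    shape f g {N} ≡.refl g-top f-top =
      (λ i N<i → trans (fibre-coeff f g i) (prove 3 (λ f x p → :1 ∙ f ⊜ con 0 ⇒ :- x ∙ p ⊜ con 0 ⇒ f :- x :* p ⊜ con 0) ≡.refl _ xQ _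
        (above-top i N<i f-top) (above-top i (ℕₚ.≤-trans (ℕₚ.n≤1+n (suc N)) N<i) g-top))) ,
      trans (fibre-coeff f g (suc N)) (prove 3 (λ f x p → :1 ∙ f ⊜ :1 ⇒ :- x ∙ p ⊜ con 0 ⇒ f :- x :* p ⊜ :1) ≡.refl _ xQ _
        (top-coeff f-top) (above-top (suc N) ℕₚ.≤-refl g-top)) ,
      trans (fibre-coeff f g N) (prove 4 (λ f x p n → :1 ∙ f ⊜ con 0 ⇒ :- x ∙ p ⊜ n ⇒ f :- x :* p ⊜ :- (x :* n)) ≡.refl _ xQ _ (κ (suc N))
        (second-coeff f-top) (top-coeff g-top))

  degree-fibre : ∃ λ N → suc N ≡ suc k ℕ.* suc k
    × Bounded (suc (suc k ℕ.* suc k)) fibre × coeff fibre (suc k ℕ.* suc k) ≈ 1# × coeff fibre N ≈ - (xQ * κ (suc k ℕ.* suc k))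
  degree-fibre = proj₁ (ψ²-top k) , proj₁ (proj₂ (ψ²-top k)) ,
    shape (φ k) (ψ² (1 ℕ.+ k)) (proj₁ (proj₂ (ψ²-top k))) (proj₂ (proj₂ (ψ²-top k))) (φ-top k)

  -- The degree n² of φₙ exceeds that of ψₙ² by one, and φₙ has no term of degree n² - 1; so -n² x_Q
  -- is the second coefficient. A commutative ring is enough here, because the formula is to be
  -- applied over dual numbers.
  fibre-sum : ∀ L → AllPairs Comaximal L → All Lies L → length L ≡ suc k ℕ.* suc k →
              total (map xOf L) ≈ xQ * κ (suc k ℕ.* suc k)
  fibre-sum L pairs lies len = conclude degree-fibre (fibre-factors L pairs lies)
    where
    conclude : (∃ λ N → suc N ≡ suc k ℕ.* suc k
        × Bounded (suc (suc k ℕ.* suc k)) fibre × coeff fibre (suc k ℕ.* suc k) ≈ 1# × coeff fibre N ≈ - (xQ * κ (suc k ℕ.* suc k))) →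
      (∃ λ h → fibre ≈ₚ ∏ (map xOf L) *ₚ h) → total (map xOf L) ≈ xQ * κ (suc k ℕ.* suc k)
    conclude (N , N≡ , bounded , monic , second) (h , F≈) =
      trans (sum-of-roots {N} (map xOf L) fibre h (≡.trans (Listₚ.length-map xOf L) (≡.trans len (≡.sym N≡))) F≈
          (≡.subst (λ S → Bounded (suc S) fibre) (≡.sym N≡) bounded) (≡.subst (λ S → coeff fibre S ≈ 1#) (≡.sym N≡) monic))
        (prove 2 (λ f s → :- :1 ∙ f ⊜ :- s ⇒ :- f ⊜ s) ≡.refl _ _ second)

-- The number of points in the fibre

module AdditionIdentities {c ℓ} (R : CommutativeRing c ℓ) where
  open CommutativeRing R hiding (zero)
  open Numerals R
  open Power R
  open Solver R

  chord-coefficient : ∀ A B x₁ y₁ x₂ y₂ λ′ →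
    y₁ * y₁ ≈ x₁ * x₁ * x₁ + A * x₁ + B →
    y₂ * y₂ ≈ x₂ * x₂ * x₂ + A * x₂ + B →
    λ′ * (x₂ - x₁) ≈ y₂ - y₁ →
    (x₂ - x₁) * (λ′ * (y₁ + y₂) - (x₂ * x₂ + x₁ * x₂ + x₁ * x₁)) ≈ (x₂ - x₁) * A
  chord-coefficient = prove 7 (λ A B x₁ y₁ x₂ y₂ λ′ →
    con 0 :- :1 ∙ y₁ :* y₁ ⊜ x₁ :* x₁ :* x₁ :+ A :* x₁ :+ B ⇒
    :1 ∙ y₂ :* y₂ ⊜ x₂ :* x₂ :* x₂ :+ A :* x₂ :+ B ⇒
    y₁ :+ y₂ ∙ λ′ :* (x₂ :- x₁) ⊜ y₂ :- y₁ ⇒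
    (x₂ :- x₁) :* (λ′ :* (y₁ :+ y₂) :- (x₂ :* x₂ :+ x₁ :* x₂ :+ x₁ :* x₁)) ⊜ (x₂ :- x₁) :* A) ≡.refl

  chord-closed : ∀ A B x₁ y₁ x₂ y₂ λ′ →
    λ′ * (y₁ + y₂) - (x₂ * x₂ + x₁ * x₂ + x₁ * x₁) ≈ A →
    y₁ * y₁ ≈ x₁ * x₁ * x₁ + A * x₁ + B →
    λ′ * (x₂ - x₁) ≈ y₂ - y₁ →
    (λ′ * (x₁ - (λ′ * λ′ - x₁ - x₂)) - y₁) * (λ′ * (x₁ - (λ′ * λ′ - x₁ - x₂)) - y₁)
      ≈ (λ′ * λ′ - x₁ - x₂) * (λ′ * λ′ - x₁ - x₂) * (λ′ * λ′ - x₁ - x₂) + A * (λ′ * λ′ - x₁ - x₂) + B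
  chord-closed = prove 7 (λ A B x₁ y₁ x₂ y₂ λ′ →
    λ′ :* λ′ :- x₁ :- x₂ :- x₁ ∙ λ′ :* (y₁ :+ y₂) :- (x₂ :* x₂ :+ x₁ :* x₂ :+ x₁ :* x₁) ⊜ A ⇒
    :1 ∙ y₁ :* y₁ ⊜ x₁ :* x₁ :* x₁ :+ A :* x₁ :+ B ⇒
    λ′ :* (λ′ :* λ′ :- x₁ :- x₂ :- x₁) ∙ λ′ :* (x₂ :- x₁) ⊜ y₂ :- y₁ ⇒
    (λ′ :* (x₁ :- (λ′ :* λ′ :- x₁ :- x₂)) :- y₁) :* (λ′ :* (x₁ :- (λ′ :* λ′ :- x₁ :- x₂)) :- y₁)
      ⊜ (λ′ :* λ′ :- x₁ :- x₂) :* (λ′ :* λ′ :- x₁ :- x₂) :* (λ′ :* λ′ :- x₁ :- x₂) :+ A :* (λ′ :* λ′ :- x₁ :- x₂) :+ B) ≡.refl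

  tangent-closed : ∀ A B x₁ y₁ x₂ λ′ →
    λ′ * (κ 2 * y₁) ≈ κ 3 * x₁ * x₁ + A →
    y₁ * y₁ ≈ x₁ * x₁ * x₁ + A * x₁ + B →
    x₁ ≈ x₂ →
    (λ′ * (x₁ - (λ′ * λ′ - x₁ - x₂)) - y₁) * (λ′ * (x₁ - (λ′ * λ′ - x₁ - x₂)) - y₁)
      ≈ (λ′ * λ′ - x₁ - x₂) * (λ′ * λ′ - x₁ - x₂) * (λ′ * λ′ - x₁ - x₂) + A * (λ′ * λ′ - x₁ - x₂) + B
  tangent-closed = prove 6 (λ A B x₁ y₁ x₂ λ′ →
    λ′ :* λ′ :- x₁ :- x₂ :- x₁ ∙ λ′ :* (con 2 :* y₁) ⊜ con 3 :* x₁ :* x₁ :+ A ⇒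
    :1 ∙ y₁ :* y₁ ⊜ x₁ :* x₁ :* x₁ :+ A :* x₁ :+ B ⇒
    con 0 :- (λ′ :* λ′ :- x₁ :- x₂ :- x₁) :^ 2 ∙ x₁ ⊜ x₂ ⇒
    (λ′ :* (x₁ :- (λ′ :* λ′ :- x₁ :- x₂)) :- y₁) :* (λ′ :* (x₁ :- (λ′ :* λ′ :- x₁ :- x₂)) :- y₁)
      ⊜ (λ′ :* λ′ :- x₁ :- x₂) :* (λ′ :* λ′ :- x₁ :- x₂) :* (λ′ :* λ′ :- x₁ :- x₂) :+ A :* (λ′ :* λ′ :- x₁ :- x₂) :+ B) ≡.refl

  slope-from-inverse : ∀ d v e →
    d * v ≈ 1# →
    e * v * d ≈ e
  slope-from-inverse = prove 3 (λ d v e →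
    e ∙ d :* v ⊜ :1 ⇒
    e :* v :* d ⊜ e) ≡.refl

  equal-ordinates : ∀ A B x₁ y₁ x₂ y₂ →
    y₁ * y₁ ≈ x₁ * x₁ * x₁ + A * x₁ + B →
    y₂ * y₂ ≈ x₂ * x₂ * x₂ + A * x₂ + B →
    x₁ ≈ x₂ →
    (y₁ + y₂) * y₁ ≈ (y₁ + y₂) * y₂
  equal-ordinates = prove 6 (λ A B x₁ y₁ x₂ y₂ →
    :1 ∙ y₁ :* y₁ ⊜ x₁ :* x₁ :* x₁ :+ A :* x₁ :+ B ⇒
    con 0 :- :1 ∙ y₂ :* y₂ ⊜ x₂ :* x₂ :* x₂ :+ A :* x₂ :+ B ⇒
    x₁ :* x₁ :+ x₁ :* x₂ :+ x₂ :* x₂ :+ A ∙ x₁ ⊜ x₂ ⇒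
    (y₁ :+ y₂) :* y₁ ⊜ (y₁ :+ y₂) :* y₂) ≡.refl

  sum-nonzero : ∀ y₁ y₂ →
    y₁ + y₂ ≈ 0# →
    y₁ ≈ - y₂
  sum-nonzero = prove 2 (λ y₁ y₂ →
    :1 ∙ y₁ :+ y₂ ⊜ con 0 ⇒
    y₁ ⊜ :- y₂) ≡.refl

  equal-squares : ∀ xS yS xQ yQ A B →
    yS * yS ≈ xS * xS * xS + A * xS + B →
    yQ * yQ ≈ xQ * xQ * xQ + A * xQ + B →
    xS ≈ xQ →
    yS * yS ≈ yQ * yQ
  equal-squares = prove 6 (λ xS yS xQ yQ A B →
    :1 ∙ yS :* yS ⊜ xS :* xS :* xS :+ A :* xS :+ B ⇒
    con 0 :- :1 ∙ yQ :* yQ ⊜ xQ :* xQ :* xQ :+ A :* xQ :+ B ⇒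
    xS :* xS :+ xS :* xQ :+ xQ :* xQ :+ A ∙ xS ⊜ xQ ⇒
    yS :* yS ⊜ yQ :* yQ) ≡.refl

module ClassicalAddition {c ℓ} (F : Field c ℓ) (A B : Field.Carrier F)
  (nonsingular : Nonsingular (Field.commutativeRing F) A B) where
  open Field F hiding (zero)
  private
    R = commutativeRing
  open Numerals R
  open Units R
  open Nonsingular nonsingular
  open AdditionIdentities R
  open Weierstrass F A B

  open Solver R

  -- Choosing between chord, tangent and opposite points requires equality to be decided, so
  -- existence is only obtained under double negation. It will be used towards contradictions.
  add-exists : ∀ S {x y} (P : OnCurve x y) → ¬ ¬ (∃ λ T → Add S (aff x y P) T)
  add-exists O {x} {y} P k = k (aff x y P , O-left (refl , refl))
  add-exists (aff x₁ y₁ P₁) {x₂} {y₂} P₂ k = ¬¬-excluded-middle λ where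
      (no x₁≉x₂) → k (chordal x₁≉x₂)
      (yes x₁≈x₂) → ¬¬-excluded-middle λ where
        (yes y₁≈-y₂) → k (O , opposite x₁≈x₂ y₁≈-y₂)
        (no y₁≉-y₂) → k (tangential x₁≈x₂ y₁≉-y₂)
    where
    chordal : ¬ (x₁ ≈ x₂) → ∃ λ T → Add (aff x₁ y₁ P₁) (aff x₂ y₂ P₂) T
    chordal x₁≉x₂ = aff x₃ y₃ (chord-closed A B x₁ y₁ x₂ y₂ λ′ coefficient P₁ slope) , chord λ′ x₁≉x₂ slope refl refl
      where
      unit : IsUnit (x₂ - x₁)
      unit = inverse _ λ z → x₁≉x₂ (prove 2 (λ a b → :- :1 ∙ b :- a ⊜ con 0 ⇒ a ⊜ b) ≡.refl x₁ x₂ z)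
      λ′ = (y₂ - y₁) * proj₁ unit
      x₃ = λ′ * λ′ - x₁ - x₂
      y₃ = λ′ * (x₁ - x₃) - y₁
      slope = slope-from-inverse (x₂ - x₁) (proj₁ unit) (y₂ - y₁) (proj₂ unit)
      coefficient = unit-cancelˡ unit (chord-coefficient A B x₁ y₁ x₂ y₂ λ′ P₁ P₂ slope)

    tangential : x₁ ≈ x₂ → ¬ (y₁ ≈ - y₂) → ∃ λ T → Add (aff x₁ y₁ P₁) (aff x₂ y₂ P₂) T
    tangential x₁≈x₂ y₁≉-y₂ = aff x₃ y₃ (tangent-closed A B x₁ y₁ x₂ λ′ slope P₁ x₁≈x₂) ,
        tangent λ′ x₁≈x₂ y₁≈y₂ y₁≉0 slope refl refl
      where
      y₁≈y₂ : y₁ ≈ y₂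
      y₁≈y₂ = unit-cancelˡ (inverse (y₁ + y₂) λ z → y₁≉-y₂ (sum-nonzero y₁ y₂ z)) (equal-ordinates A B x₁ y₁ x₂ y₂ P₁ P₂ x₁≈x₂)
      y₁≉0 : ¬ (y₁ ≈ 0#)
      y₁≉0 z = y₁≉-y₂ (prove 2 (λ a b → con 2 ∙ a ⊜ con 0 ⇒ :- :1 ∙ a ⊜ b ⇒ a ⊜ :- b) ≡.refl y₁ y₂ z y₁≈y₂)
      unit : IsUnit (κ 2 * y₁)
      unit = unit-* 2-unit (inverse y₁ y₁≉0)
      λ′ = (κ 3 * x₁ * x₁ + A) * proj₁ unit
      x₃ = λ′ * λ′ - x₁ - x₂
      y₃ = λ′ * (x₁ - x₃) - y₁
      slope = slope-from-inverse (κ 2 * y₁) (proj₁ unit) (κ 3 * x₁ * x₁ + A) (proj₂ unit)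

  mul-exists : ∀ n {x y} (P : OnCurve x y) → ¬ ¬ (∃ λ S → Mul n (aff x y P) S)
  mul-exists zero    P k = k (O , lift (lift _))
  mul-exists (suc n) P k = mul-exists n P λ { (S , M) → add-exists S P λ { (T , a) → k (T , S , M , a) } }

  add-resp : ∀ {S x y P x′ y′ P′ x″ y″ P″} → x′ ≈ x″ → y′ ≈ y″ →
             Add S (aff x y P) (aff x′ y′ P′) → Add S (aff x y P) (aff x″ y″ P″)
  add-resp ex ey (O-left (p , q)) = O-left (trans (sym ex) p , trans (sym ey) q)
  add-resp ex ey (chord λ′ d s p q) =
    chord λ′ d s (trans (sym ex) p) (trans (sym ey) (trans q (+-congʳ (*-congˡ (+-congˡ (-‿cong ex))))))
  add-resp ex ey (tangent λ′ e₁ e₂ d s p q) =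
    tangent λ′ e₁ e₂ d s (trans (sym ex) p) (trans (sym ey) (trans q (+-congʳ (*-congˡ (+-congˡ (-‿cong ex))))))

module Roots {c ℓ} (R : CommutativeRing c ℓ) where
  open CommutativeRing R hiding (zero)
  open Polynomials R
  open SyntheticDivision R using (evalAt; divide)
  open PolynomialFactors R using (∏)
  open LinearFactors R using (Bounded)
  private
    module RX = CommutativeRing polyRing

  infix 9 _⟦_⟧
  _⟦_⟧ : Poly → Carrier → Carrier
  p ⟦ x ⟧ = Hom.⟨_⟩ (evalAt x) p

  X-_ : Carrier → Poly
  X- x = X RX.- constant x

  factor : ∀ x p → p ⟦ x ⟧ ≈ 0# → ∃ λ q → p ≈ₚ (X- x) *ₚ q
  factor x p z with divide x p
  ... | q , e = q , RX.trans e (RX.trans (RX.+-congˡ {(X- x) *ₚ q} (RX.trans (∷-cong z ≈ₚ-refl) 0∷[])) (RX.+-identityʳ ((X- x) *ₚ q)))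

  linear-vanishes : ∀ x q → ((X- x) *ₚ q) ⟦ x ⟧ ≈ 0#
  linear-vanishes x q = trans (homo (evalAt x) 3 (λ X c q → (X :- c) :* q) {X ∷ constant x ∷ q ∷ []} {x ∷ x ∷ q ⟦ x ⟧ ∷ []}
      (Evaluation.ev-X (idHom R) x ∷ Evaluation.ev-constant (idHom R) x x ∷ refl ∷ []))
    (Solver.prove R 2 (λ x q → (x :- x) :* q ⊜ con 0) ≡.refl x (q ⟦ x ⟧))

  X-cong : ∀ {x x′} → x ≈ x′ → (X- x) ≈ₚ (X- x′)
  X-cong e = RX.+-congˡ {X} (RX.-‿cong (∷-cong e (≈ₚ-refl {[]})))

  private
    swap : ∀ (a b c d p : Poly) → p ≈ₚ b *ₚ c → a *ₚ p ≈ₚ b *ₚ (a *ₚ c)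
    swap = Solver.prove polyRing 5 (λ a b c d p → a ∙ p ⊜ b :* c ⇒ a :* p ⊜ b :* (a :* c)) ≡.refl

  Near : Carrier → Carrier → Carrier × Carrier → Set ℓ
  Near x y (x′ , y′) = x ≈ x′ × y ≈ y′

  ∏-root : ∀ {x y} Λ → Any (Near x y) Λ → ∃ λ π → ∏ (map proj₁ Λ) ≈ₚ (X- x) *ₚ π
  ∏-root ((x′ , y′) ∷ Λ) (here (e , _)) = ∏ (map proj₁ Λ) , RX.*-congʳ (X-cong (sym e))
  ∏-root {x} ((x′ , y′) ∷ Λ) (there m) with ∏-root Λ m
  ... | π , e = (X- x′) *ₚ π , swap (X- x′) (X- x) π π (∏ (map proj₁ Λ)) e

  -- Different ordinates occupy different positions in the list, and each position contributes its
  -- own factor X - x.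
  ∏-double-root : ∀ {x y y₁} Λ → ¬ (y ≈ y₁) → Any (Near x y) Λ → Any (Near x y₁) Λ →
                  ∃ λ π → ∏ (map proj₁ Λ) ≈ₚ (X- x) *ₚ ((X- x) *ₚ π)
  ∏-double-root ((x′ , y′) ∷ Λ) d (here (_ , e)) (here (_ , e₁)) = contradiction (trans e (sym e₁)) d
  ∏-double-root {x} ((x′ , y′) ∷ Λ) d (here (e , _)) (there m) with ∏-root Λ m
  ... | π , e′ = π , RX.*-cong (X-cong (sym e)) e′
  ∏-double-root {x} ((x′ , y′) ∷ Λ) d (there m) (here (e , _)) with ∏-root Λ m
  ... | π , e′ = π , RX.*-cong (X-cong (sym e)) e′
  ∏-double-root {x} ((x′ , y′) ∷ Λ) d (there m) (there m₁) with ∏-double-root Λ d m m₁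
  ... | π , e = (X- x′) *ₚ π , RX.trans (swap (X- x′) (X- x) ((X- x) *ₚ π) π (∏ (map proj₁ Λ)) e)
                  (RX.*-congˡ {X- x} (swap (X- x′) (X- x) π π ((X- x) *ₚ π) RX.refl))

  prefix : ℕ → Poly → Poly
  prefix zero    h = []
  prefix (suc m) h = coeff h 0 ∷ prefix m (List.drop 1 h)

  private
    drop-coeff : ∀ h k → coeff (List.drop 1 h) k ≈ coeff h (suc k)
    drop-coeff []      k = refl
    drop-coeff (a ∷ h) k = refl

  -- Brings a monic polynomial, whose list may end in zeros, into the form with last entry `1#` on
  -- which algebraic closedness is stated.
  monic-prefix : ∀ m h → Bounded (suc m) h → coeff h m ≈ 1# → (prefix m h ++ [ 1# ]) ≈ₚ h
  monic-prefix zero    h bounded monic = mk λ { zero → sym monic ; (suc k) → sym (bounded (suc k) (s≤s z≤n)) }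
  monic-prefix (suc m) h bounded monic = mk λ
    { zero → refl
    ; (suc k) → trans (at (monic-prefix m (List.drop 1 h) (λ k le → trans (drop-coeff h k) (bounded (suc k) (s≤s le)))
                             (trans (drop-coeff h m) monic)) k) (drop-coeff h k) }

module Multiplicity {c ℓ} (R : CommutativeRing c ℓ) where
  open CommutativeRing R hiding (zero)
  open DualNumbers R
  open Polynomials R
  open Roots R using (X-_)

  inclusion : Hom R dual
  inclusion = record
    { ⟨_⟩ = λ a → a , 0# ; cong = λ e → e & refl ; +-homo = λ _ _ → refl & sym (+-identityˡ 0#)
    ; *-homo = λ a b → refl & Solver.prove R 2 (λ a b → con 0 ⊜ a :* con 0 :+ con 0 :* b) ≡.refl a b
    ; 1-homo = refl & refl }

  module _ (x u : Carrier) where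
    evalᵈ : Hom polyRing dual
    evalᵈ = Evaluation.evHom inclusion (x , u)

    private
      module D = CommutativeRing dual

    evalᵈ-linear : ∀ q → Hom.⟨_⟩ evalᵈ ((X- x) *ₚ q) ≈ᵈ D._*_ (0# , u) (Hom.⟨_⟩ evalᵈ q)
    evalᵈ-linear q = D.trans (homo evalᵈ 3 (λ X c q → (X :- c) :* q) {X ∷ constant x ∷ q ∷ []} {(x , u) ∷ (x , 0#) ∷ Hom.⟨_⟩ evalᵈ q ∷ []}
        (Evaluation.ev-X inclusion (x , u) ∷ Evaluation.ev-constant inclusion (x , u) x ∷ D.refl ∷ []))
      (D.*-congʳ (-‿inverseʳ x & Solver.prove R 1 (λ u → u :- con 0 ⊜ u) ≡.refl u))

    evalᵈ-double : ∀ q → Hom.⟨_⟩ evalᵈ ((X- x) *ₚ ((X- x) *ₚ q)) ≈ᵈ D.0#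
    evalᵈ-double q = D.trans (evalᵈ-linear ((X- x) *ₚ q)) (D.trans (D.*-congˡ (evalᵈ-linear q))
      (Solver.prove R 1 (λ g → con 0 :* (con 0 :* g) ⊜ con 0) ≡.refl g
       & Solver.prove R 3 (λ u g g′ → con 0 :* (con 0 :* g′ :+ u :* g) :+ u :* (con 0 :* g) ⊜ con 0) ≡.refl u g g′))
      where
      g = proj₁ (Hom.⟨_⟩ evalᵈ q)
      g′ = proj₂ (Hom.⟨_⟩ evalᵈ q)

module CountingIdentities {c ℓ} (R : CommutativeRing c ℓ) where
  open CommutativeRing R hiding (zero)
  open Numerals R
  open Power R
  open Solver R

  vanishing-φ : ∀ x xQ ψ² ψψ →
    x * ψ² - ψψ - xQ * ψ² ≈ 0# →
    ψ² ≈ 0# →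
    ψψ ≈ 0#
  vanishing-φ = prove 4 (λ x xQ ψ² ψψ →
    con 0 :- :1 ∙ x :* ψ² :- ψψ :- xQ :* ψ² ⊜ con 0 ⇒
    x :- xQ ∙ ψ² ⊜ con 0 ⇒
    ψψ ⊜ con 0) ≡.refl

  same-abscissa : ∀ φ xQ xS ψ² →
    φ - xQ * ψ² ≈ 0# →
    φ ≈ xS * ψ² →
    ψ² * xS ≈ ψ² * xQ
  same-abscissa = prove 4 (λ φ xQ xS ψ² →
    :1 ∙ φ :- xQ :* ψ² ⊜ con 0 ⇒
    con 0 :- :1 ∙ φ ⊜ xS :* ψ² ⇒
    ψ² :* xS ⊜ ψ² :* xQ) ≡.refl

  opposite-ordinates : ∀ yS yS⁻ yQ e ψ →
    e ≈ κ 2 * yS⁻ * ψ ^ 3 →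
    e + κ 2 * yS * ψ ^ 3 ≈ 0# →
    yS ≈ - yQ →
    κ 2 * ψ ^ 3 * yS⁻ ≈ κ 2 * ψ ^ 3 * yQ
  opposite-ordinates = prove 5 (λ yS yS⁻ yQ e ψ →
    con 0 :- :1 ∙ e ⊜ con 2 :* yS⁻ :* ψ :^ 3 ⇒
    :1 ∙ e :+ con 2 :* yS :* ψ :^ 3 ⊜ con 0 ⇒
    con 0 :- con 2 :* ψ :^ 3 ∙ yS ⊜ :- yQ ⇒
    con 2 :* ψ :^ 3 :* yS⁻ ⊜ con 2 :* ψ :^ 3 :* yQ) ≡.refl

  ordinate-sign : ∀ yS yQ →
    yS * yS ≈ yQ * yQ →
    (yS - yQ) * yS ≈ (yS - yQ) * (- yQ)
  ordinate-sign = prove 2 (λ yS yQ →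
    :1 ∙ yS :* yS ⊜ yQ :* yQ ⇒
    (yS :- yQ) :* yS ⊜ (yS :- yQ) :* (:- yQ)) ≡.refl

  square-zero : ∀ yS yQ →
    yS * yS ≈ yQ * yQ →
    yQ ≈ 0# →
    yS * yS ≈ 0#
  square-zero = prove 2 (λ yS yQ →
    :1 ∙ yS :* yS ⊜ yQ :* yQ ⇒
    yQ ∙ yQ ⊜ con 0 ⇒
    yS :* yS ⊜ con 0) ≡.refl

  derivative-vanishes : ∀ n y xQ ψ² ψ²′ →
    xQ * ψ²′ + n * (κ 2 * y) * ψ² - (xQ * ψ²′ + 0# * ψ²) ≈ 0# →
    n * κ 2 * (ψ² * y) ≈ n * κ 2 * 0#
  derivative-vanishes = prove 5 (λ n y xQ ψ² ψ²′ →
    :1 ∙ xQ :* ψ²′ :+ n :* (con 2 :* y) :* ψ² :- (xQ :* ψ²′ :+ con 0 :* ψ²) ⊜ con 0 ⇒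
    n :* con 2 :* (ψ² :* y) ⊜ n :* con 2 :* con 0) ≡.refl

AlgebraicallyClosed : ∀ {c ℓ} → Field c ℓ → Set (c ⊔ ℓ)
AlgebraicallyClosed F = ∀ (k₀ : Carrier) (ks : List Carrier) → ∃ λ x → FieldOps.eval F ((k₀ ∷ ks) ++ [ 1# ]) x ≈ 0#
  where open Field F

module Counting {c ℓ} (F : Field c ℓ) (A B : Field.Carrier F)
  (nonsingular : Nonsingular (Field.commutativeRing F) A B)
  (algClosed : AlgebraicallyClosed F)
  (k : ℕ) (n-unit : Units.IsUnit (Field.commutativeRing F) (Numerals.κ (Field.commutativeRing F) (1 ℕ.+ k)))
  {xQ yQ : Field.Carrier F} (hQ : Weierstrass.OnCurve F A B xQ yQ)
  (Λ : List (Field.Carrier F × Field.Carrier F))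
  (enumerates : Weierstrass.Enumerates F A B (suc k) (Weierstrass.aff xQ yQ hQ) Λ) where

  open Field F hiding (zero)
  private
    R = commutativeRing
  open Numerals R
  open Power R
  open Units R
  open Solver R
  open Nonsingular nonsingular
  open Weierstrass F A B hiding (_≈ₚ_)
  open FieldMultiples F A B nonsingular
  open ClassicalAddition F A B nonsingular
  open FieldUnramified F nonsingular k n-unit {xQ} {yQ} hQ
  open CountingIdentities R
  open AdditionIdentities R using (equal-squares)
  open Roots R
  open Polynomials R
  open PolynomialFactors R using (∏)
  open FibreSum R nonsingular k {xQ} {yQ} hQ using
    (Pt; xOf; Comaximal; Lies; fibre; fibre-factors; 2-torsion-norm; degree-fibre; Bounded; peel-∏; leading-product; Bounded-≈; linear-cancel)
  private
    module RX where
      open CommutativeRing polyRing public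
      open Numerals polyRing public
    n = κ (1 ℕ.+ k)

    MultipleQ : Carrier × Carrier → Set (c ⊔ ℓ)
    MultipleQ (x , y) = Σ (OnCurve x y) λ h → Mul (suc k) (aff x y h) (aff xQ yQ hQ)

  points : ∀ Λ → All MultipleQ Λ → List Pt
  points []            []             = []
  points ((x , y) ∷ Λ) ((h , _) ∷ ms) = ((x , y) , h) ∷ points Λ ms

  points-lie : ∀ Λ ms → All Lies (points Λ ms)
  points-lie []            []             = []
  points-lie ((x , y) ∷ Λ) ((h , M) ∷ ms) = claim {x} {y} h (suc k) M ∷ points-lie Λ ms

  private
    Distinct : Carrier × Carrier → Carrier × Carrier → Set ℓ
    Distinct (x , y) (x′ , y′) = ¬ (x ≈ x′ × y ≈ y′)

    comaximal-with : ∀ {x y} (h : OnCurve x y) → Mul (suc k) (aff x y h) (aff xQ yQ hQ) → ∀ Λ ms →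
      All (Distinct (x , y)) Λ → All (Comaximal ((x , y) , h)) (points Λ ms)
    comaximal-with h M []              []               []       = []
    comaximal-with h M ((x′ , y′) ∷ Λ) ((h′ , M′) ∷ ms) (d ∷ ds) =
      distinct⇒comaximal h h′ (claim h (suc k) M) (claim h′ (suc k) M′) d ∷ comaximal-with h M Λ ms ds

  points-comaximal : ∀ Λ ms → AllPairs Distinct Λ → AllPairs Comaximal (points Λ ms)
  points-comaximal []            []             []       = []
  points-comaximal ((x , y) ∷ Λ) ((h , M) ∷ ms) (d ∷ ds) = comaximal-with h M Λ ms d ∷ points-comaximal Λ ms ds

  points-x : ∀ Λ ms → map xOf (points Λ ms) ≡ map proj₁ Λ
  points-x []            []             = ≡.refl
  points-x ((x , y) ∷ Λ) ((h , M) ∷ ms) = ≡.cong (x ∷_) (points-x Λ ms)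

  private
    listed : All MultipleQ Λ
    listed = proj₁ enumerates
    complete : ∀ {x y} (h : OnCurve x y) → Mul (suc k) (aff x y h) (aff xQ yQ hQ) → Any (Near x y) Λ
    complete {x} {y} h M = proj₁ (proj₂ enumerates) x y h M
    distinct : AllPairs Distinct Λ
    distinct = proj₂ (proj₂ enumerates)

  fibre-splits : ∃ λ h → fibre ≈ₚ ∏ (map proj₁ Λ) *ₚ h
  fibre-splits = ≡.subst (λ xs → ∃ λ h → fibre ≈ₚ ∏ xs *ₚ h) (points-x Λ listed)
    (fibre-factors (points Λ listed) (points-comaximal Λ listed distinct) (points-lie Λ listed))

  monic-root : ∀ m h → Bounded (suc (suc m)) h → coeff h (suc m) ≈ 1# → ∃ λ x → h ⟦ x ⟧ ≈ 0#
  monic-root m h bounded monic = proj₁ root , trans (Hom.cong (SyntheticDivision.evalAt R (proj₁ root)) (RX.sym (monic-prefix (suc m) h bounded monic)))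
    (trans (sym (eval-ev (prefix (suc m) h ++ [ 1# ]) (proj₁ root))) (proj₂ root))
    where
    root = algClosed (coeff h 0) (prefix m (List.drop 1 h))
    eval-ev : ∀ p x → FieldOps.eval F p x ≈ p ⟦ x ⟧
    eval-ev []      x = refl
    eval-ev (a ∷ p) x = +-congˡ (*-congˡ (eval-ev p x))

  square-root : ∀ a → ∃ λ y → y * y ≈ a
  square-root a = proj₁ root , prove 2 (λ y a → :1 ∙ :- a :+ y :* (con 0 :+ y :* (:1 :+ y :* con 0)) ⊜ con 0 ⇒ y :* y ⊜ a)
      ≡.refl (proj₁ root) a (proj₂ root)
    where root = algClosed (- a) (0# ∷ [])

  private
    module V (x : Carrier) = XOnly R A B x

    fibre-along : ∀ {b ℓ′} {S : CommutativeRing b ℓ′} (g : Hom polyRing S) {A′ B′ x′ xQ′} (let module S = CommutativeRing S) →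
      Hom.⟨_⟩ g (constant A) S.≈ A′ → Hom.⟨_⟩ g (constant B) S.≈ B′ → Hom.⟨_⟩ g X S.≈ x′ → Hom.⟨_⟩ g (constant xQ) S.≈ xQ′ →
      Hom.⟨_⟩ g fibre S.≈ XOnly.φ S A′ B′ x′ k S.- xQ′ S.* XOnly.ψ² S A′ B′ x′ (1 ℕ.+ k)
    fibre-along g {A′} {B′} {x′} {xQ′} A≈ B≈ x≈ xQ≈ = homo g 3 (λ a b c → a :- b :* c)
      {XOnly.φ polyRing (constant A) (constant B) X k ∷ constant xQ ∷ XOnly.ψ² polyRing (constant A) (constant B) X (1 ℕ.+ k) ∷ []}
      (φ-homo g {constant A} {constant B} {X} {A′} {B′} {x′} A≈ B≈ x≈ k ∷ xQ≈
       ∷ ψ²-homo g {constant A} {constant B} {X} {A′} {B′} {x′} A≈ B≈ x≈ (1 ℕ.+ k) ∷ [])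

    fibre-at : ∀ x → fibre ⟦ x ⟧ ≈ V.φ x k - xQ * V.ψ² x (1 ℕ.+ k)
    fibre-at x = fibre-along (SyntheticDivision.evalAt R x) (Evaluation.ev-constant (idHom R) x A)
      (Evaluation.ev-constant (idHom R) x B) (Evaluation.ev-X (idHom R) x) (Evaluation.ev-constant (idHom R) x xQ)

  module _ {x : Carrier} (root : fibre ⟦ x ⟧ ≈ 0#) where
    private
      φ-root : V.φ x k - xQ * V.ψ² x (1 ℕ.+ k) ≈ 0#
      φ-root = trans (sym (fibre-at x)) root

      -- If ψₙ vanished at a root, so would φₙ, hence ψₙ₊₁ ψₙ₋₁. Coprimality of ψₙ₋₁ and ψₙ first
      -- gives ψₙ₊₁ = 0, and coprimality of ψₙ and ψₙ₊₁ then gives 1 = 0.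
      finite : ∀ {y} (P : OnCurve x y) → ¬ (DivisionPolynomials.AtPoint.ψ R A B x y (1 ℕ.+ k) ≈ 0#)
      finite {y} P ψ≈0 = 1≉0 (consecutive-coprime (1 ℕ.+ k) 1# (trans (*-identityˡ _) ψ≈0) (trans (*-identityˡ _) ψ₊≈0))
        where
        open Smooth R nonsingular {x} {y} P
        open DivisionPolynomials.AtPoint R A B x y
        ψψ≈0 : V.ψψ x k ≈ 0#
        ψψ≈0 = vanishing-φ x xQ (V.ψ² x (1 ℕ.+ k)) (V.ψψ x k) φ-root
          (trans (sym (V.ψ²≈ x P (1 ℕ.+ k))) (trans (*-congʳ ψ≈0) (zeroˡ _)))
        ψ₊≈0 : ψ (2 ℕ.+ k) ≈ 0#
        ψ₊≈0 = consecutive-coprime k (ψ (2 ℕ.+ k)) (trans (V.ψψ≈ x P k) ψψ≈0) (trans (*-congˡ ψ≈0) (zeroʳ _))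

    -- A root x of the fibre polynomial is the abscissa of points with x(nP) = x_Q. The ordinate is
    -- then known up to sign, which is recorded by its square.
    reaches : ∀ {y} (P : OnCurve x y) → ¬ ¬ (∃ λ yₛ → yₛ * yₛ ≈ yQ * yQ × IsMultiple R A B x y k xQ yₛ
      × (yₛ ≈ yQ → Mul (suc k) (aff x y P) (aff xQ yQ hQ)))
    reaches {y} P continue = mul-exists (suc k) P λ where
        (O , M) → finite P (lower (claim P (suc k) M))
        (aff xₛ yₛ hₛ , M@(S , M′ , a)) →
          let multiple = claim P (suc k) M
              xₛ≈xQ = same-x multiple
          in continue (yₛ , equal-squares xₛ yₛ xQ yQ A B hₛ hQ xₛ≈xQ
                      , record { ψ-unit = IsMultiple.ψ-unit multiple
                               ; x-eq = trans (IsMultiple.x-eq multiple) (*-congʳ xₛ≈xQ)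
                               ; e-eq = IsMultiple.e-eq multiple }
                      , λ yₛ≈yQ → S , M′ , add-resp xₛ≈xQ yₛ≈yQ a)
      where
      same-x : ∀ {xₛ yₛ} → IsMultiple R A B x y k xₛ yₛ → xₛ ≈ xQ
      same-x {xₛ} M = unit-cancelˡ (unit-≈ (V.ψ²≈ x P (1 ℕ.+ k)) (unit-^ 2 (IsMultiple.ψ-unit M)))
        (same-abscissa (V.φ x k) xQ xₛ (V.ψ² x (1 ℕ.+ k)) φ-root
          (trans (+-cong (*-congˡ (sym (V.ψ²≈ x P (1 ℕ.+ k)))) (-‿cong (sym (V.ψψ≈ x P k))))
            (trans (IsMultiple.x-eq M) (*-congˡ (V.ψ²≈ x P (1 ℕ.+ k))))))

    Hit : Carrier → Set (c ⊔ ℓ)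
    Hit y = OnCurve x y × Any (Near x y) Λ × IsMultiple R A B x y k xQ yQ

    hit-from : ∀ {y yₛ} (P : OnCurve x y) → yₛ ≈ yQ → IsMultiple R A B x y k xQ yₛ →
      (yₛ ≈ yQ → Mul (suc k) (aff x y P) (aff xQ yQ hQ)) → Hit y
    hit-from P e M f = P , complete P (f e) , record
      { ψ-unit = IsMultiple.ψ-unit M ; x-eq = IsMultiple.x-eq M ; e-eq = trans (IsMultiple.e-eq M) (*-congʳ (*-congˡ e)) }

    private
      reflected : ∀ y yₛ → DivisionPolynomials.AtPoint.e R A B x y (1 ℕ.+ k) ≈ κ 2 * yₛ * DivisionPolynomials.AtPoint.ψ R A B x y (1 ℕ.+ k) ^ 3 →
        DivisionPolynomials.AtPoint.e R A B x (- y) (1 ℕ.+ k) + κ 2 * yₛ * DivisionPolynomials.AtPoint.ψ R A B x (- y) (1 ℕ.+ k) ^ 3 ≈ 0#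
      reflected y yₛ = cases (even? (1 ℕ.+ k)) (DivisionPolynomials.d R A B x (1 ℕ.+ k)) (DivisionPolynomials.p R A B x (1 ℕ.+ k))
        where
        module D = DivisionPolynomials R A B x
        cases : ∀ b d p → D.AtPoint.twist y (not b) d ≈ κ 2 * yₛ * D.AtPoint.twist y b p ^ 3 →
          D.AtPoint.twist (- y) (not b) d + κ 2 * yₛ * D.AtPoint.twist (- y) b p ^ 3 ≈ 0#
        cases true  d p = FactorIdentities.vanishing-G⁻-even R y yₛ d p
        cases false d p = FactorIdentities.vanishing-G⁻-odd R y yₛ d p

    -- If the ordinate of nP is not y_Q, it is -y_Q, and -P is carried to Q.
    hit-exists : ∀ {y} (P : OnCurve x y) → ¬ ¬ (∃ Hit)
    hit-exists {y} P continue = reaches P λ { (yₛ , square , M , mul) → ¬¬-excluded-middle λ where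
      (yes yₛ≈yQ) → continue (y , hit-from P yₛ≈yQ M mul)
      (no yₛ≉yQ)  → reaches (FactorIdentities.negative-point R x y A B P) λ { (yₛ⁻ , _ , M⁻ , mul⁻) →
        continue (- y , hit-from (FactorIdentities.negative-point R x y A B P)
          (unit-cancelˡ (unit-* 2-unit (unit-^ 3 (IsMultiple.ψ-unit M⁻)))
            (opposite-ordinates yₛ yₛ⁻ yQ _ _ (IsMultiple.e-eq M⁻) (reflected y yₛ (IsMultiple.e-eq M))
              (unit-cancelˡ (inverse (yₛ - yQ) λ z → yₛ≉yQ (prove 2 (λ a b → :1 ∙ a :- b ⊜ con 0 ⇒ a ⊜ b) ≡.refl yₛ yQ z))
                (ordinate-sign yₛ yQ square))))
          M⁻ mul⁻) } }

  module NoTripleRoot {x y : Carrier} (P : OnCurve x y) (M : IsMultiple R A B x y k xQ yQ) where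
    open DualNumbers R using (dual; standard; infinitesimal; _&_)
    open Multiplicity R
    open Displacement R A B using (displaced-multiple)
    open DisplacementIdentities R using (smooth-combination)
    private
      module D = CommutativeRing dual
      module UD = Units dual
      module PX = DivisionPolynomials polyRing (constant A) (constant B) X
      module XX = XOnly polyRing (constant A) (constant B) X
      xᵈ yᵈ Aᵈ Bᵈ : Carrier × Carrier
      xᵈ = x , κ 2 * y
      yᵈ = y , κ 3 * x ^ 2 + A
      Aᵈ = A , 0#
      Bᵈ = B , 0#
      at-xᵈ = evalᵈ x (κ 2 * y)
      module at-xᵈ = Hom at-xᵈ
      A≈ = Evaluation.ev-constant inclusion xᵈ A
      B≈ = Evaluation.ev-constant inclusion xᵈ B
      X≈ = Evaluation.ev-X inclusion xᵈ

      Mᵈ : IsMultiple dual Aᵈ Bᵈ xᵈ yᵈ k (xQ , n * (κ 2 * yQ)) (yQ , n * (κ 3 * xQ ^ 2 + A))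
      Mᵈ = displaced-multiple P M
      module Mᵈ = IsMultiple Mᵈ

      on-curveᵈ : IsPoint dual Aᵈ Bᵈ xᵈ yᵈ
      on-curveᵈ = Tangent.on-curveᵈ R A B x y P

      module Xᵈ = XOnly dual Aᵈ Bᵈ xᵈ

      φᵈ≈ : Xᵈ.φ k D.≈ (xQ , n * (κ 2 * yQ)) D.* Xᵈ.ψ² (1 ℕ.+ k)
      φᵈ≈ = D.trans (D.+-cong (D.*-congˡ (D.sym (Xᵈ.ψ²≈ on-curveᵈ (1 ℕ.+ k)))) (D.-‿cong (D.sym (Xᵈ.ψψ≈ on-curveᵈ k))))
        (D.trans Mᵈ.x-eq (D.*-congˡ (Xᵈ.ψ²≈ on-curveᵈ (1 ℕ.+ k))))

      ψ²-unit : IsUnit (proj₁ (Xᵈ.ψ² (1 ℕ.+ k)))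
      ψ²-unit = unit-homo {R = dual} {S = R} (DualNumbers.standardHom R)
        (UD.unit-≈ (Xᵈ.ψ²≈ on-curveᵈ (1 ℕ.+ k)) (UD.unit-* Mᵈ.ψ-unit Mᵈ.ψ-unit))

    -- At x + 2yε the fibre polynomial takes the value 2n y_Q ψₙ² ε, while a double root makes it
    -- vanish there. Since n, 2 and ψₙ are invertible, y_Q = 0.
    double-root⇒2-torsion : ∀ {g} → fibre ≈ₚ (X- x) *ₚ ((X- x) *ₚ g) → yQ ≈ 0#
    double-root⇒2-torsion {g} e = unit-cancelˡ ψ²-unit (trans (unit-cancelˡ (unit-* n-unit 2-unit)
        (derivative-vanishes n yQ xQ (proj₁ (Xᵈ.ψ² (1 ℕ.+ k))) (proj₂ (Xᵈ.ψ² (1 ℕ.+ k))) (infinitesimal vanishes)))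
        (sym (zeroʳ _)))
      where
      vanishes : (xQ , n * (κ 2 * yQ)) D.* Xᵈ.ψ² (1 ℕ.+ k) D.- (xQ , 0#) D.* Xᵈ.ψ² (1 ℕ.+ k) D.≈ D.0#
      vanishes = D.trans (D.+-congʳ (D.sym φᵈ≈)) (D.trans (D.sym (fibre-along {S = dual} at-xᵈ {Aᵈ} {Bᵈ} {xᵈ} {xQ , 0#} A≈ B≈ X≈
          (Evaluation.ev-constant inclusion xᵈ xQ)))
        (D.trans (at-xᵈ.cong e) (evalᵈ-double x (κ 2 * y) g)))

    -- The numerator of the y-coordinate has a simple zero at a point above a 2-torsion point.
    simple-zero : yQ ≈ 0# → ¬ (at-xᵈ.⟨ PX.d (1 ℕ.+ k) ⟩ D.≈ D.0#)
    simple-zero yQ≈0 z = 1≉0 (trans (sym (smooth-combination A B xQ yQ (proj₁ Δ-unit) (proj₁ 2-unit) (proj₂ 2-unit) (proj₂ Δ-unit) hQ))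
        (prove 4 (λ s t y g → s :* con 2 ∙ y ⊜ con 0 ⇒ t ∙ g ⊜ con 0 ⇒ s :* (con 2 :* y) :+ t :* g ⊜ con 0) ≡.refl _ _ yQ (κ 3 * xQ ^ 2 + A) yQ≈0
          (unit-cancelˡ n-unit (trans (infinitesimal yQᵈ≈0) (sym (zeroʳ n))))))
      where
      module Dᵈ = DivisionPolynomials dual Aᵈ Bᵈ xᵈ
      twist-zero : ∀ b {u} → u D.≈ D.0# → Dᵈ.AtPoint.twist yᵈ b u D.≈ D.0#
      twist-zero true  e = D.trans (D.*-congˡ e) (D.zeroʳ _)
      twist-zero false e = e
      e≈0 : Dᵈ.AtPoint.e yᵈ (1 ℕ.+ k) D.≈ D.0#
      e≈0 = twist-zero (not (even? (1 ℕ.+ k)))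
        (D.trans (D.sym (d-homo at-xᵈ {constant A} {constant B} {X} {Aᵈ} {Bᵈ} {xᵈ} A≈ B≈ X≈ (1 ℕ.+ k))) z)
      yQᵈ≈0 : (yQ , n * (κ 3 * xQ ^ 2 + A)) D.≈ D.0#
      yQᵈ≈0 = UD.unit-cancelˡ {u = Numerals.κ dual 2} (dual-unit R 2-unit)
        (UD.unit-cancelˡ {u = Power._^_ dual (Dᵈ.AtPoint.ψ yᵈ (1 ℕ.+ k)) 3} (UD.unit-^ 3 Mᵈ.ψ-unit)
          (D.trans (D.*-comm _ _) (D.trans (D.trans (D.sym Mᵈ.e-eq) e≈0)
            (D.sym (D.trans (D.*-congˡ (D.zeroʳ _)) (D.zeroʳ _))))))

    private
      evaluate-untwist : ∀ b δ → XX.untwist b (δ *ₚ δ) ⟦ x ⟧ ≈ V.untwist x b (δ ⟦ x ⟧ * δ ⟦ x ⟧)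
      evaluate-untwist b δ = untwist-homo (SyntheticDivision.evalAt R x) {constant A} {constant B} {X} {A} {B} {x}
        (Evaluation.ev-constant (idHom R) x A) (Evaluation.ev-constant (idHom R) x B) (Evaluation.ev-X (idHom R) x) b
        (Hom.*-homo (SyntheticDivision.evalAt R x) δ δ)

      untwist-unit : ¬ (y ≈ 0#) → ∀ b {u} → ¬ (u ≈ 0#) → ¬ (V.untwist x b (u * u) ≈ 0#)
      untwist-unit y≉0 b {u} u≉0 z = u≉0 (unit-cancelˡ (inverse u u≉0) (trans (untwisted b z) (sym (zeroʳ u))))
        where
        untwisted : ∀ b → V.untwist x b (u * u) ≈ 0# → u * u ≈ 0#
        untwisted true  z = unit-cancelˡ (unit-≈ (sym (Twisted.h≈β² R A B x y P)) (unit-^ 2 (unit-* 2-unit (inverse y y≉0))))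
                              (trans z (sym (zeroʳ _)))
        untwisted false z = z

      root-of-square : ¬ (y ≈ 0#) → ∀ b δ G → XX.untwist b (δ *ₚ δ) ≈ₚ (X- x) *ₚ G → ¬ ¬ (δ ⟦ x ⟧ ≈ 0#)
      root-of-square y≉0 b δ G e δ≉0 = untwist-unit y≉0 b δ≉0
        (trans (sym (evaluate-untwist b δ)) (trans (Hom.cong (SyntheticDivision.evalAt R x) e) (linear-vanishes x G)))

      untwist-factor : ∀ b δ δ₁ → δ ≈ₚ (X- x) *ₚ δ₁ → XX.untwist b (δ *ₚ δ) ≈ₚ (X- x) *ₚ ((X- x) *ₚ XX.untwist b (δ₁ *ₚ δ₁))
      untwist-factor true  δ δ₁ = Solver.prove polyRing 4 (λ h d δ δ₁ → h :* (δ :+ d :* δ₁) ∙ δ ⊜ d :* δ₁ ⇒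
        h :* (δ :* δ) ⊜ d :* (d :* (h :* (δ₁ :* δ₁)))) ≡.refl PX.h (X- x) δ δ₁
      untwist-factor false δ δ₁ = Solver.prove polyRing 3 (λ d δ δ₁ → (δ :+ d :* δ₁) ∙ δ ⊜ d :* δ₁ ⇒
        δ :* δ ⊜ d :* (d :* (δ₁ :* δ₁))) ≡.refl (X- x) δ δ₁

    -- By `2-torsion-norm` a triple root of the fibre is a triple root of (2ωₙ)². If y ≠ 0, a factor
    -- `h` in this square is a unit at x, so the polynomial `d` behind 2ωₙ has a double root,
    -- against `simple-zero`.
    no-triple-root : yQ ≈ 0# → ¬ (y ≈ 0#) → ∀ {g} → ¬ (fibre ≈ₚ (X- x) *ₚ ((X- x) *ₚ ((X- x) *ₚ g)))
    no-triple-root yQ≈0 y≉0 {g} F≈ = from-norm (2-torsion-norm yQ≈0)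
      where
      b = not (even? (1 ℕ.+ k))
      δ = PX.d (1 ℕ.+ k)
      from-norm : ¬ (∃ λ W → XX.e² (1 ℕ.+ k) ≈ₚ fibre *ₚ W)
      from-norm (W , e) = root-of-square y≉0 b δ ((X- x) *ₚ ((X- x) *ₚ (g *ₚ W))) triple λ z → once (factor x δ z)
        where
        triple : XX.untwist b (δ *ₚ δ) ≈ₚ (X- x) *ₚ ((X- x) *ₚ ((X- x) *ₚ (g *ₚ W)))
        triple = RX.trans e (Solver.prove polyRing 4 (λ F d g W → W ∙ F ⊜ d :* (d :* (d :* g)) ⇒ F :* W ⊜ d :* (d :* (d :* (g :* W))))
          ≡.refl fibre (X- x) g W F≈)
        once : ¬ (∃ λ δ₁ → δ ≈ₚ (X- x) *ₚ δ₁)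
        once (δ₁ , e₁) = root-of-square y≉0 b δ₁ (g *ₚ W)
            (linear-cancel x _ _ (linear-cancel x _ _ (RX.trans (RX.sym (untwist-factor b δ δ₁ e₁)) triple)))
            λ z → twice (factor x δ₁ z)
          where
          twice : ¬ (∃ λ δ₂ → δ₁ ≈ₚ (X- x) *ₚ δ₂)
          twice (δ₂ , e₂) = simple-zero yQ≈0 (D.trans (at-xᵈ.cong (RX.trans e₁ (RX.*-congˡ {X- x} e₂))) (evalᵈ-double x (κ 2 * y) δ₂))

    private
      odd-at-2-torsion : y ≈ 0# → even? (1 ℕ.+ k) ≡ false
      odd-at-2-torsion y≈0 = cases (even? (1 ℕ.+ k)) (DivisionPolynomials.p R A B x (1 ℕ.+ k)) (IsMultiple.ψ-unit M)
        where
        cases : ∀ b a → IsUnit (DivisionPolynomials.AtPoint.twist R A B x y b a) → b ≡ false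
        cases false a _       = ≡.refl
        cases true  a (v , e) = ⊥-elim (1≉0 (trans (sym e)
          (prove 3 (λ y a v → con 2 :* a :* v ∙ y ⊜ con 0 ⇒ ((con 2 :* y) :* a) :* v ⊜ con 0) ≡.refl y a v y≈0)))

      cubic-factor : ∀ (A B X x y : Poly) → y *ₚ y ≈ₚ x *ₚ x *ₚ x +ₚ A *ₚ x +ₚ B → y ≈ₚ RX.0# →
        X *ₚ X *ₚ X +ₚ A *ₚ X +ₚ B ≈ₚ (X RX.- x) *ₚ (X *ₚ X +ₚ X *ₚ x +ₚ x *ₚ x +ₚ A)
      cubic-factor = Solver.prove polyRing 5 (λ A B X x y → :- :1 ∙ y :* y ⊜ x :* x :* x :+ A :* x :+ B ⇒ y ∙ y ⊜ con 0 ⇒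
        X :* X :* X :+ A :* X :+ B ⊜ (X :- x) :* (X :* X :+ X :* x :+ x :* x :+ A)) ≡.refl

    -- If y = 0 then n is odd, as ψₙ is a unit, and (2ωₙ)² = h d² where `h` has a simple root at x.
    -- A double root of the fibre leaves a root of `d`. At such a point x + 2yε is x itself, so a
    -- single root already contradicts `simple-zero`.
    no-double-root : yQ ≈ 0# → y ≈ 0# → ∀ {g} → ¬ (fibre ≈ₚ (X- x) *ₚ ((X- x) *ₚ g))
    no-double-root yQ≈0 y≈0 {g} F≈ = from-norm (2-torsion-norm yQ≈0)
      where
      δ = PX.d (1 ℕ.+ k)
      q = X *ₚ X +ₚ X *ₚ constant x +ₚ constant x *ₚ constant x +ₚ constant A
      f≈ : PX.f ≈ₚ (X- x) *ₚ q
      f≈ = cubic-factor (constant A) (constant B) X (constant x) (constant y)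
        (transfer constantHom 4 (λ A B x y → y :* y) (λ A B x y → x :* x :* x :+ A :* x :+ B) {A ∷ B ∷ x ∷ y ∷ []}
          (RX.refl ∷ RX.refl ∷ RX.refl ∷ RX.refl ∷ []) P)
        (RX.trans (∷-cong y≈0 (≈ₚ-refl {[]})) 0∷[])
      slope-unit : IsUnit (κ 3 * x ^ 2 + A)
      slope-unit = inverse _ λ g≈0 → 1≉0 (trans (sym (smooth-combination A B x y (proj₁ Δ-unit) (proj₁ 2-unit) (proj₂ 2-unit) (proj₂ Δ-unit) P))
        (prove 4 (λ s t y g → s :* con 2 ∙ y ⊜ con 0 ⇒ t ∙ g ⊜ con 0 ⇒ s :* (con 2 :* y) :+ t :* g ⊜ con 0) ≡.refl _ _ y (κ 3 * x ^ 2 + A) y≈0 g≈0))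
      from-norm : ¬ (∃ λ W → XX.e² (1 ℕ.+ k) ≈ₚ fibre *ₚ W)
      from-norm (W , e) = ¬¬-excluded-middle λ where
          (yes z) → once (factor x δ z)
          (no δ≉0) → δ≉0 (unit-cancelˡ (inverse _ δ≉0) (trans
            (unit-cancelˡ (unit-* (unit-* 2-unit 2-unit) slope-unit) (trans (sym value) (trans vanishing (sym (zeroʳ _))))) (sym (zeroʳ _))))
        where
        norm : PX.h *ₚ (δ *ₚ δ) ≈ₚ fibre *ₚ W
        norm = ≡.subst (λ b → XX.untwist (not b) (δ *ₚ δ) ≈ₚ fibre *ₚ W) (odd-at-2-torsion y≈0) e
        cancelled : RX.κ 4 *ₚ q *ₚ (δ *ₚ δ) ≈ₚ (X- x) *ₚ (g *ₚ W)
        cancelled = linear-cancel x _ _ (Solver.prove polyRing 7 (λ f d q δ F g W → :- con 4 :* δ :* δ ∙ f ⊜ d :* q ⇒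
            :1 ∙ (con 4 :* f) :* (δ :* δ) ⊜ F :* W ⇒ W ∙ F ⊜ d :* (d :* g) ⇒
            d :* (con 4 :* q :* (δ :* δ)) ⊜ d :* (d :* (g :* W))) ≡.refl PX.f (X- x) q δ fibre g W f≈ norm F≈)
        vanishing : (RX.κ 4 *ₚ q *ₚ (δ *ₚ δ)) ⟦ x ⟧ ≈ 0#
        vanishing = trans (Hom.cong (SyntheticDivision.evalAt R x) cancelled) (linear-vanishes x (g *ₚ W))
        value : (RX.κ 4 *ₚ q *ₚ (δ *ₚ δ)) ⟦ x ⟧ ≈ κ 2 * κ 2 * (κ 3 * x ^ 2 + A) * (δ ⟦ x ⟧ * δ ⟦ x ⟧)
        value = trans (homo (SyntheticDivision.evalAt R x) 4 (λ X x A δ → con 4 :* (X :* X :+ X :* x :+ x :* x :+ A) :* (δ :* δ))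
            {X ∷ constant x ∷ constant A ∷ δ ∷ []} {x ∷ x ∷ A ∷ δ ⟦ x ⟧ ∷ []}
            (Evaluation.ev-X (idHom R) x ∷ Evaluation.ev-constant (idHom R) x x ∷ Evaluation.ev-constant (idHom R) x A ∷ refl ∷ []))
          (prove 3 (λ x A δ → con 4 :* (x :* x :+ x :* x :+ x :* x :+ A) :* (δ :* δ) ⊜ con 2 :* con 2 :* (con 3 :* x :^ 2 :+ A) :* (δ :* δ))
            ≡.refl x A (δ ⟦ x ⟧))
        once : ¬ (∃ λ δ₁ → δ ≈ₚ (X- x) *ₚ δ₁)
        once (δ₁ , e₁) = simple-zero yQ≈0 (D.trans (at-xᵈ.cong e₁) (D.trans (evalᵈ-linear x (κ 2 * y) δ₁)
          (zeroˡ _ & prove 3 (λ y a a′ → con 2 :* a ∙ y ⊜ con 0 ⇒ con 0 :* a′ :+ (con 2 :* y) :* a ⊜ con 0) ≡.refl y _ _ y≈0)))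

  private
    -- A root x of the cofactor is the abscissa of some listed point P, so the fibre has a double
    -- root there and y_Q = 0. If y ≠ 0, then -P is listed too and the root is triple. Either case
    -- is excluded.
    no-extra-root : ∀ h → fibre ≈ₚ ∏ (map proj₁ Λ) *ₚ h → ∀ x → ¬ (h ⟦ x ⟧ ≈ 0#)
    no-extra-root h F≈ x h≈0 = hit-exists root (proj₂ (square-root (x * x * x + A * x + B))) λ { (y , P , any , M) →
        multiplicity P M any (∏-root Λ any) (factor x h h≈0) }
      where
      root : fibre ⟦ x ⟧ ≈ 0#
      root = trans (Hom.cong (SyntheticDivision.evalAt R x) F≈)
        (trans (Hom.*-homo (SyntheticDivision.evalAt R x) (∏ (map proj₁ Λ)) h) (trans (*-congˡ h≈0) (zeroʳ _)))

      multiplicity : ∀ {y} (P : OnCurve x y) → IsMultiple R A B x y k xQ yQ → Any (Near x y) Λ →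
        (∃ λ π → ∏ (map proj₁ Λ) ≈ₚ (X- x) *ₚ π) → ¬ (∃ λ h′ → h ≈ₚ (X- x) *ₚ h′)
      multiplicity {y} P M any (π , ∏≈) (h′ , h≈) = ¬¬-excluded-middle λ where
          (yes y≈0) → no-double-root yQ≈0 y≈0 {π *ₚ h′} F≈²
          (no y≉0)  → reaches root (FactorIdentities.negative-point R x y A B P) λ { (yₛ , square , _ , mul) →
            ¬¬-excluded-middle λ where
              (no yₛ≉0)  → yₛ≉0 (unit-cancelˡ (inverse yₛ yₛ≉0) (trans (square-zero yₛ yQ square yQ≈0) (sym (zeroʳ yₛ))))
              (yes yₛ≈0) → three y≉0 (∏-double-root Λ (λ y≈-y → y≉0 (unit-cancelˡ 2-unit
                  (prove 1 (λ y → :1 ∙ y ⊜ :- y ⇒ con 2 :* y ⊜ con 2 :* con 0) ≡.refl y y≈-y)))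
                any (complete (FactorIdentities.negative-point R x y A B P) (mul (trans yₛ≈0 (sym yQ≈0))))) }
        where
        open NoTripleRoot {x} {y} P M
        F≈² : fibre ≈ₚ (X- x) *ₚ ((X- x) *ₚ (π *ₚ h′))
        F≈² = Solver.prove polyRing 6 (λ F p h d π h′ → :1 ∙ F ⊜ p :* h ⇒ h ∙ p ⊜ d :* π ⇒ d :* π ∙ h ⊜ d :* h′ ⇒ F ⊜ d :* (d :* (π :* h′)))
          ≡.refl fibre (∏ (map proj₁ Λ)) h (X- x) π h′ F≈ ∏≈ h≈
        yQ≈0 : yQ ≈ 0#
        yQ≈0 = double-root⇒2-torsion {π *ₚ h′} F≈²
        three : ¬ (y ≈ 0#) → ¬ (∃ λ ρ → ∏ (map proj₁ Λ) ≈ₚ (X- x) *ₚ ((X- x) *ₚ ρ))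
        three y≉0 (ρ , ∏≈²) = no-triple-root yQ≈0 y≉0 {ρ *ₚ h′}
          (Solver.prove polyRing 6 (λ F p h d ρ h′ → :1 ∙ F ⊜ p :* h ⇒ h ∙ p ⊜ d :* (d :* ρ) ⇒ d :* (d :* ρ) ∙ h ⊜ d :* h′ ⇒
              F ⊜ d :* (d :* (d :* (ρ :* h′)))) ≡.refl fibre (∏ (map proj₁ Λ)) h (X- x) ρ h′ F≈ ∏≈² h≈)

    xs : List Carrier
    xs = map proj₁ Λ

    N : ℕ
    N = suc k ℕ.* suc k

    fibre-bounded : Bounded (suc N) fibre
    fibre-bounded = proj₁ (proj₂ (proj₂ degree-fibre))

    fibre-monic : coeff fibre N ≈ 1#
    fibre-monic = proj₁ (proj₂ (proj₂ (proj₂ degree-fibre)))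

    -- The cofactor is then monic of positive degree and has a root.
    not-fewer : ∀ h → fibre ≈ₚ ∏ xs *ₚ h → ∀ m → ¬ (length xs ℕ.+ suc m ≡ N)
    not-fewer h F≈ m len = no-extra-root h F≈ (proj₁ root) (proj₂ root)
      where
      h-bounded : Bounded (suc (suc m)) h
      h-bounded = peel-∏ xs h (suc (suc m)) (≡.subst (λ b → Bounded b (∏ xs *ₚ h))
        (≡.sym (≡.trans (ℕₚ.+-suc (length xs) (suc m)) (≡.cong suc len))) (Bounded-≈ {suc N} F≈ fibre-bounded))
      root = monic-root m h h-bounded (trans (sym (leading-product xs h (suc m) h-bounded))
        (trans (sym (at F≈ _)) (≡.subst (λ i → coeff fibre i ≈ 1#) (≡.sym len) fibre-monic)))

    not-more : ∀ h → fibre ≈ₚ ∏ xs *ₚ h → ¬ (N ℕ.< length xs)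
    not-more h F≈ N< = 1≉0 (trans (sym fibre-monic) (at (RX.trans F≈ (RX.trans (RX.*-congˡ {∏ xs} h≈0) (RX.zeroʳ (∏ xs)))) N))
      where
      h≈0 : h ≈ₚ []
      h≈0 = mk λ i → peel-∏ xs h 0 (λ j le → Bounded-≈ {suc N} F≈ fibre-bounded j
        (ℕₚ.≤-trans N< (ℕₚ.≤-trans (ℕₚ.m≤m+n (length xs) 0) le))) i z≤n

  -- Natural numbers can be compared outright, so it suffices to refute both inequalities, and for
  -- this the doubly negated existence of multiples is strong enough.
  count : length Λ ≡ suc k ℕ.* suc k
  count = ≡.trans (≡.sym (Listₚ.length-map proj₁ Λ)) (decide (ℕₚ.<-cmp (length xs) N))
    where
    decide : _ → length xs ≡ N
    decide (tri≈ _ e _) = e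
    decide (tri> _ _ N<) = ⊥-elim (not-more (proj₁ fibre-splits) (proj₂ fibre-splits) N<)
    decide (tri< l< _ _) = ⊥-elim (not-fewer (proj₁ fibre-splits) (proj₂ fibre-splits) (N ℕ.∸ suc (length xs))
      (≡.trans (ℕₚ.+-suc (length xs) _) (ℕₚ.m+[n∸m]≡n l<)))

-- The fibre over the dual numbers and the sum of the ordinates

module DisplacedFibre {c ℓ} (F : Field c ℓ) {A B : Field.Carrier F}
  (nonsingular : Nonsingular (Field.commutativeRing F) A B)
  (algClosed : AlgebraicallyClosed F)
  (k : ℕ) (n-unit : Units.IsUnit (Field.commutativeRing F) (Numerals.κ (Field.commutativeRing F) (1 ℕ.+ k)))
  {xQ yQ : Field.Carrier F} (hQ : Weierstrass.OnCurve F A B xQ yQ)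
  (Λ : List (Field.Carrier F × Field.Carrier F))
  (enumerates : Weierstrass.Enumerates F A B (suc k) (Weierstrass.aff xQ yQ hQ) Λ) where

  open Field F hiding (zero)
  private
    R = commutativeRing
  open Numerals R
  open Power R
  open Nonsingular nonsingular
  open Counting F A B nonsingular algClosed k n-unit {xQ} {yQ} hQ Λ enumerates
  open DualNumbers R
  open Displacement R A B
  open FieldOps F using (sum)
  private
    module D = CommutativeRing dual
    n = κ (1 ℕ.+ k)
    N = suc k ℕ.* suc k

    nonsingularᵈ : Nonsingular dual (A , 0#) (B , 0#)
    nonsingularᵈ = record { 2-unit = dual-unit R 2-unit ; Δ-unit = dual-unit R Δ-unit }

    xQᵈ yQᵈ : Carrier × Carrier
    xQᵈ = xQ , n * (κ 2 * yQ)
    yQᵈ = yQ , n * (κ 3 * xQ ^ 2 + A)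

    module S = FibreSum dual {A , 0#} {B , 0#} nonsingularᵈ k {xQᵈ} {yQᵈ} (displaced hQ n)
    module O = FibreSum R {A} {B} nonsingular k {xQ} {yQ} hQ

    lift-point : O.Pt → S.Pt
    lift-point ((x , y) , h) = ((x , κ 2 * y) , (y , κ 3 * x ^ 2 + A)) , Tangent.on-curveᵈ R A B x y h

    lift-lies : ∀ P → O.Lies P → S.Lies (lift-point P)
    lift-lies ((x , y) , h) M = displaced-multiple h M

    rescale : ∀ (w α α′ u v z : D.Carrier) → z D.* w D.≈ D.1# → z D.≈ α D.* u D.+ α′ D.* v →
      (w D.* α) D.* u D.+ (w D.* α′) D.* v D.≈ D.1#
    rescale = Solver.prove dual 6 (λ w α α′ u v z → :1 ∙ z :* w ⊜ :1 ⇒ :- w ∙ z ⊜ α :* u :+ α′ :* v ⇒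
      (w :* α) :* u :+ (w :* α′) :* v ⊜ :1) ≡.refl

    -- The old combination, formed with the displaced coordinates, has standard part 1. Such a dual
    -- number is a unit, and dividing by it restores the value 1.
    lift-comaximal : ∀ P P′ → O.Comaximal P P′ → S.Comaximal (lift-point P) (lift-point P′)
    lift-comaximal P P′ (α , α′ , e) = proj₁ unit D.* (α , 0#) , proj₁ unit D.* (α′ , 0#) ,
      rescale (proj₁ unit) (α , 0#) (α′ , 0#) _ _ _ (proj₂ unit) D.refl
      where
      unit : Units.IsUnit dual ((α , 0#) D.* (S.xOf (lift-point P) D.- S.xOf (lift-point P′))
        D.+ (α′ , 0#) D.* (proj₂ (proj₁ (lift-point P)) D.- proj₂ (proj₁ (lift-point P′))))
      unit = dual-unit R (1# , trans (*-identityʳ _) e)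

    lift-pairs : ∀ L → AllPairs O.Comaximal L → AllPairs S.Comaximal (map lift-point L)
    lift-pairs []      []       = []
    lift-pairs (P ∷ L) (c ∷ cs) = Allₚ.map⁺ (All.map (λ {P′} → lift-comaximal P P′) c) ∷ lift-pairs L cs

    listed = proj₁ enumerates
    L = points Λ listed

    total-lift : ∀ Λ ms → S.total (map S.xOf (map lift-point (points Λ ms))) ≈ᵈ (sum (map proj₁ Λ) , κ 2 * sum (map proj₂ Λ))
    total-lift []            []             = refl & sym (zeroʳ (κ 2))
    total-lift ((x , y) ∷ Λ) ((h , _) ∷ ms) =
      +-congˡ (standard (total-lift Λ ms)) & trans (+-congˡ (infinitesimal (total-lift Λ ms))) (sym (distribˡ _ _ _))

    length-points : ∀ Λ ms → length (points Λ ms) ≡ length Λ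
    length-points []            []             = ≡.refl
    length-points ((x , y) ∷ Λ) ((h , _) ∷ ms) = ≡.cong suc (length-points Λ ms)

  sums : (sum (map proj₁ Λ) , κ 2 * sum (map proj₂ Λ)) ≈ᵈ (xQ * κ N , n * (κ 2 * yQ) * κ N)
  sums = D.trans (D.sym (total-lift Λ listed)) (D.trans
    -- Each P is displaced by ε and Q by nε, so the prescribed abscissa is x_Q + 2n y_Q ε.
    (S.fibre-sum (map lift-point L) (lift-pairs L (points-comaximal Λ listed (proj₂ (proj₂ enumerates))))
      (Allₚ.map⁺ (All.map (λ {P} → lift-lies P) (points-lie Λ listed)))
      (≡.trans (Listₚ.length-map lift-point L) (≡.trans (length-points Λ listed) count)))
    (D.trans (D.*-congˡ (κ-dual N)) (refl & Solver.prove R 4 (λ a b c d → a :* con 0 :+ b :* c ⊜ b :* c) ≡.refl xQ (n * (κ 2 * yQ)) (κ N) xQ)))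

theorem1 : {k kℓ c ℓ : Level}
    (K : Field k kℓ) (Kbar : Field c ℓ) (ι : Field.Carrier K → Field.Carrier Kbar) →
    IsAlgebraicClosure K Kbar ι →
    (∀ p → HasChar K p → p ≢ 2 × p ≢ 3) →
    (n : ℕ) → 1 ℕ.≤ n →
    (∀ p → HasChar K p → gcd p n ≡ 1 ⊎ p ≡ 0) →
    (a b : Field.Carrier K) →
    ¬ (Field._≈_ K
    (Field._+_ K (Field._*_ K (FieldOps.fromℕ K 4) (Field._*_ K a (Field._*_ K a a)))
    (Field._*_ K (FieldOps.fromℕ K 27) (Field._*_ K b b)))
    (Field.0# K)) →
    (xQ yQ : Field.Carrier Kbar) →
    (hQ : Weierstrass.OnCurve Kbar (ι a) (ι b) xQ yQ) →
    (Λ : List (Field.Carrier Kbar × Field.Carrier Kbar)) →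
    Weierstrass.Enumerates Kbar (ι a) (ι b) n (Weierstrass.aff xQ yQ hQ) Λ →
    (u : Field.Carrier Kbar) →
    Field._≈_ Kbar (Field._*_ Kbar u (FieldOps.fromℕ Kbar (n ℕ.* n))) (Field.1# Kbar) →
    Field._≈_ Kbar (Field._*_ Kbar u (FieldOps.sum Kbar (map proj₁ Λ))) xQ
    × Field._≈_ Kbar (Field._*_ Kbar u (FieldOps.sum Kbar (map proj₂ Λ)))
    (Field._*_ Kbar (FieldOps.fromℕ Kbar n) yQ)
theorem1 K Kbar ι closure char≠2,3 (suc k) _ _ a b Δ≉0 xQ yQ hQ Λ enumerates u uN≈1 =
    trans (*-congˡ (standard sums)) (prove 3 (λ u x N → x ∙ u :* N ⊜ :1 ⇒ u :* (x :* N) ⊜ x) ≡.refl u xQ (κ N) uκN≈1) ,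
    trans (*-congˡ sum-y) (trans (prove 4 (λ u n y N → n :* y ∙ u :* N ⊜ :1 ⇒ u :* (n :* y :* N) ⊜ n :* y) ≡.refl u (κ (suc k)) yQ (κ N) uκN≈1)
      (*-congʳ (sym (fromℕ≈κ (suc k)))))
  where
  open Field Kbar hiding (zero)
  R = commutativeRing
  open Numerals R
  open Units R
  open Solver R
  open DualNumbers R using (standard; infinitesimal)
  module K = Field K
  N = suc k ℕ.* suc k

  open IsAlgebraicClosure closure using (isRingHomomorphism; algClosed)
  open RingMorphisms.IsRingHomomorphism isRingHomomorphism using (+-homo; *-homo; 1#-homo; ⟦⟧-cong)

  base-change : Hom K.commutativeRing R
  base-change = record { ⟨_⟩ = ι ; cong = ⟦⟧-cong ; +-homo = +-homo ; *-homo = *-homo ; 1-homo = 1#-homo }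

  fromℕ≈κ : ∀ m → FieldOps.fromℕ Kbar m ≈ κ m
  fromℕ≈κ zero    = refl
  fromℕ≈κ (suc m) = +-congˡ (fromℕ≈κ m)

  -- If 2 = 0 in K, then 2 is the characteristic: the only smaller positive number is 1, and 1 ≠ 0.
  2≉0 : ¬ (FieldOps.fromℕ K 2 K.≈ K.0#)
  2≉0 z = proj₁ (char≠2,3 2 (inj₂ ((λ ()) , z , one))) ≡.refl
    where
    one : ∀ m → 0 ℕ.< m → m ℕ.< 2 → ¬ (FieldOps.fromℕ K m K.≈ K.0#)
    one (suc zero)    _ _               e = K.1≉0 (K.trans (K.sym (K.+-identityʳ K.1#)) e)
    one (suc (suc m)) _ (s≤s (s≤s ()))

  nonsingular : Nonsingular R (ι a) (ι b)
  nonsingular = record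
    { 2-unit = unit-≈ (κ-hom base-change 2) (unit-homo base-change (K.inverse _ 2≉0))
    ; Δ-unit = unit-≈ (homo base-change 2 (λ a b → con 4 :* (a :* (a :* a)) :+ con 27 :* (b :* b)) (refl ∷ refl ∷ []))
                 (unit-homo base-change (K.inverse _ Δ≉0))
    }
  open Nonsingular nonsingular using (2-unit)

  uκN≈1 : u * κ N ≈ 1#
  uκN≈1 = trans (*-congˡ (sym (fromℕ≈κ N))) uN≈1

  -- n · (n u) = n² u = 1, so the given inverse `u` of n² supplies the inverse of n.
  n-unit : IsUnit (κ (suc k))
  n-unit = κ (suc k) * u , trans (prove 3 (λ n u N → u ∙ n :* n ⊜ N ⇒ n :* (n :* u) ⊜ u :* N) ≡.refl (κ (suc k)) u (κ N) (sym (κ-* (suc k) (suc k)))) uκN≈1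

  open DisplacedFibre Kbar nonsingular algClosed k n-unit {xQ} {yQ} hQ Λ enumerates

  sum-y : FieldOps.sum Kbar (map proj₂ Λ) ≈ κ (suc k) * yQ * κ N
  sum-y = unit-cancelˡ 2-unit (trans (infinitesimal sums)
    (prove 3 (λ n y N → n :* (con 2 :* y) :* N ⊜ con 2 :* (n :* y :* N)) ≡.refl (κ (suc k)) yQ (κ N)))
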